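{- Let $k\ge 1$ and let $c,r\ge 1$ be integers with $c+r=k+1$, and let $R=(c^r)$ be the rectangular partition with $r$ rows of length $c$. Then, in the affine nilCoxeter algebra $\mathbb{A}$, $$s_R^{(k)}=X_R:=\sum_{\nu\subseteq R}{\bf u}\big(V_{(R,\nu)/\nu}\big),$$ where the sum is over all partitions $\nu$ whose Young diagram is contained in $R$.
   Context: Indices of generators are taken modulo $k+1$. $W$ is the affine symmetric group with generators $s_0,\dots,s_k$ and relations $s_i^2=1$, $s_is_j=s_js_i$ if $i-j\not\equiv\pm1$, $s_is_{i+1}s_i=s_{i+1}s_is_{i+1}$. The affine nilCoxeter algebra $\mathbb{A}$ is generated by $u_0,\dots,u_k$ with relations $u_i^2=0$, $u_iu_j=u_ju_i$ if $i-j\not\equiv\pm1$, $u_iu_{i+1}u_i=u_{i+1}u_iu_{i+1}$. For $w\in W$ with reduced word $s_{i_1}\cdots s_{i_m}$, ${\bf u}(w)=u_{i_1}\cdots u_{i_m}$ (independent of the reduced word). The content of the box in row $i$, column $j$ of a Young diagram is $(j-i)\bmod (k+1)$. $\mathbb{A}$ acts on the free abelian group with basis the $(k+1)$-cores: $u_i\nu$ is the core obtained by adding all addable boxes of content $i$ if $\nu$ has at least one such box, and $0$ otherwise. $W$ acts on $(k+1)$-cores: $s_i\nu$ adds all addable boxes of content $i$ if there are any, removes all removable boxes of content $i$ if there are any, and is $\nu$ otherwise. Let $W_0=\langle s_1,\dots,s_k\rangle$ and $W^0$ the set of minimal length coset representatives of $W/W_0$; $w\mapsto w\emptyset$ is a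 bijection from $W^0$ to $(k+1)$-cores. A partition $\lambda$ is $k$-bounded if $\lambda_1\le k$; $\mathfrak{c}(\lambda)$ is the $(k+1)$-core corresponding to $\lambda$ under the Lapointe–Morse bijection (whose inverse sends a core to the partition whose $i$-th part is the number of cells in row $i$ of hook length $\le k$), and $w_\lambda\in W^0$ is the element with $w_\lambda\emptyset=\mathfrak{c}(\lambda)$; set $u_\lambda={\bf u}(w_\lambda)$. For a proper subset $D\subsetneq\{0,\dots,k\}$, $u_D$ is the product of the $u_m$, $m\in D$, each once, ordered so that whenever $j,j+1\in D$, $u_{j+1}$ occurs to the left of $u_j$ (cyclically decreasing). Put ${\bf h}_i=\sum_{|D|=i}u_D$. The $k$-Schur functions $s^{(k)}_\lambda$ ($\lambda$ $k$-bounded) are the unique elements of the subalgebra generated by ${\bf h}_1,\dots,{\bf h}_k$ with $s^{(k)}_\emptyset=1$ and ${\bf h}_is^{(k)}_\lambda=\sum_\mu s^{(k)}_\mu$, summed over $k$-bounded $\mu$ with $u_\mu=u_Du_\lambda$ for some $D$ with $|D|=i$. For a skew shape $\nu/\mu$, $V_{\nu/\mu}\in W$ is the product of $s_{\text{content}}$ over its boxes, read row by row starting from the last (highest-indexed) row and ending with row 1, each row read from right to left. For $\nu\subseteq R$, $(R,\nu)$ denotes the partition $(c,\dots,c,\nu_1,\nu_2,\dots)$ with $r$ parts equal to $c$ followed by the parts of $\nu$.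
   Formalization: For k = 1 the braid relations s_0s_1s_0 = s_1s_0s_1 and u_0u_1u_0 = u_1u_0u_1 are not imposed (the usual convention), since imposing them would make W finite and the correspondence with 2-cores fail. -}

module Defs where

open import Data.Nat using (ℕ; zero; suc; _+_; _*_; _∸_; _≤_; _<_; _≤?_; _<?_)
open import Data.Nat.DivMod using (_mod_; _%_)
open import Data.Fin using (Fin; toℕ) renaming (_≟_ to _≟F_)
open import Data.Fin.Subset using (Subset; ∣_∣)
open import Data.Integer using (ℤ; +_; -_) renaming (_+_ to _+ℤ_; _*_ to _*ℤ_)
open import Data.List using (List; []; _∷_; _++_; [_]; map; concat; concatMap; filter; length; upTo; allFin; reverse; replicate; foldr)
open import Data.Bool.ListAction using (any)
open import Data.List.Properties using (≡-dec)
open import Data.Vec using (Vec; lookup) renaming ([] to []ᵥ; _∷_ to _∷ᵥ_)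
open import Data.Bool using (Bool; true; false; if_then_else_; _∧_; _∨_)
open import Data.Product using (Σ; _×_; _,_; proj₁; proj₂)
open import Relation.Nullary using (¬_; yes; no)
open import Relation.Nullary.Decidable using (⌊_⌋)
open import Relation.Binary.PropositionalEquality using (_≡_)
open import Relation.Binary.Construct.Closure.Equivalence using (EqClosure)
open import Data.List.Relation.Unary.All using (All)
open import Data.List.Relation.Unary.Unique.Propositional using (Unique)
open import Data.List.Membership.Propositional renaming (_∈_ to _∈L_)
open import Function.Bundles using (_⇔_)

Gen : ℕ → Set
Gen k = Fin (suc k)

Word : ℕ → Set
Word k = List (Gen k)

-- content of the box in row i, column j (0-indexed; only j - i matters):
-- (j - i) mod (k+1) = (j + k i) mod (k+1)
content : (k : ℕ) → ℕ → ℕ → Gen k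
content k i j = (j + k * i) mod (suc k)

AdjNext : (k : ℕ) → Gen k → Gen k → Set
AdjNext k i j = toℕ j ≡ (suc (toℕ i)) % (suc k)

NonAdj : (k : ℕ) → Gen k → Gen k → Set
NonAdj k i j = (¬ AdjNext k i j) × (¬ AdjNext k j i)

part : List ℕ → ℕ → ℕ
part [] _ = 0
part (x ∷ xs) zero = x
part (x ∷ xs) (suc i) = part xs i

IsPartition : List ℕ → Set
IsPartition la = (∀ i → part la (suc i) ≤ part la i) × All (λ x → 1 ≤ x) la

KBounded : ℕ → List ℕ → Set
KBounded k la = IsPartition la × All (λ x → x ≤ k) la

positives : List ℕ → List ℕ
positives = filter (λ x → 1 ≤? x)

colLen : List ℕ → ℕ → ℕ
colLen la j = length (filter (λ x → suc j ≤? x) la)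

hook : List ℕ → ℕ → ℕ → ℕ
hook la i j = (part la i ∸ suc j) + (colLen la j ∸ suc i) + 1

IsCore : ℕ → List ℕ → Set
IsCore k κ = IsPartition κ × (∀ i j → j < part κ i → ¬ (hook κ i j ≡ suc k))

-- inverse of the Lapointe–Morse bijection: i-th part = number of cells in
-- row i with hook length ≤ k
boundedPart : ℕ → List ℕ → List ℕ
boundedPart k κ =
  positives (map (λ i → length (filter (λ j → hook κ i j ≤? k) (upTo (part κ i))))
                 (upTo (length κ)))

isZero : ℕ → Bool
isZero zero = true
isZero (suc _) = false

rowsOf : List ℕ → List ℕ
rowsOf la = upTo (suc (length la))

addableB : (k : ℕ) → Gen k → List ℕ → ℕ → Bool
addableB k c la r =
  (isZero r ∨ ⌊ suc (part la r) ≤? part la (r ∸ 1) ⌋) ∧ ⌊ content k r (part la r) ≟F c ⌋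

removableB : (k : ℕ) → Gen k → List ℕ → ℕ → Bool
removableB k c la r =
  ⌊ 1 ≤? part la r ⌋ ∧ ⌊ suc (part la (suc r)) ≤? part la r ⌋
  ∧ ⌊ content k r (part la r ∸ 1) ≟F c ⌋

addAll : (k : ℕ) → Gen k → List ℕ → List ℕ
addAll k c la =
  positives (map (λ r → if addableB k c la r then suc (part la r) else part la r) (rowsOf la))

removeAll : (k : ℕ) → Gen k → List ℕ → List ℕ
removeAll k c la =
  positives (map (λ r → if removableB k c la r then part la r ∸ 1 else part la r) (rowsOf la))

sAct : (k : ℕ) → Gen k → List ℕ → List ℕ
sAct k c la =
  if any (addableB k c la) (rowsOf la) then addAll k c la
  else (if any (removableB k c la) (rowsOf la) then removeAll k c la else la)

act : (k : ℕ) → Word k → List ℕ → List ℕ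
act k a la = foldr (sAct k) la a

-- The affine symmetric group W via its Coxeter presentation

data CStep (k : ℕ) : Word k → Word k → Set where
  del   : ∀ p q i → CStep k (p ++ i ∷ i ∷ q) (p ++ q)
  comm  : ∀ p q i j → NonAdj k i j → CStep k (p ++ i ∷ j ∷ q) (p ++ j ∷ i ∷ q)
  braid : ∀ p q i j → 2 ≤ k → AdjNext k i j →
          CStep k (p ++ i ∷ j ∷ i ∷ q) (p ++ j ∷ i ∷ j ∷ q)

EqW : (k : ℕ) → Word k → Word k → Set
EqW k = EqClosure (CStep k)

Reduced : (k : ℕ) → Word k → Set
Reduced k a = ∀ b → EqW k a b → length a ≤ length b

-- (for a reduced) a represents a minimal length representative of a W_0
MinCoset : (k : ℕ) → Word k → Set
MinCoset k a = ∀ (v b : Word k) → All (λ i → ¬ (toℕ i ≡ 0)) v →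
               EqW k b (a ++ v) → length a ≤ length b

ReducedRep : (k : ℕ) → Word k → Word k → Set
ReducedRep k a b = Reduced k b × EqW k a b

-- a is a reduced word of w_λ (w_λ ∈ W^0, w_λ ∅ = 𝔠(λ))
WordOf : (k : ℕ) → List ℕ → Word k → Set
WordOf k la a = Reduced k a × MinCoset k a ×
  Σ (List ℕ) (λ κ → IsCore k κ × boundedPart k κ ≡ la × act k a [] ≡ κ)

-- The affine nilCoxeter algebra 𝔸 via its presentation:
-- formal ℤ-combinations of words modulo the two-sided ideal of relations

Comb : ℕ → Set
Comb k = List (ℤ × Word k)

coeff : (k : ℕ) → Comb k → Word k → ℤ
coeff k [] w = + 0
coeff k ((c , a) ∷ x) w with ≡-dec _≟F_ a w
... | yes _ = c +ℤ coeff k x w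
... | no _ = coeff k x w

uA : (k : ℕ) → Word k → Comb k
uA k a = [ (+ 1 , a) ]

oneA : (k : ℕ) → Comb k
oneA k = uA k []

sumC : (k : ℕ) → List (Comb k) → Comb k
sumC k = concat

scale : (k : ℕ) → ℤ → Comb k → Comb k
scale k c = map (λ { (d , a) → (c *ℤ d , a) })

mulC : (k : ℕ) → Comb k → Comb k → Comb k
mulC k x y = concatMap (λ { (c , a) → map (λ { (d , b) → (c *ℤ d , a ++ b) }) y }) x

data ARel (k : ℕ) : Comb k → Set where
  sq    : ∀ i → ARel k ((+ 1 , i ∷ i ∷ []) ∷ [])
  comm  : ∀ i j → NonAdj k i j →
          ARel k ((+ 1 , i ∷ j ∷ []) ∷ (- (+ 1) , j ∷ i ∷ []) ∷ [])
  braid : ∀ i j → 2 ≤ k → AdjNext k i j →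
          ARel k ((+ 1 , i ∷ j ∷ i ∷ []) ∷ (- (+ 1) , j ∷ i ∷ j ∷ []) ∷ [])

IdealGen : ℕ → Set
IdealGen k = ℤ × Word k × Σ (Comb k) (ARel k) × Word k

expand : (k : ℕ) → List (IdealGen k) → Comb k
expand k = concatMap (λ { (c , p , (r , _) , q) → scale k c (mulC k (uA k p) (mulC k r (uA k q))) })

AEq : (k : ℕ) → Comb k → Comb k → Set
AEq k x y = Σ (List (IdealGen k)) λ L → ∀ w → coeff k x w ≡ coeff k y w +ℤ coeff k (expand k L) w

allSubsets : (n : ℕ) → List (Subset n)
allSubsets zero = []ᵥ ∷ []
allSubsets (suc n) = concatMap (λ s → (true ∷ᵥ s) ∷ (false ∷ᵥ s) ∷ []) (allSubsets n)

firstOut : (k : ℕ) → Subset (suc k) → ℕ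
firstOut k D with filter (λ m → lookup D m Data.Bool.≟ false) (allFin (suc k))
... | [] = 0
... | m ∷ _ = toℕ m
  where import Data.Bool

-- cyclically decreasing word of D: m-1, m-2, …, m+1 (mod k+1), m ∉ D
uDWord : (k : ℕ) → Subset (suc k) → Word k
uDWord k D = filter (λ g → lookup D g Data.Bool.≟ true)
  (map (λ t → (firstOut k D + suc k ∸ suc t) mod (suc k)) (upTo (suc k)))
  where import Data.Bool

hA : (k : ℕ) → ℕ → Comb k
hA k i = map (λ D → (+ 1 , uDWord k D))
             (filter (λ D → ∣ D ∣ Data.Nat.≟ i) (allSubsets (suc k)))
  where import Data.Nat

prodH : (k : ℕ) → List ℕ → Comb k
prodH k [] = oneA k
prodH k (i ∷ is) = mulC k (hA k i) (prodH k is)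

InSub : (k : ℕ) → Comb k → Set
InSub k x = Σ (List (ℤ × List ℕ)) λ terms →
  All (λ t → All (λ i → 1 ≤ i × i ≤ k) (proj₂ t)) terms ×
  AEq k x (sumC k (map (λ { (c , is) → scale k c (prodH k is) }) terms))

PieriRel : (k : ℕ) → ℕ → List ℕ → List ℕ → Set
PieriRel k i la mu = Σ (Subset (suc k)) λ D → ∣ D ∣ ≡ i ×
  Σ (Word k) λ am → Σ (Word k) λ al → WordOf k mu am × WordOf k la al ×
  AEq k (uA k am) (mulC k (uA k (uDWord k D)) (uA k al))

IsKSchur : (k : ℕ) → (List ℕ → Comb k) → Set
IsKSchur k s =
  AEq k (s []) (oneA k) ×
  (∀ la → KBounded k la → InSub k (s la)) ×
  (∀ i la → 1 ≤ i → i ≤ k → KBounded k la →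
    Σ (List (List ℕ)) λ L → Unique L ×
      (∀ mu → (mu ∈L L) ⇔ (KBounded k mu × PieriRel k i la mu)) ×
      AEq k (mulC k (hA k i) (s la)) (sumC k (map s L)))

pIn : ℕ → ℕ → List (List ℕ)
pIn zero m = [] ∷ []
pIn (suc r) m = [] ∷ concatMap (λ a → map (a ∷_) (pIn r a)) (map suc (upTo m))

RNu : ℕ → ℕ → List ℕ → List ℕ
RNu c r nu = replicate r c ++ nu

Vword : (k c r : ℕ) → List ℕ → Word k
Vword k c r nu = concatMap rowWord (reverse (upTo (length lam)))
  where
    lam = RNu c r nu
    rowWord : ℕ → Word k
    rowWord i = map (λ t → content k i (part lam i ∸ suc t)) (upTo (part lam i ∸ part nu i))

{-# OPTIONS --safe #-}

-- Put n = k + 1.  The affine symmetric group acts on ℤ by n-periodic permutations, hence on states, the functions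
-- f with f (x + n) = f x + p for a fixed p > 0, by f ↦ f ∘ π a.  In 𝔸 a generator acts as its simple
-- transposition when this is an ascent of the state and as 0 otherwise; the orbit of vac x = ⌊(x − 1)/n⌋ is the set
-- of n-cores, beads being the places with a negative value.  Every element of W is carried by a suitable group
-- element into a word that acts on vac, so elements of 𝔸 with the same action on the orbit of vac are equal.
--
-- Peeling off the first row of a core with the Pieri rule shows inductively that s_λ sends vac to the core of λ.
-- The 𝐡_i commute.  The elements V_{(R,ν)/ν} are exactly the permutations that move r residue classes by c and the
-- other c classes by − r; reflecting the set of classes gives X_R u_g = u_{g−r} X_R, and as the set of D with
-- |D| = i is invariant under rotation, X_R commutes with every 𝐡_i.  On vac only the term ν = ∅ of X_R survives and
-- it yields the core of R.  Hence s_R (s_λ vac) = s_λ (s_R vac) = s_λ (X_R vac) = X_R (s_λ vac) for every λ, and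
-- s_R = X_R by faithfulness.
module Submission where

open import Defs
open import Data.Nat as ℕ using (ℕ; zero; suc)
import Data.Bool as Bool
open import Data.Bool using (Bool; true; false; if_then_else_; _∧_; _∨_; not)
open import Data.Bool.ListAction using (any)
open import Data.Empty using (⊥; ⊥-elim)
open import Data.Fin as Fin using (Fin; toℕ; fromℕ<) renaming (_≟_ to _≟F_)
import Data.Fin.Properties as Fin
open import Data.Fin.Subset using (Subset; ∣_∣)
import Data.Integer.DivMod as DivMod
open import Data.Integer.DivMod using (n%ℕd<d; a≡a%ℕn+[a/ℕn]*n)
import Data.Integer.Properties as ℤ
open import Data.Integer.Tactic.RingSolver using (solve-∀)
open import Data.List using (List; []; _∷_; _++_; [_]; length; reverse; map; concatMap; filter; upTo; allFin; applyUpTo; replicate; downFrom)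
open import Data.List.Membership.Propositional using (_∈_; _∉_)
open import Data.List.Membership.Propositional.Properties using (∈-filter⁻; ∈-filter⁺; ∈-allFin; ∈-upTo⁺; ∈-map⁺; ∈-map⁻; ∈-++⁻)
open import Data.List.Membership.Propositional.Properties.WithK using (unique∧set⇒bag)
open import Data.List.Properties using (++-assoc; length-++; ++-identityʳ; unfold-reverse; ≡-dec; concatMap-++; map-upTo; upTo-∷ʳ; filter-++; filter-accept; filter-reject; length-map; reverse-upTo; map-++; length-replicate; length-filter)
open import Data.List.Relation.Binary.BagAndSetEquality using (∼bag⇒↭)
open import Data.List.Relation.Binary.Permutation.Propositional using (_↭_; prep; swap) renaming (refl to ↭-refl′; trans to ↭-trans′)
import Data.List.Relation.Unary.All as All
open import Data.List.Relation.Unary.All using (All; []; _∷_)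
open import Data.List.Relation.Unary.All.Properties using (all-filter; ∷ʳ⁺; replicate⁺)
open import Data.List.Relation.Unary.AllPairs using ([]; _∷_)
open import Data.List.Relation.Unary.Any using (here; there)
open import Data.List.Relation.Unary.Unique.Propositional using (Unique)
import Data.List.Relation.Unary.Unique.Propositional.Properties as Unique
import Data.Nat.DivMod as ℕ
import Data.Nat.Properties as ℕ
open import Data.Product using (Σ; _×_; _,_; proj₁; proj₂)
open import Data.Sum using (_⊎_; inj₁; inj₂)
open import Data.Unit using (⊤; tt)
open import Data.Vec using (lookup; tabulate) renaming ([] to []ᵥ; _∷_ to _∷ᵥ_)
open import Data.Vec.Properties using (lookup∘tabulate)
import Data.Vec.Relation.Binary.Pointwise.Extensional as Pointwise
open import Function using (_∘_; id; _$_)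
open import Function.Bundles using (mk⇔; Equivalence)
open import Relation.Binary using (tri<; tri≈; tri>)
import Relation.Binary.Construct.Closure.Equivalence as EqC
open import Relation.Binary.Construct.Closure.ReflexiveTransitive using (ε; _◅_)
open import Relation.Binary.Construct.Closure.Symmetric using (fwd; bwd)
open import Relation.Binary.PropositionalEquality hiding ([_])
open import Relation.Nullary using (¬_; Dec; yes; no)
open import Relation.Nullary.Decidable using (_×-dec_; ⌊_⌋)
open import Relation.Unary using (Decidable)

-- A core only remembers a coset of W_0, so faithfulness on cores is not automatic. It holds because
-- the base point can vary: for each reduced word `a` a translation spreads the values of `vac` so
-- far apart that `a` followed by its minimal representative `base` is again a minimal
-- representative, and then `a` can be recovered.
--
-- The displacements c and - r agree modulo n. All the V_{(R,ν)/ν} therefore rotate residues in the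
-- same way, which is why a generator crossing X_R changes its index by - r whatever ν is; ν only
-- records which residues go which way round.
--
-- The words `b ν` are arbitrary reduced words, so nothing may depend on their letters. Whether a
-- word acts as zero is read off from its permutation: it acts as nonzero exactly when it is reduced
-- and the state strictly separates all its inversions.
--
-- Commutation of the 𝐡_i is drawn from the Pieri hypothesis: 𝐡_j is itself the k-Schur function of
-- one row, and 𝐡_i 𝐡_j and 𝐡_j 𝐡_i expand over the same cores.

-- Linear integer arithmetic by reflection

module LinearArithmetic where

  open import Data.Fin using (zero; suc)
  open import Data.Integer using (ℤ; +_; -[1+_]; +≤+; +<+; _≤?_; _<?_) renaming (_+_ to _+ℤ_; _*_ to _*ℤ_; -_ to -ℤ_; _-_ to _-ℤ_; _≤_ to _≤ℤ_; _<_ to _<ℤ_; ∣_∣ to abs)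
  open import Data.Bool using (T)
  open import Data.Vec as Vec using (Vec; zipWith)
  open import Data.Vec.N-ary using (N-ary; _$ⁿ_)

  infixl 6 _⊕_ _⊝_
  infixl 7 _⊛_
  infix  4 _≲_ _≺_ _≈_
  infixr 3 _⇒_
  infix  3 ⊢_

  data Expr (n : ℕ) : Set where
    var     : Fin n → Expr n
    con     : ℤ → Expr n
    _⊕_ _⊝_ : Expr n → Expr n → Expr n
    ⊖_      : Expr n → Expr n
    _⊛_     : ℤ → Expr n → Expr n

  data Atom (n : ℕ) : Set where
    _≲_ _≺_ _≈_ : Expr n → Expr n → Atom n

  data Sequent (n : ℕ) : Set where
    _⇒_  : Atom n → Sequent n → Sequent n
    ⊢_   : Atom n → Sequent n

  one : ∀ {n} → Expr n
  one = con (+ 1)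

  ⟦_⟧ₑ : ∀ {n} → Expr n → Vec ℤ n → ℤ
  ⟦ var i ⟧ₑ   xs = lookup xs i
  ⟦ con c ⟧ₑ   xs = c
  ⟦ a ⊕ b ⟧ₑ   xs = ⟦ a ⟧ₑ xs +ℤ ⟦ b ⟧ₑ xs
  ⟦ a ⊝ b ⟧ₑ   xs = ⟦ a ⟧ₑ xs -ℤ ⟦ b ⟧ₑ xs
  ⟦ ⊖ a ⟧ₑ     xs = -ℤ ⟦ a ⟧ₑ xs
  ⟦ c ⊛ a ⟧ₑ   xs = c *ℤ ⟦ a ⟧ₑ xs

  ⟦_⟧ₐ : ∀ {n} → Atom n → Vec ℤ n → Set
  ⟦ a ≲ b ⟧ₐ xs = ⟦ a ⟧ₑ xs ≤ℤ ⟦ b ⟧ₑ xs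
  ⟦ a ≺ b ⟧ₐ xs = ⟦ a ⟧ₑ xs <ℤ ⟦ b ⟧ₑ xs
  ⟦ a ≈ b ⟧ₐ xs = ⟦ a ⟧ₑ xs ≡ ⟦ b ⟧ₑ xs

  ⟦_⟧ₛ : ∀ {n} → Sequent n → Vec ℤ n → Set
  ⟦ h ⇒ s ⟧ₛ xs = ⟦ h ⟧ₐ xs → ⟦ s ⟧ₛ xs
  ⟦ ⊢ g ⟧ₛ   xs = ⟦ g ⟧ₐ xs

  Form : ℕ → Set
  Form n = ℤ × Vec ℤ n

  dot : ∀ {n} → Vec ℤ n → Vec ℤ n → ℤ
  dot []ᵥ       []ᵥ       = + 0
  dot (a ∷ᵥ as) (x ∷ᵥ xs) = a *ℤ x +ℤ dot as xs

  ⟦_⟧f : ∀ {n} → Form n → Vec ℤ n → ℤ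
  ⟦ c , as ⟧f xs = c +ℤ dot as xs

  zeros : ∀ n → Vec ℤ n
  zeros n = Vec.replicate n (+ 0)

  unit : ∀ {n} → Fin n → Vec ℤ n
  unit {suc n} zero    = + 1 ∷ᵥ zeros n
  unit         (suc i) = + 0 ∷ᵥ unit i

  comb : ∀ {n} → ℤ → Form n → ℤ → Form n → Form n
  comb s (c , as) t (d , bs) = s *ℤ c +ℤ t *ℤ d , zipWith (λ a b → s *ℤ a +ℤ t *ℤ b) as bs

  dot-zeros : ∀ {n} (xs : Vec ℤ n) → dot (zeros n) xs ≡ + 0
  dot-zeros []ᵥ       = refl
  dot-zeros (x ∷ᵥ xs) rewrite dot-zeros xs = ℤ.*-zeroˡ x

  dot-unit : ∀ {n} (i : Fin n) (xs : Vec ℤ n) → dot (unit i) xs ≡ lookup xs i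
  dot-unit zero    (x ∷ᵥ xs) rewrite dot-zeros xs = trans (ℤ.+-identityʳ _) (ℤ.*-identityˡ x)
  dot-unit (suc i) (x ∷ᵥ xs) = trans (ℤ.+-identityˡ _) (dot-unit i xs)

  dot-comb : ∀ {n} s t (as bs xs : Vec ℤ n) →
             dot (zipWith (λ a b → s *ℤ a +ℤ t *ℤ b) as bs) xs ≡ s *ℤ dot as xs +ℤ t *ℤ dot bs xs
  dot-comb s t []ᵥ []ᵥ []ᵥ = ring s t
    where
    ring : ∀ s t → + 0 ≡ s *ℤ + 0 +ℤ t *ℤ + 0
    ring = solve-∀
  dot-comb s t (a ∷ᵥ as) (b ∷ᵥ bs) (x ∷ᵥ xs) rewrite dot-comb s t as bs xs =
    ring s t a b x (dot as xs) (dot bs xs)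
    where
    ring : ∀ s t a b x u v → (s *ℤ a +ℤ t *ℤ b) *ℤ x +ℤ (s *ℤ u +ℤ t *ℤ v)
                           ≡ s *ℤ (a *ℤ x +ℤ u) +ℤ t *ℤ (b *ℤ x +ℤ v)
    ring = solve-∀

  comb-sound : ∀ {n} s t (f g : Form n) xs → ⟦ comb s f t g ⟧f xs ≡ s *ℤ ⟦ f ⟧f xs +ℤ t *ℤ ⟦ g ⟧f xs
  comb-sound s t (c , as) (d , bs) xs rewrite dot-comb s t as bs xs =
    ring s t c d (dot as xs) (dot bs xs)
    where
    ring : ∀ s t c d u v → s *ℤ c +ℤ t *ℤ d +ℤ (s *ℤ u +ℤ t *ℤ v) ≡ s *ℤ (c +ℤ u) +ℤ t *ℤ (d +ℤ v)
    ring = solve-∀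

  lin : ∀ {n} → Expr n → Form n
  lin {n} (var i) = + 0 , unit i
  lin {n} (con c) = c , zeros n
  lin (a ⊕ b)     = comb (+ 1) (lin a) (+ 1) (lin b)
  lin (a ⊝ b)     = comb (+ 1) (lin a) (-ℤ + 1) (lin b)
  lin (⊖ a)       = comb (-ℤ + 1) (lin a) (+ 0) (lin a)
  lin (c ⊛ a)     = comb c (lin a) (+ 0) (lin a)

  lin-sound : ∀ {n} (e : Expr n) xs → ⟦ lin e ⟧f xs ≡ ⟦ e ⟧ₑ xs
  lin-sound (var i) xs = trans (ℤ.+-identityˡ _) (dot-unit i xs)
  lin-sound (con c) xs rewrite dot-zeros xs = ℤ.+-identityʳ c
  lin-sound (a ⊕ b) xs rewrite comb-sound (+ 1) (+ 1) (lin a) (lin b) xs | lin-sound a xs | lin-sound b xs =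
    cong₂ _+ℤ_ (ℤ.*-identityˡ (⟦ a ⟧ₑ xs)) (ℤ.*-identityˡ (⟦ b ⟧ₑ xs))
  lin-sound (a ⊝ b) xs rewrite comb-sound (+ 1) (-ℤ + 1) (lin a) (lin b) xs | lin-sound a xs | lin-sound b xs =
    cong₂ _+ℤ_ (ℤ.*-identityˡ (⟦ a ⟧ₑ xs)) (ℤ.-1*i≡-i (⟦ b ⟧ₑ xs))
  lin-sound (⊖ a) xs rewrite comb-sound (-ℤ + 1) (+ 0) (lin a) (lin a) xs | lin-sound a xs =
    ring (⟦ a ⟧ₑ xs)
    where
    ring : ∀ u → (-ℤ + 1) *ℤ u +ℤ + 0 *ℤ u ≡ -ℤ u
    ring = solve-∀
  lin-sound (c ⊛ a) xs rewrite comb-sound c (+ 0) (lin a) (lin a) xs | lin-sound a xs =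
    ring c (⟦ a ⟧ₑ xs)
    where
    ring : ∀ c u → c *ℤ u +ℤ + 0 *ℤ u ≡ c *ℤ u
    ring = solve-∀

  -- Nonnegativity of a linear form is the only kind of hypothesis; Fourier-Motzkin elimination of the
  -- head variable adds up suitable multiples of the forms in which it has opposite signs.

  NonNeg : ∀ {n} → Vec ℤ n → Form n → Set
  NonNeg xs f = + 0 ≤ℤ ⟦ f ⟧f xs

  split : ∀ {n} → List (Form (suc n)) → List (Form n) × List (Form (suc n)) × List (Form (suc n))
  split [] = [] , [] , []
  split (f@(c , a ∷ᵥ as) ∷ fs) with a | split fs
  ... | + 0      | zs , ps , ns = (c , as) ∷ zs , ps , ns
  ... | + suc _  | zs , ps , ns = zs , f ∷ ps , ns
  ... | -[1+ _ ] | zs , ps , ns = zs , ps , f ∷ ns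

  headCoeff : ∀ {n} → Form (suc n) → ℤ
  headCoeff (_ , a ∷ᵥ _) = a

  dropHead : ∀ {n} → Form (suc n) → Form n
  dropHead (c , _ ∷ᵥ as) = c , as

  -- The multipliers are the absolute values of the opposite head coefficients, so the head cancels
  -- when the signs differ. `dropHead` discards it unchecked; `resolve-nonneg` is where the signs
  -- are demanded.
  resolve : ∀ {n} → Form (suc n) → Form (suc n) → Form n
  resolve f g = dropHead (comb (+ abs (headCoeff g)) f (+ abs (headCoeff f)) g)

  eliminate : ∀ {n} → List (Form (suc n)) → List (Form n)
  eliminate fs = let zs , ps , ns = split fs in zs ++ concatMap (λ p → map (resolve p) ns) ps

  absurd : List (Form zero) → Bool
  absurd []             = false
  absurd ((c , _) ∷ fs) = ⌊ c <? + 0 ⌋ ∨ absurd fs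

  refutes : ∀ {n} → List (Form n) → Bool
  refutes {zero}  fs = absurd fs
  refutes {suc n} fs = refutes (eliminate fs)

  Positive Negative : ∀ {n} → Form (suc n) → Set
  Positive f = headCoeff f ≡ + abs (headCoeff f)
  Negative f = headCoeff f ≡ -ℤ + abs (headCoeff f)

  0≤* : ∀ m {i} → + 0 ≤ℤ i → + 0 ≤ℤ + m *ℤ i
  0≤* m (+≤+ {n = n} _) = subst (+ 0 ≤ℤ_) (ℤ.pos-* m n) (+≤+ ℕ.z≤n)

  resolve-nonneg : ∀ {n} x (xs : Vec ℤ n) f g → Positive f → Negative g →
    NonNeg (x ∷ᵥ xs) f → NonNeg (x ∷ᵥ xs) g → NonNeg xs (resolve f g)
  resolve-nonneg x xs f@(c , a ∷ᵥ as) g@(d , b ∷ᵥ bs) pa nb 0≤f 0≤g =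
    subst (+ 0 ≤ℤ_) eq (ℤ.+-mono-≤ (0≤* (abs b) 0≤f) (0≤* (abs a) 0≤g))
    where
    A = + abs a
    B = + abs b
    ring : ∀ A B c d x u v → B *ℤ (c +ℤ (A *ℤ x +ℤ u)) +ℤ A *ℤ (d +ℤ ((-ℤ B) *ℤ x +ℤ v))
                         ≡ B *ℤ c +ℤ A *ℤ d +ℤ (B *ℤ u +ℤ A *ℤ v)
    ring = solve-∀
    eq : B *ℤ ⟦ f ⟧f (x ∷ᵥ xs) +ℤ A *ℤ ⟦ g ⟧f (x ∷ᵥ xs) ≡ ⟦ resolve f g ⟧f xs
    eq = trans (cong₂ (λ p q → B *ℤ (c +ℤ (p *ℤ x +ℤ dot as xs)) +ℤ A *ℤ (d +ℤ (q *ℤ x +ℤ dot bs xs))) pa nb)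
        (trans (ring A B c d x (dot as xs) (dot bs xs))
               (cong (B *ℤ c +ℤ A *ℤ d +ℤ_) (sym (dot-comb B A as bs xs))))

  All² : ∀ {n} → Vec ℤ (suc n) → (Form (suc n) → Set) → List (Form (suc n)) → Set
  All² xs P = All (λ f → P f × NonNeg xs f)

  ++-All : ∀ {A : Set} {P : A → Set} {xs ys} → All P xs → All P ys → All P (xs ++ ys)
  ++-All []         qs = qs
  ++-All (p ∷ ps) qs = p ∷ ++-All ps qs

  split-nonneg : ∀ {n} x (xs : Vec ℤ n) fs → All (NonNeg (x ∷ᵥ xs)) fs →
    let zs , ps , ns = split fs in
    All (NonNeg xs) zs × All² (x ∷ᵥ xs) Positive ps × All² (x ∷ᵥ xs) Negative ns
  split-nonneg x xs [] [] = [] , [] , []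
  split-nonneg x xs ((c , a ∷ᵥ as) ∷ fs) (h ∷ hs) with a | split fs | split-nonneg x xs fs hs
  ... | + 0      | _ | Z , P , N = subst (λ t → + 0 ≤ℤ c +ℤ t) drop h ∷ Z , P , N
    where
    drop : + 0 *ℤ x +ℤ dot as xs ≡ dot as xs
    drop = trans (cong (_+ℤ dot as xs) (ℤ.*-zeroˡ x)) (ℤ.+-identityˡ _)
  ... | + suc _  | _ | Z , P , N = Z , (refl , h) ∷ P , N
  ... | -[1+ _ ] | _ | Z , P , N = Z , P , (refl , h) ∷ N

  eliminate-nonneg : ∀ {n} x (xs : Vec ℤ n) fs → All (NonNeg (x ∷ᵥ xs)) fs → All (NonNeg xs) (eliminate fs)
  eliminate-nonneg x xs fs hs with split fs | split-nonneg x xs fs hs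
  ... | zs , ps , ns | Z , P , N = ++-All Z (pairs P)
    where
    row : ∀ {p ms} → Positive p × NonNeg (x ∷ᵥ xs) p → All² (x ∷ᵥ xs) Negative ms →
          All (NonNeg xs) (map (resolve p) ms)
    row _ [] = []
    row {p} (pa , hp) ((na , hn) ∷ ms) = resolve-nonneg x xs p _ pa na hp hn ∷ row (pa , hp) ms
    pairs : ∀ {qs} → All² (x ∷ᵥ xs) Positive qs → All (NonNeg xs) (concatMap (λ p → map (resolve p) ns) qs)
    pairs []       = []
    pairs (q ∷ qs) = ++-All (row q N) (pairs qs)

  absurd-sound : ∀ fs → T (absurd fs) → All (NonNeg []ᵥ) fs → ⊥
  absurd-sound ((c , []ᵥ) ∷ fs) t (h ∷ hs) with c <? + 0
  ... | yes c<0 = ℤ.<⇒≱ c<0 (subst (+ 0 ≤ℤ_) (ℤ.+-identityʳ c) h)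
  ... | no _    = absurd-sound fs t hs

  refutes-sound : ∀ {n} (xs : Vec ℤ n) fs → T (refutes fs) → All (NonNeg xs) fs → ⊥
  refutes-sound []ᵥ       fs t hs = absurd-sound fs t hs
  refutes-sound (x ∷ᵥ xs) fs t hs = refutes-sound xs (eliminate fs) t (eliminate-nonneg x xs fs hs)

  -- Over the integers a strict inequality is a weak one with a unit to spare. This is the only
  -- place where integrality enters the procedure; the elimination itself is rational.
  gap≤ gap< : ∀ {n} → Expr n → Expr n → Form n
  gap≤ a b = lin (b ⊝ a)
  gap< a b = lin (b ⊝ a ⊝ one)

  gap≤-nonneg : ∀ {n} (a b : Expr n) xs → ⟦ a ≲ b ⟧ₐ xs → NonNeg xs (gap≤ a b)
  gap≤-nonneg a b xs h = subst (+ 0 ≤ℤ_) (sym (lin-sound (b ⊝ a) xs)) (ℤ.i≤j⇒0≤j-i h)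

  i<j⇒0≤j-i-1 : ∀ {i j} → i <ℤ j → + 0 ≤ℤ j -ℤ i -ℤ + 1
  i<j⇒0≤j-i-1 {i} {j} h = subst (+ 0 ≤ℤ_) (ring i j) (ℤ.i≤j⇒0≤j-i (ℤ.i<j⇒suc[i]≤j h))
    where
    ring : ∀ i j → j -ℤ (+ 1 +ℤ i) ≡ j -ℤ i -ℤ + 1
    ring = solve-∀

  gap<-nonneg : ∀ {n} (a b : Expr n) xs → ⟦ a ≺ b ⟧ₐ xs → NonNeg xs (gap< a b)
  gap<-nonneg a b xs h = subst (+ 0 ≤ℤ_) (sym (lin-sound (b ⊝ a ⊝ one) xs)) (i<j⇒0≤j-i-1 h)

  forms : ∀ {n} → Atom n → List (Form n)
  forms (a ≲ b) = gap≤ a b ∷ []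
  forms (a ≺ b) = gap< a b ∷ []
  forms (a ≈ b) = gap≤ a b ∷ gap≤ b a ∷ []

  forms-nonneg : ∀ {n} (h : Atom n) xs → ⟦ h ⟧ₐ xs → All (NonNeg xs) (forms h)
  forms-nonneg (a ≲ b) xs h = gap≤-nonneg a b xs h ∷ []
  forms-nonneg (a ≺ b) xs h = gap<-nonneg a b xs h ∷ []
  forms-nonneg (a ≈ b) xs h = gap≤-nonneg a b xs (ℤ.≤-reflexive h) ∷ gap≤-nonneg b a xs (ℤ.≤-reflexive (sym h)) ∷ []

  valid : ∀ {n} → List (Form n) → Sequent n → Bool
  valid fs (h ⇒ s)     = valid (forms h ++ fs) s
  valid fs (⊢ (a ≲ b)) = refutes (gap< b a ∷ fs)
  valid fs (⊢ (a ≺ b)) = refutes (gap≤ b a ∷ fs)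
  valid fs (⊢ (a ≈ b)) = refutes (gap< b a ∷ fs) ∧ refutes (gap< a b ∷ fs)

  ≤-by-refutation : ∀ {n} (a b : Expr n) xs {fs} → T (refutes (gap< b a ∷ fs)) → All (NonNeg xs) fs → ⟦ a ≲ b ⟧ₐ xs
  ≤-by-refutation a b xs {fs} t hs with ⟦ a ⟧ₑ xs ≤? ⟦ b ⟧ₑ xs
  ... | yes p = p
  ... | no ¬p = ⊥-elim (refutes-sound xs (gap< b a ∷ fs) t (gap<-nonneg b a xs (ℤ.≰⇒> ¬p) ∷ hs))

  T-∧ : ∀ {a b} → T (a ∧ b) → T a × T b
  T-∧ {true} t = _ , t

  valid-sound : ∀ {n} fs (s : Sequent n) xs → T (valid fs s) → All (NonNeg xs) fs → ⟦ s ⟧ₛ xs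
  valid-sound fs (h ⇒ s) xs t hs p = valid-sound (forms h ++ fs) s xs t (++-All (forms-nonneg h xs p) hs)
  valid-sound fs (⊢ (a ≲ b)) xs t hs = ≤-by-refutation a b xs t hs
  valid-sound fs (⊢ (a ≺ b)) xs t hs with ⟦ a ⟧ₑ xs <? ⟦ b ⟧ₑ xs
  ... | yes p = p
  ... | no ¬p = ⊥-elim (refutes-sound xs (gap≤ b a ∷ fs) t (gap≤-nonneg b a xs (ℤ.≮⇒≥ ¬p) ∷ hs))
  valid-sound fs (⊢ (a ≈ b)) xs t hs with T-∧ {refutes (gap< b a ∷ fs)} t
  ... | t₁ , t₂ = ℤ.≤-antisym (≤-by-refutation a b xs t₁ hs) (≤-by-refutation b a xs t₂ hs)

  close : ∀ {A : Set} n → N-ary n (Expr n) A → A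
  close n f = f $ⁿ Vec.map var (Vec.allFin n)

  Curried : ∀ m → (Vec ℤ m → Set) → Set
  Curried zero    B = B []ᵥ
  Curried (suc m) B = ∀ x → Curried m (λ xs → B (x ∷ᵥ xs))

  curried : ∀ m {B : Vec ℤ m → Set} → (∀ xs → B xs) → Curried m B
  curried zero    g = g []ᵥ
  curried (suc m) g = λ x → curried m (λ xs → g (x ∷ᵥ xs))

  -- Linear arithmetic over ℤ, used as  lia n (λ x … → hypothesis ⇒ … ⇒ ⊢ goal) x …
  lia : ∀ n (f : N-ary n (Expr n) (Sequent n)) {_ : T (valid [] (close n f))} →
        Curried n ⟦ close n f ⟧ₛ
  lia n f {t} = curried n (λ xs → valid-sound [] (close n f) xs t [])

module AffineSymmetricGroup (k : ℕ) (1≤k : 1 ℕ.≤ k) where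

  open LinearArithmetic
  open import Data.Integer using (ℤ; +_; -[1+_]; _+_; _*_; -_; _-_; _≤_; _<_; _%ℕ_; _/ℕ_; +≤+; +<+; _<?_; _≤?_; _≟_; nonNegative)

  -- Affine permutations

  n : ℕ
  n = suc k

  opaque
    -- Opaque, so that `x + N` and `m * N` stay atoms for `lia` and the ring solver; `N≡n` gives the
    -- value back.
    N : ℤ
    N = + n

    N≡n : N ≡ + n
    N≡n = refl

  G : Set
  G = Fin n

  W : Set
  W = List G

  2≤N : + 2 ≤ N
  2≤N = subst (+ 2 ≤_) (sym N≡n) (+≤+ (ℕ.s≤s 1≤k))

  0<N : + 0 < N
  0<N = subst (+ 0 <_) (sym N≡n) (+<+ (ℕ.s≤s ℕ.z≤n))

  opaque
    ρ : ℤ → G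
    ρ x = fromℕ< (n%ℕd<d x n)

    toℕ-ρ : ∀ x → toℕ (ρ x) ≡ x %ℕ n
    toℕ-ρ x = Fin.toℕ-fromℕ< (n%ℕd<d x n)

  N-multiple-small : ∀ d → - N < d * N → d * N < N → d ≡ + 0
  N-multiple-small d lo hi = lia 1 (λ d → d ≺ one ⇒ con (- + 1) ≺ d ⇒ ⊢ d ≈ con (+ 0)) d
    (ℤ.*-cancelʳ-<-nonNeg N {{nonNeg}} (subst (d * N <_) (sym (ℤ.*-identityˡ N)) hi))
    (ℤ.*-cancelʳ-<-nonNeg N {{nonNeg}} (subst (_< d * N) (sym (ℤ.-1*i≡-i N)) lo))
    where
    nonNeg = nonNegative (ℤ.<⇒≤ 0<N)

  ρ-split : ∀ x → x ≡ + toℕ (ρ x) + (x /ℕ n) * N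
  ρ-split x = trans (a≡a%ℕn+[a/ℕn]*n x n)
    (cong₂ (λ t M → + t + (x /ℕ n) * M) (sym (toℕ-ρ x)) (sym N≡n))

  toℕ<N : ∀ (g : G) → + toℕ g < N
  toℕ<N g = subst (+ toℕ g <_) (sym N≡n) (+<+ (Fin.toℕ<n g))

  0≤toℕ : ∀ (g : G) → + 0 ≤ + toℕ g
  0≤toℕ g = +≤+ ℕ.z≤n

  ρ-unique : ∀ x (g : G) m → x ≡ + toℕ g + m * N → ρ x ≡ g
  ρ-unique x g m eq = Fin.toℕ-injective (ℤ.+-injective (lia 5
    (λ a b u v d → a ⊕ u ≈ b ⊕ v ⇒ u ⊝ v ≈ d ⇒ d ≈ con (+ 0) ⇒ ⊢ a ≈ b)
    a b u v ((q - m) * N) eq′ (diff q m N) (trans (cong (_* N) q≡m) (ℤ.*-zeroˡ N))))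
    where
    a = + toℕ (ρ x)
    b = + toℕ g
    q = x /ℕ n
    u = q * N
    v = m * N
    diff : ∀ q m N → q * N - m * N ≡ (q - m) * N
    diff = solve-∀
    eq′ : a + u ≡ b + v
    eq′ = trans (sym (ρ-split x)) eq
    q≡m : q - m ≡ + 0
    q≡m = N-multiple-small (q - m)
      (lia 6 (λ a b u v d N → a ⊕ u ≈ b ⊕ v ⇒ u ⊝ v ≈ d ⇒ a ≺ N ⇒ con (+ 0) ≲ b ⇒ ⊢ ⊖ N ≺ d)
        a b u v ((q - m) * N) N eq′ (diff q m N) (toℕ<N (ρ x)) (0≤toℕ g))
      (lia 6 (λ a b u v d N → a ⊕ u ≈ b ⊕ v ⇒ u ⊝ v ≈ d ⇒ b ≺ N ⇒ con (+ 0) ≲ a ⇒ ⊢ d ≺ N)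
        a b u v ((q - m) * N) N eq′ (diff q m N) (toℕ<N g) (0≤toℕ (ρ x)))

  ⌜_⌝ : G → ℤ
  ⌜ g ⌝ = + toℕ g

  ρ-⌜⌝ : ∀ g → ρ ⌜ g ⌝ ≡ g
  ρ-⌜⌝ g = ρ-unique ⌜ g ⌝ g (+ 0) (sym (ℤ.+-identityʳ _))

  ρ-periodic : ∀ x m → ρ (x + m * N) ≡ ρ x
  ρ-periodic x m = ρ-unique (x + m * N) (ρ x) (x /ℕ n + m)
    (trans (cong (_+ m * N) (ρ-split x)) (ring ⌜ ρ x ⌝ (x /ℕ n) m N))
    where
    ring : ∀ r q m N → r + q * N + m * N ≡ r + (q + m) * N
    ring = solve-∀

  ρ+N : ∀ x → ρ (x + N) ≡ ρ x
  ρ+N x = trans (cong (λ t → ρ (x + t)) (sym (ℤ.*-identityˡ N))) (ρ-periodic x (+ 1))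

  ρ-≡⇒multiple : ∀ {x y} → ρ x ≡ ρ y → Σ ℤ λ m → y ≡ x + m * N
  ρ-≡⇒multiple {x} {y} eq = y /ℕ n - x /ℕ n ,
    (begin
      y                                              ≡⟨ ρ-split y ⟩
      ⌜ ρ y ⌝ + (y /ℕ n) * N                         ≡⟨ cong (λ g → ⌜ g ⌝ + (y /ℕ n) * N) (sym eq) ⟩
      ⌜ ρ x ⌝ + (y /ℕ n) * N                         ≡⟨ ring ⌜ ρ x ⌝ (x /ℕ n) (y /ℕ n) N ⟩
      ⌜ ρ x ⌝ + (x /ℕ n) * N + (y /ℕ n - x /ℕ n) * N ≡⟨ cong (_+ (y /ℕ n - x /ℕ n) * N) (sym (ρ-split x)) ⟩
      x + (y /ℕ n - x /ℕ n) * N                      ∎)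
    where
    open ≡-Reasoning
    ring : ∀ r p q N → r + q * N ≡ r + p * N + (q - p) * N
    ring = solve-∀

  ρ-injective-window : ∀ {x y} → x - N < y → y < x + N → ρ x ≡ ρ y → y ≡ x
  ρ-injective-window {x} {y} lo hi eq with ρ-≡⇒multiple eq
  ... | m , refl = trans (cong (λ t → x + t * N) m≡0) (trans (cong (_+_ x) (ℤ.*-zeroˡ N)) (ℤ.+-identityʳ x))
    where
    m≡0 = N-multiple-small m
      (lia 3 (λ x u N → x ⊝ N ≺ x ⊕ u ⇒ ⊢ ⊖ N ≺ u) x (m * N) N lo)
      (lia 3 (λ x u N → x ⊕ u ≺ x ⊕ N ⇒ ⊢ u ≺ N) x (m * N) N hi)

  ρ-≢ : ∀ {x y} → x < y → y < x + N → ρ x ≢ ρ y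
  ρ-≢ {x} {y} lo hi eq = ℤ.<-irrefl (sym (ρ-injective-window
    (lia 3 (λ x y N → x ≺ y ⇒ con (+ 0) ≺ N ⇒ ⊢ x ⊝ N ≺ y) x y N lo 0<N) hi eq)) lo

  ρ-cong+ : ∀ {x y} d → ρ x ≡ ρ y → ρ (x + d) ≡ ρ (y + d)
  ρ-cong+ {x} d eq with ρ-≡⇒multiple eq
  ... | m , refl = sym (trans (cong ρ (ring x d (m * N))) (ρ-periodic (x + d) m))
    where
    ring : ∀ x d u → x + u + d ≡ x + d + u
    ring = solve-∀

  AdjNext-ρ : ∀ x → AdjNext k (ρ x) (ρ (x + + 1))
  AdjNext-ρ x = begin
    toℕ (ρ (x + + 1))          ≡⟨ cong toℕ (ρ-cong+ (+ 1) (sym (ρ-⌜⌝ (ρ x)))) ⟩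
    toℕ (ρ (⌜ ρ x ⌝ + + 1))    ≡⟨ toℕ-ρ (⌜ ρ x ⌝ + + 1) ⟩
    (toℕ (ρ x) ℕ.+ 1) ℕ.% n    ≡⟨ cong (ℕ._% n) (ℕ.+-comm (toℕ (ρ x)) 1) ⟩
    suc (toℕ (ρ x)) ℕ.% n      ∎
    where open ≡-Reasoning

  AdjNext⇒ρ : ∀ {i j} → AdjNext k i j → ∀ {x} → ρ x ≡ i → ρ (x + + 1) ≡ j
  AdjNext⇒ρ adj {x} refl = Fin.toℕ-injective (trans (AdjNext-ρ x) (sym adj))

  -- The n-periodic simple transposition: `x` and `x + 1` are exchanged for every `x` of residue
  -- `g`. The two tests exclude each other because `2 ≤ N`, as `σ-hi` has to verify.
  σ : G → ℤ → ℤ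
  σ g x with ρ x ≟F g | ρ (x - + 1) ≟F g
  ... | yes _ | _     = x + + 1
  ... | no _  | yes _ = x - + 1
  ... | no _  | no _  = x

  σ-lo : ∀ {g x} → ρ x ≡ g → σ g x ≡ x + + 1
  σ-lo {g} {x} eq with ρ x ≟F g | ρ (x - + 1) ≟F g
  ... | yes _ | _ = refl
  ... | no ¬p | _ = ⊥-elim (¬p eq)

  x+1-1 : ∀ x → x + + 1 - + 1 ≡ x
  x+1-1 = solve-∀

  x-1+1 : ∀ x → x - + 1 + + 1 ≡ x
  x-1+1 = solve-∀

  x<x+1 : ∀ x → x < x + + 1
  x<x+1 = lia 1 (λ x → ⊢ x ≺ x ⊕ one)

  x+1<x+N : ∀ x → x + + 1 < x + N
  x+1<x+N x = lia 2 (λ x N → con (+ 2) ≲ N ⇒ ⊢ x ⊕ one ≺ x ⊕ N) x N 2≤N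

  σ-hi : ∀ {g x} → ρ x ≡ g → σ g (x + + 1) ≡ x
  σ-hi {g} {x} eq with ρ (x + + 1) ≟F g | ρ (x + + 1 - + 1) ≟F g
  ... | yes p | _     = ⊥-elim (ρ-≢ (x<x+1 x) (x+1<x+N x) (trans eq (sym p)))
  ... | no _  | yes _ = x+1-1 x
  ... | no _  | no ¬p = ⊥-elim (¬p (trans (cong ρ (x+1-1 x)) eq))

  σ-fix : ∀ {g x} → ρ x ≢ g → ρ (x - + 1) ≢ g → σ g x ≡ x
  σ-fix {g} {x} p q with ρ x ≟F g | ρ (x - + 1) ≟F g
  ... | yes e | _     = ⊥-elim (p e)
  ... | no _  | yes e = ⊥-elim (q e)
  ... | no _  | no _  = refl

  data Place (g : G) (x : ℤ) : Set where
    at-lo : ρ x ≡ g → Place g x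
    at-hi : ∀ y → x ≡ y + + 1 → ρ y ≡ g → Place g x
    off   : ρ x ≢ g → ρ (x - + 1) ≢ g → Place g x

  place : ∀ g x → Place g x
  place g x with ρ x ≟F g | ρ (x - + 1) ≟F g
  ... | yes p | _     = at-lo p
  ... | no _  | yes p = at-hi (x - + 1) (sym (x-1+1 x)) p
  ... | no p  | no q  = off p q

  σ-involutive : ∀ g x → σ g (σ g x) ≡ x
  σ-involutive g x with place g x
  ... | at-lo p        = trans (cong (σ g) (σ-lo p)) (σ-hi p)
  ... | at-hi y refl p = trans (cong (σ g) (σ-hi p)) (σ-lo p)
  ... | off p q     = trans (cong (σ g) (σ-fix p q)) (σ-fix p q)

  σ-periodic : ∀ g x → σ g (x + N) ≡ σ g x + N
  σ-periodic g x with place g x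
  ... | at-lo p        = trans (σ-lo (trans (ρ+N x) p)) (trans (ring x N) (cong (_+ N) (sym (σ-lo p))))
    where
    ring : ∀ x N → x + N + + 1 ≡ x + + 1 + N
    ring = solve-∀
  ... | at-hi y refl p = trans (cong (σ g) (ring y N)) (trans (σ-hi (trans (ρ+N y) p)) (cong (_+ N) (sym (σ-hi p))))
    where
    ring : ∀ x N → x + + 1 + N ≡ x + N + + 1
    ring = solve-∀
  ... | off p q     = trans (σ-fix (p ∘ trans (sym (ρ+N x))) (q ∘ trans (sym (trans (cong ρ (ring x N)) (ρ+N (x - + 1)))))) (cong (_+ N) (sym (σ-fix p q)))
    where
    ring : ∀ x N → x + N - + 1 ≡ x - + 1 + N
    ring = solve-∀

  ρ-pred : ∀ {x y} → ρ (x + + 1) ≡ ρ (y + + 1) → ρ x ≡ ρ y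
  ρ-pred {x} {y} eq = trans (cong ρ (sym (x+1-1 x))) (trans (ρ-cong+ (- + 1) eq) (cong ρ (x+1-1 y)))

  σ-comm : ∀ {i j} → NonAdj k i j → ∀ x → σ i (σ j x) ≡ σ j (σ i x)
  σ-comm {i} {j} (i≁j , j≁i) x with i ≟F j
  -- `NonAdj` holds of a generator and itself, so equal generators have to be treated apart.
  ... | yes refl = refl
  ... | no i≢j with place i x
  ... | at-lo p = trans (cong (σ i) (σ-fix a b)) (trans (σ-lo p) (sym (trans (cong (σ j) (σ-lo p)) (σ-fix c d))))
    where
    a : ρ x ≢ j
    a e = i≢j (trans (sym p) e)
    b : ρ (x - + 1) ≢ j
    b refl = j≁i (subst (AdjNext k j) (trans (cong ρ (x-1+1 x)) p) (AdjNext-ρ (x - + 1)))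
    c : ρ (x + + 1) ≢ j
    c refl = i≁j (subst (λ g → AdjNext k g j) p (AdjNext-ρ x))
    d : ρ (x + + 1 - + 1) ≢ j
    d e = a (trans (cong ρ (sym (x+1-1 x))) e)
  ... | at-hi y refl p = trans (cong (σ i) (σ-fix c d)) (trans (σ-hi p) (sym (trans (cong (σ j) (σ-hi p)) (σ-fix a b))))
    where
    a : ρ y ≢ j
    a e = i≢j (trans (sym p) e)
    b : ρ (y - + 1) ≢ j
    b refl = j≁i (subst (AdjNext k j) (trans (cong ρ (x-1+1 y)) p) (AdjNext-ρ (y - + 1)))
    c : ρ (y + + 1) ≢ j
    c refl = i≁j (subst (λ g → AdjNext k g j) p (AdjNext-ρ y))
    d : ρ (y + + 1 - + 1) ≢ j
    d e = a (trans (cong ρ (sym (x+1-1 y))) e)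
  ... | off p q with place j x
  ... | at-lo r = trans (cong (σ i) (σ-lo r)) (trans (σ-fix c d) (sym (trans (cong (σ j) (σ-fix p q)) (σ-lo r))))
    where
    c : ρ (x + + 1) ≢ i
    c refl = j≁i (subst (λ g → AdjNext k g i) r (AdjNext-ρ x))
    d : ρ (x + + 1 - + 1) ≢ i
    d e = p (trans (cong ρ (sym (x+1-1 x))) e)
  ... | at-hi y refl r = trans (cong (σ i) (σ-hi r)) (trans (σ-fix c d) (sym (trans (cong (σ j) (σ-fix p q)) (σ-hi r))))
    where
    c : ρ y ≢ i
    c e = i≢j (trans (sym e) r)
    d : ρ (y - + 1) ≢ i
    d refl = i≁j (subst (AdjNext k i) (trans (cong ρ (x-1+1 y)) r) (AdjNext-ρ (y - + 1)))
  ... | off r s = trans (cong (σ i) (σ-fix r s)) (trans (σ-fix p q) (sym (trans (cong (σ j) (σ-fix p q)) (σ-fix r s))))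

  +1+1 : ∀ x → x + + 1 + + 1 ≡ x + + 2
  +1+1 = solve-∀

  module Triple (3≤N : + 3 ≤ N) {i j : G} (adj : AdjNext k i j) where

    next : ∀ {x} → ρ x ≡ i → ρ (x + + 1) ≡ j
    next = AdjNext⇒ρ adj

    i-lo : ∀ {x} → ρ x ≡ i → σ i x ≡ x + + 1
    i-lo = σ-lo

    i-hi : ∀ {x} → ρ x ≡ i → σ i (x + + 1) ≡ x
    i-hi = σ-hi

    j-lo : ∀ {x} → ρ x ≡ i → σ j (x + + 1) ≡ x + + 2
    j-lo {x} p = trans (σ-lo (next p)) (+1+1 x)

    j-hi : ∀ {x} → ρ x ≡ i → σ j (x + + 2) ≡ x + + 1
    j-hi {x} p = trans (cong (σ j) (sym (+1+1 x))) (σ-hi (next p))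

    i-fix : ∀ {x} → ρ x ≡ i → σ i (x + + 2) ≡ x + + 2
    i-fix {x} refl = σ-fix
      (λ e → ρ-≢ (lia 1 (λ x → ⊢ x ≺ x ⊕ con (+ 2)) x) (lia 2 (λ x N → con (+ 3) ≲ N ⇒ ⊢ x ⊕ con (+ 2) ≺ x ⊕ N) x N 3≤N) (sym e))
      (λ e → ρ-≢ (lia 1 (λ x → ⊢ x ≺ x ⊕ con (+ 2) ⊝ one) x) (lia 2 (λ x N → con (+ 3) ≲ N ⇒ ⊢ x ⊕ con (+ 2) ⊝ one ≺ x ⊕ N) x N 3≤N) (sym e))

    j-fix : ∀ {x} → ρ x ≡ i → σ j x ≡ x
    j-fix {x} refl = σ-fix
      (λ e → ρ-≢ (x<x+1 x) (x+1<x+N x) (trans e (sym (next refl))))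
      (λ e → ρ-≢ (lia 1 (λ x → ⊢ x ⊝ one ≺ x ⊕ one) x) (lia 2 (λ x N → con (+ 3) ≲ N ⇒ ⊢ x ⊕ one ≺ x ⊝ one ⊕ N) x N 3≤N) (trans e (sym (next refl))))

    -- Both sides reverse each triple `x`, `x + 1`, `x + 2` with `x` of residue `i` and fix all
    -- other places; `3 ≤ N` keeps the three residues distinct.
    σ-braid : ∀ x → σ i (σ j (σ i x)) ≡ σ j (σ i (σ j x))
    σ-braid x with place i x
    ... | at-lo p = trans (cong (σ i ∘ σ j) (i-lo p)) (trans (cong (σ i) (j-lo p)) (trans (i-fix p)
                 (sym (trans (cong (σ j ∘ σ i) (j-fix p)) (trans (cong (σ j) (i-lo p)) (j-lo p))))))
    ... | at-hi y refl p = trans (cong (σ i ∘ σ j) (i-hi p)) (trans (cong (σ i) (j-fix p)) (trans (i-lo p)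
                 (sym (trans (cong (σ j ∘ σ i) (j-lo p)) (trans (cong (σ j) (i-fix p)) (j-hi p))))))
    ... | off p q with place j x
    ... | at-lo r = ⊥-elim (q (trans (ρ-pred (trans (trans (cong ρ (x-1+1 x)) r) (sym (next (ρ-⌜⌝ i))))) (ρ-⌜⌝ i)))
    ... | at-hi y refl r = subst (λ t → σ i (σ j (σ i t)) ≡ σ j (σ i (σ j t))) eq top
      where
      z = y - + 1
      z≡i : ρ z ≡ i
      z≡i = trans (ρ-pred (trans (trans (cong ρ (x-1+1 y)) r) (sym (next (ρ-⌜⌝ i))))) (ρ-⌜⌝ i)
      eq : z + + 2 ≡ y + + 1
      eq = trans (sym (+1+1 z)) (cong (_+ + 1) (x-1+1 y))
      top : σ i (σ j (σ i (z + + 2))) ≡ σ j (σ i (σ j (z + + 2)))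
      top = trans (cong (σ i ∘ σ j) (i-fix z≡i)) (trans (cong (σ i) (j-hi z≡i)) (trans (i-hi z≡i)
            (sym (trans (cong (σ j ∘ σ i) (j-hi z≡i)) (trans (cong (σ j) (i-hi z≡i)) (j-fix z≡i))))))
    ... | off r s = trans (cong (σ i ∘ σ j) (σ-fix p q)) (trans (cong (σ i) (σ-fix r s)) (trans (σ-fix p q)
                 (sym (trans (cong (σ j ∘ σ i) (σ-fix r s)) (trans (cong (σ j) (σ-fix p q)) (σ-fix r s))))))

  3≤N-of : 2 ℕ.≤ k → + 3 ≤ N
  3≤N-of h = subst (+ 3 ≤_) (sym N≡n) (+≤+ (ℕ.s≤s h))

  -- The head letter meets a position first and therefore a state last: `f ∘ π (g ∷ a)` is
  -- `(f ∘ π a) ∘ σ g`. In this way words act on states from the left.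
  π : W → ℤ → ℤ
  π []      x = x
  π (g ∷ a) x = π a (σ g x)

  π-++ : ∀ a b x → π (a ++ b) x ≡ π b (π a x)
  π-++ []      b x = refl
  π-++ (g ∷ a) b x = π-++ a b (σ g x)

  π-periodic : ∀ a x → π a (x + N) ≡ π a x + N
  π-periodic []      x = refl
  π-periodic (g ∷ a) x = trans (cong (π a) (σ-periodic g x)) (π-periodic a (σ g x))

  π⁻¹ : W → ℤ → ℤ
  π⁻¹ []      x = x
  π⁻¹ (g ∷ a) x = σ g (π⁻¹ a x)

  π-π⁻¹ : ∀ a x → π a (π⁻¹ a x) ≡ x
  π-π⁻¹ []      x = refl
  π-π⁻¹ (g ∷ a) x = trans (cong (π a) (σ-involutive g (π⁻¹ a x))) (π-π⁻¹ a x)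

  π⁻¹-π : ∀ a x → π⁻¹ a (π a x) ≡ x
  π⁻¹-π []      x = refl
  π⁻¹-π (g ∷ a) x = trans (cong (σ g) (π⁻¹-π a (σ g x))) (σ-involutive g x)

  -- Ascents and good words

  State : Set
  State = ℤ → ℤ

  -- The period is left free because two sorted states are needed: `id`, of period `N`, governs
  -- reduced words, and `vac`, of period 1, governs cores.
  record Quasi (f : State) : Set where
    field
      per    : ℤ
      per>0  : + 0 < per
      stepN  : ∀ x → f (x + N) ≡ f x + per

  open Quasi

  quasi-∘ : ∀ {f} (h : ℤ → ℤ) → (∀ x → h (x + N) ≡ h x + N) → Quasi f → Quasi (f ∘ h)
  quasi-∘ {f} h eq q = record { per = per q ; per>0 = per>0 q ; stepN = λ x → trans (cong f (eq x)) (stepN q (h x)) }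

  quasi-π : ∀ {f} a → Quasi f → Quasi (f ∘ π a)
  quasi-π a = quasi-∘ (π a) (π-periodic a)

  quasi-σ : ∀ {f} g → Quasi f → Quasi (f ∘ σ g)
  quasi-σ g = quasi-∘ (σ g) (σ-periodic g)

  module _ {f} (q : Quasi f) where

    quasi-multipleℕ : ∀ m x → f (x + + m * N) ≡ f x + + m * per q
    quasi-multipleℕ zero x = trans (cong f (ring x N)) (sym (ring (f x) (per q)))
      where
      ring : ∀ x N → x + + 0 * N ≡ x
      ring = solve-∀
    quasi-multipleℕ (suc m) x = begin
      f (x + + suc m * N)             ≡⟨ cong f (ring x (+ m) N) ⟩
      f (x + + m * N + N)             ≡⟨ stepN q (x + + m * N) ⟩
      f (x + + m * N) + per q         ≡⟨ cong (_+ per q) (quasi-multipleℕ m x) ⟩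
      f x + + m * per q + per q       ≡⟨ sym (ring (f x) (+ m) (per q)) ⟩
      f x + + suc m * per q           ∎
      where
      open ≡-Reasoning
      ring : ∀ x m N → x + (+ 1 + m) * N ≡ x + m * N + N
      ring = solve-∀

    quasi-multiple : ∀ m x → f (x + m * N) ≡ f x + m * per q
    quasi-multiple (+ m)    x = quasi-multipleℕ m x
    quasi-multiple -[1+ m ] x = ring₂ (f (x + -[1+ m ] * N)) (f x) (+ suc m) (per q)
        (trans (cong f (sym (ring₁ x (+ suc m) N))) (quasi-multipleℕ (suc m) (x + -[1+ m ] * N)))
      where
      ring₁ : ∀ x m N → x + (- m) * N + m * N ≡ x
      ring₁ = solve-∀
      ring₀ : ∀ u m p → u ≡ u + m * p + (- m) * p
      ring₀ = solve-∀
      ring₂ : ∀ u v m p → v ≡ u + m * p → u ≡ v + (- m) * p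
      ring₂ u v m p refl = ring₀ u m p

    -- The constant serves all offsets `d` at once, hence comparing neighbouring values gives the
    -- same answer at all places of one residue. This justifies testing ascents at `⌜ g ⌝` only.
    shift : ∀ {x y} → ρ x ≡ ρ y → Σ ℤ λ c → ∀ d → f (y + d) ≡ f (x + d) + c
    shift {x} {y} eq with ρ-≡⇒multiple {x} {y} eq
    ... | m , refl = m * per q , λ d → trans (cong f (ring x (m * N) d)) (quasi-multiple m (x + d))
      where
      ring : ∀ x u d → x + u + d ≡ x + d + u
      ring = solve-∀

  Cmp : (ℤ → ℤ → Set) → G → State → Set
  Cmp R g f = R (f ⌜ g ⌝) (f (⌜ g ⌝ + + 1))

  Asc Desc Flat : G → State → Set
  Asc  = Cmp _<_
  Desc = Cmp (λ a b → b < a)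
  Flat = Cmp _≡_

  Translatable : (ℤ → ℤ → Set) → Set
  Translatable R = ∀ {a b} c → R a b → R (a + c) (b + c)

  <-translatable : Translatable _<_
  <-translatable c p = ℤ.+-monoˡ-< c p

  >-translatable : Translatable (λ a b → b < a)
  >-translatable c p = ℤ.+-monoˡ-< c p

  ≡-translatable : Translatable _≡_
  ≡-translatable c refl = refl

  transport : ∀ {R} → Translatable R → ∀ {f} → Quasi f → ∀ {x y} → ρ x ≡ ρ y → R (f x) (f (x + + 1)) → R (f y) (f (y + + 1))
  transport {R} tr {f} q {x} {y} eq r with shift q {x} {y} eq
  ... | c , h = subst₂ R (sym (subst₂ (λ u v → f u ≡ f v + c) (ℤ.+-identityʳ y) (ℤ.+-identityʳ x) (h (+ 0)))) (sym (h (+ 1))) (tr c r)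

  module _ {R} (tr : Translatable R) {f} (q : Quasi f) {g : G} where

    cmp-at : ∀ x → ρ x ≡ g → Cmp R g f → R (f x) (f (x + + 1))
    cmp-at x eq = transport {R} tr q (trans (ρ-⌜⌝ g) (sym eq))

    cmp-from : ∀ x → ρ x ≡ g → R (f x) (f (x + + 1)) → Cmp R g f
    cmp-from x eq = transport {R} tr q (trans eq (sym (ρ-⌜⌝ g)))

  asc-at : ∀ {f} → Quasi f → ∀ {g} x → ρ x ≡ g → Asc g f → f x < f (x + + 1)
  asc-at = cmp-at {_<_} <-translatable

  asc-from : ∀ {f} → Quasi f → ∀ {g} x → ρ x ≡ g → f x < f (x + + 1) → Asc g f
  asc-from = cmp-from {_<_} <-translatable

  desc-at : ∀ {f} → Quasi f → ∀ {g} x → ρ x ≡ g → Desc g f → f (x + + 1) < f x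
  desc-at = cmp-at {λ a b → b < a} >-translatable

  desc-from : ∀ {f} → Quasi f → ∀ {g} x → ρ x ≡ g → f (x + + 1) < f x → Desc g f
  desc-from = cmp-from {λ a b → b < a} >-translatable

  flat-at : ∀ {f} → Quasi f → ∀ {g} x → ρ x ≡ g → Flat g f → f x ≡ f (x + + 1)
  flat-at = cmp-at {_≡_} ≡-translatable

  cmp-≗ : ∀ R {g} {f f′ : State} → (∀ x → f x ≡ f′ x) → Cmp R g f → Cmp R g f′
  cmp-≗ R e r = subst₂ R (e _) (e _) r

  σ-swaps : ∀ R g (f : State) → Cmp R g (f ∘ σ g) → R (f (⌜ g ⌝ + + 1)) (f ⌜ g ⌝)
  σ-swaps R g f = subst₂ R (cong f (σ-lo (ρ-⌜⌝ g))) (cong f (σ-hi (ρ-⌜⌝ g)))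

  σ-swaps⁻ : ∀ R g (f : State) → R (f (⌜ g ⌝ + + 1)) (f ⌜ g ⌝) → Cmp R g (f ∘ σ g)
  σ-swaps⁻ R g f = subst₂ R (sym (cong f (σ-lo (ρ-⌜⌝ g)))) (sym (cong f (σ-hi (ρ-⌜⌝ g))))

  flat-σ : ∀ {f} → Quasi f → ∀ {g} → Flat g f → ∀ x → f (σ g x) ≡ f x
  flat-σ {f} q {g} fl x with place g x
  ... | at-lo p        = trans (cong f (σ-lo p)) (sym (flat-at q x p fl))
  ... | at-hi y refl p = trans (cong f (σ-hi p)) (flat-at q y p fl)
  ... | off p r     = cong f (σ-fix p r)

  NonAdj-sym : ∀ {i j} → NonAdj k i j → NonAdj k j i
  NonAdj-sym (p , q) = q , p

  -- For `N ≡ 2` the two generators are neighbours on both sides and satisfy no braid relation.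
  -- `double` isolates this case, which `double-absurd` excludes wherever it could occur.
  data Position (g h : G) : Set where
    same   : g ≡ h → Position g h
    far    : g ≢ h → NonAdj k g h → Position g h
    before : + 3 ≤ N → AdjNext k g h → Position g h
    after  : + 3 ≤ N → AdjNext k h g → Position g h
    double : N ≡ + 2 → ρ (⌜ h ⌝ + + 1) ≡ g → Position g h

  AdjNext? : ∀ g h → Dec (AdjNext k g h)
  AdjNext? g h = toℕ h ℕ.≟ _

  N-cases : + 3 ≤ N ⊎ N ≡ + 2
  N-cases with N ≤? + 2
  ... | yes p = inj₂ (lia 1 (λ N → N ≲ con (+ 2) ⇒ con (+ 2) ≲ N ⇒ ⊢ N ≈ con (+ 2)) N p 2≤N)
  ... | no ¬p = inj₁ (lia 1 (λ N → con (+ 2) ≺ N ⇒ ⊢ con (+ 3) ≲ N) N (ℤ.≰⇒> ¬p))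

  position : ∀ g h → Position g h
  position g h with g ≟F h
  ... | yes p = same p
  ... | no ¬p with AdjNext? g h | AdjNext? h g | N-cases
  ... | no a  | no b  | _      = far ¬p (a , b)
  ... | yes a | _     | inj₁ t = before t a
  ... | no _  | yes b | inj₁ t = after t b
  ... | no _  | yes b | inj₂ t = double t (AdjNext⇒ρ b (ρ-⌜⌝ h))
  ... | yes a | _     | inj₂ t = double t (trans (cong ρ eq) (trans (ρ+N ⌜-⌝) g≡))
    where
    ⌜-⌝ = ⌜ h ⌝ - + 1
    eq : ⌜ h ⌝ + + 1 ≡ ⌜-⌝ + N
    eq = lia 2 (λ x N → N ≈ con (+ 2) ⇒ ⊢ x ⊕ one ≈ x ⊝ one ⊕ N) ⌜ h ⌝ N t
    g≡ : ρ ⌜-⌝ ≡ g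
    g≡ = trans (ρ-pred (trans (cong ρ (x-1+1 ⌜ h ⌝)) (trans (ρ-⌜⌝ h) (sym (AdjNext⇒ρ a (ρ-⌜⌝ g)))))) (ρ-⌜⌝ g)

  far-cmp : ∀ R {f} {g h} → g ≢ h → NonAdj k g h → Cmp R g (f ∘ σ h) → Cmp R g f
  far-cmp R {f} {g} {h} g≢h (g≁h , h≁g) = subst₂ R
    (cong f (σ-fix (λ e → g≢h (trans (sym (ρ-⌜⌝ g)) e)) pred))
    (cong f (σ-fix succ (λ e → g≢h (trans (sym (trans (cong ρ (x+1-1 ⌜ g ⌝)) (ρ-⌜⌝ g))) e))))
    where
    pred : ρ (⌜ g ⌝ - + 1) ≢ h
    pred refl = h≁g (subst (AdjNext k h) (trans (cong ρ (x-1+1 ⌜ g ⌝)) (ρ-⌜⌝ g)) (AdjNext-ρ (⌜ g ⌝ - + 1)))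
    succ : ρ (⌜ g ⌝ + + 1) ≢ h
    succ refl = g≁h (subst (λ t → AdjNext k t h) (ρ-⌜⌝ g) (AdjNext-ρ ⌜ g ⌝))

  far-cmp⁻ : ∀ R {f} {g h} → g ≢ h → NonAdj k g h → Cmp R g f → Cmp R g (f ∘ σ h)
  far-cmp⁻ R {f} {g} {h} g≢h na r =
    far-cmp R {f ∘ σ h} g≢h na (cmp-≗ R {g} {f} {f ∘ σ h ∘ σ h} (λ x → sym (cong f (σ-involutive h x))) r)

  module Local (3≤N : + 3 ≤ N) {i j : G} (adj : AdjNext k i j) where
    open Triple 3≤N adj

    record Vals (f : State) (A B C : ℤ) : Set where
      constructor vals
      field
        quasi : Quasi f
        v₀    : f ⌜ i ⌝ ≡ A
        v₁    : f (⌜ i ⌝ + + 1) ≡ B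
        v₂    : f (⌜ i ⌝ + + 2) ≡ C
    open Vals

    values : ∀ {f} → Quasi f → Vals f (f ⌜ i ⌝) (f (⌜ i ⌝ + + 1)) (f (⌜ i ⌝ + + 2))
    values q = vals q refl refl refl

    swap-i : ∀ {f A B C} → Vals f A B C → Vals (f ∘ σ i) B A C
    swap-i {f} (vals q a b c) = vals (quasi-σ i q)
      (trans (cong f (i-lo (ρ-⌜⌝ i))) b) (trans (cong f (i-hi (ρ-⌜⌝ i))) a) (trans (cong f (i-fix (ρ-⌜⌝ i))) c)

    swap-j : ∀ {f A B C} → Vals f A B C → Vals (f ∘ σ j) A C B
    swap-j {f} (vals q a b c) = vals (quasi-σ j q)
      (trans (cong f (j-fix (ρ-⌜⌝ i))) a) (trans (cong f (j-lo (ρ-⌜⌝ i))) c) (trans (cong f (j-hi (ρ-⌜⌝ i))) b)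

    module _ {R} (tr : Translatable R) {f A B C} (v : Vals f A B C) where

      at-i : Cmp R i f → R A B
      at-i = subst₂ R (v₀ v) (v₁ v)

      from-i : R A B → Cmp R i f
      from-i = subst₂ R (sym (v₀ v)) (sym (v₁ v))

      at-j : Cmp R j f → R B C
      at-j r = subst₂ R (v₁ v) (trans (cong f (+1+1 ⌜ i ⌝)) (v₂ v)) (cmp-at {R} tr (quasi v) (⌜ i ⌝ + + 1) (next (ρ-⌜⌝ i)) r)

      from-j : R B C → Cmp R j f
      from-j r = cmp-from {R} tr (quasi v) (⌜ i ⌝ + + 1) (next (ρ-⌜⌝ i)) (subst₂ R (sym (v₁ v)) (sym (trans (cong f (+1+1 ⌜ i ⌝)) (v₂ v))) r)

    asc-i  = λ {f A B C} → at-i   {_<_} <-translatable {f} {A} {B} {C}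
    asc-j  = λ {f A B C} → at-j   {_<_} <-translatable {f} {A} {B} {C}
    asc-i⁻ = λ {f A B C} → from-i {_<_} <-translatable {f} {A} {B} {C}
    asc-j⁻ = λ {f A B C} → from-j {_<_} <-translatable {f} {A} {B} {C}

    desc-i  = λ {f A B C} → at-i   {λ a b → b < a} >-translatable {f} {A} {B} {C}
    desc-j  = λ {f A B C} → at-j   {λ a b → b < a} >-translatable {f} {A} {B} {C}
    desc-i⁻ = λ {f A B C} → from-i {λ a b → b < a} >-translatable {f} {A} {B} {C}
    desc-j⁻ = λ {f A B C} → from-j {λ a b → b < a} >-translatable {f} {A} {B} {C}

    flat-i  = λ {f A B C} → at-i   {_≡_} ≡-translatable {f} {A} {B} {C}
    flat-j  = λ {f A B C} → at-j   {_≡_} ≡-translatable {f} {A} {B} {C}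
    flat-i⁻ = λ {f A B C} → from-i {_≡_} ≡-translatable {f} {A} {B} {C}
    flat-j⁻ = λ {f A B C} → from-j {_≡_} ≡-translatable {f} {A} {B} {C}

  -- What exchange needs to know about two adjacent generators g, h and a state with an ascent at h
  -- that acquires a descent, or a flat step, at g after applying h.
  record Unbraid (g h : G) (f : State) : Set where
    field
      desc-g  : Desc g f
      desc-h  : Desc h (f ∘ σ g)
      asc-g   : Asc g (f ∘ σ g ∘ σ h)
      asc-h   : Asc h (f ∘ σ g ∘ σ h ∘ σ g)

  -- If A, B, C are the values of the state at three consecutive places starting at residue `g`, the
  -- hypotheses say B < C < A, and each field compares two of these values after some swaps.
  unbraid-before : + 3 ≤ N → ∀ {g h f} → AdjNext k g h → Quasi f → Asc h f → Desc g (f ∘ σ h) → Unbraid g h f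
  unbraid-before t {f = f} adj q a d = record
    { desc-g = desc-i⁻ v (ℤ.<-trans B<C C<A) ; desc-h = desc-j⁻ (swap-i v) C<A
    ; asc-g = asc-i⁻ (swap-j (swap-i v)) B<C ; asc-h = asc-j⁻ (swap-i (swap-j (swap-i v))) (ℤ.<-trans B<C C<A) }
    where
    open Local t adj
    v = values q
    B<C = asc-j v a
    C<A = desc-i (swap-j v) d

  unbraid-after : + 3 ≤ N → ∀ {g h f} → AdjNext k h g → Quasi f → Asc h f → Desc g (f ∘ σ h) → Unbraid g h f
  unbraid-after t adj q a d = record
    { desc-g = desc-j⁻ v (ℤ.<-trans C<A A<B) ; desc-h = desc-i⁻ (swap-j v) C<A
    ; asc-g = asc-j⁻ (swap-i (swap-j v)) A<B ; asc-h = asc-i⁻ (swap-j (swap-i (swap-j v))) (ℤ.<-trans C<A A<B) }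
    where
    open Local t adj
    v = values q
    A<B = asc-i v a
    C<A = desc-j (swap-i v) d

  flat-before : + 3 ≤ N → ∀ {g h f} → AdjNext k g h → Quasi f → Asc h f → Flat g (f ∘ σ h) → Desc g f × Flat h (f ∘ σ g)
  flat-before t adj q a fl = desc-i⁻ v (ℤ.<-≤-trans B<C (ℤ.≤-reflexive (sym A≡C))) , flat-j⁻ (swap-i v) A≡C
    where
    open Local t adj
    v = values q
    B<C = asc-j v a
    A≡C = flat-i (swap-j v) fl

  flat-after : + 3 ≤ N → ∀ {g h f} → AdjNext k h g → Quasi f → Asc h f → Flat g (f ∘ σ h) → Desc g f × Flat h (f ∘ σ g)
  flat-after t adj q a fl = desc-j⁻ v (ℤ.≤-<-trans (ℤ.≤-reflexive (sym A≡C)) A<B) , flat-i⁻ (swap-j v) A≡C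
    where
    open Local t adj
    v = values q
    A<B = asc-i v a
    A≡C = flat-j (swap-i v) fl

  -- With two residues, an ascent at `h` followed by the swap leaves `f h` at the next place and
  -- `f (h + 1)` plus a period at the one after it, so the other generator is again an ascent.
  -- Positivity of the period is what decides.
  double-absurd : ∀ {g h f} → N ≡ + 2 → ρ (⌜ h ⌝ + + 1) ≡ g → Quasi f → Asc h f →
    (f ∘ σ h) (⌜ h ⌝ + + 1 + + 1) ≤ (f ∘ σ h) (⌜ h ⌝ + + 1) → ⊥
  double-absurd {g} {h} {f} N≡2 e q a le = ℤ.<⇒≱ a (lia 5
    (λ A B p u v → u ≲ v ⇒ v ≈ A ⇒ u ≈ B ⊕ p ⇒ con (+ 0) ≺ p ⇒ ⊢ B ≲ A)
    (f x) (f (x + + 1)) (per q) (f (σ h (x + + 1 + + 1))) (f (σ h (x + + 1))) le (cong f (σ-hi (ρ-⌜⌝ h))) B′ (per>0 q))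
    where
    x = ⌜ h ⌝
    eq₁ : x + + 1 + + 1 ≡ x + N
    eq₁ = lia 2 (λ x N → N ≈ con (+ 2) ⇒ ⊢ x ⊕ one ⊕ one ≈ x ⊕ N) x N N≡2
    eq₂ : x + N + + 1 ≡ x + + 1 + N
    eq₂ = lia 2 (λ x N → ⊢ x ⊕ N ⊕ one ≈ x ⊕ one ⊕ N) x N
    B′ : f (σ h (x + + 1 + + 1)) ≡ f (x + + 1) + per q
    B′ = trans (cong (f ∘ σ h) eq₁) (trans (cong f (trans (σ-lo (trans (ρ+N x) (ρ-⌜⌝ h))) eq₂)) (stepN q (x + + 1)))

  -- Braid equivalence and the Coxeter presentation

  infix 4 _∼_

  -- Commutations and braids without cancellation: the relations common to W and 𝔸. They preserve
  -- the length, so they can carry statements about reduced words to both.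
  data _∼_ : W → W → Set where
    ∼-refl  : ∀ {a} → a ∼ a
    ∼-sym   : ∀ {a b} → a ∼ b → b ∼ a
    ∼-trans : ∀ {a b c} → a ∼ b → b ∼ c → a ∼ c
    ∼-cons  : ∀ g {a b} → a ∼ b → g ∷ a ∼ g ∷ b
    ∼-comm  : ∀ {i j} a → NonAdj k i j → i ∷ j ∷ a ∼ j ∷ i ∷ a
    ∼-braid : ∀ {i j} a → + 3 ≤ N → AdjNext k i j → i ∷ j ∷ i ∷ a ∼ j ∷ i ∷ j ∷ a

  ∼-length : ∀ {a b} → a ∼ b → length a ≡ length b
  ∼-length ∼-refl          = refl
  ∼-length (∼-sym e)       = sym (∼-length e)
  ∼-length (∼-trans e f)   = trans (∼-length e) (∼-length f)
  ∼-length (∼-cons g e)    = cong suc (∼-length e)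
  ∼-length (∼-comm a _)    = refl
  ∼-length (∼-braid a _ _) = refl

  ∼-π : ∀ {a b} → a ∼ b → ∀ x → π a x ≡ π b x
  ∼-π ∼-refl          x = refl
  ∼-π (∼-sym e)       x = sym (∼-π e x)
  ∼-π (∼-trans e f)   x = trans (∼-π e x) (∼-π f x)
  ∼-π (∼-cons g e)    x = ∼-π e (σ g x)
  ∼-π (∼-comm a na)   x = cong (π a) (sym (σ-comm na x))
  ∼-π (∼-braid a t p) x = cong (π a) (Triple.σ-braid t p x)

  ∼-++ʳ : ∀ {a b} c → a ∼ b → a ++ c ∼ b ++ c
  ∼-++ʳ c ∼-refl          = ∼-refl
  ∼-++ʳ c (∼-sym e)       = ∼-sym (∼-++ʳ c e)
  ∼-++ʳ c (∼-trans e f)   = ∼-trans (∼-++ʳ c e) (∼-++ʳ c f)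
  ∼-++ʳ c (∼-cons g e)    = ∼-cons g (∼-++ʳ c e)
  ∼-++ʳ c (∼-comm a na)   = ∼-comm (a ++ c) na
  ∼-++ʳ c (∼-braid a t p) = ∼-braid (a ++ c) t p

  ∼-++ˡ : ∀ c {a b} → a ∼ b → c ++ a ∼ c ++ b
  ∼-++ˡ []      e = e
  ∼-++ˡ (g ∷ c) e = ∼-cons g (∼-++ˡ c e)

  2≤k : + 3 ≤ N → 2 ℕ.≤ k
  2≤k t with subst (+ 3 ≤_) N≡n t
  ... | +≤+ (ℕ.s≤s h) = h

  CStep-cons : ∀ g {a b} → CStep k a b → CStep k (g ∷ a) (g ∷ b)
  CStep-cons g (del p q i)         = del (g ∷ p) q i
  CStep-cons g (comm p q i j h)    = comm (g ∷ p) q i j h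
  CStep-cons g (braid p q i j t h) = braid (g ∷ p) q i j t h

  CStep-++ʳ : ∀ c {a b} → CStep k a b → CStep k (a ++ c) (b ++ c)
  CStep-++ʳ c (del p q i)         = subst₂ (CStep k) (sym (++-assoc p _ c)) (sym (++-assoc p _ c)) (del p (q ++ c) i)
  CStep-++ʳ c (comm p q i j h)    = subst₂ (CStep k) (sym (++-assoc p _ c)) (sym (++-assoc p _ c)) (comm p (q ++ c) i j h)
  CStep-++ʳ c (braid p q i j t h) = subst₂ (CStep k) (sym (++-assoc p _ c)) (sym (++-assoc p _ c)) (braid p (q ++ c) i j t h)

  EqW-refl : ∀ {a} → EqW k a a
  EqW-refl = EqC.reflexive (CStep k)

  EqW-sym : ∀ {a b} → EqW k a b → EqW k b a
  EqW-sym = EqC.symmetric (CStep k)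

  EqW-trans : ∀ {a b c} → EqW k a b → EqW k b c → EqW k a c
  EqW-trans = EqC.transitive (CStep k)

  EqW-cons : ∀ g {a b} → EqW k a b → EqW k (g ∷ a) (g ∷ b)
  EqW-cons g = EqC.gmap (g ∷_) (CStep-cons g)

  EqW-++ʳ : ∀ c {a b} → EqW k a b → EqW k (a ++ c) (b ++ c)
  EqW-++ʳ c = EqC.gmap (_++ c) (CStep-++ʳ c)

  EqW-++ˡ : ∀ c {a b} → EqW k a b → EqW k (c ++ a) (c ++ b)
  EqW-++ˡ []      e = e
  EqW-++ˡ (g ∷ c) e = EqW-cons g (EqW-++ˡ c e)

  EqW-del : ∀ g a → EqW k (g ∷ g ∷ a) a
  EqW-del g a = EqC.return (del [] a g)

  ∼⇒EqW : ∀ {a b} → a ∼ b → EqW k a b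
  ∼⇒EqW ∼-refl          = EqW-refl
  ∼⇒EqW (∼-sym e)       = EqW-sym (∼⇒EqW e)
  ∼⇒EqW (∼-trans e f)   = EqW-trans (∼⇒EqW e) (∼⇒EqW f)
  ∼⇒EqW (∼-cons g e)    = EqW-cons g (∼⇒EqW e)
  ∼⇒EqW (∼-comm a na)   = EqC.return (comm [] a _ _ na)
  ∼⇒EqW (∼-braid a t p) = EqC.return (braid [] a _ _ (2≤k t) p)

  π-cong-++ : ∀ p {a b} → (∀ x → π a x ≡ π b x) → ∀ x → π (p ++ a) x ≡ π (p ++ b) x
  π-cong-++ []      h x = h x
  π-cong-++ (g ∷ p) h x = π-cong-++ p h (σ g x)

  CStep-π : ∀ {a b} → CStep k a b → ∀ x → π a x ≡ π b x
  CStep-π (del p q i)          = π-cong-++ p {i ∷ i ∷ q} {q} (λ x → cong (π q) (σ-involutive i x))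
  CStep-π (comm p q i j na)    = π-cong-++ p (∼-π (∼-comm q na))
  CStep-π (braid p q i j t na) = π-cong-++ p (∼-π (∼-braid q (3≤N-of t) na))

  EqW-π : ∀ {a b} → EqW k a b → ∀ x → π a x ≡ π b x
  EqW-π ε              x = refl
  EqW-π (fwd s ◅ rest) x = trans (CStep-π s x) (EqW-π rest x)
  EqW-π (bwd s ◅ rest) x = trans (sym (CStep-π s x)) (EqW-π rest x)

  -- In the action on states a good word is one that does not act as zero; for the state id the good words are
  -- the reduced ones, and for vac those of minimal coset representatives.
  Good : W → State → Set
  Good []      f = ⊤
  Good (g ∷ a) f = Good a f × Asc g (f ∘ π a)

  good? : ∀ a f → Dec (Good a f)
  good? []      f = yes tt
  good? (g ∷ a) f = good? a f ×-dec (_ <? _)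

  Sorted : State → Set
  Sorted f = ∀ g → f ⌜ g ⌝ ≤ f (⌜ g ⌝ + + 1)

  good-++ : ∀ a b {f} → Good (a ++ b) f → Good a (f ∘ π b) × Good b f
  good-++ []      b gd       = tt , gd
  good-++ (g ∷ a) b {f} (gd , h) =
    let ga , gb = good-++ a b gd in (ga , cmp-≗ _<_ {g} (λ x → cong f (π-++ a b x)) h) , gb

  good-++⁻ : ∀ a b {f} → Good a (f ∘ π b) → Good b f → Good (a ++ b) f
  good-++⁻ []      b ga       gb = gb
  good-++⁻ (g ∷ a) b {f} (ga , h) gb = good-++⁻ a b ga gb , cmp-≗ _<_ {g} (λ x → sym (cong f (π-++ a b x))) h

  good-≗ : ∀ a {f f′} → (∀ x → f x ≡ f′ x) → Good a f → Good a f′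
  good-≗ []      e gd       = tt
  good-≗ (g ∷ a) e (gd , h) = good-≗ a e gd , cmp-≗ _<_ {g} (λ x → e (π a x)) h

  -- Exchange, Matsumoto's theorem and coset factorisation over a sorted state

  module _ {f} (qf : Quasi f) (sf : Sorted f) where

    Exchange : W → G → Set
    Exchange a g = Σ W λ a′ → (a ∼ g ∷ a′) × Good a′ f

    ExchangeBelow : ℕ → Set
    ExchangeBelow m = ∀ a g → length a ℕ.≤ m → Good a f → Desc g (f ∘ π a) → Exchange a g

    remove-head : ∀ {a g a′} → a ∼ g ∷ a′ → ∀ x → f (π a (σ g x)) ≡ f (π a′ x)
    remove-head {g = g} {a′} e x = cong f (trans (∼-π e (σ g x)) (cong (π a′) (σ-involutive g x)))

    -- Exchange is applied twice: it pulls `g` out of `a`, then `h` out of what remains. The word is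
    -- now `h g h` followed by the rest, and a braid brings `g` to the front. The second call
    -- concerns a word other than the tail, whence the induction on a bound for the length.
    exchange-adjacent : ∀ m → ExchangeBelow m → ∀ {a g h} → length a ℕ.≤ m → Good a f → Unbraid g h (f ∘ π a) →
      (∀ c → h ∷ g ∷ h ∷ c ∼ g ∷ h ∷ g ∷ c) → Exchange (h ∷ a) g
    exchange-adjacent m below {a} {g} {h} le ga u br =
      let open Unbraid u
          a₁ , e₁ , g₁ = below a g le ga desc-g
          a₂ , e₂ , g₂ = below a₁ h (ℕ.≤-trans (ℕ.n≤1+n _) (subst (ℕ._≤ m) (∼-length e₁) le)) g₁
                           (cmp-≗ (λ u v → v < u) {h} (remove-head e₁) desc-h)
          back : ∀ x → f (π a (σ g (σ h x))) ≡ f (π a₂ x)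
          back x = trans (remove-head e₁ (σ h x)) (remove-head e₂ x)
      in h ∷ g ∷ a₂ , ∼-trans (∼-cons h (∼-trans e₁ (∼-cons g e₂))) (br a₂) ,
         (g₂ , cmp-≗ _<_ {g} back asc-g) , cmp-≗ _<_ {h} (λ x → back (σ g x)) asc-h

    exchange′ : ∀ m → ExchangeBelow m
    exchange′ m [] g _ _ d = ⊥-elim (ℤ.<⇒≱ d (sf g))
    exchange′ (suc m) (h ∷ a) g (ℕ.s≤s le) (ga , up) d with position g h
    ... | same refl = a , ∼-refl , ga
    ... | far g≢h na =
      let a′ , e , ga′ = exchange′ m a g le ga (far-cmp (λ u v → v < u) {f ∘ π a} g≢h na d)
      in h ∷ a′ , ∼-trans (∼-cons h e) (∼-comm a′ (NonAdj-sym na)) ,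
         ga′ , far-cmp _<_ {f ∘ π a′} (≢-sym g≢h) (NonAdj-sym na) (cmp-≗ _<_ {h} (λ x → cong f (∼-π e x)) up)
    ... | double t e = ⊥-elim (double-absurd {g} t e (quasi-π a qf) up (ℤ.<⇒≤ (desc-at (quasi-σ h (quasi-π a qf)) (⌜ h ⌝ + + 1) e d)))
    ... | before t adj = exchange-adjacent m (exchange′ m) le ga (unbraid-before t adj (quasi-π a qf) up d) (λ c → ∼-sym (∼-braid c t adj))
    ... | after t adj  = exchange-adjacent m (exchange′ m) le ga (unbraid-after t adj (quasi-π a qf) up d) (λ c → ∼-braid c t adj)

    exchange : ∀ a g → Good a f → Desc g (f ∘ π a) → Exchange a g
    exchange a g = exchange′ (length a) a g ℕ.≤-refl

    desc-last : ∀ {g a} → Good (g ∷ a) f → Desc g (f ∘ π (g ∷ a))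
    desc-last {g} {a} (_ , up) = σ-swaps⁻ (λ u v → v < u) g (f ∘ π a) up

    -- The head of `b` is a descent of the common final state, so exchange moves it to the front of
    -- `a` as well. At `id` this is Matsumoto's theorem for W; at `vac` it is the version for
    -- minimal coset representatives.
    matsumoto : ∀ a b → Good a f → Good b f → (∀ x → f (π a x) ≡ f (π b x)) → a ∼ b
    matsumoto [] [] ga gb e = ∼-refl
    matsumoto (h ∷ a) [] ga gb e = ⊥-elim (ℤ.<⇒≱ (cmp-≗ (λ u v → v < u) {h} e (desc-last {h} {a} ga)) (sf h))
    matsumoto a (h ∷ b) ga gb e =
      let a′ , s , ga′ = exchange a h ga (cmp-≗ (λ u v → v < u) {h} (λ x → sym (e x)) (desc-last {h} {b} gb))
      in ∼-trans s (∼-cons h (matsumoto a′ b ga′ (proj₁ gb) (λ x →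
           trans (sym (remove-head s x)) (trans (e (σ h x)) (cong (f ∘ π b) (σ-involutive h x))))))

    -- Deodhar's alternative to exchange: a generator that fixes the state `f ∘ π a` passes through
    -- `a` and comes out as a generator fixing `f`.
    Slide : W → G → Set
    Slide a g = Σ G λ j → Flat j f × EqW k (g ∷ a) (a ++ [ j ])

    SlideBelow : ℕ → Set
    SlideBelow m = ∀ a g → length a ℕ.≤ m → Good a f → Flat g (f ∘ π a) → Slide a g

    slide-adjacent : ∀ m → SlideBelow m → ∀ {a g h} → length a ℕ.≤ m → Good a f →
      Desc g (f ∘ π a) × Flat h (f ∘ π a ∘ σ g) → (∀ c → g ∷ h ∷ g ∷ c ∼ h ∷ g ∷ h ∷ c) → Slide (h ∷ a) g
    slide-adjacent m below {a} {g} {h} le ga (dg , fh) br =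
      let a₁ , e₁ , g₁ = exchange a g ga dg
          j , fj , e = below a₁ h (ℕ.≤-trans (ℕ.n≤1+n _) (subst (ℕ._≤ m) (∼-length e₁) le)) g₁
                         (cmp-≗ _≡_ {h} (remove-head e₁) fh)
      in j , fj , EqW-trans (∼⇒EqW (∼-trans (∼-cons g (∼-cons h e₁)) (br a₁)))
           (EqW-cons h (EqW-trans (EqW-cons g e) (EqW-++ʳ [ j ] (EqW-sym (∼⇒EqW e₁)))))

    slide′ : ∀ m → SlideBelow m
    slide′ m [] g _ _ fl = g , fl , EqW-refl
    slide′ (suc m) (h ∷ a) g (ℕ.s≤s le) (ga , up) fl with position g h
    ... | same refl = ⊥-elim (ℤ.<-irrefl (σ-swaps (λ u v → v ≡ u) g (f ∘ π a) (sym fl)) up)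
    ... | far g≢h na =
      let j , fj , e = slide′ m a g le ga (far-cmp _≡_ {f ∘ π a} g≢h na fl)
      in j , fj , EqW-trans (∼⇒EqW (∼-comm a na)) (EqW-cons h e)
    ... | double t e = ⊥-elim (double-absurd {g} t e (quasi-π a qf) up
                         (ℤ.≤-reflexive (sym (flat-at (quasi-σ h (quasi-π a qf)) (⌜ h ⌝ + + 1) e fl))))
    ... | before t adj = slide-adjacent m (slide′ m) le ga (flat-before t adj (quasi-π a qf) up fl) (λ c → ∼-braid c t adj)
    ... | after t adj  = slide-adjacent m (slide′ m) le ga (flat-after t adj (quasi-π a qf) up fl) (λ c → ∼-sym (∼-braid c t adj))

    slide : ∀ a g → Good a f → Flat g (f ∘ π a) → Slide a g
    slide a g = slide′ (length a) a g ℕ.≤-refl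

    -- The factorisation of a group element into a good word and an element of the stabiliser of
    -- `f`. The field `strict` makes shortness a criterion: a word that cannot be shortened in its
    -- coset must be good.
    record Normal (a : W) : Set where
      field
        word   : W
        tail   : W
        eqW    : EqW k a (word ++ tail)
        good   : Good word f
        stab   : All (λ g → Flat g f) tail
        short  : length word ℕ.≤ length a
        strict : Good a f ⊎ length word ℕ.< length a

    stab-fixes : ∀ t → All (λ g → Flat g f) t → ∀ y → f (π t y) ≡ f y
    stab-fixes []      []       y = refl
    stab-fixes (j ∷ t) (p ∷ ps) y = trans (stab-fixes t ps (σ j y)) (flat-σ qf p y)

    -- Letters are added from the right. An ascent extends the good word, a flat step slides through
    -- it into the stabiliser, and a descent cancels against a letter brought forward by exchange.
    normalise : ∀ a → Normal a
    normalise [] = record { word = [] ; tail = [] ; eqW = EqW-refl ; good = tt ; stab = [] ; short = ℕ.z≤n ; strict = inj₁ tt }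
    normalise (g ∷ a) with normalise a
    ... | record { word = w ; tail = t ; eqW = e ; good = gw ; stab = st ; short = sh ; strict = sc }
      with ℤ.<-cmp (f (π w ⌜ g ⌝)) (f (π w (⌜ g ⌝ + + 1)))
    ... | tri< up _ _ = record { word = g ∷ w ; tail = t ; eqW = EqW-cons g e ; good = gw , up ; stab = st
                               ; short = ℕ.s≤s sh ; strict = strict′ sc }
      where
      strict′ : Good a f ⊎ length w ℕ.< length a → Good (g ∷ a) f ⊎ suc (length w) ℕ.< suc (length a)
      strict′ (inj₂ lt) = inj₂ (ℕ.s≤s lt)
      strict′ (inj₁ ga) with good? (g ∷ a) f
      ... | yes p = inj₁ p
      ... | no ¬p = ⊥-elim (¬p (ga , cmp-≗ _<_ {g} same-state up))
        where
        same-state : ∀ x → f (π w x) ≡ f (π a x)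
        same-state x = sym (trans (cong f (trans (EqW-π e x) (π-++ w t x))) (stab-fixes t st (π w x)))
    ... | tri≈ _ fl _ with slide w g gw fl
    ... | j , fj , s = record { word = w ; tail = j ∷ t
          ; eqW = EqW-trans (EqW-cons g e) (subst (EqW k (g ∷ w ++ t)) (++-assoc w [ j ] t) (EqW-++ʳ t s))
          ; good = gw ; stab = fj ∷ st ; short = ℕ.m≤n⇒m≤1+n sh ; strict = inj₂ (ℕ.s≤s sh) }
    normalise (g ∷ a) | record { word = w ; tail = t ; eqW = e ; good = gw ; stab = st ; short = sh ; strict = sc }
      | tri> _ _ dn with exchange w g gw dn
    ... | w′ , s , gw′ = record { word = w′ ; tail = t
          ; eqW = EqW-trans (EqW-cons g (EqW-trans e (EqW-++ʳ t (∼⇒EqW s)))) (EqW-del g (w′ ++ t))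
          ; good = gw′ ; stab = st ; short = ℕ.m≤n⇒m≤1+n (ℕ.<⇒≤ lt) ; strict = inj₂ (ℕ.m≤n⇒m≤1+n lt) }
      where
      lt : length w′ ℕ.< length a
      lt = subst (ℕ._≤ length a) (∼-length s) sh

    normal-state : ∀ {a} (na : Normal a) → ∀ x → f (π a x) ≡ f (π (Normal.word na) x)
    normal-state {a} na x = trans (cong f (trans (EqW-π eqW x) (π-++ word tail x))) (stab-fixes tail stab (π word x))
      where open Normal na

    good-shortest : ∀ {a} b → Good a f → (∀ x → f (π a x) ≡ f (π b x)) → length a ℕ.≤ length b
    good-shortest {a} b ga e = subst (ℕ._≤ length b) (sym (∼-length (matsumoto a word ga good (λ x → trans (e x) (normal-state (normalise b) x))))) short
      where open Normal (normalise b)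

  -- Inversions

  id-quasi : Quasi id
  id-quasi = record { per = N ; per>0 = 0<N ; stepN = λ x → refl }

  id-sorted : Sorted id
  id-sorted g = ℤ.<⇒≤ (x<x+1 ⌜ g ⌝)

  -- The ground state

  opaque
    -- The offset by one makes the negative places exactly those with `x ≤ 0`, the beads `- r` of
    -- the empty partition. It also makes generator 0 the only one at which `vac` is not flat, so
    -- the generators of W_0 are those fixing it.
    vac : State
    vac x = (x - + 1) /ℕ n

    vac-split : ∀ x → Σ ℕ λ r → r ℕ.< n × x - + 1 ≡ + r + vac x * N
    vac-split x = (x - + 1) %ℕ n , DivMod.n%ℕd<d (x - + 1) n ,
      trans (DivMod.a≡a%ℕn+[a/ℕn]*n (x - + 1) n) (cong (λ M → + ((x - + 1) %ℕ n) + vac x * M) (sym N≡n))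

  vac-lower : ∀ x → vac x * N < x
  vac-lower x with vac-split x
  ... | r , r<n , eq = lia 3 (λ x r u → x ⊝ one ≈ r ⊕ u ⇒ con (+ 0) ≲ r ⇒ ⊢ u ≺ x) x (+ r) (vac x * N) eq (+≤+ ℕ.z≤n)

  vac-upper : ∀ x → x ≤ vac x * N + N
  vac-upper x with vac-split x
  ... | r , r<n , eq = lia 4 (λ x r u N → x ⊝ one ≈ r ⊕ u ⇒ r ≺ N ⇒ ⊢ x ≲ u ⊕ N) x (+ r) (vac x * N) N eq
                         (subst (+ r <_) (sym N≡n) (+<+ r<n))

  vac-unique : ∀ x m → m * N < x → x ≤ m * N + N → vac x ≡ m
  vac-unique x m lo hi = lia 2 (λ u m → u ⊝ m ≈ con (+ 0) ⇒ ⊢ u ≈ m) (vac x) m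
    (N-multiple-small (vac x - m)
      (lia 5 (λ x u v d N → v ≺ x ⇒ x ≲ u ⊕ N ⇒ d ≈ u ⊝ v ⇒ ⊢ ⊖ N ≺ d) x (vac x * N) (m * N) ((vac x - m) * N) N
        lo (vac-upper x) (ring (vac x) m N))
      (lia 5 (λ x u v d N → u ≺ x ⇒ x ≲ v ⊕ N ⇒ d ≈ u ⊝ v ⇒ ⊢ d ≺ N) x (vac x * N) (m * N) ((vac x - m) * N) N
        (vac-lower x) hi (ring (vac x) m N)))
    where
    ring : ∀ u m N → (u - m) * N ≡ u * N - m * N
    ring = solve-∀

  vac-stepN : ∀ x → vac (x + N) ≡ vac x + + 1
  vac-stepN x = vac-unique (x + N) (vac x + + 1)
    (lia 4 (λ x u v N → u ≺ x ⇒ v ≈ u ⊕ N ⇒ ⊢ v ≺ x ⊕ N) x (vac x * N) ((vac x + + 1) * N) N (vac-lower x) (ring (vac x) N))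
    (lia 4 (λ x u v N → x ≲ u ⊕ N ⇒ v ≈ u ⊕ N ⇒ ⊢ x ⊕ N ≲ v ⊕ N) x (vac x * N) ((vac x + + 1) * N) N (vac-upper x) (ring (vac x) N))
    where
    ring : ∀ u N → (u + + 1) * N ≡ u * N + N
    ring = solve-∀

  vac-quasi : Quasi vac
  vac-quasi = record { per = + 1 ; per>0 = +<+ (ℕ.s≤s ℕ.z≤n) ; stepN = vac-stepN }

  *N-mono : ∀ {a b} → a ≤ b → a * N ≤ b * N
  *N-mono = ℤ.*-monoʳ-≤-nonNeg N {{Data.Integer.nonNegative (ℤ.<⇒≤ 0<N)}}

  vac-mono : ∀ {x y} → x ≤ y → vac x ≤ vac y
  vac-mono {x} {y} le with vac x ≤? vac y
  ... | yes p = p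
  ... | no ¬p = ⊥-elim (ℤ.<⇒≱ (vac-lower x)
    (lia 5 (λ x y u v N → x ≲ y ⇒ y ≲ v ⊕ N ⇒ v ⊕ N ≲ u ⇒ ⊢ x ≲ u) x y (vac x * N) (vac y * N) N le (vac-upper y)
      (subst (_≤ vac x * N) (ring (vac y) N) (*N-mono (ℤ.i<j⇒suc[i]≤j (ℤ.≰⇒> ¬p))))))
    where
    ring : ∀ u N → (+ 1 + u) * N ≡ u * N + N
    ring = solve-∀

  vac-sorted : Sorted vac
  vac-sorted g = vac-mono (ℤ.<⇒≤ (x<x+1 ⌜ g ⌝))

  vac≡0 : ∀ x → + 0 < x → x ≤ N → vac x ≡ + 0
  vac≡0 x lo hi = vac-unique x (+ 0) (subst (_< x) (sym (ℤ.*-zeroˡ N)) lo)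
    (subst (x ≤_) (sym (trans (cong (_+ N) (ℤ.*-zeroˡ N)) (ℤ.+-identityˡ N))) hi)

  vac≡-1 : ∀ x → - N < x → x ≤ + 0 → vac x ≡ - + 1
  vac≡-1 x lo hi = lia 1 (λ u → con (+ 0) ≈ u ⊕ one ⇒ ⊢ u ≈ con (- + 1)) (vac x)
    (trans (sym (vac≡0 (x + N) (lia 2 (λ x N → ⊖ N ≺ x ⇒ ⊢ con (+ 0) ≺ x ⊕ N) x N lo)
                               (lia 2 (λ x N → x ≲ con (+ 0) ⇒ ⊢ x ⊕ N ≲ N) x N hi)))
           (vac-stepN x))

  vac-nonneg : ∀ x → + 0 < x → + 0 ≤ vac x
  vac-nonneg x lo = subst (_≤ vac x) (vac≡0 (+ 1) (+<+ (ℕ.s≤s ℕ.z≤n)) (ℤ.≤-trans (+≤+ (ℕ.s≤s ℕ.z≤n)) 2≤N))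
    (vac-mono (ℤ.i<j⇒suc[i]≤j lo))

  vac-neg : ∀ x → x ≤ + 0 → vac x < + 0
  vac-neg x hi = ℤ.≤-<-trans (vac-mono hi) (subst (_< + 0) (sym (vac≡-1 (+ 0) (lia 1 (λ N → con (+ 0) ≺ N ⇒ ⊢ ⊖ N ≺ con (+ 0)) N 0<N) ℤ.≤-refl)) Data.Integer.-<+)

  vac-flat : ∀ g → Flat g vac → ¬ (toℕ g ≡ 0)
  vac-flat g fl eq = ℤ.<⇒≢ (ℤ.<-≤-trans (vac-neg ⌜ g ⌝ (ℤ.≤-reflexive (cong +_ eq)))
    (vac-nonneg (⌜ g ⌝ + + 1) (lia 1 (λ x → con (+ 0) ≲ x ⇒ ⊢ con (+ 0) ≺ x ⊕ one) ⌜ g ⌝ (0≤toℕ g)))) fl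

  flat-vac : ∀ g → ¬ (toℕ g ≡ 0) → Flat g vac
  flat-vac g ne = trans (vac≡0 _ g>0 (ℤ.<⇒≤ (toℕ<N g)))
    (sym (vac≡0 _ (ℤ.<-trans g>0 (x<x+1 ⌜ g ⌝)) (lia 2 (λ x N → x ≺ N ⇒ ⊢ x ⊕ one ≲ N) ⌜ g ⌝ N (toℕ<N g))))
    where
    g>0 : + 0 < ⌜ g ⌝
    g>0 = +<+ (ℕ.n≢0⇒n>0 ne)

  infix 2 _⟺_
  _⟺_ : Set → Set → Set
  A ⟺ B = (A → B) × (B → A)

  ∼-good : ∀ {f} → Quasi f → ∀ {a b} → a ∼ b → Good a f ⟺ Good b f
  ∼-good qf ∼-refl          = id , id
  ∼-good qf (∼-sym e)       = proj₂ (∼-good qf e) , proj₁ (∼-good qf e)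
  ∼-good qf (∼-trans e e′)  = proj₁ (∼-good qf e′) ∘ proj₁ (∼-good qf e) , proj₂ (∼-good qf e) ∘ proj₂ (∼-good qf e′)
  ∼-good {f} qf (∼-cons g e) =
    (λ (p , h) → proj₁ (∼-good qf e) p , cmp-≗ _<_ {g} (λ x → cong f (∼-π e x)) h) ,
    (λ (p , h) → proj₂ (∼-good qf e) p , cmp-≗ _<_ {g} (λ x → sym (cong f (∼-π e x))) h)
  ∼-good {f} qf (∼-comm {i} {j} a na) with i ≟F j
  ... | yes refl = id , id
  ... | no i≢j   = flip i≢j na , flip (≢-sym i≢j) (NonAdj-sym na)
    where
    flip : ∀ {i j} → i ≢ j → NonAdj k i j → Good (i ∷ j ∷ a) f → Good (j ∷ i ∷ a) f
    flip {i} {j} ne na ((p , hj) , hi) =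
      (p , far-cmp _<_ {f ∘ π a} ne na hi) , far-cmp⁻ _<_ {f ∘ π a} (≢-sym ne) (NonAdj-sym na) hj
  ∼-good {f} qf (∼-braid {i} {j} a t adj) =
    (λ (((p , h₁) , h₂) , h₃) →
      ((p , asc-j⁻ v (asc-i (swap-j (swap-i v)) h₃)) ,
        asc-i⁻ (swap-j v) (asc-j (swap-i v) h₂)) ,
        asc-j⁻ (swap-i (swap-j v)) (asc-i v h₁)) ,
    (λ (((p , h₁) , h₂) , h₃) →
      ((p , asc-i⁻ v (asc-j (swap-i (swap-j v)) h₃)) ,
        asc-j⁻ (swap-i v) (asc-i (swap-j v) h₂)) ,
        asc-i⁻ (swap-j (swap-i v)) (asc-j v h₁))
    where
    open Local t adj
    v = values (quasi-π a qf)

  record Repeats (a : W) : Set where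
    constructor repeats
    field
      pre    : W
      letter : G
      post   : W
      equiv  : a ∼ pre ++ letter ∷ letter ∷ post

  π-injective : ∀ a {x y} → π a x ≡ π a y → x ≡ y
  π-injective a {x} {y} e = trans (sym (π⁻¹-π a x)) (trans (cong (π⁻¹ a) e) (π⁻¹-π a y))

  not-good-repeats : ∀ a → ¬ Good a id → Repeats a
  not-good-repeats [] ¬g = ⊥-elim (¬g tt)
  not-good-repeats (h ∷ a) ¬g with good? a id
  ... | no ¬ga = let open Repeats (not-good-repeats a ¬ga) in repeats (h ∷ pre) letter post (∼-cons h equiv)
  ... | yes ga with ℤ.<-cmp (π a ⌜ h ⌝) (π a (⌜ h ⌝ + + 1))
  ... | tri< up _ _ = ⊥-elim (¬g (ga , up))
  ... | tri≈ _ eq _ = ⊥-elim (ℤ.<-irrefl (π-injective a eq) (x<x+1 ⌜ h ⌝))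
  ... | tri> _ _ dn =
    let b , e , _ = exchange id-quasi id-sorted a h ga dn in repeats [] h b (∼-cons h e)

  repeats-not-good : ∀ {f} → Quasi f → ∀ {a} → Repeats a → ¬ Good a f
  repeats-not-good {f} qf (repeats p g b e) ga =
    let _ , (gb , h₁) , h₂ = good-++ p (g ∷ g ∷ b) (proj₁ (∼-good qf e) ga)
    in ℤ.<-asym h₁ (σ-swaps _<_ g (f ∘ π b) h₂)

  -- A word that is not good at `id` is braid equivalent to one with a doubled letter, and a doubled
  -- letter cannot be good at any state.
  good-id : ∀ {f} → Quasi f → ∀ a → Good a f → Good a id
  good-id qf a ga with good? a id
  ... | yes p = p
  ... | no ¬p = ⊥-elim (repeats-not-good qf (not-good-repeats a ¬p) ga)

  σ-order : ∀ g {p p′} → p < p′ → σ g p < σ g p′ ⊎ (ρ p ≡ g × p′ ≡ p + + 1)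
  σ-order g {p} {p′} lt with place g p | place g p′
  ... | at-lo e        | at-lo e′         = inj₁ (subst₂ _<_ (sym (σ-lo e)) (sym (σ-lo e′)) (ℤ.+-monoˡ-< (+ 1) lt))
  ... | at-lo e        | off a b       = inj₁ (subst₂ _<_ (sym (σ-lo e)) (sym (σ-fix a b))
        (ℤ.≤∧≢⇒< (lia 2 (λ p q → p ≺ q ⇒ ⊢ p ⊕ one ≲ q) p p′ lt) (λ eq → b (trans (cong ρ (trans (cong (_- + 1) (sym eq)) (x+1-1 p))) e))))
  ... | at-lo e        | at-hi y′ refl e′ with p ≟ y′
  ...   | yes refl = inj₂ (e , refl)
  ...   | no p≢y′  = inj₁ (subst₂ _<_ (sym (σ-lo e)) (sym (σ-hi e′)) (lia 3
          (λ p y N → p ≺ y ⊕ one ⇒ p ⊕ N ≲ y ⇒ con (+ 2) ≲ N ⇒ ⊢ p ⊕ one ≺ y) p y′ N lt far-apart 2≤N))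
    where
    p<y′ : p < y′
    p<y′ = ℤ.≤∧≢⇒< (lia 2 (λ p y → p ≺ y ⊕ one ⇒ ⊢ p ≲ y) p y′ lt) p≢y′
    far-apart : p + N ≤ y′
    far-apart with y′ <? p + N
    ... | yes near = ⊥-elim (ρ-≢ p<y′ near (trans e (sym e′)))
    ... | no ¬near = ℤ.≮⇒≥ ¬near
  σ-order g {p} {p′} lt | at-hi y refl e | q = inj₁ (ℤ.<-≤-trans (subst (_< y + + 1) (sym (σ-hi e)) (x<x+1 y)) (below q))
    where
    below : Place g p′ → y + + 1 ≤ σ g p′
    below (at-lo e′) = subst (y + + 1 ≤_) (sym (σ-lo e′)) (lia 2 (λ y q → y ⊕ one ≺ q ⇒ ⊢ y ⊕ one ≲ q ⊕ one) y p′ lt)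
    below (at-hi y′ refl e′) = subst (y + + 1 ≤_) (sym (σ-hi e′)) (lia 2 (λ y q → y ⊕ one ≺ q ⊕ one ⇒ ⊢ y ⊕ one ≲ q) y y′ lt)
    below (off a b) = subst (y + + 1 ≤_) (sym (σ-fix a b)) (ℤ.<⇒≤ lt)
  σ-order g {p} {p′} lt | off a b | q = inj₁ (subst (_< σ g p′) (sym (σ-fix a b)) (above q))
    where
    above : Place g p′ → p < σ g p′
    above (at-lo e′) = subst (p <_) (sym (σ-lo e′)) (ℤ.<-trans lt (x<x+1 p′))
    above (at-hi y′ refl e′) = subst (p <_) (sym (σ-hi e′))
      (ℤ.≤∧≢⇒< (lia 2 (λ p y → p ≺ y ⊕ one ⇒ ⊢ p ≲ y) p y′ lt) (λ { refl → a e′ }))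
    above (off c d) = subst (p <_) (sym (σ-fix c d)) lt

  -- Strict separation by `f` of every inversion of the permutation. Unlike `Good` this ignores the
  -- letters, and for words good at `id` the two conditions agree by the next two lemmas. It is the
  -- means of handling reduced words that are not given explicitly.
  Inverts : W → State → Set
  Inverts a f = ∀ {p p′} → p < p′ → π a p′ < π a p → f (π a p′) < f (π a p)

  good⇒inverts : ∀ {f} → Quasi f → ∀ a → Good a f → Inverts a f
  good⇒inverts qf [] _ lt inv = ⊥-elim (ℤ.<-asym lt inv)
  good⇒inverts {f} qf (g ∷ a) (ga , up) {p} {p′} lt inv with σ-order g lt
  ... | inj₁ lt′ = good⇒inverts qf a ga lt′ inv
  ... | inj₂ (e , refl) = subst₂ (λ s t → f (π a s) < f (π a t)) (sym (σ-hi e)) (sym (σ-lo e)) (asc-at (quasi-π a qf) p e up)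

  inverts⇒good : ∀ {f} → Quasi f → ∀ a → Good a id → Inverts a f → Good a f
  inverts⇒good qf [] _ _ = tt
  inverts⇒good {f} qf (g ∷ a) (ga , up) inv = inverts⇒good qf a ga inv′ , up′
    where
    x = ⌜ g ⌝
    inv′ : Inverts a f
    inv′ {p} {p′} lt h with σ-order g lt
    ... | inj₁ lt′ = subst₂ (λ s t → f (π a s) < f (π a t)) (σ-involutive g p′) (σ-involutive g p)
          (inv lt′ (subst₂ (λ s t → π a s < π a t) (sym (σ-involutive g p′)) (sym (σ-involutive g p)) h))
    ... | inj₂ (e , refl) = ⊥-elim (ℤ.<-asym h (asc-at (quasi-π a id-quasi) p e up))
    up′ : f (π a x) < f (π a (x + + 1))
    up′ = subst₂ (λ s t → f (π a s) < f (π a t)) (σ-hi (ρ-⌜⌝ g)) (σ-lo (ρ-⌜⌝ g))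
      (inv (x<x+1 x) (subst₂ (λ s t → π a s < π a t) (sym (σ-hi (ρ-⌜⌝ g))) (sym (σ-lo (ρ-⌜⌝ g))) up))

  -- Runs of consecutive generators and translations

  -- For `m` below `N`, a cycle: the place `a + m` returns to `a` and the `m` places before it move
  -- up by one. Blocks of cyclically decreasing words and rows of skew shapes are both runs.
  run : ℤ → ℕ → W
  run a zero    = []
  run a (suc m) = ρ (a + + m) ∷ run a m

  module Run (a : ℤ) where

    private
      a+suc : ∀ m → a + + suc m ≡ a + + m + + 1
      a+suc m = trans (cong (λ t → a + + t) (ℕ.+-comm 1 m)) (sym (ℤ.+-assoc a (+ m) (+ 1)))

    run-end : ∀ m → π (run a m) (a + + m) ≡ a
    run-end zero    = ℤ.+-identityʳ a
    run-end (suc m) = trans (cong (λ t → π (run a m) (σ (ρ (a + + m)) t)) (a+suc m))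
                            (trans (cong (π (run a m)) (σ-hi refl)) (run-end m))

    run-out : ∀ m x → a + + m < x → x < a + N → π (run a m) x ≡ x
    run-out zero    x lo hi = refl
    run-out (suc m) x lo hi = trans (cong (π (run a m)) (σ-fix
        (λ e → ρ-≢ m<x (ℤ.<-≤-trans hi a+N≤) (sym e))
        (λ e → ρ-≢ m<x-1 (lia 4 (λ x a m N → x ≺ a ⊕ N ⇒ a ⊕ N ≲ a ⊕ m ⊕ N ⇒ ⊢ x ⊝ one ≺ a ⊕ m ⊕ N) x a (+ m) N hi a+N≤) (sym e))))
        (run-out m x m<x hi)
      where
      lo′ : a + + m + + 1 < x
      lo′ = subst (_< x) (a+suc m) lo
      m<x : a + + m < x
      m<x = ℤ.<-trans (x<x+1 _) lo′
      m<x-1 : a + + m < x - + 1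
      m<x-1 = lia 2 (λ u x → u ⊕ one ≺ x ⇒ ⊢ u ≺ x ⊝ one) (a + + m) x lo′
      a+N≤ : a + N ≤ a + + m + N
      a+N≤ = lia 3 (λ a m N → con (+ 0) ≲ m ⇒ ⊢ a ⊕ N ≲ a ⊕ m ⊕ N) a (+ m) N (+≤+ ℕ.z≤n)

    run-mid : ∀ m x → + m < N → a ≤ x → x < a + + m → π (run a m) x ≡ x + + 1
    run-mid zero    x _   lo hi = ⊥-elim (ℤ.<⇒≱ hi (subst (_≤ x) (sym (ℤ.+-identityʳ a)) lo))
    run-mid (suc m) x m<N lo hi with x ≟ a + + m
    ... | yes refl = trans (cong (π (run a m)) (σ-lo refl)) (run-out m (a + + m + + 1) (x<x+1 _)
          (lia 3 (λ a m N → one ⊕ m ≺ N ⇒ ⊢ a ⊕ m ⊕ one ≺ a ⊕ N) a (+ m) N m<N))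
    ... | no x≢ = trans (cong (π (run a m)) (σ-fix
        (λ e → ρ-≢ x<m (lia 4 (λ a m N x → one ⊕ m ≺ N ⇒ a ≲ x ⇒ ⊢ a ⊕ m ≺ x ⊕ N) a (+ m) N x m<N lo) e)
        (λ e → ρ-≢ (ℤ.<-trans (lia 1 (λ x → ⊢ x ⊝ one ≺ x) x) x<m) (lia 4 (λ a m N x → one ⊕ m ≺ N ⇒ a ≲ x ⇒ ⊢ a ⊕ m ≺ x ⊝ one ⊕ N) a (+ m) N x m<N lo) e)))
        (run-mid m x (ℤ.<-trans (+<+ (ℕ.n<1+n m)) m<N) lo x<m)
      where
      x<m : x < a + + m
      x<m = ℤ.≤∧≢⇒< (lia 3 (λ x a m → x ≺ a ⊕ (one ⊕ m) ⇒ ⊢ x ≲ a ⊕ m) x a (+ m) hi) x≢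

  π-reverse : ∀ a x → π (reverse a) x ≡ π⁻¹ a x
  π-reverse []      x = refl
  π-reverse (g ∷ a) x = trans (cong (λ w → π w x) (unfold-reverse g a))
    (trans (π-++ (reverse a) (g ∷ []) x) (cong (σ g) (π-reverse a x)))

  π-multiple : ∀ a m x → π a (x + m * N) ≡ π a x + m * N
  π-multiple a m x = quasi-multiple (quasi-π a id-quasi) m x

  π⁻¹-unique : ∀ a {x y} → π a x ≡ y → π⁻¹ a y ≡ x
  π⁻¹-unique a {x} refl = π⁻¹-π a x

  -- Displacements are realised by group elements: π (spread a) translates x by −N times the displacement
  -- of x under a.  Applied to vac this produces a state on which the word a is good.

  -- A product of two parallel reflections, hence a translation. The first two factors conjugate a
  -- simple transposition into the swap of `⌜ g ⌝ + 1` and `⌜ g ⌝ + N`; followed by `g` itself it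
  -- moves the class of `g` down by `N`, the next class up by `N`, and fixes the others.
  twist : G → W
  twist g = reverse (run (⌜ g ⌝ + + 1) (k ℕ.∸ 1)) ++ run (⌜ g ⌝ + + 1) k ++ [ g ]

  +k≡ : + (k ℕ.∸ 1) ≡ N - + 2
  +k≡ = trans (sym (ℤ.⊖-≥ 1≤k)) (trans (sym (ℤ.m-n≡m⊖n k 1)) (trans (ring (+ k)) (cong (_- + 2) (sym N≡n))))
    where
    ring : ∀ u → u - + 1 ≡ + 1 + u - + 2
    ring = solve-∀

  k≡N-1 : + k ≡ N - + 1
  k≡N-1 = trans (ring (+ k)) (cong (_- + 1) (sym N≡n))
    where
    ring : ∀ u → u ≡ + 1 + u - + 1
    ring = solve-∀

  π-twist : ∀ g x → π (twist g) x ≡ σ g (π (run (⌜ g ⌝ + + 1) k) (π⁻¹ (run (⌜ g ⌝ + + 1) (k ℕ.∸ 1)) x))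
  π-twist g x = trans (π-++ (reverse (run a (k ℕ.∸ 1))) (run a k ++ [ g ]) x)
    (trans (π-++ (run a k) [ g ] _) (cong (σ g ∘ π (run a k)) (π-reverse (run a (k ℕ.∸ 1)) x)))
    where a = ⌜ g ⌝ + + 1

  twist-lo : ∀ {g} x → ρ x ≡ g → π (twist g) x ≡ x - N
  twist-lo {g} x e = go x (trans (ρ-⌜⌝ g) (sym e))
    where
    a = ⌜ g ⌝ + + 1
    g+N≡a+k : ⌜ g ⌝ + N ≡ a + + k
    g+N≡a+k = lia 3 (λ g N k → k ≈ N ⊝ one ⇒ ⊢ g ⊕ N ≈ g ⊕ one ⊕ k) ⌜ g ⌝ N (+ k) k≡N-1
    base : π (twist g) (⌜ g ⌝ + N) ≡ ⌜ g ⌝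
    base = trans (π-twist g (⌜ g ⌝ + N)) (trans (cong (σ g ∘ π (run a k)) (π⁻¹-unique (run a (k ℕ.∸ 1))
        (Run.run-out a (k ℕ.∸ 1) (⌜ g ⌝ + N) (lia 3 (λ g N k → k ≈ N ⊝ con (+ 2) ⇒ ⊢ g ⊕ one ⊕ k ≺ g ⊕ N) ⌜ g ⌝ N (+ (k ℕ.∸ 1)) +k≡)
          (lia 2 (λ g N → ⊢ g ⊕ N ≺ g ⊕ one ⊕ N) ⌜ g ⌝ N))))
      (trans (cong (σ g ∘ π (run a k)) g+N≡a+k) (trans (cong (σ g) (Run.run-end a k)) (σ-hi (ρ-⌜⌝ g)))))
    go : ∀ x → ρ ⌜ g ⌝ ≡ ρ x → π (twist g) x ≡ x - N
    go x e with ρ-≡⇒multiple {⌜ g ⌝} {x} e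
    ... | m , refl = trans (π-multiple (twist g) m ⌜ g ⌝)
      (lia 4 (λ u g N m → g ≈ u ⊕ N ⇒ ⊢ u ⊕ m ≈ g ⊕ m ⊝ N) (π (twist g) ⌜ g ⌝) ⌜ g ⌝ N (m * N)
        (trans (sym base) (π-periodic (twist g) ⌜ g ⌝)))

  twist-hi : ∀ {g} x → ρ x ≡ g → π (twist g) (x + + 1) ≡ x + + 1 + N
  twist-hi {g} x e = go x (trans (ρ-⌜⌝ g) (sym e))
    where
    a = ⌜ g ⌝ + + 1
    end = a + + (k ℕ.∸ 1)
    end≡ : end + + 1 ≡ ⌜ g ⌝ + N
    end≡ = lia 3 (λ g N k → k ≈ N ⊝ con (+ 2) ⇒ ⊢ g ⊕ one ⊕ k ⊕ one ≈ g ⊕ N) ⌜ g ⌝ N (+ (k ℕ.∸ 1)) +k≡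
    base : π (twist g) a ≡ a + N
    base = trans (π-twist g a) (trans (cong (σ g ∘ π (run a k)) (π⁻¹-unique (run a (k ℕ.∸ 1)) (Run.run-end a (k ℕ.∸ 1))))
      (trans (cong (σ g) (Run.run-mid a k end (lia 2 (λ k N → k ≈ N ⊝ one ⇒ ⊢ k ≺ N) (+ k) N k≡N-1)
                (lia 3 (λ a k N → con (+ 2) ≲ N ⇒ k ≈ N ⊝ con (+ 2) ⇒ ⊢ a ≲ a ⊕ k) a (+ (k ℕ.∸ 1)) N 2≤N +k≡)
                (lia 4 (λ a k k′ N → k ≈ N ⊝ con (+ 2) ⇒ k′ ≈ N ⊝ one ⇒ ⊢ a ⊕ k ≺ a ⊕ k′) a (+ (k ℕ.∸ 1)) (+ k) N +k≡ k≡N-1)))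
      (trans (cong (σ g) end≡) (trans (σ-lo (trans (ρ+N ⌜ g ⌝) (ρ-⌜⌝ g))) (lia 2 (λ g N → ⊢ g ⊕ N ⊕ one ≈ g ⊕ one ⊕ N) ⌜ g ⌝ N)))))
    go : ∀ x → ρ ⌜ g ⌝ ≡ ρ x → π (twist g) (x + + 1) ≡ x + + 1 + N
    go x e with ρ-≡⇒multiple {⌜ g ⌝} {x} e
    ... | m , refl = trans (cong (π (twist g)) (lia 2 (λ g m → ⊢ g ⊕ m ⊕ one ≈ g ⊕ one ⊕ m) ⌜ g ⌝ (m * N)))
      (trans (π-multiple (twist g) m a) (trans (cong (_+ m * N) base) (lia 3 (λ g m N → ⊢ g ⊕ one ⊕ N ⊕ m ≈ g ⊕ m ⊕ one ⊕ N) ⌜ g ⌝ (m * N) N)))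

  opaque
    window : ∀ b x → Σ ℤ λ y → Σ ℤ λ m → b ≤ y × y < b + N × x ≡ y + m * N
    window b x = b + ⌜ r ⌝ , (x - b) /ℕ n , lia 2 (λ b r → con (+ 0) ≲ r ⇒ ⊢ b ≲ b ⊕ r) b ⌜ r ⌝ (0≤toℕ r) ,
      ℤ.+-monoʳ-< b (toℕ<N r) ,
      lia 4 (λ x b r u → x ⊝ b ≈ r ⊕ u ⇒ ⊢ x ≈ b ⊕ r ⊕ u) x b ⌜ r ⌝ (((x - b) /ℕ n) * N) (ρ-split (x - b))
      where
      r : G
      r = ρ (x - b)

  -- Functionals

  twist-off : ∀ {g} x → ρ x ≢ g → ρ (x - + 1) ≢ g → π (twist g) x ≡ x
  twist-off {g} x p q with window ⌜ g ⌝ x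
  ... | y , m , lo , hi , refl = trans (π-multiple (twist g) m y) (cong (_+ m * N) base)
    where
    a = ⌜ g ⌝ + + 1
    y≢g : ρ y ≢ g
    y≢g e = p (trans (ρ-periodic y m) e)
    y-1≢g : ρ (y - + 1) ≢ g
    y-1≢g e = q (trans (cong ρ (lia 2 (λ y m → ⊢ y ⊕ m ⊝ one ≈ y ⊝ one ⊕ m) y (m * N))) (trans (ρ-periodic (y - + 1) m) e))
    g<y : ⌜ g ⌝ < y
    g<y = ℤ.≤∧≢⇒< lo (λ e → y≢g (trans (cong ρ (sym e)) (ρ-⌜⌝ g)))
    a<y : a < y
    a<y = ℤ.≤∧≢⇒< (lia 2 (λ g y → g ≺ y ⇒ ⊢ g ⊕ one ≲ y) ⌜ g ⌝ y g<y)
      (λ e → y-1≢g (trans (cong (λ t → ρ (t - + 1)) (sym e)) (trans (cong ρ (x+1-1 ⌜ g ⌝)) (ρ-⌜⌝ g))))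
    a≤y-1 : a ≤ y - + 1
    a≤y-1 = lia 2 (λ a y → a ≺ y ⇒ ⊢ a ≲ y ⊝ one) a y a<y
    first : π⁻¹ (run a (k ℕ.∸ 1)) y ≡ y - + 1
    first = π⁻¹-unique (run a (k ℕ.∸ 1)) (trans (Run.run-mid a (k ℕ.∸ 1) (y - + 1)
      (lia 2 (λ k N → k ≈ N ⊝ con (+ 2) ⇒ ⊢ k ≺ N) (+ (k ℕ.∸ 1)) N +k≡)
      a≤y-1
      (lia 4 (λ g k N y → k ≈ N ⊝ con (+ 2) ⇒ y ≺ g ⊕ N ⇒ ⊢ y ⊝ one ≺ g ⊕ one ⊕ k) ⌜ g ⌝ (+ (k ℕ.∸ 1)) N y +k≡ hi)) (x-1+1 y))
    base : π (twist g) y ≡ y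
    base = trans (π-twist g y) (trans (cong (σ g ∘ π (run a k)) first) (trans (cong (σ g) (trans (Run.run-mid a k (y - + 1)
      (lia 2 (λ k N → k ≈ N ⊝ one ⇒ ⊢ k ≺ N) (+ k) N k≡N-1)
      a≤y-1
      (lia 4 (λ g k N y → k ≈ N ⊝ one ⇒ y ≺ g ⊕ N ⇒ ⊢ y ⊝ one ≺ g ⊕ one ⊕ k) ⌜ g ⌝ (+ k) N y k≡N-1 hi)) (x-1+1 y)))
      (σ-fix y≢g y-1≢g)))

  spread : W → W
  spread []      = []
  spread (g ∷ a) = (reverse a ++ twist g ++ a) ++ spread a

  π-spread : ∀ a x → π (spread a) x ≡ x + (x - π⁻¹ a x) * N
  π-spread [] x = ring x N
    where
    ring : ∀ x N → x ≡ x + (x - x) * N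
    ring = solve-∀
  π-spread (g ∷ a) x = trans (π-++ (reverse a ++ twist g ++ a) (spread a) x)
    (trans (cong (π (spread a)) (trans (π-++ (reverse a) (twist g ++ a) x)
      (trans (π-++ (twist g) a _) (cong (π a ∘ π (twist g)) (π-reverse a x)))))
      (by-place (place g v)))
    where
    v = π⁻¹ a x
    ring : ∀ x m v w N → v - w ≡ m → x + m * N + (x - v) * N ≡ x + (x - w) * N
    ring x _ v w N refl = ring′ x v w N
      where
      ring′ : ∀ x v w N → x + (v - w) * N + (x - v) * N ≡ x + (x - w) * N
      ring′ = solve-∀
    moved : ∀ m → π (twist g) v ≡ v + m * N → v - σ g v ≡ m →
            π (spread a) (π a (π (twist g) v)) ≡ x + (x - σ g v) * N
    moved m e d = trans (cong (π (spread a)) (trans (cong (π a) e) (trans (π-multiple a m v) (cong (_+ m * N) (π-π⁻¹ a x)))))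
      (trans (π-multiple (spread a) m x) (trans (cong (_+ m * N) (π-spread a x))
        (trans (lia 3 (λ x m u → ⊢ x ⊕ u ⊕ m ≈ x ⊕ m ⊕ u) x (m * N) ((x - v) * N)) (ring x m v (σ g v) N d))))
    by-place : Place g v → π (spread a) (π a (π (twist g) v)) ≡ x + (x - σ g v) * N
    by-place (at-lo p) = moved (- + 1) (trans (twist-lo v p) (cong (_+_ (v)) (sym (ℤ.-1*i≡-i N))))
      (trans (cong (λ t → v - t) (σ-lo p)) (lia 1 (λ v → ⊢ v ⊝ (v ⊕ one) ≈ con (- + 1)) v))
    by-place (at-hi y eq p) = moved (+ 1)
      (trans (cong (π (twist g)) eq) (trans (twist-hi y p) (cong₂ _+_ (sym eq) (sym (ℤ.*-identityˡ N)))))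
      (trans (cong (λ t → t - σ g t) eq) (trans (cong (λ t → y + + 1 - t) (σ-hi p)) (lia 1 (λ y → ⊢ y ⊕ one ⊝ y ≈ one) y)))
    by-place (off p q) = moved (+ 0)
      (trans (twist-off v p q) (sym (trans (cong (_+_ (v)) (ℤ.*-zeroˡ N)) (ℤ.+-identityʳ v))))
      (trans (cong (λ t → v - t) (σ-fix p q)) (ℤ.+-inverseʳ v))

  record Deep (a : W) : Set where
    field
      base      : W
      base-good : Good base vac
      good      : Good a (vac ∘ π base)

  deep : ∀ a → Good a id → Deep a
  deep a ga = record { base = word ; base-good = good ; good = inverts⇒good (quasi-π word vac-quasi) a ga inv }
    where
    open Normal (normalise vac-quasi vac-sorted (spread a))
    value : ∀ x → vac (π word x) ≡ vac x + (x - π⁻¹ a x)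
    value x = trans (sym (normal-state vac-quasi vac-sorted (normalise vac-quasi vac-sorted (spread a)) x))
      (trans (cong vac (π-spread a x)) (trans (quasi-multiple vac-quasi (x - π⁻¹ a x) x) (cong (_+_ (vac x)) (ℤ.*-identityʳ _))))
    -- At the image of `p` the base state has the value of `vac` plus the displacement of `p`. Along
    -- an inversion the larger image comes from the smaller `p`, so the displacements differ
    -- strictly while `vac` is monotone.
    inv : Inverts a (vac ∘ π word)
    inv {p} {p′} lt h = subst₂ _<_ (sym (trans (value y) (cong (λ t → vac y + (y - t)) (π⁻¹-π a p′))))
                                  (sym (trans (value x) (cong (λ t → vac x + (x - t)) (π⁻¹-π a p))))
      (lia 6 (λ x y p q u v → y ≺ x ⇒ p ≺ q ⇒ v ≲ u ⇒ ⊢ v ⊕ (y ⊝ q) ≺ u ⊕ (x ⊝ p)) x y p p′ (vac x) (vac y) h lt (vac-mono (ℤ.<⇒≤ h)))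
      where
      x = π a p
      y = π a p′

  -- Equal states alone identify cosets. Here `a ++ c` and `b ++ c` are both good at `vac`, so they
  -- are braid equivalent, `c` cancels from the permutations, and Matsumoto at `id` compares `a`
  -- with `b` themselves.
  separated : ∀ a b c → Good c vac → Good a (vac ∘ π c) → Good b (vac ∘ π c) →
    (∀ x → vac (π c (π a x)) ≡ vac (π c (π b x))) → a ∼ b
  separated a b c gc ga gb e = matsumoto id-quasi id-sorted a b (good-id q a ga) (good-id q b gb)
    (λ x → π-injective c (trans (sym (π-++ a c x)) (trans (∼-π ac∼bc x) (π-++ b c x))))
    where
    q = quasi-π c vac-quasi
    ac∼bc : a ++ c ∼ b ++ c
    ac∼bc = matsumoto vac-quasi vac-sorted (a ++ c) (b ++ c) (good-++⁻ a c ga gc) (good-++⁻ b c gb gc)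
      (λ x → trans (cong vac (π-++ a c x)) (trans (e x) (sym (cong vac (π-++ b c x)))))

  -- The nilCoxeter algebra acts from the right on functionals of states

  Func : Set
  Func = State → ℤ

  -- States are functions known only up to pointwise equality; this condition takes the place of
  -- function extensionality.
  Ext : Func → Set
  Ext φ = ∀ {f f′} → f ≗ f′ → φ f ≡ φ f′

  ev : Func → W → Func
  ev φ a f with good? a f
  ... | yes _ = φ (f ∘ π a)
  ... | no _  = + 0

  ev-good : ∀ φ {a f} → Good a f → ev φ a f ≡ φ (f ∘ π a)
  ev-good φ {a} {f} g with good? a f
  ... | yes _ = refl
  ... | no ¬g = ⊥-elim (¬g g)

  ev-bad : ∀ φ {a f} → ¬ Good a f → ev φ a f ≡ + 0
  ev-bad φ {a} {f} ¬g with good? a f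
  ... | yes g = ⊥-elim (¬g g)
  ... | no _  = refl

  ev-cong : ∀ {φ a b f f′} → Good a f ⟺ Good b f′ → (Good a f → φ (f ∘ π a) ≡ φ (f′ ∘ π b)) → ev φ a f ≡ ev φ b f′
  ev-cong {φ} {a} {b} {f} (to , from) e with good? a f
  ... | yes g = trans (e g) (sym (ev-good φ {b} (to g)))
  ... | no ¬g = sym (ev-bad φ {b} (¬g ∘ from))

  ev-ext : ∀ {φ} → Ext φ → ∀ a → Ext (ev φ a)
  ev-ext {φ} ex a {f} {f′} e = ev-cong {φ} {a} {a} (good-≗ a e , good-≗ a (sym ∘ e)) (λ _ → ex (λ x → e (π a x)))

  ev-∼ : ∀ {φ} → Ext φ → ∀ {f} → Quasi f → ∀ {a b} → a ∼ b → ev φ a f ≡ ev φ b f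
  ev-∼ {φ} ex {f} qf {a} {b} s = ev-cong {φ} {a} {b} (∼-good qf s) (λ _ → ex (λ x → cong f (∼-π s x)))

  ev-++ : ∀ {φ} → Ext φ → ∀ a b f → ev φ (a ++ b) f ≡ ev (ev φ a) b f
  ev-++ {φ} ex a b f with good? b f
  ... | no ¬g = ev-bad φ {a ++ b} (¬g ∘ proj₂ ∘ good-++ a b)
  ... | yes g = ev-cong {φ} {a ++ b} {a} (proj₁ ∘ good-++ a b , λ ga → good-++⁻ a b ga g)
                  (λ _ → ex (λ x → cong f (π-++ a b x)))

  ev-linear : ∀ c φ ψ a f → ev (λ h → c * φ h + ψ h) a f ≡ c * ev φ a f + ev ψ a f
  ev-linear c φ ψ a f with good? a f
  ... | yes _ = refl
  ... | no _  = ring c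
    where
    ring : ∀ c → + 0 ≡ c * + 0 + + 0
    ring = solve-∀

  ev-0 : ∀ a f → ev (λ _ → + 0) a f ≡ + 0
  ev-0 a f with good? a f
  ... | yes _ = refl
  ... | no _  = refl

  ev-≗ : ∀ {φ ψ} a f → (φ (f ∘ π a) ≡ ψ (f ∘ π a)) → ev φ a f ≡ ev ψ a f
  ev-≗ a f e with good? a f
  ... | yes _ = e
  ... | no _  = refl

  -- Formal combinations as operators on functionals

  pair : (W → ℤ) → Comb k → ℤ
  pair ψ []            = + 0
  pair ψ ((c , a) ∷ x) = c * ψ a + pair ψ x

  ⟦_⟧ : Comb k → Func → Func
  ⟦ x ⟧ φ f = pair (λ a → ev φ a f) x

  pair-++ : ∀ ψ x y → pair ψ (x ++ y) ≡ pair ψ x + pair ψ y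
  pair-++ ψ []            y = sym (ℤ.+-identityˡ _)
  pair-++ ψ ((c , a) ∷ x) y = trans (cong (_+_ (c * ψ a)) (pair-++ ψ x y)) (sym (ℤ.+-assoc (c * ψ a) _ _))

  pair-scale : ∀ ψ c x → pair ψ (scale k c x) ≡ c * pair ψ x
  pair-scale ψ c []            = sym (ℤ.*-zeroʳ c)
  pair-scale ψ c ((d , a) ∷ x) = trans (cong (_+_ (c * d * ψ a)) (pair-scale ψ c x)) (ring c d (ψ a) (pair ψ x))
    where
    ring : ∀ c d u v → c * d * u + c * v ≡ c * (d * u + v)
    ring = solve-∀

  pair-cong : ∀ {ψ ψ′} → (∀ a → ψ a ≡ ψ′ a) → ∀ x → pair ψ x ≡ pair ψ′ x
  pair-cong e []            = refl
  pair-cong e ((c , a) ∷ x) = cong₂ (λ u v → c * u + v) (e a) (pair-cong e x)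

  ⟦⟧-ext : ∀ x {φ} → Ext φ → Ext (⟦ x ⟧ φ)
  ⟦⟧-ext x ex e = pair-cong (λ a → ev-ext ex a e) x

  ⟦⟧-linear : ∀ x c φ ψ f → ⟦ x ⟧ (λ h → c * φ h + ψ h) f ≡ c * ⟦ x ⟧ φ f + ⟦ x ⟧ ψ f
  ⟦⟧-linear []            c φ ψ f = ring c
    where
    ring : ∀ c → + 0 ≡ c * + 0 + + 0
    ring = solve-∀
  ⟦⟧-linear ((d , a) ∷ x) c φ ψ f = trans (cong₂ (λ u v → d * u + v) (ev-linear c φ ψ a f) (⟦⟧-linear x c φ ψ f))
      (ring c d (ev φ a f) (ev ψ a f) (⟦ x ⟧ φ f) (⟦ x ⟧ ψ f))
    where
    ring : ∀ c d p q r s → d * (c * p + q) + (c * r + s) ≡ c * (d * p + r) + (d * q + s)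
    ring = solve-∀

  ⟦⟧-0 : ∀ x f → ⟦ x ⟧ (λ _ → + 0) f ≡ + 0
  ⟦⟧-0 []            f = refl
  ⟦⟧-0 ((c , a) ∷ x) f = trans (cong₂ (λ u v → c * u + v) (ev-0 a f) (⟦⟧-0 x f)) (trans (ℤ.+-identityʳ _) (ℤ.*-zeroʳ c))

  ⟦⟧-cong : ∀ x {φ ψ f} → Quasi f → (∀ {h} → Quasi h → φ h ≡ ψ h) → ⟦ x ⟧ φ f ≡ ⟦ x ⟧ ψ f
  ⟦⟧-cong x {φ} {ψ} {f} qf e = pair-cong (λ a → ev-≗ {φ} {ψ} a f (e (quasi-π a qf))) x

  -- The right factor meets the state first, so it becomes the outer operator on functionals:
  -- multiplication turns into composition in the reverse order.
  ⟦mulC⟧ : ∀ x y {φ} → Ext φ → ∀ f → ⟦ mulC k x y ⟧ φ f ≡ ⟦ y ⟧ (⟦ x ⟧ φ) f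
  ⟦mulC⟧ []            y {φ} ex f = sym (⟦⟧-0 y f)
  ⟦mulC⟧ ((c , a) ∷ x) y {φ} ex f = trans (pair-++ _ (map _ y) (mulC k x y))
    (trans (cong₂ _+_ (row _ (λ _ _ → refl) y) (⟦mulC⟧ x y ex f)) (sym (⟦⟧-linear y c (ev φ a) (⟦ x ⟧ φ) f)))
    where
    row : (h : ℤ × W → ℤ × W) → (∀ d b → h (d , b) ≡ (c * d , a ++ b)) → ∀ y →
          ⟦ map h y ⟧ φ f ≡ c * ⟦ y ⟧ (ev φ a) f
    row h eq []            = sym (ℤ.*-zeroʳ c)
    row h eq ((d , b) ∷ y) rewrite eq d b =
      trans (cong₂ (λ u v → c * d * u + v) (ev-++ ex a b f) (row h eq y)) (ring c d (ev (ev φ a) b f) (⟦ y ⟧ (ev φ a) f))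
      where
      ring : ∀ c d u v → c * d * u + c * v ≡ c * (d * u + v)
      ring = solve-∀

  δ : W → W → ℤ
  δ a w with ≡-dec _≟F_ a w
  ... | yes _ = + 1
  ... | no _  = + 0

  coeff-∷ : ∀ c a x w → coeff k ((c , a) ∷ x) w ≡ c * δ a w + coeff k x w
  coeff-∷ c a x w with ≡-dec _≟F_ a w
  ... | yes _ = cong (_+ coeff k x w) (sym (ℤ.*-identityʳ c))
  ... | no _  = sym (trans (cong (_+ coeff k x w) (ℤ.*-zeroʳ c)) (ℤ.+-identityˡ _))

  coeff-pair : ∀ x w → coeff k x w ≡ pair (λ a → δ a w) x
  coeff-pair []            w = refl
  coeff-pair ((c , a) ∷ x) w = trans (coeff-∷ c a x w) (cong (_+_ (c * δ a w)) (coeff-pair x w))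

  coeff-++ : ∀ x y w → coeff k (x ++ y) w ≡ coeff k x w + coeff k y w
  coeff-++ x y w = trans (coeff-pair (x ++ y) w) (trans (pair-++ _ x y) (cong₂ _+_ (sym (coeff-pair x w)) (sym (coeff-pair y w))))

  coeff-scale : ∀ c x w → coeff k (scale k c x) w ≡ c * coeff k x w
  coeff-scale c x w = trans (coeff-pair (scale k c x) w) (trans (pair-scale _ c x) (cong (c *_) (sym (coeff-pair x w))))

  without : W → Comb k → Comb k
  without a [] = []
  without a ((c , b) ∷ x) with ≡-dec _≟F_ b a
  ... | yes _ = without a x
  ... | no _  = (c , b) ∷ without a x

  length-without : ∀ a x → length (without a x) ℕ.≤ length x
  length-without a [] = ℕ.z≤n
  length-without a ((c , b) ∷ x) with ≡-dec _≟F_ b a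
  ... | yes _ = ℕ.m≤n⇒m≤1+n (length-without a x)
  ... | no _  = ℕ.s≤s (length-without a x)

  pair-without : ∀ ψ a x → pair ψ x ≡ coeff k x a * ψ a + pair ψ (without a x)
  pair-without ψ a [] = sym (trans (ℤ.+-identityʳ _) (ℤ.*-zeroˡ (ψ a)))
  pair-without ψ a ((c , b) ∷ x) with ≡-dec _≟F_ b a
  ... | yes refl = trans (cong (_+_ (c * ψ a)) (pair-without ψ a x)) (ring c (ψ a) (coeff k x a) (pair ψ (without a x)))
    where
    ring : ∀ c u d v → c * u + (d * u + v) ≡ (c + d) * u + v
    ring = solve-∀
  ... | no _ = trans (cong (_+_ (c * ψ b)) (pair-without ψ a x)) (ring (c * ψ b) (coeff k x a * ψ a) (pair ψ (without a x)))
    where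
    ring : ∀ u d v → u + (d + v) ≡ d + (u + v)
    ring = solve-∀

  coeff-without-other : ∀ a x w → a ≢ w → coeff k (without a x) w ≡ coeff k x w
  coeff-without-other a [] w a≢w = refl
  coeff-without-other a ((c , b) ∷ x) w a≢w with ≡-dec _≟F_ b a
  ... | no _ = trans (coeff-∷ c b (without a x) w)
                 (trans (cong (_+_ (c * δ b w)) (coeff-without-other a x w a≢w)) (sym (coeff-∷ c b x w)))
  ... | yes refl with ≡-dec _≟F_ b w
  ...   | yes e = ⊥-elim (a≢w e)
  ...   | no _  = coeff-without-other a x w a≢w

  coeff-without-self : ∀ a x → coeff k (without a x) a ≡ + 0
  coeff-without-self a [] = refl
  coeff-without-self a ((c , b) ∷ x) with ≡-dec _≟F_ b a in eq
  ... | yes _ = coeff-without-self a x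
  ... | no _ rewrite eq = coeff-without-self a x

  -- A word may occur several times in a combination and cancel only in total. The induction
  -- therefore removes all occurrences of the first word at once and runs on a bound for the length.
  pair-zero : ∀ ψ m x → length x ℕ.≤ m → (∀ w → coeff k x w ≡ + 0) → pair ψ x ≡ + 0
  pair-zero ψ m [] _ _ = refl
  pair-zero ψ (suc m) ((c , a) ∷ x) (ℕ.s≤s le) z = begin
    c * ψ a + pair ψ x                                              ≡⟨ cong (_+_ (c * ψ a)) (pair-without ψ a x) ⟩
    c * ψ a + (coeff k x a * ψ a + pair ψ (without a x))            ≡⟨ ring c (ψ a) (coeff k x a) _ ⟩
    (c * + 1 + coeff k x a) * ψ a + pair ψ (without a x)            ≡⟨ cong₂ (λ u v → u * ψ a + v) head rest ⟩
    + 0 * ψ a + + 0                                                 ≡⟨ cong (_+ + 0) (ℤ.*-zeroˡ (ψ a)) ⟩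
    + 0                                                             ∎
    where
    open ≡-Reasoning
    ring : ∀ c u d v → c * u + (d * u + v) ≡ (c * + 1 + d) * u + v
    ring = solve-∀
    δ-refl : δ a a ≡ + 1
    δ-refl with ≡-dec _≟F_ a a
    ... | yes _ = refl
    ... | no ¬e = ⊥-elim (¬e refl)
    head : c * + 1 + coeff k x a ≡ + 0
    head = trans (cong (λ t → c * t + coeff k x a) (sym δ-refl)) (trans (sym (coeff-∷ c a x a)) (z a))
    coeff-x : ∀ w → a ≢ w → coeff k x w ≡ + 0
    coeff-x w a≢w with ≡-dec _≟F_ a w | z w
    ... | yes e | _  = ⊥-elim (a≢w e)
    ... | no _  | zw = zw
    coeff-rest : ∀ w → coeff k (without a x) w ≡ + 0
    coeff-rest w with ≡-dec _≟F_ a w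
    ... | no a≢w   = trans (coeff-without-other a x w a≢w) (coeff-x w a≢w)
    ... | yes refl = coeff-without-self a x
    rest : pair ψ (without a x) ≡ + 0
    rest = pair-zero ψ m (without a x) (ℕ.≤-trans (length-without a x) le) coeff-rest

  pair-coeff : ∀ ψ x y e → (∀ w → coeff k x w ≡ coeff k y w + coeff k e w) → pair ψ x ≡ pair ψ y + pair ψ e
  pair-coeff ψ x y e h = ring (pair ψ x) _ (trans (sym total) (pair-zero ψ _ z ℕ.≤-refl zero-coeff))
    where
    z = x ++ scale k (- + 1) (y ++ e)
    total : pair ψ z ≡ pair ψ x + - + 1 * (pair ψ y + pair ψ e)
    total = trans (pair-++ ψ x _) (cong (_+_ (pair ψ x)) (trans (pair-scale ψ (- + 1) (y ++ e)) (cong (- + 1 *_) (pair-++ ψ y e))))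
    zero-coeff : ∀ w → coeff k z w ≡ + 0
    zero-coeff w = trans (coeff-++ x _ w) (trans (cong₂ _+_ (h w) (trans (coeff-scale (- + 1) (y ++ e) w) (cong (- + 1 *_) (coeff-++ y e w))))
      (ring′ (coeff k y w + coeff k e w)))
      where
      ring′ : ∀ u → u + - + 1 * u ≡ + 0
      ring′ = solve-∀
    ring : ∀ u v → u + - + 1 * v ≡ + 0 → u ≡ v
    ring u v = lia 2 (λ u v → u ⊕ (- + 1) ⊛ v ≈ con (+ 0) ⇒ ⊢ u ≈ v) u v

  -- Faithfulness

  not-good-++ : ∀ p g b → ¬ Good (p ++ g ∷ g ∷ b) id
  not-good-++ p g b = repeats-not-good id-quasi (repeats p g b ∼-refl)

  expand-vanishes : ∀ {φ} → Ext φ → ∀ {f} → Quasi f → ∀ L → pair (λ a → ev φ a f) (expand k L) ≡ + 0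
  expand-vanishes ex qf [] = refl
  expand-vanishes {φ} ex {f} qf ((c , p , (r , rel) , q) ∷ L) =
    trans (pair-++ ψ (scale k c (mulC k (uA k p) (mulC k r (uA k q)))) (expand k L))
      (trans (cong₂ _+_ (trans (pair-scale ψ c (mulC k (uA k p) (mulC k r (uA k q))))
                               (trans (cong (c *_) (gen rel)) (ℤ.*-zeroʳ c)))
                        (expand-vanishes ex qf L)) refl)
    where
    ψ = λ a → ev φ a f
    ring : ∀ u v → u ≡ v → + 1 * u + (- + 1 * v + + 0) ≡ + 0
    ring u v refl = ring′ u
      where
      ring′ : ∀ u → + 1 * u + (- + 1 * u + + 0) ≡ + 0
      ring′ = solve-∀
    gen : ∀ {r} → ARel k r → pair ψ (mulC k (uA k p) (mulC k r (uA k q))) ≡ + 0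
    gen (sq i) = cong (λ u → + 1 * u + + 0)
      (ev-bad φ {p ++ i ∷ i ∷ q} (not-good-++ p i q ∘ good-id qf (p ++ i ∷ i ∷ q)))
    gen (comm i j na) = ring _ _ (ev-∼ ex qf (∼-++ˡ p (∼-comm q na)))
    gen (braid i j t adj) = ring _ _ (ev-∼ ex qf (∼-++ˡ p (∼-braid q (3≤N-of t) adj)))

  AEq⇒⟦⟧ : ∀ x y → AEq k x y → ∀ {φ} → Ext φ → ∀ {f} → Quasi f → ⟦ x ⟧ φ f ≡ ⟦ y ⟧ φ f
  AEq⇒⟦⟧ x y (L , h) {φ} ex {f} qf =
    trans (pair-coeff (λ a → ev φ a f) x y (expand k L) h)
      (trans (cong (_+_ (⟦ y ⟧ φ f)) (expand-vanishes ex qf L)) (ℤ.+-identityʳ _))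

  infix 4 _≐_
  -- `AEq` unfolds to an equation between coefficients, from which the combinations cannot be
  -- inferred; the record keeps them visible.
  record _≐_ (x y : Comb k) : Set where
    constructor ≐-intro
    field
      ≐-elim : AEq k x y

  open _≐_ public

  ≐⇒⟦⟧ : ∀ {x y} → x ≐ y → ∀ {φ} → Ext φ → ∀ {f} → Quasi f → ⟦ x ⟧ φ f ≡ ⟦ y ⟧ φ f
  ≐⇒⟦⟧ {x} {y} (≐-intro e) = AEq⇒⟦⟧ x y e

  ≐-coeff : ∀ {x y} → (∀ w → coeff k x w ≡ coeff k y w) → x ≐ y
  ≐-coeff e = ≐-intro ([] , λ w → trans (e w) (sym (ℤ.+-identityʳ _)))

  ≐-trans : ∀ {x y z} → x ≐ y → y ≐ z → x ≐ z
  ≐-trans {x} {y} {z} (≐-intro (L , h)) (≐-intro (M , h′)) = ≐-intro $ M ++ L , λ w → begin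
    coeff k x w                                               ≡⟨ h w ⟩
    coeff k y w + coeff k (expand k L) w                      ≡⟨ cong (_+ coeff k (expand k L) w) (h′ w) ⟩
    coeff k z w + coeff k (expand k M) w + coeff k (expand k L) w ≡⟨ ℤ.+-assoc (coeff k z w) _ _ ⟩
    coeff k z w + (coeff k (expand k M) w + coeff k (expand k L) w)
      ≡⟨ cong (_+_ (coeff k z w)) (sym (coeff-++ (expand k M) (expand k L) w)) ⟩
    coeff k z w + coeff k (expand k M ++ expand k L) w
      ≡⟨ cong (λ e → coeff k z w + coeff k e w) (sym (concatMap-++ _ M L)) ⟩
    coeff k z w + coeff k (expand k (M ++ L)) w               ∎
    where open ≡-Reasoning

  ≐-++ : ∀ {x x′ y y′} → x ≐ x′ → y ≐ y′ → (x ++ y) ≐ (x′ ++ y′)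
  ≐-++ {x} {x′} {y} {y′} (≐-intro (L , h)) (≐-intro (M , h′)) = ≐-intro $ L ++ M , λ w → begin
    coeff k (x ++ y) w                                        ≡⟨ coeff-++ x y w ⟩
    coeff k x w + coeff k y w                                 ≡⟨ cong₂ _+_ (h w) (h′ w) ⟩
    coeff k x′ w + coeff k (expand k L) w + (coeff k y′ w + coeff k (expand k M) w)
      ≡⟨ ring (coeff k x′ w) (coeff k (expand k L) w) (coeff k y′ w) _ ⟩
    coeff k x′ w + coeff k y′ w + (coeff k (expand k L) w + coeff k (expand k M) w)
      ≡⟨ cong₂ _+_ (sym (coeff-++ x′ y′ w)) (trans (sym (coeff-++ (expand k L) (expand k M) w)) (cong (λ e → coeff k e w) (sym (concatMap-++ _ L M)))) ⟩
    coeff k (x′ ++ y′) w + coeff k (expand k (L ++ M)) w      ∎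
    where
    open ≡-Reasoning
    ring : ∀ a b c d → a + b + (c + d) ≡ a + c + (b + d)
    ring = solve-∀

  negateGens : List (IdealGen k) → List (IdealGen k)
  negateGens = map (λ { (c , g) → (- c , g) })

  coeff-negate : ∀ L w → coeff k (expand k (negateGens L)) w ≡ - coeff k (expand k L) w
  coeff-negate [] w = refl
  coeff-negate ((c , p , (r , rel) , q) ∷ L) w = begin
    coeff k (scale k (- c) m ++ expand k (negateGens L)) w          ≡⟨ coeff-++ (scale k (- c) m) _ w ⟩
    coeff k (scale k (- c) m) w + coeff k (expand k (negateGens L)) w ≡⟨ cong₂ _+_ (coeff-scale (- c) m w) (coeff-negate L w) ⟩
    - c * coeff k m w + - coeff k (expand k L) w                    ≡⟨ ring c (coeff k m w) _ ⟩
    - (c * coeff k m w + coeff k (expand k L) w)                    ≡⟨ cong (λ u → - (u + coeff k (expand k L) w)) (sym (coeff-scale c m w)) ⟩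
    - (coeff k (scale k c m) w + coeff k (expand k L) w)            ≡⟨ cong -_ (sym (coeff-++ (scale k c m) (expand k L) w)) ⟩
    - coeff k (scale k c m ++ expand k L) w                         ∎
    where
    open ≡-Reasoning
    m = mulC k (uA k p) (mulC k r (uA k q))
    ring : ∀ c u v → - c * u + - v ≡ - (c * u + v)
    ring = solve-∀

  ≐-sym : ∀ {x y} → x ≐ y → y ≐ x
  ≐-sym {x} {y} (≐-intro (L , h)) = ≐-intro $ negateGens L , λ w → trans (ring (coeff k y w) (coeff k (expand k L) w))
    (cong₂ _+_ (sym (h w)) (sym (coeff-negate L w)))
    where
    ring : ∀ u v → u ≡ u + v + - v
    ring = solve-∀

  ≐-gen : ∀ c p q {i j : W} (rel : ARel k ((+ 1 , i) ∷ (- (+ 1) , j) ∷ [])) →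
    ((c , p ++ i ++ q) ∷ []) ≐ ((c , p ++ j ++ q) ∷ [])
  ≐-gen c p q {i} {j} rel = ≐-intro $ (c , p , (_ , rel) , q) ∷ [] , λ w →
    trans (coeff-∷ c (p ++ i ++ q) [] w) (trans (ring c (δ (p ++ i ++ q) w) (δ (p ++ j ++ q) w))
      (cong₂ _+_ (sym (coeff-∷ c (p ++ j ++ q) [] w))
        (sym (trans (coeff-∷ _ (p ++ i ++ q) _ w) (cong (_+_ (c * + 1 * δ (p ++ i ++ q) w)) (coeff-∷ _ (p ++ j ++ q) [] w))))))
    where
    ring : ∀ c u v → c * u + + 0 ≡ c * v + + 0 + (c * + 1 * u + (c * (- + 1) * v + + 0))
    ring = solve-∀

  ∼⇒≐ : ∀ c p {a b} → a ∼ b → ((c , p ++ a) ∷ []) ≐ ((c , p ++ b) ∷ [])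
  ∼⇒≐ c p ∼-refl          = ≐-coeff (λ _ → refl)
  ∼⇒≐ c p (∼-sym e)       = ≐-sym (∼⇒≐ c p e)
  ∼⇒≐ c p (∼-trans e f)   = ≐-trans (∼⇒≐ c p e) (∼⇒≐ c p f)
  ∼⇒≐ c p (∼-cons g {a} {b} e) = subst₂ (λ u v → ((c , u) ∷ []) ≐ ((c , v) ∷ []))
    (++-assoc p [ g ] a) (++-assoc p [ g ] b) (∼⇒≐ c (p ++ [ g ]) e)
  ∼⇒≐ c p (∼-comm a na)   = ≐-gen c p a (comm _ _ na)
  ∼⇒≐ c p (∼-braid a t h) = ≐-gen c p a (braid _ _ (2≤k t) h)

  ≐-square : ∀ c p i q → ((c , p ++ i ∷ i ∷ q) ∷ []) ≐ []
  ≐-square c p i q = ≐-intro $ (c , p , (_ , sq i) , q) ∷ [] , λ w →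
    trans (coeff-∷ c a [] w) (trans (ring c (δ a w)) (cong (_+_ (+ 0)) (sym (coeff-∷ _ a [] w))))
    where
    a = p ++ i ∷ i ∷ q
    ring : ∀ c u → c * u + + 0 ≡ + 0 + (c * + 1 * u + + 0)
    ring = solve-∀

  ≐-not-good : ∀ c a → ¬ Good a id → ((c , a) ∷ []) ≐ []
  ≐-not-good c a ¬g = let open Repeats (not-good-repeats a ¬g) in
    ≐-trans (∼⇒≐ c [] equiv) (≐-square c pre letter post)

  -- Comparing one value per residue is decidable, and between states of equal period it decides
  -- equality everywhere (`agree-on-period`).
  indicator : State → Func
  indicator f h with Fin.all? (λ g → h ⌜ g ⌝ ≟ f ⌜ g ⌝)
  ... | yes _ = + 1
  ... | no _  = + 0

  indicator-ext : ∀ f → Ext (indicator f)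
  indicator-ext f {h} {h′} e with Fin.all? (λ g → h ⌜ g ⌝ ≟ f ⌜ g ⌝) | Fin.all? (λ g → h′ ⌜ g ⌝ ≟ f ⌜ g ⌝)
  ... | yes _ | yes _ = refl
  ... | no _  | no _  = refl
  ... | yes p | no ¬q = ⊥-elim (¬q (λ g → trans (sym (e ⌜ g ⌝)) (p g)))
  ... | no ¬p | yes q = ⊥-elim (¬p (λ g → trans (e ⌜ g ⌝) (q g)))

  indicator-refl : ∀ {f h} → h ≗ f → indicator f h ≡ + 1
  indicator-refl {f} {h} e with Fin.all? (λ g → h ⌜ g ⌝ ≟ f ⌜ g ⌝)
  ... | yes _ = refl
  ... | no ¬p = ⊥-elim (¬p (λ g → e ⌜ g ⌝))

  agree-on-period : ∀ {f h} (qf : Quasi f) (qh : Quasi h) → per qf ≡ per qh → (∀ g → h ⌜ g ⌝ ≡ f ⌜ g ⌝) → h ≗ f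
  agree-on-period {f} {h} qf qh pe e x with window (+ 0) x
  ... | y , m , lo , hi , refl = begin
      h (y + m * N)             ≡⟨ quasi-multiple qh m y ⟩
      h y + m * per qh          ≡⟨ cong₂ (λ u p → u + m * p) hy (sym pe) ⟩
      f y + m * per qf          ≡⟨ sym (quasi-multiple qf m y) ⟩
      f (y + m * N)             ∎
    where
    open ≡-Reasoning
    y≡ : ⌜ ρ y ⌝ ≡ y
    y≡ = ρ-injective-window (lia 3 (λ y r N → y ≺ con (+ 0) ⊕ N ⇒ con (+ 0) ≲ r ⇒ ⊢ y ⊝ N ≺ r) y ⌜ ρ y ⌝ N hi (0≤toℕ (ρ y)))
           (lia 3 (λ y r N → con (+ 0) ≲ y ⇒ r ≺ N ⇒ ⊢ r ≺ y ⊕ N) y ⌜ ρ y ⌝ N lo (toℕ<N (ρ y))) (sym (ρ-⌜⌝ (ρ y)))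
    hy : h y ≡ f y
    hy = subst (λ t → h t ≡ f t) y≡ (e (ρ y))

  indicator-one : ∀ {f h} (qf : Quasi f) (qh : Quasi h) → per qf ≡ per qh → indicator f h ≡ + 0 ⊎ (indicator f h ≡ + 1 × h ≗ f)
  indicator-one {f} {h} qf qh pe with Fin.all? (λ g → h ⌜ g ⌝ ≟ f ⌜ g ⌝)
  ... | no _  = inj₁ refl
  ... | yes p = inj₂ (refl , agree-on-period qf qh pe p)

  -- Gathering the terms equivalent to a good word a: evaluated at a state that separates a
  -- from every other word, the remaining terms contribute nothing.
  module Gather (a : W) (d : Deep a) where
    open Deep d

    q : State
    q = vac ∘ π base

    q-quasi : Quasi q
    q-quasi = quasi-π base vac-quasi

    φ : Func
    φ = indicator (q ∘ π a)

    record Gathered (x : Comb k) : Set where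
      field
        total : ℤ
        rest  : Comb k
        eq    : x ≐ ((total , a) ∷ rest)
        short : length rest ℕ.≤ length x
        null  : ⟦ rest ⟧ φ q ≡ + 0

    drop-zero : ∀ b x → ((+ 0 , b) ∷ x) ≐ x
    drop-zero b x = ≐-coeff (λ w → trans (coeff-∷ (+ 0) b x w) (trans (cong (_+ coeff k x w) (ℤ.*-zeroˡ (δ b w))) (ℤ.+-identityˡ _)))

    merge : ∀ c d x → ((c , a) ∷ (d , a) ∷ x) ≐ ((c + d , a) ∷ x)
    merge c d x = ≐-coeff (λ w → trans (coeff-∷ c a _ w) (trans (cong (_+_ (c * δ a w)) (coeff-∷ d a x w))
      (trans (ring c d (δ a w) (coeff k x w)) (sym (coeff-∷ (c + d) a x w)))))
      where
      ring : ∀ c d u v → c * u + (d * u + v) ≡ (c + d) * u + v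
      ring = solve-∀

    transpose : ∀ c b t x → ((c , b) ∷ (t , a) ∷ x) ≐ ((t , a) ∷ (c , b) ∷ x)
    transpose c b t x = ≐-coeff (λ w → trans (coeff-∷ c b _ w) (trans (cong (_+_ (c * δ b w)) (coeff-∷ t a x w))
      (trans (ring (c * δ b w) (t * δ a w) (coeff k x w)) (sym (trans (coeff-∷ t a _ w) (cong (_+_ (t * δ a w)) (coeff-∷ c b x w)))))))
      where
      ring : ∀ u v w → u + (v + w) ≡ v + (u + w)
      ring = solve-∀

    term : ∀ b → ev φ b q ≡ + 0 ⊎ (ev φ b q ≡ + 1 × b ∼ a)
    term b with good? b q
    ... | no _ = inj₁ refl
    ... | yes gb with indicator-one (quasi-π a q-quasi) (quasi-π b q-quasi) refl
    ... | inj₁ e = inj₁ e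
    ... | inj₂ (e , agree) = inj₂ (e , separated b a base base-good gb good agree)

    gather : ∀ x → Gathered x
    gather [] = record { total = + 0 ; rest = [] ; eq = ≐-sym (drop-zero a []) ; short = ℕ.z≤n ; null = refl }
    gather ((c , b) ∷ x) = add (term b)
      where
      open Gathered (gather x)
      add : ev φ b q ≡ + 0 ⊎ (ev φ b q ≡ + 1 × b ∼ a) → Gathered ((c , b) ∷ x)
      add (inj₁ e) = record { total = total ; rest = (c , b) ∷ rest
        ; eq = ≐-trans (≐-++ {(c , b) ∷ []} {(c , b) ∷ []} (≐-coeff (λ _ → refl)) eq) (transpose c b total rest)
        ; short = ℕ.s≤s short
        ; null = trans (cong₂ (λ u v → c * u + v) e null) (trans (ℤ.+-identityʳ _) (ℤ.*-zeroʳ c)) }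
      add (inj₂ (_ , s)) = record { total = c + total ; rest = rest
        ; eq = ≐-trans (≐-++ {(c , b) ∷ []} {(c , a) ∷ []} (∼⇒≐ c [] s) eq) (merge c total rest)
        ; short = ℕ.m≤n⇒m≤1+n short ; null = null }

    φ-self : ev φ a q ≡ + 1
    φ-self = trans (ev-good φ {a} good) (indicator-refl (λ _ → refl))

    gathered-total : ∀ x (r : Gathered x) → ⟦ x ⟧ φ q ≡ + 0 → Gathered.total r ≡ + 0
    gathered-total x r z = trans (ring total) (trans (sym (cong₂ (λ u v → total * u + v) φ-self null))
      (trans (sym (≐⇒⟦⟧ eq (indicator-ext (q ∘ π a)) q-quasi)) z))
      where
      open Gathered r
      ring : ∀ t → t ≡ t * + 1 + + 0
      ring = solve-∀

  VanishesOnOrbit : Comb k → Set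
  VanishesOnOrbit x = ∀ {φ} → Ext φ → ∀ a → Good a vac → ⟦ x ⟧ φ (vac ∘ π a) ≡ + 0

  faithful′ : ∀ m x → length x ℕ.≤ m → VanishesOnOrbit x → x ≐ []
  faithful′ m [] _ _ = ≐-coeff (λ _ → refl)
  faithful′ (suc m) x@((c , a) ∷ y) (ℕ.s≤s le) v with good? a id
  ... | no ¬ga = ≐-trans first (faithful′ m y le v′)
    where
    first : x ≐ y
    first = ≐-++ {(c , a) ∷ []} {[]} (≐-not-good c a ¬ga) (≐-coeff {y} (λ _ → refl))
    v′ : VanishesOnOrbit y
    v′ ex b gb = trans (sym (≐⇒⟦⟧ first ex (quasi-π b vac-quasi))) (v ex b gb)
  ... | yes ga = ≐-trans first (faithful′ m rest (ℕ.≤-trans short le) v′)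
    where
    open Gather a (deep a ga)
    r : Gathered y
    r = gather y
    open Gathered r
    all : Gathered x
    all = record { total = c + total ; rest = rest ; short = ℕ.m≤n⇒m≤1+n short ; null = null
      ; eq = ≐-trans (≐-++ {(c , a) ∷ []} {(c , a) ∷ []} (≐-coeff (λ _ → refl)) eq) (merge c total rest) }
    first : x ≐ rest
    first = ≐-trans (subst (λ t → x ≐ ((t , a) ∷ rest))
      (gathered-total x all (v (indicator-ext (vac ∘ π (Deep.base (deep a ga)) ∘ π a)) (Deep.base (deep a ga)) (Deep.base-good (deep a ga)))) (Gathered.eq all)) (drop-zero a rest)
    v′ : VanishesOnOrbit rest
    v′ ex b gb = trans (sym (≐⇒⟦⟧ first ex (quasi-π b vac-quasi))) (v ex b gb)

  faithful : ∀ x y → (∀ {φ} → Ext φ → ∀ a → Good a vac → ⟦ x ⟧ φ (vac ∘ π a) ≡ ⟦ y ⟧ φ (vac ∘ π a)) → x ≐ y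
  faithful x y h = ≐-trans (≐-coeff coeffs) (≐-++ {x ++ scale k (- + 1) y} {[]} {y} {y}
      (faithful′ _ (x ++ scale k (- + 1) y) ℕ.≤-refl vanish) (≐-coeff (λ _ → refl)))
    where
    ring : ∀ u → u + - + 1 * u ≡ + 0
    ring = solve-∀
    ring₂ : ∀ u v → u ≡ u + - + 1 * v + v
    ring₂ = solve-∀
    vanish : VanishesOnOrbit (x ++ scale k (- + 1) y)
    vanish {φ} ex a ga = trans (pair-++ _ x (scale k (- + 1) y)) (trans (cong₂ _+_ (h ex a ga) (pair-scale _ (- + 1) y)) (ring (⟦ y ⟧ φ (vac ∘ π a))))
    coeffs : ∀ w → coeff k x w ≡ coeff k ((x ++ scale k (- + 1) y) ++ y) w
    coeffs w = trans (ring₂ (coeff k x w) (coeff k y w)) (sym (trans (coeff-++ (x ++ scale k (- + 1) y) y w)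
      (cong (_+ coeff k y w) (trans (coeff-++ x _ w) (cong (_+_ (coeff k x w)) (coeff-scale (- + 1) y w))))))

  -- Cyclically decreasing words

  _∋_ : Subset n → ℤ → Bool
  D ∋ x = lookup D (ρ x)

  ∋-+N : ∀ D x m → D ∋ (x + m * N) ≡ D ∋ x
  ∋-+N D x m = cong (lookup D) (ρ-periodic x m)

  true≢false : true ≢ false
  true≢false ()

  letter : Bool → G → W → W
  letter true  g a = g ∷ a
  letter false g a = a

  -- The members of `D` among `t` consecutive places from `a`, highest first. When `a - 1` lies
  -- outside `D` and `t` is `k`, this is the cyclically decreasing word with the circle cut open at
  -- `a - 1`.
  cut : Subset n → ℤ → ℕ → W
  cut D a zero    = []
  cut D a (suc t) = letter (D ∋ (a + + t)) (ρ (a + + t)) (cut D a t)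

  -- `s` is the bottom of the maximal stretch of `D` ending just before `x`, and `x` itself if that
  -- stretch is empty. The place `x` may or may not belong to `D`.
  record BlockStart (D : Subset n) (s x : ℤ) : Set where
    constructor block
    field
      s≤x    : s ≤ x
      inside : ∀ z → s ≤ z → z < x → D ∋ z ≡ true
      edge   : D ∋ (s - + 1) ≡ false

  blockStart-unique : ∀ {D s s′ x} → BlockStart D s x → BlockStart D s′ x → s ≡ s′
  blockStart-unique {D} {s} {s′} {x} b b′ with ℤ.<-cmp s s′
  ... | tri≈ _ e _ = e
  ... | tri< lt _ _ = ⊥-elim (true≢false (trans (sym (BlockStart.inside b (s′ - + 1)
          (lia 2 (λ s t → s ≺ t ⇒ ⊢ s ≲ t ⊝ one) s s′ lt)
          (lia 2 (λ t x → t ≲ x ⇒ ⊢ t ⊝ one ≺ x) s′ x (BlockStart.s≤x b′)))) (BlockStart.edge b′)))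
  ... | tri> _ _ lt = ⊥-elim (true≢false (trans (sym (BlockStart.inside b′ (s - + 1)
          (lia 2 (λ s t → s ≺ t ⇒ ⊢ s ≲ t ⊝ one) s′ s lt)
          (lia 2 (λ t x → t ≲ x ⇒ ⊢ t ⊝ one ≺ x) s x (BlockStart.s≤x b)))) (BlockStart.edge b)))

  blockStart-shift : ∀ {D s x} m → BlockStart D s x → BlockStart D (s + m * N) (x + m * N)
  blockStart-shift {D} {s} {x} m (block le ins e) = block (ℤ.+-monoˡ-≤ (m * N) le)
    (λ z lo hi → trans (cong (D ∋_) (lia 2 (λ z u → ⊢ z ≈ z ⊝ u ⊕ u) z (m * N))) (trans (∋-+N D (z - m * N) m)
       (ins (z - m * N) (lia 3 (λ s u z → s ⊕ u ≲ z ⇒ ⊢ s ≲ z ⊝ u) s (m * N) z lo) (lia 3 (λ x u z → z ≺ x ⊕ u ⇒ ⊢ z ⊝ u ≺ x) x (m * N) z hi))))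
    (trans (cong (D ∋_) (lia 2 (λ s u → ⊢ s ⊕ u ⊝ one ≈ s ⊝ one ⊕ u) s (m * N))) (trans (∋-+N D (s - + 1) m) e))

  pick : Bool → ℤ → ℤ → ℤ
  pick true  u v = u
  pick false u v = v

  module Cut (D : Subset n) (a : ℤ) (outside : D ∋ (a - + 1) ≡ false) where

    start : ℕ → ℤ
    start zero    = a
    start (suc t) = pick (D ∋ (a + + t)) (start t) (a + + suc t)

    a+suc : ∀ t → a + + suc t ≡ a + + t + + 1
    a+suc t = lia 2 (λ a t → ⊢ a ⊕ (one ⊕ t) ≈ a ⊕ t ⊕ one) a (+ t)

    start-block : ∀ t → BlockStart D (start t) (a + + t)
    start-block zero = block (ℤ.≤-reflexive (sym (ℤ.+-identityʳ a)))
      (λ z lo hi → ⊥-elim (ℤ.<⇒≱ hi (subst (_≤ z) (sym (ℤ.+-identityʳ a)) lo))) outside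
    start-block (suc t) with D ∋ (a + + t) in eq
    ... | false = block ℤ.≤-refl (λ z lo hi → ⊥-elim (ℤ.<⇒≱ hi lo))
                    (trans (cong (D ∋_) (trans (cong (_- + 1) (a+suc t)) (x+1-1 (a + + t)))) eq)
    ... | true with start-block t
    ...   | block le ins e = block (ℤ.≤-trans le (lia 2 (λ a t → ⊢ a ⊕ t ≲ a ⊕ (one ⊕ t)) a (+ t))) ins′ e
      where
      ins′ : ∀ z → start t ≤ z → z < a + + suc t → D ∋ z ≡ true
      ins′ z lo hi with z ≟ a + + t
      ... | yes refl = eq
      ... | no z≢    = ins z lo (ℤ.≤∧≢⇒< (lia 3 (λ z a t → z ≺ a ⊕ (one ⊕ t) ⇒ ⊢ z ≲ a ⊕ t) z a (+ t) hi) z≢)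

    within : ∀ {t} → suc t ℕ.≤ k → a + + suc t < a + N
    within {t} le = ℤ.+-monoʳ-< a (subst (+ suc t <_) (sym N≡n) (+<+ (ℕ.s≤s le)))

    fixed : ∀ t x → suc t ℕ.≤ k → a ≤ x → x < a + N → x ≢ a + + t → x ≢ a + + suc t → σ (ρ (a + + t)) x ≡ x
    fixed t x le lo hi ne₁ ne₂ = σ-fix (λ e → ne₁ (ρ-injective-window (down (+≤+ ℕ.z≤n) lo hi) (up (+≤+ ℕ.z≤n) lo hi) (sym e)))
      (λ e → ne₂ (trans (sym (x-1+1 x)) (trans (cong (_+ + 1) (ρ-injective-window
        (lia 4 (λ a t N x → a ≲ x ⇒ a ⊕ (one ⊕ t) ≺ a ⊕ N ⇒ ⊢ a ⊕ t ⊝ N ≺ x ⊝ one) a (+ t) N x lo (within le))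
        (lia 4 (λ a t N x → x ≺ a ⊕ N ⇒ con (+ 0) ≲ t ⇒ ⊢ x ⊝ one ≺ a ⊕ t ⊕ N) a (+ t) N x hi (+≤+ ℕ.z≤n)) (sym e))) (sym (a+suc t)))))
      where
      down : + 0 ≤ + t → a ≤ x → x < a + N → a + + t - N < x
      down _ lo hi = lia 4 (λ a t N x → a ≲ x ⇒ a ⊕ (one ⊕ t) ≺ a ⊕ N ⇒ ⊢ a ⊕ t ⊝ N ≺ x) a (+ t) N x lo (within le)
      up : + 0 ≤ + t → a ≤ x → x < a + N → x < a + + t + N
      up h lo hi = lia 4 (λ a t N x → x ≺ a ⊕ N ⇒ con (+ 0) ≲ t ⇒ ⊢ x ≺ a ⊕ t ⊕ N) a (+ t) N x hi h

    π-cut-end : ∀ t → t ℕ.≤ k → π (cut D a t) (a + + t) ≡ start t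
    π-cut-above : ∀ t x → t ℕ.≤ k → a + + t < x → x < a + N → π (cut D a t) x ≡ x

    π-cut-end zero    _  = ℤ.+-identityʳ a
    π-cut-end (suc t) le with D ∋ (a + + t)
    ... | true  = trans (cong (λ x → π (cut D a t) (σ (ρ (a + + t)) x)) (a+suc t))
                    (trans (cong (π (cut D a t)) (σ-hi refl)) (π-cut-end t (ℕ.≤-trans (ℕ.n≤1+n t) le)))
    ... | false = π-cut-above t (a + + suc t) (ℕ.≤-trans (ℕ.n≤1+n t) le) (lia 2 (λ a t → ⊢ a ⊕ t ≺ a ⊕ (one ⊕ t)) a (+ t)) (within le)

    π-cut-above zero    x _  _  _  = refl
    π-cut-above (suc t) x le lo hi with D ∋ (a + + t)
    ... | true  = trans (cong (π (cut D a t)) (fixed t x le (ℤ.<⇒≤ (ℤ.≤-<-trans (lia 2 (λ a t → con (+ 0) ≲ t ⇒ ⊢ a ≲ a ⊕ (one ⊕ t)) a (+ t) (+≤+ ℕ.z≤n)) lo)) hi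
                     (λ e → ℤ.<-asym lo (subst (_< a + + suc t) (sym e) (lia 2 (λ a t → ⊢ a ⊕ t ≺ a ⊕ (one ⊕ t)) a (+ t))))
                     (λ e → ℤ.<-irrefl (sym e) lo)))
                   (π-cut-above t x (ℕ.≤-trans (ℕ.n≤1+n t) le) (ℤ.<-trans (lia 2 (λ a t → ⊢ a ⊕ t ≺ a ⊕ (one ⊕ t)) a (+ t)) lo) hi)
    ... | false = π-cut-above t x (ℕ.≤-trans (ℕ.n≤1+n t) le) (ℤ.<-trans (lia 2 (λ a t → ⊢ a ⊕ t ≺ a ⊕ (one ⊕ t)) a (+ t)) lo) hi

    π-cut-below : ∀ t i → t ℕ.≤ k → i ℕ.< t → π (cut D a t) (a + + i) ≡ pick (D ∋ (a + + i)) (a + + suc i) (start i)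
    π-cut-below (suc t) i le (ℕ.s≤s i≤t) with i ℕ.≟ t
    π-cut-below (suc t) i le (ℕ.s≤s i≤t) | yes refl with D ∋ (a + + i)
    ... | true  = trans (cong (π (cut D a i)) (trans (σ-lo refl) (sym (a+suc i))))
                    (π-cut-above i (a + + suc i) (ℕ.≤-trans (ℕ.n≤1+n i) le) (lia 2 (λ a t → ⊢ a ⊕ t ≺ a ⊕ (one ⊕ t)) a (+ i)) (within le))
    ... | false = π-cut-end i (ℕ.≤-trans (ℕ.n≤1+n i) le)
    π-cut-below (suc t) i le (ℕ.s≤s i≤t) | no i≢t with D ∋ (a + + t)
    ... | true  = trans (cong (π (cut D a t)) (fixed t (a + + i) le
                     (lia 2 (λ a t → con (+ 0) ≲ t ⇒ ⊢ a ≲ a ⊕ t) a (+ i) (+≤+ ℕ.z≤n))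
                     (ℤ.<-trans (ℤ.+-monoʳ-< a (+<+ (ℕ.s≤s i≤t))) (within le))
                     (λ e → ℤ.<-irrefl e (ℤ.+-monoʳ-< a (+<+ i<t))) (λ e → ℤ.<-irrefl e (ℤ.+-monoʳ-< a (+<+ (ℕ.s≤s i≤t))))))
                   (π-cut-below t i (ℕ.≤-trans (ℕ.n≤1+n t) le) i<t)
      where i<t = ℕ.≤∧≢⇒< i≤t i≢t
    ... | false = π-cut-below t i (ℕ.≤-trans (ℕ.n≤1+n t) le) (ℕ.≤∧≢⇒< i≤t i≢t)

    last-outside : D ∋ (a + + k) ≡ false
    last-outside = trans (cong (D ∋_) (lia 3 (λ a k N → k ≈ N ⊝ one ⇒ ⊢ a ⊕ k ≈ a ⊝ one ⊕ N) a (+ k) N k≡N-1))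
      (trans (cong (lookup D) (ρ+N (a - + 1))) outside)

    π-cut : ∀ i → i ℕ.≤ k → π (cut D a k) (a + + i) ≡ pick (D ∋ (a + + i)) (a + + suc i) (start i)
    π-cut i le with i ℕ.≟ k
    ... | no i≢k   = π-cut-below k i ℕ.≤-refl (ℕ.≤∧≢⇒< le i≢k)
    ... | yes refl = trans (π-cut-end k ℕ.≤-refl) (cong (λ b → pick b (a + + suc k) (start k)) (sym last-outside))

    opaque
      locate : ∀ x → Σ ℕ λ i → Σ ℤ λ m → i ℕ.≤ k × x ≡ a + + i + m * N
      locate x with window a x
      ... | y , m , lo , hi , refl = Data.Integer.∣ y - a ∣ , m , i≤k , cong (_+ m * N) (lia 3 (λ y a i → i ≈ y ⊝ a ⇒ ⊢ y ≈ a ⊕ i) y a (+ Data.Integer.∣ y - a ∣) abs)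
        where
        abs : + Data.Integer.∣ y - a ∣ ≡ y - a
        abs = ℤ.0≤i⇒+∣i∣≡i (lia 2 (λ y a → a ≲ y ⇒ ⊢ con (+ 0) ≲ y ⊝ a) y a lo)
        i≤k : Data.Integer.∣ y - a ∣ ℕ.≤ k
        i≤k = ℕ.s≤s⁻¹ (ℤ.drop‿+<+ (subst₂ _<_ (sym abs) N≡n (lia 3 (λ y a N → y ≺ a ⊕ N ⇒ ⊢ y ⊝ a ≺ N) y a N hi)))

    blockStart : ∀ x → Σ ℤ λ s → BlockStart D s x
    blockStart x with locate x
    ... | i , m , _ , refl = start i + m * N , blockStart-shift m (start-block i)

    π-inside : ∀ x → D ∋ x ≡ true → π (cut D a k) x ≡ x + + 1
    π-inside x e with locate x
    ... | i , m , le , refl = trans (π-multiple (cut D a k) m (a + + i))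
      (trans (cong (_+ m * N) (trans (π-cut i le) (cong (λ b → pick b (a + + suc i) (start i)) (trans (sym (∋-+N D (a + + i) m)) e))))
             (lia 3 (λ a i u → ⊢ a ⊕ (one ⊕ i) ⊕ u ≈ a ⊕ i ⊕ u ⊕ one) a (+ i) (m * N)))

    π-outside : ∀ x s → D ∋ x ≡ false → BlockStart D s x → π (cut D a k) x ≡ s
    π-outside x s e b with locate x
    ... | i , m , le , refl = trans (π-multiple (cut D a k) m (a + + i))
      (trans (cong (_+ m * N) (trans (π-cut i le) (cong (λ b → pick b (a + + suc i) (start i)) (trans (sym (∋-+N D (a + + i) m)) e))))
             (blockStart-unique (blockStart-shift m (start-block i)) b))

    cut-good-id : ∀ t → t ℕ.≤ k → Good (cut D a t) id
    cut-good-id zero    le = tt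
    cut-good-id (suc t) le with D ∋ (a + + t)
    ... | false = cut-good-id t (ℕ.≤-trans (ℕ.n≤1+n t) le)
    ... | true  = cut-good-id t le′ , asc-from (quasi-π (cut D a t) id-quasi) (a + + t) refl
        (subst₂ _<_ (sym (π-cut-end t le′)) (sym (trans (cong (π (cut D a t)) (sym (a+suc t)))
          (π-cut-above t (a + + suc t) le′ (lia 2 (λ a t → ⊢ a ⊕ t ≺ a ⊕ (one ⊕ t)) a (+ t)) (within le))))
          (ℤ.≤-<-trans (BlockStart.s≤x (start-block t)) (lia 2 (λ a t → ⊢ a ⊕ t ≺ a ⊕ (one ⊕ t)) a (+ t))))
      where le′ = ℕ.≤-trans (ℕ.n≤1+n t) le

    cut-good⇒ : ∀ {f} → Quasi f → ∀ t → t ℕ.≤ k → Good (cut D a t) f → ∀ i → i ℕ.< t → D ∋ (a + + i) ≡ true → f (start i) < f (a + + suc i)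
    cut-good⇒ qf (suc t) le gd i (ℕ.s≤s i≤t) e with i ℕ.≟ t
    cut-good⇒ {f} qf (suc t) le gd i (ℕ.s≤s i≤t) e | yes refl rewrite e =
      subst₂ (λ u v → f u < f v) (π-cut-end i le′) (trans (cong (π (cut D a i)) (sym (a+suc i)))
          (π-cut-above i (a + + suc i) le′ (lia 2 (λ a t → ⊢ a ⊕ t ≺ a ⊕ (one ⊕ t)) a (+ i)) (within le)))
        (asc-at (quasi-π (cut D a i) qf) (a + + i) refl (proj₂ gd))
      where le′ = ℕ.≤-trans (ℕ.n≤1+n i) le
    cut-good⇒ qf (suc t) le gd i (ℕ.s≤s i≤t) e | no i≢t with D ∋ (a + + t)
    ... | true  = cut-good⇒ qf t (ℕ.≤-trans (ℕ.n≤1+n t) le) (proj₁ gd) i (ℕ.≤∧≢⇒< i≤t i≢t) e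
    ... | false = cut-good⇒ qf t (ℕ.≤-trans (ℕ.n≤1+n t) le) gd i (ℕ.≤∧≢⇒< i≤t i≢t) e

    -- By the time the letter at `x` acts, the letters below it in the block have carried the value
    -- of `s` up to `x`; its ascent is this inequality.
    good⇒below : ∀ {f} → Quasi f → Good (cut D a k) f → ∀ x s → D ∋ x ≡ true → BlockStart D s x → f s < f (x + + 1)
    good⇒below {f} qf gd x s e b with locate x
    ... | i , m , le , refl = subst₂ (λ u v → f u < f v) (blockStart-unique (blockStart-shift m (start-block i)) b)
        (lia 3 (λ a i u → ⊢ a ⊕ (one ⊕ i) ⊕ u ≈ a ⊕ i ⊕ u ⊕ one) a (+ i) (m * N))
        (subst₂ _<_ (sym (quasi-multiple qf m (start i))) (sym (quasi-multiple qf m (a + + suc i)))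
          (ℤ.+-monoˡ-< (m * per qf) (cut-good⇒ qf k ℕ.≤-refl gd i i<k e′)))
      where
      e′ : D ∋ (a + + i) ≡ true
      e′ = trans (sym (∋-+N D (a + + i) m)) e
      i<k : i ℕ.< k
      i<k = ℕ.≤∧≢⇒< le λ { refl → true≢false (trans (sym e′) last-outside) }

  module _ (D : Subset n) {a b : ℤ} (oa : D ∋ (a - + 1) ≡ false) (ob : D ∋ (b - + 1) ≡ false) where

    π-cut-independent : ∀ x → π (cut D a k) x ≡ π (cut D b k) x
    π-cut-independent x with D ∋ x in eq
    ... | true  = trans (Cut.π-inside D a oa x eq) (sym (Cut.π-inside D b ob x eq))
    ... | false = let s , bs = Cut.blockStart D a oa x
                  in trans (Cut.π-outside D a oa x s eq bs) (sym (Cut.π-outside D b ob x s eq bs))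

    -- The permutation sends members of `D` up by one and any other place to the start of the block
    -- before it. This description does not involve the cut point, so Matsumoto's theorem applies.
    cut-independent : cut D a k ∼ cut D b k
    cut-independent = matsumoto id-quasi id-sorted (cut D a k) (cut D b k)
      (Cut.cut-good-id D a oa k ℕ.≤-refl) (Cut.cut-good-id D b ob k ℕ.≤-refl) π-cut-independent

  subset-ext : ∀ {m} {D E : Subset m} → (∀ g → lookup D g ≡ lookup E g) → D ≡ E
  subset-ext h = Pointwise.Pointwise-≡⇒≡ (Pointwise.ext h)

  ∋-ext : ∀ {D E} → (∀ x → D ∋ x ≡ E ∋ x) → D ≡ E
  ∋-ext {D} {E} h = subset-ext (λ g → subst₂ (λ s t → lookup D s ≡ lookup E t) (ρ-⌜⌝ g) (ρ-⌜⌝ g) (h ⌜ g ⌝))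

  -- The permutation shows its set: members of `D` are the places that move up, since all others go
  -- to a block start at or below them.
  cut-determines : ∀ D E {a b} → D ∋ (a - + 1) ≡ false → E ∋ (b - + 1) ≡ false →
    (∀ x → π (cut D a k) x ≡ π (cut E b k) x) → D ≡ E
  cut-determines D E {a} {b} oa ob h = ∋-ext same-membership
    where
    clash : ∀ D E {a b} → (oa : D ∋ (a - + 1) ≡ false) (ob : E ∋ (b - + 1) ≡ false) →
      (∀ x → π (cut D a k) x ≡ π (cut E b k) x) → ∀ x → D ∋ x ≡ true → E ∋ x ≡ false → ⊥
    clash D E {a} {b} oa ob h x d e = let s , bs = Cut.blockStart E b ob x in
      ℤ.<⇒≱ (x<x+1 x) (subst (_≤ x) (trans (sym (Cut.π-outside E b ob x s e bs)) (trans (sym (h x)) (Cut.π-inside D a oa x d))) (BlockStart.s≤x bs))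
    same-membership : ∀ x → D ∋ x ≡ E ∋ x
    same-membership x with D ∋ x in d | E ∋ x in e
    ... | true  | true  = refl
    ... | false | false = refl
    ... | true  | false = ⊥-elim (clash D E oa ob h x d e)
    ... | false | true  = ⊥-elim (clash E D ob oa (sym ∘ h) x e d)

  cut-snoc : ∀ D a t → cut D a (suc t) ≡ cut D (a + + 1) t ++ letter (D ∋ a) (ρ a) []
  cut-snoc D a zero    = cong (λ x → letter (D ∋ x) (ρ x) []) (ℤ.+-identityʳ a)
  cut-snoc D a (suc t) = trans (cong₂ (λ x w → letter (D ∋ x) (ρ x) w) (lia 2 (λ a t → ⊢ a ⊕ (one ⊕ t) ≈ a ⊕ one ⊕ t) a (+ t)) (cut-snoc D a t))
    (pull (D ∋ (a + + 1 + + t)))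
    where
    pull : ∀ b {g} {v w : W} → letter b g (v ++ w) ≡ letter b g v ++ w
    pull true  = refl
    pull false = refl

  bit : Bool → ℕ
  bit true  = 1
  bit false = 0

  length-letter : ∀ b g a → length (letter b g a) ≡ bit b ℕ.+ length a
  length-letter true  g a = refl
  length-letter false g a = refl

  length-cut-suc : ∀ D a t → length (cut D (a + + 1) t) ℕ.+ bit (D ∋ a) ≡ bit (D ∋ (a + + t)) ℕ.+ length (cut D a t)
  length-cut-suc D a t = begin
    length (cut D (a + + 1) t) ℕ.+ bit (D ∋ a)                        ≡⟨ cong (length (cut D (a + + 1) t) ℕ.+_) (sym (trans (length-letter (D ∋ a) (ρ a) []) (ℕ.+-identityʳ _))) ⟩
    length (cut D (a + + 1) t) ℕ.+ length (letter (D ∋ a) (ρ a) [])   ≡⟨ sym (length-++ (cut D (a + + 1) t)) ⟩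
    length (cut D (a + + 1) t ++ letter (D ∋ a) (ρ a) [])             ≡⟨ cong length (sym (cut-snoc D a t)) ⟩
    length (cut D a (suc t))                                          ≡⟨ length-letter (D ∋ (a + + t)) _ _ ⟩
    bit (D ∋ (a + + t)) ℕ.+ length (cut D a t)                        ∎
    where open ≡-Reasoning

  length-cut-shift : ∀ D a → length (cut D (a + + 1) n) ≡ length (cut D a n)
  length-cut-shift D a = ℕ.+-cancelʳ-≡ (bit (D ∋ a)) _ _ (trans (length-cut-suc D a n)
    (trans (cong (λ b → bit b ℕ.+ length (cut D a n)) (trans (cong (λ M → D ∋ (a + M)) (sym N≡n)) (cong (lookup D) (ρ+N a)))) (ℕ.+-comm (bit (D ∋ a)) _)))

  count : (ℕ → Bool) → ℕ → ℕ
  count h zero    = 0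
  count h (suc t) = bit (h 0) ℕ.+ count (h ∘ suc) t

  count-last : ∀ h t → count h (suc t) ≡ bit (h t) ℕ.+ count h t
  count-last h zero    = refl
  count-last h (suc t) = trans (cong (bit (h 0) ℕ.+_) (count-last (h ∘ suc) t))
    (ℕ-swap (bit (h 0)) (bit (h (suc t))) (count (h ∘ suc) t))
    where
    ℕ-swap : ∀ a b c → a ℕ.+ (b ℕ.+ c) ≡ b ℕ.+ (a ℕ.+ c)
    ℕ-swap a b c = trans (sym (ℕ.+-assoc a b c)) (trans (cong (ℕ._+ c) (ℕ.+-comm a b)) (ℕ.+-assoc b a c))

  count-subset : ∀ {m} (D : Subset m) (h : ℕ → Bool) → (∀ i → h (toℕ i) ≡ lookup D i) → count h m ≡ ∣ D ∣
  count-subset []ᵥ          h e = refl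
  count-subset (true  ∷ᵥ D) h e = cong₂ (λ b c → bit b ℕ.+ c) (e Fin.zero) (count-subset D (h ∘ suc) (e ∘ Fin.suc))
  count-subset (false ∷ᵥ D) h e = cong₂ (λ b c → bit b ℕ.+ c) (e Fin.zero) (count-subset D (h ∘ suc) (e ∘ Fin.suc))

  length-cut-count : ∀ D t → length (cut D (+ 0) t) ≡ count (λ i → D ∋ (+ i)) t
  length-cut-count D zero    = refl
  length-cut-count D (suc t) = trans (length-letter (D ∋ (+ 0 + + t)) _ _)
    (trans (cong₂ (λ b c → bit b ℕ.+ c) (cong (D ∋_) (ℤ.+-identityˡ (+ t))) (length-cut-count D t)) (sym (count-last (λ i → D ∋ (+ i)) t)))

  cut-ρ : ∀ D {a b} t → ρ a ≡ ρ b → cut D a t ≡ cut D b t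
  cut-ρ D zero    e = refl
  cut-ρ D (suc t) e = cong₂ (λ g w → letter (lookup D g) g w) (ρ-cong+ (+ t) e) (cut-ρ D t e)

  -- Over a full period, moving the starting point by one removes a letter at one end and restores
  -- it at the other; from 0 the letters are counted directly.
  length-cut-n : ∀ D a → length (cut D a n) ≡ ∣ D ∣
  length-cut-n D a = trans (cong length (cut-ρ D n (sym (ρ-⌜⌝ (ρ a))))) (from-ℕ (toℕ (ρ a)))
    where
    from-ℕ : ∀ m → length (cut D (+ m) n) ≡ ∣ D ∣
    from-ℕ zero    = trans (length-cut-count D n) (count-subset D (λ i → D ∋ (+ i)) (λ i → cong (lookup D) (ρ-⌜⌝ i)))
    from-ℕ (suc m) = trans (cong (λ x → length (cut D x n)) (ℤ.+-comm (+ 1) (+ m))) (trans (length-cut-shift D (+ m)) (from-ℕ m))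

  cut-drop : ∀ D a → D ∋ (a - + 1) ≡ false → cut D (a - + 1) n ≡ cut D a k
  cut-drop D a o = trans (cut-snoc D (a - + 1) k)
    (trans (cong₂ (λ x b → cut D x k ++ letter b (ρ (a - + 1)) []) (x-1+1 a) o) (++-identityʳ _))

  length-cut : ∀ D a → D ∋ (a - + 1) ≡ false → length (cut D a k) ≡ ∣ D ∣
  length-cut D a o = trans (cong length (sym (cut-drop D a o))) (length-cut-n D (a - + 1))

  full-size : ∀ {m} (D : Subset m) → (∀ i → lookup D i ≡ true) → ∣ D ∣ ≡ m
  full-size []ᵥ          h = refl
  full-size (true  ∷ᵥ D) h = cong suc (full-size D (h ∘ Fin.suc))
  full-size (false ∷ᵥ D) h = ⊥-elim (true≢false (sym (h Fin.zero)))

  filter-letters : ∀ (D : Subset n) a m h → (∀ t → t ℕ.< m → h t ≡ ρ (a + + (m ℕ.∸ suc t))) →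
    filter (λ g → lookup D g Bool.≟ true) (applyUpTo h m) ≡ cut D a m
  filter-letters D a zero    h e = refl
  filter-letters D a (suc m) h e with e 0 (ℕ.s≤s ℕ.z≤n)
  ... | e₀ rewrite e₀ with lookup D (ρ (a + + m))
  ... | true  = cong (ρ (a + + m) ∷_) (filter-letters D a m (h ∘ suc) (λ t lt → e (suc t) (ℕ.s≤s lt)))
  ... | false = filter-letters D a m (h ∘ suc) (λ t lt → e (suc t) (ℕ.s≤s lt))

  mod-ρ : ∀ m → m ℕ.mod n ≡ ρ (+ m)
  mod-ρ m = Fin.toℕ-injective (trans (Fin.toℕ-fromℕ< (ℕ.m%n<n m n)) (sym (toℕ-ρ (+ m))))

  record IsCut (D : Subset n) (w : W) : Set where
    constructor isCut
    field
      at      : ℤ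
      outside : D ∋ (at - + 1) ≡ false
      word≡   : w ≡ cut D at k

  uDWord-cut : ∀ D → ∣ D ∣ ℕ.≤ k → IsCut D (uDWord k D)
  uDWord-cut D small with filter (λ m → lookup D m Bool.≟ false) (allFin n) in eq
  ... | m ∷ ms = isCut (⌜ m ⌝ + + 1) out (trans (trans (cong (filter (λ g → lookup D g Bool.≟ true)) (map-upTo _ n))
                   (filter-letters D ⌜ m ⌝ n _ letters))
                   (trans (cong (λ x → cut D x n) (sym (x+1-1 ⌜ m ⌝))) (cut-drop D (⌜ m ⌝ + + 1) out)))
    where
    m∈ : lookup D m ≡ false
    m∈ = proj₂ (∈-filter⁻ (λ m → lookup D m Bool.≟ false) {xs = allFin n} (subst (m ∈_) (sym eq) (here refl)))
    out : D ∋ (⌜ m ⌝ + + 1 - + 1) ≡ false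
    out = trans (cong (D ∋_) (x+1-1 ⌜ m ⌝)) (trans (cong (lookup D) (ρ-⌜⌝ m)) m∈)
    letters : ∀ t → t ℕ.< n → (toℕ m ℕ.+ n ℕ.∸ suc t) ℕ.mod n ≡ ρ (⌜ m ⌝ + + (n ℕ.∸ suc t))
    letters t lt = trans (mod-ρ (toℕ m ℕ.+ n ℕ.∸ suc t)) (cong (λ i → ρ (+ i)) (ℕ.+-∸-assoc (toℕ m) lt))
  -- The default value of `firstOut` is reached only by the full set, which the bound on the size
  -- excludes.
  ... | [] = ⊥-elim (ℕ.<-irrefl refl (ℕ.≤-trans (ℕ.≤-reflexive (sym (full-size D all-inside))) small))
    where
    all-inside : ∀ g → lookup D g ≡ true
    all-inside g with lookup D g in e
    ... | true  = refl
    ... | false with subst (g ∈_) eq (∈-filter⁺ (λ m → lookup D m Bool.≟ false) (∈-allFin g) e)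
    ...   | ()

  length-uDWord : ∀ D → ∣ D ∣ ℕ.≤ k → length (uDWord k D) ≡ ∣ D ∣
  length-uDWord D small = let open IsCut (uDWord-cut D small) in trans (cong length word≡) (length-cut D at outside)

  -- Cores and bounded partitions

  Decreasing : List ℕ → Set
  Decreasing l = ∀ i → part l (suc i) ℕ.≤ part l i

  decreasing-head : ∀ l → Decreasing l → ∀ i → part l i ℕ.≤ part l 0
  decreasing-head l d zero    = ℕ.≤-refl
  decreasing-head l d (suc i) = ℕ.≤-trans (d i) (decreasing-head l d i)

  decreasing-≤ : ∀ l → Decreasing l → ∀ {i j} → i ℕ.≤ j → part l j ℕ.≤ part l i
  decreasing-≤ l d {i} {zero}  ℕ.z≤n = ℕ.≤-refl
  decreasing-≤ l d {i} {suc j} le with i ℕ.≟ suc j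
  ... | yes refl = ℕ.≤-refl
  ... | no i≢    = ℕ.≤-trans (d j) (decreasing-≤ l d (ℕ.s≤s⁻¹ (ℕ.≤∧≢⇒< le i≢)))

  part-positives : ∀ l → Decreasing l → ∀ r → part (positives l) r ≡ part l r
  part-positives []            d r = refl
  part-positives (suc x ∷ l) d zero    = refl
  part-positives (suc x ∷ l) d (suc r) = part-positives l (d ∘ suc) r
  part-positives (zero ∷ l)  d r = trans (part-positives l (d ∘ suc) r) (sym (trans (0-at r) (sym (ℕ.n≤0⇒n≡0 (ℕ.≤-trans (decreasing-head (zero ∷ l) d (suc r)) ℕ.z≤n)))))
    where
    0-at : ∀ r → part (zero ∷ l) r ≡ 0
    0-at r = ℕ.n≤0⇒n≡0 (decreasing-head (zero ∷ l) d r)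

  positives-partition : ∀ l → Decreasing l → IsPartition (positives l)
  positives-partition l d = (λ i → subst₂ ℕ._≤_ (sym (part-positives l d (suc i))) (sym (part-positives l d i)) (d i)) ,
    all-filter (1 ℕ.≤?_) l

  part-applyUpTo-< : ∀ (h : ℕ → ℕ) m r → r ℕ.< m → part (applyUpTo h m) r ≡ h r
  part-applyUpTo-< h (suc m) zero    _          = refl
  part-applyUpTo-< h (suc m) (suc r) (ℕ.s≤s lt) = part-applyUpTo-< (h ∘ suc) m r lt

  part-applyUpTo-≥ : ∀ (h : ℕ → ℕ) m r → m ℕ.≤ r → part (applyUpTo h m) r ≡ 0
  part-applyUpTo-≥ h zero    r       _          = refl
  part-applyUpTo-≥ h (suc m) (suc r) (ℕ.s≤s le) = part-applyUpTo-≥ (h ∘ suc) m r le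

  part-map-upTo : ∀ (h : ℕ → ℕ) m → (∀ r → m ℕ.≤ r → h r ≡ 0) → ∀ r → part (map h (upTo m)) r ≡ h r
  part-map-upTo h m z r with r ℕ.<? m
  ... | yes lt = trans (cong (λ l → part l r) (map-upTo h m)) (part-applyUpTo-< h m r lt)
  ... | no ¬lt = trans (cong (λ l → part l r) (map-upTo h m)) (trans (part-applyUpTo-≥ h m r (ℕ.≮⇒≥ ¬lt)) (sym (z r (ℕ.≮⇒≥ ¬lt))))

  part-positives-map : ∀ (h : ℕ → ℕ) m → (∀ r → m ℕ.≤ r → h r ≡ 0) → (∀ r → h (suc r) ℕ.≤ h r) →
    IsPartition (positives (map h (upTo m))) × (∀ r → part (positives (map h (upTo m))) r ≡ h r)
  part-positives-map h m z d = positives-partition l dl , λ r → trans (part-positives l dl r) (part-map-upTo h m z r)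
    where
    l = map h (upTo m)
    dl : Decreasing l
    dl i = subst₂ ℕ._≤_ (sym (part-map-upTo h m z (suc i))) (sym (part-map-upTo h m z i)) (d i)

  part-ext : ∀ {l l′} → IsPartition l → IsPartition l′ → (∀ r → part l r ≡ part l′ r) → l ≡ l′
  part-ext {[]}    {[]}     _ _ e = refl
  part-ext {[]}    {y ∷ l′} _ (_ , p ∷ _) e = ⊥-elim (ℕ.<⇒≢ p (e 0))
  part-ext {x ∷ l} {[]}     (_ , p ∷ _) _ e = ⊥-elim (ℕ.<⇒≢ p (sym (e 0)))
  part-ext {x ∷ l} {y ∷ l′} (d , _ ∷ p) (d′ , _ ∷ p′) e = cong₂ _∷_ (e 0) (part-ext (d ∘ suc , p) (d′ ∘ suc , p′) (e ∘ suc))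

  part-beyond : ∀ l r → length l ℕ.≤ r → part l r ≡ 0
  part-beyond []      r       _          = refl
  part-beyond (x ∷ l) (suc r) (ℕ.s≤s le) = part-beyond l r le

  all-part : ∀ {P : ℕ → Set} l → (∀ r → r ℕ.< length l → P (part l r)) → All P l
  all-part []      h = []
  all-part (x ∷ l) h = h 0 (ℕ.s≤s ℕ.z≤n) ∷ all-part l (λ r lt → h (suc r) (ℕ.s≤s lt))

  -- A core is encoded by its beads (Maya diagram); those of a state are the places where it is negative.
  β : List ℕ → ℕ → ℤ
  β κ r = + part κ r - + r

  record Beads (f : State) (κ : List ℕ) : Set where
    field
      partition : IsPartition κ
      bead      : ∀ r → f (β κ r) < + 0
      only      : ∀ x → f x < + 0 → Σ ℕ λ r → x ≡ β κ r

  open Beads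

  β-< : ∀ κ → Decreasing κ → ∀ {r s} → r ℕ.< s → β κ s < β κ r
  β-< κ d {r} {s} lt = lia 4 (λ p q r s → q ≲ p ⇒ r ≺ s ⇒ ⊢ q ⊝ s ≺ p ⊝ r) (+ part κ r) (+ part κ s) (+ r) (+ s)
    (+≤+ (decreasing-≤ κ d (ℕ.<⇒≤ lt))) (+<+ lt)

  β-<⁻ : ∀ κ → Decreasing κ → ∀ {r s} → β κ s < β κ r → r ℕ.< s
  β-<⁻ κ d {r} {s} lt with r ℕ.<? s
  ... | yes p = p
  ... | no ¬p with r ℕ.≟ s
  ...   | yes refl = ⊥-elim (ℤ.<-irrefl refl lt)
  ...   | no r≢s   = ⊥-elim (ℤ.<-asym lt (β-< κ d (ℕ.≤∧≢⇒< (ℕ.≮⇒≥ ¬p) (≢-sym r≢s))))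

  β-injective : ∀ κ → Decreasing κ → ∀ {r s} → β κ r ≡ β κ s → r ≡ s
  β-injective κ d {r} {s} e with ℕ.<-cmp r s
  ... | tri< lt _ _ = ⊥-elim (ℤ.<-irrefl (sym e) (β-< κ d lt))
  ... | tri≈ _ eq _ = eq
  ... | tri> _ _ lt = ⊥-elim (ℤ.<-irrefl e (β-< κ d lt))

  β-part : ∀ κ κ′ r → β κ r ≡ β κ′ r → part κ r ≡ part κ′ r
  β-part κ κ′ r e = ℤ.+-injective (lia 3 (λ p q r → p ⊝ r ≈ q ⊝ r ⇒ ⊢ p ≈ q) (+ part κ r) (+ part κ′ r) (+ r) e)

  content-ρ : ∀ i j → content k i j ≡ ρ (+ j - + i)
  content-ρ i j = trans (mod-ρ (j ℕ.+ k ℕ.* i)) (trans (cong ρ eq) (ρ-periodic (+ j - + i) (+ i)))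
    where
    ring : ∀ j k i → j + k * i ≡ j - i + i * (+ 1 + k)
    ring = solve-∀
    eq : + (j ℕ.+ k ℕ.* i) ≡ + j - + i + + i * N
    eq = trans (ℤ.pos-+ j (k ℕ.* i)) (trans (cong (_+_ (+ j)) (ℤ.pos-* k i))
      (trans (ring (+ j) (+ k) (+ i)) (cong (λ M → + j - + i + + i * M) (sym N≡n))))

  Addable : G → List ℕ → ℕ → Set
  Addable g κ r = ρ (β κ r) ≡ g × (∀ s → β κ s ≢ β κ r + + 1)

  ∧-true : ∀ {a b} → a ∧ b ≡ true → a ≡ true × b ≡ true
  ∧-true {true} {true} _ = refl , refl

  ∧-intro : ∀ {a b} → a ≡ true → b ≡ true → a ∧ b ≡ true
  ∧-intro refl refl = refl

  ⌊⌋-intro : ∀ {P : Set} (d : Dec P) → P → ⌊ d ⌋ ≡ true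
  ⌊⌋-intro (yes _) _ = refl
  ⌊⌋-intro (no ¬p) p = ⊥-elim (¬p p)

  ⌊⌋-true : ∀ {P : Set} (d : Dec P) → ⌊ d ⌋ ≡ true → P
  ⌊⌋-true (yes p) _ = p

  addable⇒ : ∀ g κ r → Decreasing κ → addableB k g κ r ≡ true → Addable g κ r
  addable⇒ g κ zero d e = trans (sym (content-ρ 0 (part κ 0))) (⌊⌋-true _ (proj₂ (∧-true {true} e))) ,
    λ s e′ → ℤ.<⇒≱ (x<x+1 (β κ 0)) (subst (_≤ β κ 0) e′ (top s))
    where
    top : ∀ s → β κ s ≤ β κ 0
    top zero    = ℤ.≤-refl
    top (suc s) = ℤ.<⇒≤ (β-< κ d (ℕ.s≤s ℕ.z≤n))
  addable⇒ g κ (suc r) d e =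
    let e₁ , e₂ = ∧-true {⌊ suc (part κ (suc r)) ℕ.≤? part κ r ⌋} e
        gap = ⌊⌋-true (suc (part κ (suc r)) ℕ.≤? part κ r) e₁
    in trans (sym (content-ρ (suc r) (part κ (suc r)))) (⌊⌋-true _ e₂) , λ s e′ → between s e′ gap
    where
    between : ∀ s → β κ s ≡ β κ (suc r) + + 1 → suc (part κ (suc r)) ℕ.≤ part κ r → ⊥
    between s e′ gap = ℕ.<-irrefl refl (ℕ.≤-trans (β-<⁻ κ d {r} {s} (subst (_< β κ r) (sym e′)
        (lia 3 (λ p q r → one ⊕ q ≲ p ⇒ ⊢ q ⊝ (one ⊕ r) ⊕ one ≺ p ⊝ r) (+ part κ r) (+ part κ (suc r)) (+ r) (+≤+ gap))))
      (ℕ.s≤s⁻¹ (β-<⁻ κ d {s} {suc r} (subst (β κ (suc r) <_) (sym e′) (x<x+1 _)))))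

  addable⇐ : ∀ g κ r → Decreasing κ → Addable g κ r → addableB k g κ r ≡ true
  addable⇐ g κ zero    d (e , _) = ⌊⌋-intro _ (trans (content-ρ 0 (part κ 0)) e)
  addable⇐ g κ (suc r) d (e , free) =
    ∧-intro {⌊ suc (part κ (suc r)) ℕ.≤? part κ r ⌋} {⌊ content k (suc r) (part κ (suc r)) ≟F g ⌋}
      (⌊⌋-intro (suc (part κ (suc r)) ℕ.≤? part κ r) gap)
      (⌊⌋-intro (content k (suc r) (part κ (suc r)) ≟F g) (trans (content-ρ (suc r) (part κ (suc r))) e))
    where
    gap : suc (part κ (suc r)) ℕ.≤ part κ r
    gap = ℕ.≤∧≢⇒< (d r) (λ eq → free r (trans (cong (λ p → + p - + r) (sym eq))
      (lia 2 (λ p r → ⊢ p ⊝ r ≈ p ⊝ (one ⊕ r) ⊕ one) (+ part κ (suc r)) (+ r))))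

  not-addable : ∀ g κ r → Decreasing κ → ¬ Addable g κ r → addableB k g κ r ≡ false
  not-addable g κ r d ¬a with addableB k g κ r in eq
  ... | false = refl
  ... | true  = ⊥-elim (¬a (addable⇒ g κ r d eq))

  addable-bounded : ∀ g κ r → Decreasing κ → suc (length κ) ℕ.≤ r → addableB k g κ r ≡ false
  addable-bounded g κ (suc r) d (ℕ.s≤s le) with addableB k g κ (suc r) in eq
  ... | false = refl
  ... | true  = ⊥-elim (proj₂ (addable⇒ g κ (suc r) d eq) r (trans (cong (λ p → + p - + r) (part-beyond κ r le))
        (trans (lia 1 (λ r → ⊢ con (+ 0) ⊝ r ≈ con (+ 0) ⊝ (one ⊕ r) ⊕ one) (+ r))
               (cong (λ p → + p - + suc r + + 1) (sym (part-beyond κ (suc r) (ℕ.m≤n⇒m≤1+n le)))))))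

  grow : G → List ℕ → ℕ → ℕ
  grow g κ r = if addableB k g κ r then suc (part κ r) else part κ r

  grow-true : ∀ g κ r → addableB k g κ r ≡ true → grow g κ r ≡ suc (part κ r)
  grow-true g κ r e rewrite e = refl

  grow-false : ∀ g κ r → addableB k g κ r ≡ false → grow g κ r ≡ part κ r
  grow-false g κ r e rewrite e = refl

  grow-decreasing : ∀ g κ → Decreasing κ → ∀ r → grow g κ (suc r) ℕ.≤ grow g κ r
  grow-decreasing g κ d r with addableB k g κ (suc r) in eq
  ... | true  = ℕ.≤-trans (⌊⌋-true (suc (part κ (suc r)) ℕ.≤? part κ r) (proj₁ (∧-true {⌊ suc (part κ (suc r)) ℕ.≤? part κ r ⌋} eq))) (part≤grow r)
    where
    part≤grow : ∀ r → part κ r ℕ.≤ grow g κ r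
    part≤grow r with addableB k g κ r
    ... | true  = ℕ.n≤1+n _
    ... | false = ℕ.≤-refl
  ... | false with addableB k g κ r
  ...   | true  = ℕ.m≤n⇒m≤1+n (d r)
  ...   | false = d r

  addAll-parts : ∀ g κ → Decreasing κ → IsPartition (addAll k g κ) × (∀ r → part (addAll k g κ) r ≡ grow g κ r)
  addAll-parts g κ d = part-positives-map (grow g κ) (suc (length κ))
    (λ r le → trans (grow-false g κ r (addable-bounded g κ r d le)) (part-beyond κ r (ℕ.≤-trans (ℕ.n≤1+n _) le))) (grow-decreasing g κ d)

  β-addAll-true : ∀ g κ → Decreasing κ → ∀ r → addableB k g κ r ≡ true → β (addAll k g κ) r ≡ β κ r + + 1
  β-addAll-true g κ d r e = trans (cong (λ p → + p - + r) (trans (proj₂ (addAll-parts g κ d) r) (grow-true g κ r e)))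
    (lia 2 (λ p r → ⊢ one ⊕ p ⊝ r ≈ p ⊝ r ⊕ one) (+ part κ r) (+ r))

  β-addAll-false : ∀ g κ → Decreasing κ → ∀ r → addableB k g κ r ≡ false → β (addAll k g κ) r ≡ β κ r
  β-addAll-false g κ d r e = cong (λ p → + p - + r) (trans (proj₂ (addAll-parts g κ d) r) (grow-false g κ r e))

  any-true : ∀ (p : ℕ → Bool) {x xs} → x ∈ xs → p x ≡ true → any p xs ≡ true
  any-true p (here refl) e rewrite e = refl
  any-true p {xs = y ∷ _} (there m) e with p y
  ... | true  = refl
  ... | false = any-true p m e

  if-true : ∀ {A : Set} {b} {x y : A} → b ≡ true → (if b then x else y) ≡ x
  if-true refl = refl

  module _ {f κ} (qf : Quasi f) (per1 : per qf ≡ + 1) (b : Beads f κ) where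

    private
      d = proj₁ (partition b)

    value : ∀ x m → f (x + m * N) ≡ f x + m
    value x m = trans (quasi-multiple qf m x) (cong (_+_ (f x)) (trans (cong (m *_) per1) (ℤ.*-identityʳ m)))

    not-bead : ∀ x → + 0 ≤ f x → ∀ s → β κ s ≢ x
    not-bead x h s refl = ℤ.<⇒≱ (bead b s) h

    -- Period 1 allows a translate of `⌜ g ⌝` to be chosen whose value is exactly - 1. The ascent
    -- makes the next value nonnegative, so a bead faces a free place.
    asc-addable : ∀ g → Asc g f → Σ ℕ λ r → addableB k g κ r ≡ true
    asc-addable g up = r , addable⇐ g κ r d (trans (cong ρ (sym x≡)) ρx , λ s e → not-bead (x + + 1) fx+1 s (trans e (cong (_+ + 1) (sym x≡))))
      where
      m = - + 1 - f ⌜ g ⌝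
      x = ⌜ g ⌝ + m * N
      ρx : ρ x ≡ g
      ρx = trans (ρ-periodic ⌜ g ⌝ m) (ρ-⌜⌝ g)
      fx : f x ≡ - + 1
      fx = trans (value ⌜ g ⌝ m) (lia 1 (λ u → ⊢ u ⊕ (con (- + 1) ⊝ u) ≈ con (- + 1)) (f ⌜ g ⌝))
      fx+1 : + 0 ≤ f (x + + 1)
      fx+1 = lia 2 (λ u v → u ≺ v ⇒ u ≈ con (- + 1) ⇒ ⊢ con (+ 0) ≲ v) (f x) (f (x + + 1)) (asc-at qf x ρx up) fx
      r = proj₁ (only b x (subst (_< + 0) (sym fx) Data.Integer.-<+))
      x≡ = proj₂ (only b x (subst (_< + 0) (sym fx) Data.Integer.-<+))

    sAct-asc : ∀ g → Asc g f → sAct k g κ ≡ addAll k g κ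
    sAct-asc g up =
      let r , e = asc-addable g up
          r<rows = ℕ.≰⇒> (λ le → true≢false (trans (sym e) (addable-bounded g κ r d le)))
      in if-true (any-true (addableB k g κ) (∈-upTo⁺ r<rows) e)

    -- At an ascent, a bead at the upper place of a swapped pair forces one at the lower place.
    -- Swapping values thus moves exactly the addable beads, and nothing is removable in the residue
    -- `g`.
    beads-asc : ∀ g → Asc g f → Beads (f ∘ σ g) (sAct k g κ)
    beads-asc g up = subst (Beads (f ∘ σ g)) (sym (sAct-asc g up)) record
      { partition = proj₁ (addAll-parts g κ d) ; bead = bead′ ; only = only′ }
      where
      κ′ = addAll k g κ
      bead′ : ∀ r → f (σ g (β κ′ r)) < + 0
      bead′ r with addableB k g κ r in eq
      ... | true = subst (λ x → f x < + 0) (sym (trans (cong (σ g) (β-addAll-true g κ d r eq)) (σ-hi (proj₁ (addable⇒ g κ r d eq))))) (bead b r)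
      ... | false with place g (β κ r)
      ...   | off p q = subst (λ x → f x < + 0) (sym (trans (cong (σ g) (β-addAll-false g κ d r eq)) (σ-fix p q))) (bead b r)
      ...   | at-hi y e p = subst (λ x → f x < + 0) (sym (trans (cong (σ g) (trans (β-addAll-false g κ d r eq) e)) (σ-hi p)))
                (ℤ.<-trans (asc-at qf y p up) (subst (λ x → f x < + 0) e (bead b r)))
      ...   | at-lo p with f (β κ r + + 1) <? + 0
      ...     | yes neg = subst (λ x → f x < + 0) (sym (trans (cong (σ g) (β-addAll-false g κ d r eq)) (σ-lo p))) neg
      ...     | no ¬neg with trans (sym eq) (addable⇐ g κ r d (p , not-bead _ (ℤ.≮⇒≥ ¬neg)))
      ...       | ()
      only′ : ∀ x → f (σ g x) < + 0 → Σ ℕ λ r → x ≡ β κ′ r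
      only′ x neg with place g x
      ... | at-lo p = r , trans x≡ (sym (β-addAll-false g κ d r blocked))
        where
        fx : f x < + 0
        fx = ℤ.<-trans (asc-at qf x p up) (subst (λ y → f y < + 0) (σ-lo p) neg)
        r = proj₁ (only b x fx)
        x≡ = proj₂ (only b x fx)
        blocked : addableB k g κ r ≡ false
        blocked = not-addable g κ r d (λ (_ , free) →
          let s , e = only b (x + + 1) (subst (λ y → f y < + 0) (σ-lo p) neg)
          in free s (trans (sym e) (cong (_+ + 1) x≡)))
      ... | off p q = r , trans x≡ (sym (β-addAll-false g κ d r blocked))
        where
        fx : f x < + 0
        fx = subst (λ y → f y < + 0) (σ-fix p q) neg
        r = proj₁ (only b x fx)
        x≡ = proj₂ (only b x fx)
        blocked : addableB k g κ r ≡ false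
        blocked = not-addable g κ r d (λ (e , _) → p (trans (cong ρ x≡) e))
      ... | at-hi y refl p = by-cases (f (y + + 1) <? + 0)
        where
        fy : f y < + 0
        fy = subst (λ z → f z < + 0) (σ-hi p) neg
        s = proj₁ (only b y fy)
        y≡ = proj₂ (only b y fy)
        by-cases : Dec (f (y + + 1) < + 0) → Σ ℕ λ r → y + + 1 ≡ β κ′ r
        by-cases (no ¬neg) = s , trans (cong (_+ + 1) y≡) (sym (β-addAll-true g κ d s
          (addable⇐ g κ s d (trans (cong ρ (sym y≡)) p , λ t e → not-bead (y + + 1) (ℤ.≮⇒≥ ¬neg) t (trans e (cong (_+ + 1) (sym y≡)))))))
        by-cases (yes neg′) = t , trans x≡ (sym (β-addAll-false g κ d t blocked))
          where
          t = proj₁ (only b (y + + 1) neg′)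
          x≡ = proj₂ (only b (y + + 1) neg′)
          blocked : addableB k g κ t ≡ false
          blocked = not-addable g κ t d (λ (e , _) →
            ρ-≢ (x<x+1 y) (x+1<x+N y) (trans p (sym (trans (cong ρ x≡) e))))

  vac-beads : Beads vac []
  vac-beads = record { partition = (λ i → ℕ.z≤n) , [] ; bead = λ r → vac-neg (+ 0 - + r) (lia 1 (λ r → con (+ 0) ≲ r ⇒ ⊢ con (+ 0) ⊝ r ≲ con (+ 0)) (+ r) (+≤+ ℕ.z≤n)) ; only = only′ }
    where
    only′ : ∀ x → vac x < + 0 → Σ ℕ λ r → x ≡ + 0 - + r
    only′ (+ zero)   h = 0 , refl
    only′ (+ suc m)  h = ⊥-elim (ℤ.<⇒≱ h (vac-nonneg (+ suc m) (+<+ (ℕ.s≤s ℕ.z≤n))))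
    only′ -[1+ m ]   h = suc m , refl

  act-beads : ∀ a → Good a vac → Beads (vac ∘ π a) (act k a [])
  act-beads []      _         = vac-beads
  act-beads (g ∷ a) (ga , up) = beads-asc (quasi-π a vac-quasi) refl (act-beads a ga) g up

  beads-unique : ∀ {f f′ κ κ′} → (∀ x → f x ≡ f′ x) → Beads f κ → Beads f′ κ′ → κ ≡ κ′
  beads-unique {f} {f′} {κ} {κ′} e b b′ = part-ext (partition b) (partition b′)
    (λ r → β-part κ κ′ r (upto (suc r) r ℕ.≤-refl))
    where
    below : ∀ {f f′ κ κ′} (b : Beads f κ) (b′ : Beads f′ κ′) → (∀ x → f x ≡ f′ x) → ∀ r →
      (∀ s → s ℕ.< r → β κ s ≡ β κ′ s) → β κ r ≤ β κ′ r
    below {f} {f′} {κ} {κ′} b b′ e r ih with only b′ (β κ r) (subst (_< + 0) (e _) (bead b r))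
    ... | t , eq with t ℕ.<? r
    ...   | yes t<r = ⊥-elim (ℕ.<-irrefl (β-injective κ (proj₁ (partition b)) (trans (ih t t<r) (sym eq))) t<r)
    ...   | no ¬t<r with t ℕ.≟ r
    ...     | yes refl = ℤ.≤-reflexive eq
    ...     | no t≢r   = subst (_≤ β κ′ r) (sym eq) (ℤ.<⇒≤ (β-< κ′ (proj₁ (partition b′)) (ℕ.≤∧≢⇒< (ℕ.≮⇒≥ ¬t<r) (≢-sym t≢r))))
    upto : ∀ m r → r ℕ.< m → β κ r ≡ β κ′ r
    upto (suc m) r (ℕ.s≤s r≤m) = ℤ.≤-antisym (below b b′ e r ih) (below b′ b (sym ∘ e) r (λ s lt → sym (ih s lt)))
      where
      ih : ∀ s → s ℕ.< r → β κ s ≡ β κ′ s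
      ih s lt = upto m s (ℕ.≤-trans lt r≤m)

  -- With period 1 a value measures how far its place must be translated to stop being a bead, so
  -- the bead set contains the whole state.
  state-unique : ∀ {f f′ κ} (qf : Quasi f) (qf′ : Quasi f′) → per qf ≡ + 1 → per qf′ ≡ + 1 → Beads f κ → Beads f′ κ → ∀ x → f x ≡ f′ x
  state-unique {f} {f′} {κ} qf qf′ p p′ b b′ x = ℤ.≤-antisym (half qf qf′ p p′ b b′) (half qf′ qf p′ p b′ b)
    where
    half : ∀ {f f′} (qf : Quasi f) (qf′ : Quasi f′) → per qf ≡ + 1 → per qf′ ≡ + 1 → Beads f κ → Beads f′ κ → f x ≤ f′ x
    half {f} {f′} qf qf′ p p′ b b′ with f x ≤? f′ x
    ... | yes le = le
    ... | no ¬le = ⊥-elim (ℤ.<-irrefl refl (subst (_< + 0) zero-at (neg→neg neg)))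
      where
      -- The translate at which `f` becomes 0, where `f′`, if it were smaller, would still be
      -- negative.
      m = - f x
      neg : f′ (x + m * N) < + 0
      neg = subst (_< + 0) (sym (value qf′ p′ b′ x m)) (lia 2 (λ u v → v ≺ u ⇒ ⊢ v ⊝ u ≺ con (+ 0)) (f x) (f′ x) (ℤ.≰⇒> ¬le))
      zero-at : f (x + m * N) ≡ + 0
      zero-at = trans (value qf p b x m) (ℤ.+-inverseʳ (f x))
      neg→neg : ∀ {y} → f′ y < + 0 → f y < + 0
      neg→neg {y} h with only b′ y h
      ... | r , refl = bead b r

  -- Hook lengths and bounded partitions

  colLen-spec : ∀ κ → Decreasing κ → ∀ j r → (r ℕ.< colLen κ j → j ℕ.< part κ r) × (j ℕ.< part κ r → r ℕ.< colLen κ j)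
  colLen-spec []      d j r = (λ ()) , λ ()
  colLen-spec (x ∷ κ) d j r = by-head (suc j ℕ.≤? x) r
    where
    Spec : ℕ → Set
    Spec r = (r ℕ.< colLen (x ∷ κ) j → j ℕ.< part (x ∷ κ) r) × (j ℕ.< part (x ∷ κ) r → r ℕ.< colLen (x ∷ κ) j)
    accept : suc j ℕ.≤ x → colLen (x ∷ κ) j ≡ suc (colLen κ j)
    accept h = cong length (filter-accept (λ y → suc j ℕ.≤? y) {xs = κ} h)
    reject : ¬ (suc j ℕ.≤ x) → colLen (x ∷ κ) j ≡ 0
    reject ¬h = trans (cong length (filter-reject (λ y → suc j ℕ.≤? y) {xs = κ} ¬h)) (ℕ.n≤0⇒n≡0 (ℕ.≮⇒≥ λ lt →
      ¬h (ℕ.≤-trans (proj₁ (colLen-spec κ (d ∘ suc) j 0) lt) (d 0))))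
    by-head : Dec (suc j ℕ.≤ x) → ∀ r → Spec r
    by-head (yes h) zero    = (λ _ → h) , λ _ → subst (0 ℕ.<_) (sym (accept h)) (ℕ.s≤s ℕ.z≤n)
    by-head (yes h) (suc r) = let to , from = colLen-spec κ (d ∘ suc) j r in
      (λ lt → to (ℕ.s≤s⁻¹ (subst (suc r ℕ.<_) (accept h) lt))) , λ lt → subst (suc r ℕ.<_) (sym (accept h)) (ℕ.s≤s (from lt))
    by-head (no ¬h) r = (λ lt → ⊥-elim (ℕ.n≮0 (subst (r ℕ.<_) (reject ¬h) lt))) ,
      λ lt → ⊥-elim (¬h (ℕ.≤-trans lt (decreasing-head (x ∷ κ) d r)))

  -- The free place of the Maya diagram that belongs to column `j`. A cell is a bead lying above a
  -- free place, and its hook length is their distance (`hook-βγ`).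
  γ : List ℕ → ℕ → ℤ
  γ κ j = + suc j - + colLen κ j

  γ<β : ∀ κ → Decreasing κ → ∀ {j r} → j ℕ.< part κ r → γ κ j < β κ r
  γ<β κ d {j} {r} lt = lia 4 (λ j c p r → one ⊕ j ≲ p ⇒ r ≺ c ⇒ ⊢ one ⊕ j ⊝ c ≺ p ⊝ r) (+ j) (+ colLen κ j) (+ part κ r) (+ r)
    (+≤+ lt) (+<+ (proj₂ (colLen-spec κ d j r) lt))

  β<γ : ∀ κ → Decreasing κ → ∀ {j r} → part κ r ℕ.≤ j → β κ r < γ κ j
  β<γ κ d {j} {r} le = lia 4 (λ j c p r → p ≲ j ⇒ c ≲ r ⇒ ⊢ p ⊝ r ≺ one ⊕ j ⊝ c) (+ j) (+ colLen κ j) (+ part κ r) (+ r)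
    (+≤+ le) (+≤+ (ℕ.≮⇒≥ (λ lt → ℕ.<⇒≱ (proj₁ (colLen-spec κ d j r) lt) le)))

  hook-βγ : ∀ κ → Decreasing κ → ∀ i j → j ℕ.< part κ i → + hook κ i j ≡ β κ i - γ κ j
  hook-βγ κ d i j lt = lia 7 (λ h a b p c i j → h ≈ a ⊕ b ⊕ one ⇒ a ≈ p ⊝ (one ⊕ j) ⇒ b ≈ c ⊝ (one ⊕ i) ⇒ ⊢ h ≈ p ⊝ i ⊝ (one ⊕ j ⊝ c))
    (+ hook κ i j) (+ (part κ i ℕ.∸ suc j)) (+ (colLen κ j ℕ.∸ suc i)) (+ part κ i) (+ colLen κ j) (+ i) (+ j)
    refl (monus lt) (monus (proj₂ (colLen-spec κ d j i) lt))
    where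
    monus : ∀ {a b} → b ℕ.≤ a → + (a ℕ.∸ b) ≡ + a - + b
    monus {a} {b} le = trans (sym (ℤ.⊖-≥ le)) (sym (ℤ.m-n≡m⊖n a b))

  small : List ℕ → ℕ → ℕ
  small κ i = length (filter (λ j → hook κ i j ℕ.≤? k) (upTo (part κ i)))

  length-filter-upTo : ∀ {P : ℕ → Set} (P? : Decidable P) t m → (∀ j → j ℕ.< m → (P j → t ℕ.≤ j) × (t ℕ.≤ j → P j)) →
    length (filter P? (upTo m)) ≡ m ℕ.∸ t
  length-filter-upTo P? t zero    h = sym (ℕ.0∸n≡0 t)
  length-filter-upTo P? t (suc m) h = trans (cong (length ∘ filter P?) (sym (upTo-∷ʳ m)))
    (trans (cong length (filter-++ P? (upTo m) (m ∷ []))) (trans (length-++ (filter P? (upTo m))) (last (t ℕ.≤? m))))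
    where
    ih = length-filter-upTo P? t m (λ j lt → h j (ℕ.m≤n⇒m≤1+n lt))
    last : Dec (t ℕ.≤ m) → length (filter P? (upTo m)) ℕ.+ length (filter P? (m ∷ [])) ≡ suc m ℕ.∸ t
    last (yes le) = trans (cong₂ ℕ._+_ ih (cong length (filter-accept P? {xs = []} (proj₂ (h m ℕ.≤-refl) le))))
      (trans (ℕ.+-comm (m ℕ.∸ t) 1) (sym (ℕ.+-∸-assoc 1 le)))
    last (no ¬le) = trans (cong₂ ℕ._+_ ih (cong length (filter-reject P? {xs = []} (¬le ∘ proj₁ (h m ℕ.≤-refl)))))
      (trans (ℕ.+-identityʳ _) (trans (ℕ.m≤n⇒m∸n≡0 (ℕ.<⇒≤ (ℕ.≰⇒> ¬le))) (sym (ℕ.m≤n⇒m∸n≡0 (ℕ.≰⇒> ¬le)))))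

  module Core {f κ} (qf : Quasi f) (per1 : per qf ≡ + 1) (b : Beads f κ) where

    d : Decreasing κ
    d = proj₁ (partition b)

    bead-N : ∀ i → f (β κ i - N) < + 0
    bead-N i = ℤ.<-trans (subst (f (β κ i - N) <_) (sym eq) (x<x+1 _)) (bead b i)
      where
      eq : f (β κ i) ≡ f (β κ i - N) + + 1
      eq = trans (cong f (lia 2 (λ b N → ⊢ b ≈ b ⊝ N ⊕ N) (β κ i) N)) (trans (stepN qf (β κ i - N)) (cong (_+_ (f (β κ i - N))) per1))

    core : IsCore k κ
    core = partition b , λ i j lt e → no-gap i j lt (only b (β κ i - N) (bead-N i))
      (lia 4 (λ h b g N → h ≈ b ⊝ g ⇒ h ≈ N ⇒ ⊢ b ⊝ N ≈ g) (+ hook κ i j) (β κ i) (γ κ j) N (hook-βγ κ d i j lt) (trans (cong +_ e) (sym N≡n)))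
      where
      no-gap : ∀ i j → j ℕ.< part κ i → (Σ ℕ λ r → β κ i - N ≡ β κ r) → β κ i - N ≡ γ κ j → ⊥
      no-gap i j lt (r , e) e′ with j ℕ.<? part κ r
      ... | yes p = ℤ.<-irrefl (trans (sym e′) e) (γ<β κ d p)
      ... | no ¬p = ℤ.<-irrefl (trans (sym e) e′) (β<γ κ d (ℕ.≮⇒≥ ¬p))

    -- The beads of a core are closed under subtracting `N`; this is the row of the bead so obtained
    -- from row `i`.
    jump : ℕ → ℕ
    jump i = proj₁ (only b (β κ i - N) (bead-N i))

    β-jump : ∀ i → β κ (jump i) ≡ β κ i - N
    β-jump i = sym (proj₂ (only b (β κ i - N) (bead-N i)))

    jump> : ∀ i → i ℕ.< jump i
    jump> i = β-<⁻ κ d (subst (_< β κ i) (sym (β-jump i)) (lia 2 (λ b N → con (+ 0) ≺ N ⇒ ⊢ b ⊝ N ≺ b) (β κ i) N 0<N))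

    -- A hook is at most `k` when its free place lies above `β κ i - N`. That is the bead of row
    -- `jump i`, so these are the cells of row `i` beyond the end of that row.
    small-part : ∀ i → small κ i ≡ part κ i ℕ.∸ part κ (jump i)
    small-part i = length-filter-upTo _ (part κ (jump i)) (part κ i) λ j lt →
      (λ h → ℕ.≮⇒≥ λ p → ℤ.<-irrefl refl (lia-1 j lt h (γ<β κ d p))) ,
      λ le → ℕ.s≤s⁻¹ (ℤ.drop‿+<+ (subst (+ hook κ i j <_) N≡n (lia-2 j lt (β<γ κ d le))))
      where
      lia-1 : ∀ j → j ℕ.< part κ i → hook κ i j ℕ.≤ k → γ κ j < β κ (jump i) → N < N
      lia-1 j lt h p = lia 6 (λ h b g b′ N k → h ≈ b ⊝ g ⇒ b′ ≈ b ⊝ N ⇒ g ≺ b′ ⇒ h ≲ k ⇒ k ≈ N ⊝ one ⇒ ⊢ N ≺ N)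
        (+ hook κ i j) (β κ i) (γ κ j) (β κ (jump i)) N (+ k) (hook-βγ κ d i j lt) (β-jump i) p (+≤+ h) k≡N-1
      lia-2 : ∀ j → j ℕ.< part κ i → β κ (jump i) < γ κ j → + hook κ i j < N
      lia-2 j lt p = lia 5 (λ h b g b′ N → h ≈ b ⊝ g ⇒ b′ ≈ b ⊝ N ⇒ b′ ≺ g ⇒ ⊢ h ≺ N)
        (+ hook κ i j) (β κ i) (γ κ j) (β κ (jump i)) N (hook-βγ κ d i j lt) (β-jump i) p

    small-jump : ∀ i → + small κ i + + jump i ≡ + i + N
    small-jump i = lia 6 (λ s p q i j N → s ≈ p ⊝ q ⇒ q ⊝ j ≈ p ⊝ i ⊝ N ⇒ ⊢ s ⊕ j ≈ i ⊕ N)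
      (+ small κ i) (+ part κ i) (+ part κ (jump i)) (+ i) (+ jump i) N
      (trans (cong +_ (small-part i)) (trans (sym (ℤ.⊖-≥ le)) (sym (ℤ.m-n≡m⊖n (part κ i) (part κ (jump i)))))) (β-jump i)
      where
      le = decreasing-≤ κ d (ℕ.<⇒≤ (jump> i))

    small≤k : ∀ i → small κ i ℕ.≤ k
    small≤k i = ℤ.drop‿+≤+ (lia 5 (λ s i j N k → s ⊕ j ≈ i ⊕ N ⇒ i ≺ j ⇒ k ≈ N ⊝ one ⇒ ⊢ s ≲ k)
      (+ small κ i) (+ i) (+ jump i) N (+ k) (small-jump i) (+<+ (jump> i)) k≡N-1)

    small-decreasing : ∀ i → small κ (suc i) ℕ.≤ small κ i
    small-decreasing i = ℤ.drop‿+≤+ (lia 6 (λ s s′ i j j′ N → s ⊕ j ≈ i ⊕ N ⇒ s′ ⊕ j′ ≈ one ⊕ i ⊕ N ⇒ j ≺ j′ ⇒ ⊢ s′ ≲ s)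
      (+ small κ i) (+ small κ (suc i)) (+ i) (+ jump i) (+ jump (suc i)) N (small-jump i) (small-jump (suc i)) (+<+ jumps))
      where
      jumps : jump i ℕ.< jump (suc i)
      jumps = β-<⁻ κ d (subst₂ _<_ (sym (β-jump (suc i))) (sym (β-jump i)) (ℤ.+-monoˡ-< (- N) (β-< κ d (ℕ.n<1+n i))))

    bounded-parts : IsPartition (boundedPart k κ) × (∀ r → part (boundedPart k κ) r ≡ small κ r)
    bounded-parts = part-positives-map (small κ) (length κ)
      (λ r le → cong (λ p → length (filter (λ j → hook κ r j ℕ.≤? k) (upTo p))) (part-beyond κ r le)) small-decreasing

    k-bounded : KBounded k (boundedPart k κ)
    k-bounded = proj₁ bounded-parts , all-part (boundedPart k κ) (λ r _ → subst (ℕ._≤ k) (sym (proj₂ bounded-parts r)) (small≤k r))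

  -- The count of small hooks determines the jumps by `small-jump`, and `β κ r` is `N` more than the
  -- bead of a deeper row. Agreement spreads upwards from the rows where both partitions are empty.
  boundedPart-injective : ∀ {f f′ κ κ′} (qf : Quasi f) (qf′ : Quasi f′) → per qf ≡ + 1 → per qf′ ≡ + 1 →
    Beads f κ → Beads f′ κ′ → boundedPart k κ ≡ boundedPart k κ′ → κ ≡ κ′
  boundedPart-injective {κ = κ} {κ′} qf qf′ p p′ b b′ e =
    part-ext (partition b) (partition b′) (λ r → β-part κ κ′ r (agree (length κ ℕ.+ length κ′) r (ℕ.m≤n+m _ r)))
    where
    module C  = Core qf p b
    module C′ = Core qf′ p′ b′
    small-eq : ∀ i → small κ i ≡ small κ′ i
    small-eq i = trans (sym (proj₂ C.bounded-parts i)) (trans (cong (λ l → part l i) e) (proj₂ C′.bounded-parts i))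
    jump-eq : ∀ i → C.jump i ≡ C′.jump i
    jump-eq i = ℤ.+-injective (lia 6 (λ s s′ j j′ i N → s ⊕ j ≈ i ⊕ N ⇒ s′ ⊕ j′ ≈ i ⊕ N ⇒ s ≈ s′ ⇒ ⊢ j ≈ j′)
      (+ small κ i) (+ small κ′ i) (+ C.jump i) (+ C′.jump i) (+ i) N (C.small-jump i) (C′.small-jump i) (cong +_ (small-eq i)))
    L = length κ ℕ.+ length κ′
    agree : ∀ t r → L ℕ.≤ r ℕ.+ t → β κ r ≡ β κ′ r
    agree zero r le = cong (λ q → + q - + r) (trans (part-beyond κ r (ℕ.≤-trans (ℕ.m≤m+n _ _) le′)) (sym (part-beyond κ′ r (ℕ.≤-trans (ℕ.m≤n+m _ _) le′))))
      where le′ = subst (L ℕ.≤_) (ℕ.+-identityʳ r) le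
    agree (suc t) r le = lia 5 (λ b b′ c c′ N → c ≈ b ⊝ N ⇒ c′ ≈ b′ ⊝ N ⇒ c ≈ c′ ⇒ ⊢ b ≈ b′) (β κ r) (β κ′ r) (β κ (C.jump r)) (β κ′ (C.jump r)) N
      (C.β-jump r) (trans (cong (β κ′) (jump-eq r)) (C′.β-jump r))
      (agree t (C.jump r) (ℕ.≤-trans le (subst (ℕ._≤ C.jump r ℕ.+ t) (sym (ℕ.+-suc r t)) (ℕ.+-monoˡ-≤ t (C.jump> r)))))

  -- The Pieri rule on cores

  ∑ : {A : Set} → (A → ℤ) → List A → ℤ
  ∑ h []       = + 0
  ∑ h (x ∷ xs) = h x + ∑ h xs

  ∉⇒All≢ : ∀ {A : Set} {x : A} {xs} → x ∉ xs → All (x ≢_) xs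
  ∉⇒All≢ x∉ = All.tabulate (λ { m refl → x∉ m })

  module _ {A : Set} where

    ∑-cong : ∀ {h h′ : A → ℤ} xs → (∀ {x} → x ∈ xs → h x ≡ h′ x) → ∑ h xs ≡ ∑ h′ xs
    ∑-cong []       e = refl
    ∑-cong (x ∷ xs) e = cong₂ _+_ (e (here refl)) (∑-cong xs (e ∘ there))

    ∑-++ : ∀ (h : A → ℤ) xs ys → ∑ h (xs ++ ys) ≡ ∑ h xs + ∑ h ys
    ∑-++ h []       ys = sym (ℤ.+-identityˡ _)
    ∑-++ h (x ∷ xs) ys = trans (cong (_+_ (h x)) (∑-++ h xs ys)) (sym (ℤ.+-assoc (h x) _ _))

    ∑-map : ∀ {B : Set} (h : B → ℤ) (g : A → B) xs → ∑ h (map g xs) ≡ ∑ (h ∘ g) xs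
    ∑-map h g []       = refl
    ∑-map h g (x ∷ xs) = cong (_+_ (h (g x))) (∑-map h g xs)

    ∑-↭ : ∀ (h : A → ℤ) {xs ys} → xs ↭ ys → ∑ h xs ≡ ∑ h ys
    ∑-↭ h ↭-refl′         = refl
    ∑-↭ h (prep x p)      = cong (_+_ (h x)) (∑-↭ h p)
    ∑-↭ h (swap x y p)    = trans (cong (λ t → h x + (h y + t)) (∑-↭ h p)) (ring (h x) (h y) _)
      where
      ring : ∀ a b c → a + (b + c) ≡ b + (a + c)
      ring = solve-∀
    ∑-↭ h (↭-trans′ p q) = trans (∑-↭ h p) (∑-↭ h q)

    ∑-zero : ∀ (h : A → ℤ) xs → (∀ {x} → x ∈ xs → h x ≡ + 0) → ∑ h xs ≡ + 0
    ∑-zero h []       e = refl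
    ∑-zero h (x ∷ xs) e = cong₂ _+_ (e (here refl)) (∑-zero h xs (e ∘ there))

    ∑-filter : ∀ {P : A → Set} (P? : ∀ x → Dec (P x)) h xs → (∀ {x} → x ∈ xs → ¬ P x → h x ≡ + 0) → ∑ h (filter P? xs) ≡ ∑ h xs
    ∑-filter P? h []       e = refl
    ∑-filter P? h (x ∷ xs) e with P? x
    ... | yes _ = cong (_+_ (h x)) (∑-filter P? h xs (e ∘ there))
    ... | no ¬p = trans (∑-filter P? h xs (e ∘ there)) (sym (trans (cong (_+ ∑ h xs) (e (here refl) ¬p)) (ℤ.+-identityˡ _)))

    -- This extracts the one unknown term of a Pieri sum whose other terms are known by induction.
    ∑-isolate : ∀ {h h′ : A → ℤ} {xs} e → Unique xs → e ∈ xs → (∀ {x} → x ∈ xs → x ≢ e → h x ≡ h′ x) →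
      ∑ h xs ≡ ∑ h′ xs → h e ≡ h′ e
    ∑-isolate {h} {h′} {x ∷ xs} e (ne ∷ u) (here refl) eq total = lia 4
      (λ a b c d → a ⊕ c ≈ b ⊕ d ⇒ c ≈ d ⇒ ⊢ a ≈ b) (h x) (h′ x) (∑ h xs) (∑ h′ xs) total
      (∑-cong xs (λ m → eq (there m) (λ { refl → All.lookup ne m refl })))
    ∑-isolate {h} {h′} {x ∷ xs} e (ne ∷ u) (there m) eq total = ∑-isolate e u m (eq ∘ there) (lia 4
      (λ a b c d → a ⊕ c ≈ b ⊕ d ⇒ a ≈ b ⇒ ⊢ c ≈ d) (h x) (h′ x) (∑ h xs) (∑ h′ xs) total
      (eq (here refl) (λ { refl → All.lookup ne m refl })))

    unique-↭ : ∀ {xs ys : List A} → Unique xs → Unique ys → (∀ {x} → x ∈ xs → x ∈ ys) → (∀ {x} → x ∈ ys → x ∈ xs) → xs ↭ ys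
    unique-↭ u v to from = ∼bag⇒↭ (unique∧set⇒bag u v (mk⇔ to from))

    unique-map : ∀ {B : Set} (h : A → B) {xs} → Unique xs → (∀ {x y} → x ∈ xs → y ∈ xs → h x ≡ h y → x ≡ y) → Unique (map h xs)
    unique-map h []       inj = []
    unique-map h {x ∷ xs} (ne ∷ u) inj = ∉⇒All≢ (λ m → let y , y∈ , e = ∈-map⁻ h m in
        All.lookup ne y∈ (inj (here refl) (there y∈) e)) ∷ unique-map h u (λ p q → inj (there p) (there q))

  -- Subsets of the generators and labels of cores

  doubles : ∀ {m} → List (Subset m) → List (Subset (suc m))
  doubles = concatMap (λ s → (true ∷ᵥ s) ∷ (false ∷ᵥ s) ∷ [])

  ∈-doubles⁻ : ∀ {m b} {s : Subset m} xs → (b ∷ᵥ s) ∈ doubles xs → s ∈ xs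
  ∈-doubles⁻ (x ∷ xs) (here refl)         = here refl
  ∈-doubles⁻ (x ∷ xs) (there (here refl)) = here refl
  ∈-doubles⁻ (x ∷ xs) (there (there p))   = there (∈-doubles⁻ xs p)

  ∈-doubles⁺ : ∀ {m} b {s : Subset m} {xs} → s ∈ xs → (b ∷ᵥ s) ∈ doubles xs
  ∈-doubles⁺ true  (here refl) = here refl
  ∈-doubles⁺ false (here refl) = there (here refl)
  ∈-doubles⁺ b     (there p)   = there (there (∈-doubles⁺ b p))

  allSubsets-complete : ∀ {m} (D : Subset m) → D ∈ allSubsets m
  allSubsets-complete []ᵥ      = here refl
  allSubsets-complete (b ∷ᵥ D) = ∈-doubles⁺ b (allSubsets-complete D)

  allSubsets-unique : ∀ m → Unique (allSubsets m)
  allSubsets-unique zero    = [] ∷ []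
  allSubsets-unique (suc m) = go (allSubsets-unique m)
    where
    go : ∀ {xs : List (Subset m)} → Unique xs → Unique (doubles xs)
    go []                = []
    go {x ∷ xs} (ne ∷ u) = ((λ ()) ∷ out true) ∷ out false ∷ go u
      where
      out : ∀ b → All ((b ∷ᵥ x) ≢_) (doubles xs)
      out b = ∉⇒All≢ (λ p → All.lookup ne (∈-doubles⁻ xs p) refl)

  subsets : ℕ → List (Subset n)
  subsets i = filter (λ D → ∣ D ∣ ℕ.≟ i) (allSubsets n)

  subsets-unique : ∀ i → Unique (subsets i)
  subsets-unique i = Unique.filter⁺ (λ D → ∣ D ∣ ℕ.≟ i) (allSubsets-unique n)

  ∈-subsets⁻ : ∀ {i D} → D ∈ subsets i → ∣ D ∣ ≡ i
  ∈-subsets⁻ {i} p = proj₂ (∈-filter⁻ (λ D → ∣ D ∣ ℕ.≟ i) {xs = allSubsets n} p)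

  ∈-subsets⁺ : ∀ {i D} → ∣ D ∣ ≡ i → D ∈ subsets i
  ∈-subsets⁺ {i} {D} e = ∈-filter⁺ (λ D → ∣ D ∣ ℕ.≟ i) (allSubsets-complete D) e

  ⟦words⟧ : ∀ {A : Set} (w : A → W) xs φ f → ⟦ map (λ D → (+ 1 , w D)) xs ⟧ φ f ≡ ∑ (λ D → ev φ (w D) f) xs
  ⟦words⟧ w []       φ f = refl
  ⟦words⟧ w (x ∷ xs) φ f = cong₂ _+_ (ℤ.*-identityˡ (ev φ (w x) f)) (⟦words⟧ w xs φ f)

  opaque
    u : Subset n → W
    u = uDWord k

  opaque
    unfolding u

    ⟦hA⟧ : ∀ i φ f → ⟦ hA k i ⟧ φ f ≡ ∑ (λ D → ev φ (u D) f) (subsets i)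
    ⟦hA⟧ i = ⟦words⟧ u (subsets i)

    u-cut : ∀ D → ∣ D ∣ ℕ.≤ k → IsCut D (u D)
    u-cut = uDWord-cut

    length-u : ∀ D → ∣ D ∣ ℕ.≤ k → length (u D) ≡ ∣ D ∣
    length-u = length-uDWord

  vacπ-quasi : ∀ a → Quasi (vac ∘ π a)
  vacπ-quasi a = quasi-π a vac-quasi

  label : W → List ℕ
  label a = boundedPart k (act k a [])

  EqW-++-reverse : ∀ t → EqW k (t ++ reverse t) []
  EqW-++-reverse [] = EqW-refl
  EqW-++-reverse (g ∷ t) = EqW-trans (EqW-cons g (EqW-trans (subst (λ w → EqW k (t ++ w) ((t ++ reverse t) ++ [ g ])) (sym (unfold-reverse g t))
    (subst (λ w → EqW k w ((t ++ reverse t) ++ [ g ])) (++-assoc t (reverse t) [ g ]) EqW-refl)) (EqW-++ʳ [ g ] (EqW-++-reverse t)))) (EqW-del g [])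

  reverse⁺ : ∀ {P : G → Set} {t} → All P t → All P (reverse t)
  reverse⁺ []                  = []
  reverse⁺ {P} {g ∷ t} (p ∷ ps) = subst (All P) (sym (unfold-reverse g t)) (∷ʳ⁺ (reverse⁺ ps) p)

  minCoset : ∀ {a} → Good a vac → MinCoset k a
  minCoset {a} ga v b nz e = good-shortest vac-quasi vac-sorted b ga (λ x → sym (trans (cong vac (trans (EqW-π e x) (π-++ a v x)))
    (stab-fixes vac-quasi vac-sorted v (All.map (λ {g} → flat-vac g) nz) (π a x))))

  wordOf : ∀ {a} → Good a vac → WordOf k (label a) a
  wordOf {a} ga = (λ b e → good-shortest vac-quasi vac-sorted b ga (λ x → cong vac (EqW-π e x))) , minCoset ga ,
    act k a [] , Core.core (vacπ-quasi a) refl (act-beads a ga) , refl , refl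

  -- If the word were not good, its normal form would be a strictly shorter representative of the
  -- same coset: the tail consists of generators other than 0, and multiplying by its reverse
  -- removes it.
  minCoset-good : ∀ a → MinCoset k a → Good a vac
  minCoset-good a mc = by-strict strict
    where
    open Normal (normalise vac-quasi vac-sorted a)
    by-strict : Good a vac ⊎ length word ℕ.< length a → Good a vac
    by-strict (inj₁ g)  = g
    by-strict (inj₂ lt) = ⊥-elim (ℕ.<⇒≱ lt (mc (reverse tail) word (reverse⁺ (All.map (λ {g} → vac-flat g) stab))
      (EqW-sym (EqW-trans (EqW-++ʳ (reverse tail) eqW) (subst (λ w → EqW k w word) (sym (++-assoc word tail (reverse tail)))
        (subst (EqW k (word ++ tail ++ reverse tail)) (++-identityʳ word) (EqW-++ˡ word (EqW-++-reverse tail))))))))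

  wordOf-good : ∀ {la a} → WordOf k la a → Good a vac
  wordOf-good {a = a} (_ , mc , _) = minCoset-good a mc

  wordOf-label : ∀ {la a} → WordOf k la a → label a ≡ la
  wordOf-label (_ , _ , κ , _ , e , refl) = e

  label-bounded : ∀ {a} → Good a vac → KBounded k (label a)
  label-bounded {a} ga = Core.k-bounded (vacπ-quasi a) refl (act-beads a ga)

  label-cong : ∀ {a b} → Good a vac → Good b vac → (∀ x → vac (π a x) ≡ vac (π b x)) → label a ≡ label b
  label-cong {a} {b} ga gb e = cong (boundedPart k) (beads-unique e (act-beads a ga) (act-beads b gb))

  label-injective : ∀ {a b} → Good a vac → Good b vac → label a ≡ label b → ∀ x → vac (π a x) ≡ vac (π b x)
  label-injective {a} {b} ga gb e = state-unique (vacπ-quasi a) (vacπ-quasi b) refl refl (act-beads a ga)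
    (subst (Beads (vac ∘ π b)) (sym (boundedPart-injective (vacπ-quasi a) (vacπ-quasi b) refl refl (act-beads a ga) (act-beads b gb) e)) (act-beads b gb))

  ev-indicator : ∀ a w → Good a vac → ev (indicator (vac ∘ π a)) w vac ≡ + 1 → Good w vac × (∀ x → vac (π w x) ≡ vac (π a x))
  ev-indicator a w ga e with good? w vac
  ... | no _   = ⊥-elim (0≢1 e)
    where
    0≢1 : + 0 ≢ + 1
    0≢1 ()
  ... | yes gw with indicator-one (vacπ-quasi a) (vacπ-quasi w) refl
  ...   | inj₂ (_ , h) = gw , h
  ...   | inj₁ z with trans (sym z) e
  ...     | ()

  -- Both sides are applied to `vac` and tested with the indicator of the state reached by `a`; only
  -- a word reaching that same state gives 1.
  AEq-words : ∀ a w → Good a vac → AEq k (uA k a) ((+ 1 , w) ∷ []) → Good w vac × (∀ x → vac (π w x) ≡ vac (π a x))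
  AEq-words a w ga e = ev-indicator a w ga (trans (sym (ring (ev (indicator (vac ∘ π a)) w vac))) (trans (sym (AEq⇒⟦⟧ (uA k a) ((+ 1 , w) ∷ []) e (indicator-ext (vac ∘ π a)) vac-quasi))
    (trans (ring (ev (indicator (vac ∘ π a)) a vac)) (trans (ev-good (indicator (vac ∘ π a)) {a} ga) (indicator-refl (λ _ → refl))))))
    where
    ring : ∀ t → + 1 * t + + 0 ≡ t
    ring = solve-∀

  AEq-refl : ∀ x → AEq k x x
  AEq-refl x = ≐-elim (≐-coeff {x} {x} (λ _ → refl))

  opaque
    unfolding u

    -- The relation brings its own words for the two partitions. Words with equal labels produce
    -- equal states from `vac`, so they may be replaced by `a` and `u D ++ a`.
    pieri⇒ : ∀ {i a mu} → Good a vac → PieriRel k i (label a) mu →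
      Σ (Subset n) λ D → ∣ D ∣ ≡ i × Good (u D ++ a) vac × mu ≡ label (u D ++ a)
    pieri⇒ {i} {a} {mu} ga (D , size , am , al , wm , wl , e) = D , size , good , trans (sym (wordOf-label wm)) (label-cong {am} {u D ++ a} gm good agree)
      where
      gm : Good am vac
      gm = wordOf-good wm
      gl : Good al vac
      gl = wordOf-good wl
      eval : Good (u D ++ al) vac × (∀ x → vac (π (u D ++ al) x) ≡ vac (π am x))
      eval = AEq-words am (u D ++ al) gm e
      al≗a : ∀ x → vac (π al x) ≡ vac (π a x)
      al≗a = label-injective {al} {a} gl ga (wordOf-label wl)
      good : Good (u D ++ a) vac
      good = good-++⁻ (u D) a (good-≗ (u D) al≗a (proj₁ (good-++ (u D) al (proj₁ eval)))) ga
      agree : ∀ x → vac (π am x) ≡ vac (π (u D ++ a) x)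
      agree x = trans (sym (proj₂ eval x)) (trans (cong vac (π-++ (u D) al x)) (trans (al≗a (π (u D) x)) (sym (cong vac (π-++ (u D) a x)))))

    pieri⇐ : ∀ {i a} D → ∣ D ∣ ≡ i → Good a vac → Good (u D ++ a) vac → PieriRel k i (label a) (label (u D ++ a))
    pieri⇐ {i} {a} D size ga gd = D , size , u D ++ a , a , wordOf {u D ++ a} gd , wordOf {a} ga , AEq-refl (uA k (u D ++ a))

  reached : ℕ → W → List (Subset n)
  reached i a = filter (λ D → good? (u D) (vac ∘ π a)) (subsets i)

  ∈-reached⁻ : ∀ {i a D} → Good a vac → D ∈ reached i a → ∣ D ∣ ≡ i × Good (u D ++ a) vac
  ∈-reached⁻ {i} {a} {D} ga m = let p , q = ∈-filter⁻ (λ D → good? (u D) (vac ∘ π a)) {xs = subsets i} m in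
    ∈-subsets⁻ p , good-++⁻ (u D) a q ga

  ∈-reached⁺ : ∀ {i a D} → ∣ D ∣ ≡ i → Good (u D ++ a) vac → D ∈ reached i a
  ∈-reached⁺ {i} {a} {D} e gd = ∈-filter⁺ (λ D → good? (u D) (vac ∘ π a)) (∈-subsets⁺ e) (proj₁ (good-++ (u D) a gd))

  u-determined : ∀ {D E a} → ∣ D ∣ ℕ.≤ k → ∣ E ∣ ℕ.≤ k → Good (u D ++ a) vac → Good (u E ++ a) vac →
    (∀ x → vac (π (u D ++ a) x) ≡ vac (π (u E ++ a) x)) → D ≡ E
  u-determined {D} {E} {a} sD sE gD gE h = cut-determines D E (IsCut.outside cD) (IsCut.outside cE)
    (λ x → subst₂ (λ v w → π v x ≡ π w x) (IsCut.word≡ cD) (IsCut.word≡ cE)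
      (π-injective a (trans (sym (π-++ (u D) a x)) (trans (∼-π (matsumoto vac-quasi vac-sorted (u D ++ a) (u E ++ a) gD gE h) x) (π-++ (u E) a x)))))
    where
    cD = u-cut D sD
    cE = u-cut E sE

  module Pieri {s : List ℕ → Comb k} (ks : IsKSchur k s) {i a} (1≤i : 1 ℕ.≤ i) (i≤k : i ℕ.≤ k) (ga : Good a vac) where

    private
      rule = proj₂ (proj₂ ks) i (label a) 1≤i i≤k (label-bounded ga)
      L = proj₁ rule

    -- Neither list has repetitions: for the second, a label determines the state, the state the
    -- permutation of `u D`, and this permutation `D`. Hence equal membership suffices.
    labels-↭ : L ↭ map (λ D → label (u D ++ a)) (reached i a)
    labels-↭ = unique-↭ (proj₁ (proj₂ rule))
      (unique-map _ (Unique.filter⁺ (λ D → good? (u D) (vac ∘ π a)) (subsets-unique i)) λ p q e →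
        let sD , gD = ∈-reached⁻ ga p ; sE , gE = ∈-reached⁻ ga q in
        u-determined (ℕ.≤-trans (ℕ.≤-reflexive sD) i≤k) (ℕ.≤-trans (ℕ.≤-reflexive sE) i≤k) gD gE (label-injective {u _ ++ a} {u _ ++ a} gD gE e))
      to from
      where
      members = proj₁ (proj₂ (proj₂ rule))
      to : ∀ {mu} → mu ∈ L → mu ∈ map (λ D → label (u D ++ a)) (reached i a)
      to m = let D , size , gD , e = pieri⇒ ga (proj₂ (Equivalence.to (members _) m)) in
        subst (_∈ map (λ D → label (u D ++ a)) (reached i a)) (sym e) (∈-map⁺ (λ D → label (u D ++ a)) (∈-reached⁺ size gD))
      from : ∀ {mu} → mu ∈ map (λ D → label (u D ++ a)) (reached i a) → mu ∈ L
      from m = let D , p , e = ∈-map⁻ (λ D → label (u D ++ a)) m ; size , gD = ∈-reached⁻ ga p in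
        subst (_∈ L) (sym e) (Equivalence.from (members _) (label-bounded {u D ++ a} gD , pieri⇐ D size ga gD))

    ⟦sum⟧ : ∀ φ f xs → ⟦ sumC k (map s xs) ⟧ φ f ≡ ∑ (λ mu → ⟦ s mu ⟧ φ f) xs
    ⟦sum⟧ φ f []       = refl
    ⟦sum⟧ φ f (x ∷ xs) = trans (pair-++ _ (s x) _) (cong (_+_ (⟦ s x ⟧ φ f)) (⟦sum⟧ φ f xs))

    pieri : ∀ {φ} → Ext φ → ∀ {f} → Quasi f →
      ⟦ s (label a) ⟧ (⟦ hA k i ⟧ φ) f ≡ ∑ (λ D → ⟦ s (label (u D ++ a)) ⟧ φ f) (reached i a)
    pieri {φ} ex {f} qf = trans (sym (⟦mulC⟧ (hA k i) (s (label a)) ex f))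
      (trans (AEq⇒⟦⟧ (mulC k (hA k i) (s (label a))) (sumC k (map s L)) (proj₂ (proj₂ (proj₂ rule))) ex qf)
      (trans (⟦sum⟧ φ f L) (trans (∑-↭ (λ mu → ⟦ s mu ⟧ φ f) labels-↭) (∑-map (λ mu → ⟦ s mu ⟧ φ f) (λ D → label (u D ++ a)) (reached i a)))))

  -- The action of k-Schur functions

  inside⇒nonempty : ∀ {m} (D : Subset m) g → lookup D g ≡ true → 1 ℕ.≤ ∣ D ∣
  inside⇒nonempty (true  ∷ᵥ D) g           e = ℕ.s≤s ℕ.z≤n
  inside⇒nonempty (false ∷ᵥ D) (Fin.suc g) e = inside⇒nonempty D g e

  _⊑_ : ∀ {m} → Subset m → Subset m → Set
  D ⊑ E = ∀ g → lookup D g ≡ true → lookup E g ≡ true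

  ⊑-size : ∀ {m} (D E : Subset m) → D ⊑ E → ∣ D ∣ ℕ.≤ ∣ E ∣
  ⊑-size []ᵥ          []ᵥ          h = ℕ.z≤n
  ⊑-size (true  ∷ᵥ D) (true  ∷ᵥ E) h = ℕ.s≤s (⊑-size D E (h ∘ Fin.suc))
  ⊑-size (true  ∷ᵥ D) (false ∷ᵥ E) h = ⊥-elim (true≢false (sym (h Fin.zero refl)))
  ⊑-size (false ∷ᵥ D) (true  ∷ᵥ E) h = ℕ.m≤n⇒m≤1+n (⊑-size D E (h ∘ Fin.suc))
  ⊑-size (false ∷ᵥ D) (false ∷ᵥ E) h = ⊑-size D E (h ∘ Fin.suc)

  ⊑-equal : ∀ {m} (D E : Subset m) → D ⊑ E → ∣ D ∣ ≡ ∣ E ∣ → D ≡ E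
  ⊑-equal []ᵥ          []ᵥ          h e = refl
  ⊑-equal (true  ∷ᵥ D) (true  ∷ᵥ E) h e = cong (true ∷ᵥ_) (⊑-equal D E (h ∘ Fin.suc) (ℕ.suc-injective e))
  ⊑-equal (true  ∷ᵥ D) (false ∷ᵥ E) h e = ⊥-elim (true≢false (sym (h Fin.zero refl)))
  ⊑-equal (false ∷ᵥ D) (true  ∷ᵥ E) h e = ⊥-elim (ℕ.<-irrefl refl (ℕ.≤-trans (ℕ.≤-reflexive (sym e)) (⊑-size D E (h ∘ Fin.suc))))
  ⊑-equal (false ∷ᵥ D) (false ∷ᵥ E) h e = cong (false ∷ᵥ_) (⊑-equal D E (h ∘ Fin.suc) e)

  length-cut-≤ : ∀ D a t → length (cut D a t) ℕ.≤ t
  length-cut-≤ D a zero    = ℕ.z≤n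
  length-cut-≤ D a (suc t) with D ∋ (a + + t)
  ... | true  = ℕ.s≤s (length-cut-≤ D a t)
  ... | false = ℕ.m≤n⇒m≤1+n (length-cut-≤ D a t)

  u-∼-cut : ∀ D b → D ∋ (b - + 1) ≡ false → u D ∼ cut D b k
  u-∼-cut D b o = let c = u-cut D D≤k in
    subst (_∼ cut D b k) (sym (IsCut.word≡ c)) (cut-independent D (IsCut.outside c) o)
    where
    D≤k : ∣ D ∣ ℕ.≤ k
    D≤k = subst (ℕ._≤ k) (length-cut D b o) (length-cut-≤ D b k)

  block-extend : ∀ {D s x} → BlockStart D s x → D ∋ x ≡ true → BlockStart D s (x + + 1)
  block-extend {D} {s} {x} (block le ins e) h = block (ℤ.≤-trans le (ℤ.<⇒≤ (x<x+1 x)))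
    (λ z lo hi → below z lo hi (z ≟ x)) e
    where
    below : ∀ z → s ≤ z → z < x + + 1 → Dec (z ≡ x) → D ∋ z ≡ true
    below z lo hi (yes refl) = h
    below z lo hi (no z≢x)   = ins z lo (ℤ.≤∧≢⇒< (lia 2 (λ z x → z ≺ x ⊕ one ⇒ ⊢ z ≲ x) z x hi) z≢x)

  block-end : ∀ D {s} t y → BlockStart D s y → D ∋ (y + + t) ≡ false → Σ ℤ λ z → y ≤ z × D ∋ z ≡ false × BlockStart D s z
  block-end D t y b o with D ∋ y in eq
  ... | false = y , ℤ.≤-refl , eq , b
  block-end D zero    y b o | true = ⊥-elim (true≢false (trans (sym eq) (trans (cong (D ∋_) (sym (ℤ.+-identityʳ y))) o)))
  block-end D (suc t) y b o | true =
    let z , le , oz , bz = block-end D t (y + + 1) (block-extend b eq)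
          (trans (cong (D ∋_) (lia 2 (λ y t → ⊢ y ⊕ one ⊕ t ≈ y ⊕ (one ⊕ t)) y (+ t))) o)
    in z , ℤ.≤-trans (ℤ.<⇒≤ (x<x+1 y)) le , oz , bz

  record Top (f : State) (β : ℤ) : Set where
    constructor top
    field
      neg   : f β < + 0
      above : ∀ x → β < x → + 0 ≤ f x

  find-top : ∀ f x t → f x < + 0 → (∀ y → x + + t < y → + 0 ≤ f y) → Σ ℤ λ β → x ≤ β × Top f β
  find-top f x zero    neg ab = x , ℤ.≤-refl , top neg (λ y lt → ab y (subst (_< y) (sym (ℤ.+-identityʳ x)) lt))
  find-top f x (suc t) neg ab with f (x + + suc t) <? + 0
  ... | yes h = x + + suc t , lia 2 (λ x t → con (+ 0) ≲ t ⇒ ⊢ x ≲ x ⊕ (one ⊕ t)) x (+ t) (+≤+ ℕ.z≤n) , top h ab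
  ... | no ¬h = find-top f x t neg above
    where
    above : ∀ y → x + + t < y → + 0 ≤ f y
    above y lt with y ≟ x + + suc t
    ... | yes refl = ℤ.≮⇒≥ ¬h
    ... | no y≢    = ab y (ℤ.≤∧≢⇒< (lia 3 (λ x t y → x ⊕ t ≺ y ⇒ ⊢ x ⊕ (one ⊕ t) ≲ y) x (+ t) y lt) (≢-sym y≢))

  σ-near : ∀ g x → x - + 1 ≤ σ g x × σ g x ≤ x + + 1
  σ-near g x with place g x
  ... | at-lo p        = subst (λ y → x - + 1 ≤ y × y ≤ x + + 1) (sym (σ-lo p)) (lia 1 (λ x → ⊢ x ⊝ one ≲ x ⊕ one) x , ℤ.≤-refl)
  ... | at-hi y refl p = subst (λ z → y + + 1 - + 1 ≤ z × z ≤ y + + 1 + + 1) (sym (σ-hi p)) (lia 1 (λ x → ⊢ x ⊕ one ⊝ one ≲ x) y , lia 1 (λ x → ⊢ x ≲ x ⊕ one ⊕ one) y)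
  ... | off p q        = subst (λ y → x - + 1 ≤ y × y ≤ x + + 1) (sym (σ-fix p q)) (lia 1 (λ x → ⊢ x ⊝ one ≲ x) x , ℤ.<⇒≤ (x<x+1 x))

  π-near : ∀ a x → x - + length a ≤ π a x × π a x ≤ x + + length a
  π-near []      x = lia 1 (λ x → ⊢ x ⊝ con (+ 0) ≲ x) x , lia 1 (λ x → ⊢ x ≲ x ⊕ con (+ 0)) x
  π-near (g ∷ a) x =
    let l , h = π-near a (σ g x) ; l′ , h′ = σ-near g x in
    lia 4 (λ x y z m → x ⊝ one ≲ y ⇒ y ⊝ m ≲ z ⇒ ⊢ x ⊝ (one ⊕ m) ≲ z) x (σ g x) (π a (σ g x)) (+ length a) l′ l ,
    lia 4 (λ x y z m → y ≲ x ⊕ one ⇒ z ≲ y ⊕ m ⇒ ⊢ z ≲ x ⊕ (one ⊕ m)) x (σ g x) (π a (σ g x)) (+ length a) h′ h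

  beyond-length : ∀ a x → + length a < x → + 0 ≤ vac (π a x)
  beyond-length a x lt = vac-nonneg (π a x) (lia 3 (λ l x y → l ≺ x ⇒ x ⊝ l ≲ y ⇒ ⊢ con (+ 0) ≺ y) (+ length a) x (π a x) lt (proj₁ (π-near a x)))

  ≤∣∣ : ∀ i → i ≤ + Data.Integer.∣ i ∣
  ≤∣∣ (+ m)    = ℤ.≤-refl
  ≤∣∣ -[1+ m ] = Data.Integer.-≤+

  top-from : ∀ a x → vac (π a x) < + 0 → Σ ℤ λ β → x ≤ β × Top (vac ∘ π a) β
  top-from a x neg = find-top (vac ∘ π a) x Data.Integer.∣ + length a - x ∣ neg
    (λ y lt → beyond-length a y (lia 4 (λ l x d y → l ⊝ x ≲ d ⇒ x ⊕ d ≺ y ⇒ ⊢ l ≺ y) (+ length a) x (+ Data.Integer.∣ + length a - x ∣) y (≤∣∣ (+ length a - x)) lt))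

  top-exists : ∀ a → Σ ℤ λ β → Top (vac ∘ π a) β
  top-exists a = let β , _ , t = top-from a (- + length a) (vac-neg _ (ℤ.≤-trans (proj₂ (π-near a (- + length a))) (ℤ.≤-reflexive (ℤ.+-inverseˡ (+ length a))))) in β , t

  -- Removing the first row: the highest bead at β is moved back to the beginning of its window
  -- by descents at the positions of the window that carry a nonnegative value.
  module Peel (a : W) (ga : Good a vac) (β : ℤ) (t : Top (vac ∘ π a) β) where

    q : State
    q = vac ∘ π a

    q-quasi : Quasi q
    q-quasi = vacπ-quasi a

    b : ℤ
    b = β - N + + 1

    b+k : b + + k ≡ β
    b+k = lia 3 (λ β N k → k ≈ N ⊝ one ⇒ ⊢ β ⊝ N ⊕ one ⊕ k ≈ β) β N (+ k) k≡N-1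

    q≥-1 : ∀ x → b ≤ x → - + 1 ≤ q x
    q≥-1 x lo = lia 2 (λ u v → con (+ 0) ≲ v ⇒ v ≈ u ⊕ one ⇒ ⊢ con (- + 1) ≲ u) (q x) (q (x + N))
      (Top.above t (x + N) (lia 3 (λ β N x → β ⊝ N ⊕ one ≲ x ⇒ ⊢ β ≺ x ⊕ N) β N x lo)) (stepN q-quasi x)

    qβ : q β ≡ - + 1
    qβ = lia 1 (λ u → u ≺ con (+ 0) ⇒ con (- + 1) ≲ u ⇒ ⊢ u ≈ con (- + 1)) (q β) (Top.neg t)
      (q≥-1 β (lia 2 (λ β N → con (+ 2) ≲ N ⇒ ⊢ β ⊝ N ⊕ one ≲ β) β N 2≤N))

    opaque
      -- The free places less than `N` below the top bead. They correspond to the cells of the first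
      -- row with hook length at most `k`, so the size of `E` is the first part of the bounded
      -- partition.
      E : Subset n
      E = tabulate (λ g → ⌊ + 0 ≤? q (proj₁ (window b ⌜ g ⌝)) ⌋)

      E-spec : ∀ x → b ≤ x → x ≤ β → E ∋ x ≡ ⌊ + 0 ≤? q x ⌋
      E-spec x lo hi = trans (lookup∘tabulate (λ g → ⌊ + 0 ≤? q (proj₁ (window b ⌜ g ⌝)) ⌋) (ρ x)) (cong (λ y → ⌊ + 0 ≤? q y ⌋) (same-place (window b ⌜ ρ x ⌝)))
        where
        same-place : (w : Σ ℤ λ y → Σ ℤ λ m → b ≤ y × y < b + N × ⌜ ρ x ⌝ ≡ y + m * N) → proj₁ w ≡ x
        same-place (y , m , lo′ , hi′ , e) = ρ-injective-window
          (lia 5 (λ x y b N β → b ≲ y ⇒ x ≲ β ⇒ b ≈ β ⊝ N ⊕ one ⇒ ⊢ x ⊝ N ≺ y) x y b N β lo′ hi refl)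
          (lia 4 (λ x y b N → y ≺ b ⊕ N ⇒ b ≲ x ⇒ ⊢ y ≺ x ⊕ N) x y b N hi′ lo)
          (trans (sym (ρ-⌜⌝ (ρ x))) (trans (cong ρ e) (ρ-periodic y m)))

    E-nonneg : ∀ x → b ≤ x → x ≤ β → E ∋ x ≡ true → + 0 ≤ q x
    E-nonneg x lo hi e = ⌊⌋-true (+ 0 ≤? q x) (trans (sym (E-spec x lo hi)) e)

    nonneg-E : ∀ x → b ≤ x → x ≤ β → + 0 ≤ q x → E ∋ x ≡ true
    nonneg-E x lo hi h = trans (E-spec x lo hi) (⌊⌋-intro (+ 0 ≤? q x) h)

    b≤β : b ≤ β
    b≤β = lia 2 (λ β N → con (+ 2) ≲ N ⇒ ⊢ β ⊝ N ⊕ one ≲ β) β N 2≤N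

    false-of : ∀ {c} → c ≢ true → c ≡ false
    false-of {true}  h = ⊥-elim (h refl)
    false-of {false} h = refl

    b-1+N : b - + 1 + N ≡ β
    b-1+N = lia 2 (λ β N → ⊢ β ⊝ N ⊕ one ⊝ one ⊕ N ≈ β) β N

    ∋β : ∀ D → D ∋ (b - + 1) ≡ D ∋ β
    ∋β D = trans (sym (cong (lookup D) (ρ+N (b - + 1)))) (cong (D ∋_) b-1+N)

    E-outside : E ∋ (b - + 1) ≡ false
    E-outside = trans (∋β E) (false-of (λ e → ℤ.<⇒≱ (Top.neg t) (E-nonneg β b≤β ℤ.≤-refl e)))

    -- The invariant while the top bead travels down its window: its value - 1 now sits at `b + j`,
    -- the values it has passed have moved up by one place, and the letters removed are the upper
    -- part of the cut of `E`.
    record Peeled (j : ℕ) : Set where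
      field
        word rest : W
        equiv     : a ∼ word ++ rest
        cut≡      : word ++ cut E b j ≡ cut E b k
        good      : Good rest vac
        at        : vac (π rest (b + + j)) ≡ - + 1
        below     : ∀ x → b ≤ x → x < b + + j → vac (π rest x) ≡ q x
        above     : ∀ x → b + + j ≤ x → x < β → vac (π rest (x + + 1)) ≡ q x

    start : Peeled k
    start = record { word = [] ; rest = a ; equiv = ∼-refl ; cut≡ = refl ; good = ga ; at = trans (cong q b+k) qβ
      ; below = λ _ _ _ → refl ; above = λ x lo hi → ⊥-elim (ℤ.<⇒≱ hi (subst (_≤ x) b+k lo)) }

    b+suc : ∀ j → b + + suc j ≡ b + + j + + 1
    b+suc j = lia 2 (λ b j → ⊢ b ⊕ (one ⊕ j) ≈ b ⊕ j ⊕ one) b (+ j)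

    b≤ : ∀ j → b ≤ b + + j
    b≤ j = lia 2 (λ b j → con (+ 0) ≲ j ⇒ ⊢ b ≲ b ⊕ j) b (+ j) (+≤+ ℕ.z≤n)

    descend : ∀ j → suc j ℕ.≤ k → Peeled (suc j) → Peeled j
    descend j j<k p = by-case (E ∋ x) refl
      where
      open Peeled p
      x = b + + j
      x<β : x < β
      x<β = subst (x <_) b+k (ℤ.+-monoʳ-< b (+<+ j<k))
      fx : vac (π rest x) ≡ q x
      fx = below x (b≤ j) (ℤ.+-monoʳ-< b (+<+ (ℕ.n<1+n j)))
      by-case : ∀ c → E ∋ x ≡ c → Peeled j
      -- Outside `E` the value is - 1 as well, so passing this place exchanges equal values and
      -- costs no letter.
      by-case false e = record { word = word ; rest = rest ; equiv = equiv
        ; cut≡ = trans (cong (λ c → word ++ letter c (ρ x) (cut E b j)) (sym e)) cut≡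
        ; good = good ; at = trans fx qx
        ; below = λ y lo hi → below y lo (ℤ.<-trans hi (ℤ.+-monoʳ-< b (+<+ (ℕ.n<1+n j))))
        ; above = above′ }
        where
        qx : q x ≡ - + 1
        qx = lia 1 (λ u → u ≺ con (+ 0) ⇒ con (- + 1) ≲ u ⇒ ⊢ u ≈ con (- + 1)) (q x)
          (ℤ.≰⇒> (λ h → true≢false (trans (sym (nonneg-E x (b≤ j) (ℤ.<⇒≤ x<β) h)) e))) (q≥-1 x (b≤ j))
        above′ : ∀ y → x ≤ y → y < β → vac (π rest (y + + 1)) ≡ q y
        above′ y lo hi = by-place (y ≟ x)
          where
          by-place : Dec (y ≡ x) → vac (π rest (y + + 1)) ≡ q y
          by-place (yes e′) = trans (cong (λ z → vac (π rest (z + + 1))) e′)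
            (trans (cong (vac ∘ π rest) (sym (b+suc j))) (trans at (trans (sym qx) (cong q (sym e′)))))
          by-place (no y≢x) = above y (lia 3 (λ b j y → b ⊕ j ≺ y ⇒ ⊢ b ⊕ (one ⊕ j) ≲ y) b (+ j) y (ℤ.≤∧≢⇒< lo (≢-sym y≢x))) hi
      by-case true e = record { word = word ++ [ ρ x ] ; rest = r′
        ; equiv = ∼-trans equiv (subst (word ++ rest ∼_) (sym (++-assoc word [ ρ x ] r′)) (∼-++ˡ word step))
        ; cut≡ = trans (++-assoc word [ ρ x ] (cut E b j)) (trans (cong (λ c → word ++ letter c (ρ x) (cut E b j)) (sym e)) cut≡)
        ; good = proj₂ (proj₂ ex)
        ; at = trans (moved x) (trans (cong (vac ∘ π rest) (trans (σ-lo refl) (sym (b+suc j)))) at)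
        ; below = λ y lo hi → trans (moved y) (trans (cong (vac ∘ π rest) (σ-fix
            (λ h → ρ-≢ hi (near y lo) h)
            (λ h → ρ-≢ (ℤ.<-trans (lia 1 (λ y → ⊢ y ⊝ one ≺ y) y) hi) (near′ y lo) h)))
            (below y lo (ℤ.<-trans hi (ℤ.+-monoʳ-< b (+<+ (ℕ.n<1+n j))))))
        ; above = above′ }
        where
        down : Desc (ρ x) (vac ∘ π rest)
        down = desc-from (vacπ-quasi rest) x refl (subst₂ _<_ (sym (trans (cong (vac ∘ π rest) (sym (b+suc j))) at)) (sym fx)
          (lia 1 (λ u → con (+ 0) ≲ u ⇒ ⊢ con (- + 1) ≺ u) (q x) (E-nonneg x (b≤ j) (ℤ.<⇒≤ x<β) e)))
        ex : Σ W λ r′ → (rest ∼ ρ x ∷ r′) × Good r′ vac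
        ex = exchange vac-quasi vac-sorted rest (ρ x) good down
        r′ = proj₁ ex
        step : rest ∼ ρ x ∷ r′
        step = proj₁ (proj₂ ex)
        moved : ∀ y → vac (π r′ y) ≡ vac (π rest (σ (ρ x) y))
        moved y = sym (remove-head vac-quasi vac-sorted step y)
        near : ∀ y → b ≤ y → x < y + N
        near y lo = lia 5 (λ x β b N y → x ≺ β ⇒ b ≈ β ⊝ N ⊕ one ⇒ b ≲ y ⇒ ⊢ x ≺ y ⊕ N) x β b N y x<β refl lo
        near′ : ∀ y → b ≤ y → x < y - + 1 + N
        near′ y lo = lia 5 (λ x β b N y → x ≺ β ⇒ b ≈ β ⊝ N ⊕ one ⇒ b ≲ y ⇒ ⊢ x ≺ y ⊝ one ⊕ N) x β b N y x<β refl lo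
        above′ : ∀ y → x ≤ y → y < β → vac (π r′ (y + + 1)) ≡ q y
        above′ y lo hi = by-place (y ≟ x)
          where
          by-place : Dec (y ≡ x) → vac (π r′ (y + + 1)) ≡ q y
          by-place (yes e′) = trans (cong (λ z → vac (π r′ (z + + 1))) e′)
            (trans (moved (x + + 1)) (trans (cong (vac ∘ π rest) (σ-hi refl)) (trans fx (cong q (sym e′)))))
          by-place (no y≢x) = trans (moved (y + + 1)) (trans (cong (vac ∘ π rest) (σ-fix
              (λ h → ρ-≢ (ℤ.<-trans x<y (x<x+1 y)) (lia 5 (λ x β b N y → b ≲ x ⇒ b ≈ β ⊝ N ⊕ one ⇒ y ≺ β ⇒ ⊢ y ⊕ one ≺ x ⊕ N) x β b N y (b≤ j) refl hi) (sym h))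
              (λ h → ρ-≢ x<y (lia 5 (λ x β b N y → b ≲ x ⇒ b ≈ β ⊝ N ⊕ one ⇒ y ≺ β ⇒ ⊢ y ≺ x ⊕ N) x β b N y (b≤ j) refl hi) (sym (trans (cong ρ (sym (x+1-1 y))) h)))))
              (above y (lia 3 (λ b j y → b ⊕ j ≺ y ⇒ ⊢ b ⊕ (one ⊕ j) ≲ y) b (+ j) y x<y) hi))
            where
            x<y : x < y
            x<y = ℤ.≤∧≢⇒< lo (≢-sym y≢x)

    opaque
      peeled : Peeled 0
      peeled = go k ℕ.≤-refl start
        where
        go : ∀ j → j ℕ.≤ k → Peeled j → Peeled 0
        go zero    _  p = p
        go (suc j) le p = go j (ℕ.≤-trans (ℕ.n≤1+n j) le) (descend j le p)

    rest : W
    rest = Peeled.rest peeled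

    rest-good : Good rest vac
    rest-good = Peeled.good peeled

    f : State
    f = vac ∘ π rest

    f-quasi : Quasi f
    f-quasi = vacπ-quasi rest

    f-b : f b ≡ - + 1
    f-b = trans (cong f (sym (ℤ.+-identityʳ b))) (Peeled.at peeled)

    f-above : ∀ x → b ≤ x → x < β → f (x + + 1) ≡ q x
    f-above x lo = Peeled.above peeled x (subst (_≤ x) (sym (ℤ.+-identityʳ b)) lo)

    word≡ : Peeled.word peeled ≡ cut E b k
    word≡ = trans (sym (++-identityʳ _)) (Peeled.cut≡ peeled)

    equiv : a ∼ u E ++ rest
    equiv = ∼-trans (Peeled.equiv peeled) (∼-++ʳ rest (subst (_∼ u E) (sym word≡) (∼-sym (u-∼-cut E b E-outside))))

    size-E : ∣ E ∣ ≡ length (cut E b k)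
    size-E = sym (length-cut E b E-outside)

    E≤k : ∣ E ∣ ℕ.≤ k
    E≤k = subst (ℕ._≤ k) (sym size-E) (length-cut-≤ E b k)

    length-a : length a ≡ ∣ E ∣ ℕ.+ length rest
    length-a = trans (∼-length equiv) (trans (length-++ (u E)) (cong (ℕ._+ length rest) (length-u E E≤k)))

    nonempty : ∀ {g a′} → a ≡ g ∷ a′ → 1 ℕ.≤ ∣ E ∣
    nonempty {g} {a′} refl = by-window (window b ⌜ g ⌝)
      where
      down : Desc g q
      down = desc-last vac-quasi vac-sorted {g} {a′} ga
      by-window : (Σ ℤ λ y → Σ ℤ λ m → b ≤ y × y < b + N × ⌜ g ⌝ ≡ y + m * N) → 1 ℕ.≤ ∣ E ∣
      by-window (x , m , lo , hi , e) = inside⇒nonempty E (ρ x) (nonneg-E x lo x≤β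
          (lia 2 (λ u v → v ≺ u ⇒ con (- + 1) ≲ v ⇒ ⊢ con (+ 0) ≲ u) (q x) (q (x + + 1)) drop (q≥-1 (x + + 1) (ℤ.≤-trans lo (ℤ.<⇒≤ (x<x+1 x))))))
        where
        ρx : ρ x ≡ g
        ρx = trans (sym (trans (cong ρ e) (ρ-periodic x m))) (ρ-⌜⌝ g)
        drop : q (x + + 1) < q x
        drop = desc-at q-quasi x ρx down
        x≤β : x ≤ β
        x≤β = lia 4 (λ x b N β → x ≺ b ⊕ N ⇒ b ≈ β ⊝ N ⊕ one ⇒ ⊢ x ≲ β) x b N β hi refl

    -- Any other D of the same size that acts on the remaining state raises the highest bead.
    module Other (D : Subset n) (size : ∣ D ∣ ≡ ∣ E ∣) (gd : Good (u D ++ rest) vac) where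

      private
        isc = u-cut D (ℕ.≤-trans (ℕ.≤-reflexive size) E≤k)
        c = IsCut.at isc
        o = IsCut.outside isc

      cut-good : Good (cut D c k) f
      cut-good = subst (λ w → Good w f) (IsCut.word≡ isc) (proj₁ (good-++ (u D) rest gd))

      state : ∀ x → vac (π (u D ++ rest) x) ≡ f (π (cut D c k) x)
      state x = trans (cong vac (π-++ (u D) rest x)) (cong (λ w → f (π w x)) (IsCut.word≡ isc))

      block-below : ∀ x → D ∋ x ≡ true → Σ ℤ λ s → BlockStart D s x × f s < f (x + + 1)
      block-below x e = let s , bs = Cut.blockStart D c o x in s , bs , Cut.good⇒below D c o f-quasi cut-good x s e bs

      -- No block of `D` crosses the bottom of the window, so each starts at a value of at least -
      -- 1. Goodness then makes `q` nonnegative at every member, which gives `D ⊑ E`, and the sizes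
      -- agree.
      equal : D ∋ β ≡ false → D ≡ E
      equal o′ = ⊑-equal D E sub size
        where
        at-x : ∀ x → b ≤ x → x < β → D ∋ x ≡ true → E ∋ x ≡ true
        at-x x lo hi e = nonneg-E x lo (ℤ.<⇒≤ hi) (lia 3 (λ u v w → u ≺ v ⇒ v ≈ w ⇒ con (- + 1) ≲ u ⇒ ⊢ con (+ 0) ≲ w)
            (f s) (f (x + + 1)) (q x) (proj₂ (proj₂ sb)) (f-above x lo hi) (f≥-1 (s ≟ b)))
          where
          sb = block-below x e
          s = proj₁ sb
          bs : BlockStart D s x
          bs = proj₁ (proj₂ sb)
          b≤s : b ≤ s
          b≤s = ℤ.≮⇒≥ (λ lt → true≢false (trans (sym (BlockStart.inside bs (b - + 1)
            (lia 2 (λ s b → s ≺ b ⇒ ⊢ s ≲ b ⊝ one) s b lt) (lia 2 (λ b x → b ≲ x ⇒ ⊢ b ⊝ one ≺ x) b x lo))) (trans (∋β D) o′)))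
          f≥-1 : Dec (s ≡ b) → - + 1 ≤ f s
          f≥-1 (yes s≡b) = ℤ.≤-reflexive (sym (trans (cong f s≡b) f-b))
          f≥-1 (no s≢b)  = subst (- + 1 ≤_) (trans (sym (f-above (s - + 1) b≤s-1 s-1<β)) (cong f (x-1+1 s))) (q≥-1 (s - + 1) b≤s-1)
            where
            b≤s-1 : b ≤ s - + 1
            b≤s-1 = lia 2 (λ b s → b ≺ s ⇒ ⊢ b ≲ s ⊝ one) b s (ℤ.≤∧≢⇒< b≤s (≢-sym s≢b))
            s-1<β : s - + 1 < β
            s-1<β = lia 3 (λ s x β → s ≲ x ⇒ x ≺ β ⇒ ⊢ s ⊝ one ≺ β) s x β (BlockStart.s≤x bs) hi
        sub : D ⊑ E
        sub g e = by-window (window b ⌜ g ⌝)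
          where
          by-window : (Σ ℤ λ y → Σ ℤ λ m → b ≤ y × y < b + N × ⌜ g ⌝ ≡ y + m * N) → lookup E g ≡ true
          by-window (x , m , lo , hi , e′) = trans (cong (lookup E) (sym ρx)) (at-x x lo x<β (trans (cong (lookup D) ρx) e))
            where
            ρx : ρ x ≡ g
            ρx = trans (sym (trans (cong ρ e′) (ρ-periodic x m))) (ρ-⌜⌝ g)
            x<β : x < β
            x<β = ℤ.≤∧≢⇒< (lia 4 (λ x b N β → x ≺ b ⊕ N ⇒ b ≈ β ⊝ N ⊕ one ⇒ ⊢ x ≲ β) x b N β hi refl)
              (λ x≡β → true≢false (trans (sym (trans (cong (lookup D) (trans (cong ρ (sym x≡β)) ρx)) e)) o′))

      -- The place after `β` has value 0 in the peeled state, so the block through `β` starts at a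
      -- negative value. `u D` carries that value to the end of the block, beyond `β`.
      raised : D ∋ β ≡ true → Σ ℤ λ β′ → β < β′ × Top (vac ∘ π (u D ++ rest)) β′
      raised e = let β′ , le , t′ = top-from (u D ++ rest) y neg in β′ , ℤ.<-≤-trans (ℤ.<-≤-trans (x<x+1 β) β<y) le , t′
        where
        sb = block-below β e
        s = proj₁ sb
        f-next : f (β + + 1) ≡ + 0
        f-next = trans (cong f (lia 2 (λ β N → ⊢ β ⊕ one ≈ β ⊝ N ⊕ one ⊕ N) β N)) (trans (stepN f-quasi b) (cong (_+ + 1) f-b))
        outside-later : Σ ℕ λ t → D ∋ (β + + 1 + + t) ≡ false
        outside-later = by-window (window (β + + 1) (c - + 1))
          where
          by-window : (Σ ℤ λ y → Σ ℤ λ m → β + + 1 ≤ y × y < β + + 1 + N × c - + 1 ≡ y + m * N) → Σ ℕ λ t → D ∋ (β + + 1 + + t) ≡ false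
          by-window (y , m , lo , hi , e′) = Data.Integer.∣ y - (β + + 1) ∣ ,
            trans (cong (D ∋_) (lia 3 (λ y β d → d ≈ y ⊝ (β ⊕ one) ⇒ ⊢ β ⊕ one ⊕ d ≈ y) y β (+ Data.Integer.∣ y - (β + + 1) ∣)
              (ℤ.0≤i⇒+∣i∣≡i (lia 2 (λ y β → β ⊕ one ≲ y ⇒ ⊢ con (+ 0) ≲ y ⊝ (β ⊕ one)) y β lo))))
              (trans (sym (trans (cong (D ∋_) e′) (∋-+N D y m))) o)
        end = block-end D (proj₁ outside-later) (β + + 1) (block-extend (proj₁ (proj₂ sb)) e) (proj₂ outside-later)
        y = proj₁ end
        β<y : β + + 1 ≤ y
        β<y = proj₁ (proj₂ end)
        neg : vac (π (u D ++ rest) y) < + 0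
        neg = subst (_< + 0) (sym (trans (state y) (cong f (Cut.π-outside D c o y s (proj₁ (proj₂ (proj₂ end))) (proj₂ (proj₂ (proj₂ end)))))))
          (subst (f s <_) f-next (proj₂ (proj₂ sb)))

  module KSchur {s : List ℕ → Comb k} (ks : IsKSchur k s) where

    -- On `vac` the whole k-Schur function acts like the single word of its core. As this is stated
    -- for all extensional `φ`, it can be used with `φ` replaced by the functional of another
    -- operator.
    Claim : W → Set
    Claim a = ∀ {φ} → Ext φ → ⟦ s (label a) ⟧ φ vac ≡ φ (vac ∘ π a)

    claim-[] : Claim []
    claim-[] {φ} ex = trans (AEq⇒⟦⟧ (s []) (oneA k) (proj₁ ks) ex vac-quasi)
      (trans (ℤ.+-identityʳ _) (trans (ℤ.*-identityˡ _) refl))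

    -- The product of 𝐡_i with the k-Schur function of `rest` is evaluated at `vac` in two ways: by
    -- the claim for the shorter word `rest`, and by the Pieri rule. Every set other than `E` leads
    -- to a higher top bead, where the claim is already known, so the term of `E` is forced.
    claim-step : ∀ a → Good a vac → ∀ β → (t : Top (vac ∘ π a) β) →
      1 ℕ.≤ length a →
      (∀ r → length r ℕ.< length a → Good r vac → Claim r) →
      (∀ a′ β′ → length a′ ≡ length a → Good a′ vac → Top (vac ∘ π a′) β′ → β < β′ → Claim a′) → Claim a
    claim-step a ga β t nz shorter higher {φ} ex = begin
        ⟦ s (label a) ⟧ φ vac                   ≡⟨ cong (λ la → ⟦ s la ⟧ φ vac) (label-cong {a} {u E ++ rest} ga goodE (λ x → cong vac (∼-π equiv x))) ⟩
        ⟦ s (label (u E ++ rest)) ⟧ φ vac       ≡⟨ sym isolated ⟩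
        ev φ (u E) f                            ≡⟨ ev-good φ {u E} (proj₁ (good-++ (u E) rest goodE)) ⟩
        φ (f ∘ π (u E))                         ≡⟨ ex (λ x → sym (trans (cong vac (∼-π equiv x)) (cong vac (π-++ (u E) rest x)))) ⟩
        φ (vac ∘ π a)                           ∎
      where
      open ≡-Reasoning
      open Peel a ga β t
      i = ∣ E ∣
      1≤i : 1 ℕ.≤ i
      1≤i = by-head a refl nz
        where
        by-head : ∀ w → a ≡ w → 1 ℕ.≤ length a → 1 ℕ.≤ i
        by-head []      refl ()
        by-head (g ∷ w) e    _ = nonempty e
      goodE : Good (u E ++ rest) vac
      goodE = proj₁ (∼-good vac-quasi equiv) ga
      total : ∑ (λ D → ev φ (u D) f) (reached i rest) ≡ ∑ (λ D → ⟦ s (label (u D ++ rest)) ⟧ φ vac) (reached i rest)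
      total = trans (∑-filter (λ D → good? (u D) f) (λ D → ev φ (u D) f) (subsets i) (λ {D} _ → ev-bad φ {u D}))
        (trans (sym (⟦hA⟧ i φ f)) (trans (sym (shorter rest rest-shorter rest-good {⟦ hA k i ⟧ φ} (⟦⟧-ext (hA k i) ex)))
        (Pieri.pieri ks 1≤i E≤k rest-good ex vac-quasi)))
        where
        rest-shorter : length rest ℕ.< length a
        rest-shorter = subst (length rest ℕ.<_) (sym length-a) (ℕ.+-monoˡ-≤ (length rest) 1≤i)
      others : ∀ {D} → D ∈ reached i rest → D ≢ E → ev φ (u D) f ≡ ⟦ s (label (u D ++ rest)) ⟧ φ vac
      others {D} m D≢E = by-case (D ∋ β) refl
        where
        info = ∈-reached⁻ {i} {rest} {D} rest-good m
        size = proj₁ info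
        gd : Good (u D ++ rest) vac
        gd = proj₂ info
        by-case : ∀ c → D ∋ β ≡ c → ev φ (u D) f ≡ ⟦ s (label (u D ++ rest)) ⟧ φ vac
        by-case false e = ⊥-elim (D≢E (Other.equal D size gd e))
        by-case true  e = let β′ , lt , t′ = Other.raised D size gd e in
          trans (ev-good φ {u D} (proj₁ (good-++ (u D) rest gd)))
            (trans (ex (λ x → sym (cong vac (π-++ (u D) rest x))))
              (sym (higher (u D ++ rest) β′ same-length gd t′ lt ex)))
          where
          same-length : length (u D ++ rest) ≡ length a
          same-length = trans (length-++ (u D)) (trans (cong (ℕ._+ length rest) (trans (length-u D (ℕ.≤-trans (ℕ.≤-reflexive size) E≤k)) size)) (sym length-a))
      isolated : ev φ (u E) f ≡ ⟦ s (label (u E ++ rest)) ⟧ φ vac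
      isolated = ∑-isolate {h = λ D → ev φ (u D) f} {h′ = λ D → ⟦ s (label (u D ++ rest)) ⟧ φ vac} E
        (Unique.filter⁺ (λ D → good? (u D) f) (subsets-unique i)) (∈-reached⁺ {i} {rest} {E} refl goodE) others total

    -- Induction on the length, and for fixed length downwards on the highest bead.
    claim-at : ∀ l → (∀ r → length r ℕ.< l → Good r vac → Claim r) →
      ∀ d a β → length a ≡ l → Good a vac → Top (vac ∘ π a) β → + l < β + + d → Claim a
    -- A letter moves a place by at most one, so a word of length `l` produces no bead beyond `l`;
    -- the downward induction on the top bead stops here.
    claim-at l shorter zero    a β e ga t lt = ⊥-elim (ℤ.<⇒≱ (Top.neg t) (beyond-length a β (subst₂ _<_ (cong +_ (sym e)) (ℤ.+-identityʳ β) lt)))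
    claim-at l shorter (suc d) [] β e ga t lt = claim-[]
    claim-at l shorter (suc d) a@(_ ∷ _) β refl ga t lt = claim-step a ga β t (ℕ.s≤s ℕ.z≤n) shorter
      (λ a′ β′ e′ ga′ t′ β<β′ → claim-at l shorter d a′ β′ e′ ga′ t′
        (lia 4 (λ l β β′ d → l ≺ β ⊕ (one ⊕ d) ⇒ β ≺ β′ ⇒ ⊢ l ≺ β′ ⊕ d) (+ l) β β′ (+ d) lt β<β′))

    claim-below : ∀ l a → length a ℕ.< l → Good a vac → Claim a
    claim-below (suc l) a (ℕ.s≤s le) ga = by-length (length a ℕ.≟ l)
      where
      by-length : Dec (length a ≡ l) → Claim a
      by-length (no ne) = claim-below l a (ℕ.≤∧≢⇒< le ne) ga
      by-length (yes e) = let β , t = top-exists a in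
        claim-at l (claim-below l) (suc Data.Integer.∣ + l - β ∣) a β e ga t
          (lia 3 (λ l β d → l ⊝ β ≲ d ⇒ ⊢ l ≺ β ⊕ (one ⊕ d)) (+ l) β (+ Data.Integer.∣ + l - β ∣) (≤∣∣ (+ l - β)))

    claim : ∀ a → Good a vac → Claim a
    claim a = claim-below (suc (length a)) a ℕ.≤-refl

  -- Commutation of the generators

  cut-append : ∀ D D′ a m w → cut D′ a m ≡ cut D a m ++ w → ∀ t →
    (∀ r → r ℕ.< t → D′ ∋ (a + + (m ℕ.+ r)) ≡ D ∋ (a + + (m ℕ.+ r))) → cut D′ a (m ℕ.+ t) ≡ cut D a (m ℕ.+ t) ++ w
  cut-append D D′ a m w e zero    h = subst (λ r → cut D′ a r ≡ cut D a r ++ w) (sym (ℕ.+-identityʳ m)) e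
  cut-append D D′ a m w e (suc t) h = subst (λ r → cut D′ a r ≡ cut D a r ++ w) (sym (ℕ.+-suc m t))
    (trans (cong₂ (λ c v → letter c (ρ (a + + (m ℕ.+ t))) v) (h t ℕ.≤-refl)
        (cut-append D D′ a m w e t (λ r lt → h r (ℕ.m≤n⇒m≤1+n lt))))
      (pull (D ∋ (a + + (m ℕ.+ t)))))
    where
    pull : ∀ b {g} {v w : W} → letter b g (v ++ w) ≡ letter b g v ++ w
    pull true  = refl
    pull false = refl

  cut-full : ∀ D a m → (∀ t → t ℕ.< m → D ∋ (a + + t) ≡ true) → cut D a m ≡ run a m
  cut-full D a zero    h = refl
  cut-full D a (suc m) h = cong₂ (λ c v → letter c (ρ (a + + m)) v) (h m ℕ.≤-refl) (cut-full D a m (λ t lt → h t (ℕ.m≤n⇒m≤1+n lt)))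

  cut-empty : ∀ D a m → (∀ t → t ℕ.< m → D ∋ (a + + t) ≡ false) → cut D a m ≡ []
  cut-empty D a zero    h = refl
  cut-empty D a (suc m) h = trans (cong (λ c → letter c (ρ (a + + m)) (cut D a m)) (h m ℕ.≤-refl)) (cut-empty D a m (λ t lt → h t (ℕ.m≤n⇒m≤1+n lt)))

  cut-stays : ∀ D a m t → (∀ r → r ℕ.< t → D ∋ (a + + (m ℕ.+ r)) ≡ false) → cut D a (m ℕ.+ t) ≡ cut D a m
  cut-stays D a m zero    h = cong (cut D a) (ℕ.+-identityʳ m)
  cut-stays D a m (suc t) h = trans (cong (cut D a) (ℕ.+-suc m t))
    (trans (cong (λ c → letter c (ρ (a + + (m ℕ.+ t))) (cut D a (m ℕ.+ t))) (h t ℕ.≤-refl)) (cut-stays D a m t (λ r lt → h r (ℕ.m≤n⇒m≤1+n lt))))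

  length-cut-mono : ∀ D a m t → length (cut D a m) ℕ.≤ length (cut D a (m ℕ.+ t)) × length (cut D a (m ℕ.+ t)) ℕ.≤ length (cut D a m) ℕ.+ t
  length-cut-mono D a m zero    rewrite ℕ.+-identityʳ m = ℕ.≤-refl , ℕ.≤-reflexive (sym (ℕ.+-identityʳ _))
  length-cut-mono D a m (suc t) rewrite ℕ.+-suc m t | ℕ.+-suc (length (cut D a m)) t =
    let l , h = length-cut-mono D a m t in bounds (D ∋ (a + + (m ℕ.+ t))) l h
    where
    bounds : ∀ c {g v p q} → p ℕ.≤ length v → length v ℕ.≤ q → p ℕ.≤ length (letter c g v) × length (letter c g v) ℕ.≤ suc q
    bounds true  l h = ℕ.m≤n⇒m≤1+n l , ℕ.s≤s h
    bounds false l h = l , ℕ.m≤n⇒m≤1+n h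

  length-run : ∀ a m → length (run a m) ≡ m
  length-run a zero    = refl
  length-run a (suc m) = cong suc (length-run a m)

  run-++ : ∀ a m t → run (a + + m) t ++ run a m ≡ run a (m ℕ.+ t)
  run-++ a m zero    = cong (run a) (sym (ℕ.+-identityʳ m))
  run-++ a m (suc t) = trans (cong₂ _∷_ (cong ρ (lia 3 (λ a m t → ⊢ a ⊕ m ⊕ t ≈ a ⊕ (m ⊕ t)) a (+ m) (+ t))) (run-++ a m t)) (cong (run a) (sym (ℕ.+-suc m t)))

  interval-size : ∀ D a m → m ℕ.≤ n → (∀ t → t ℕ.< m → D ∋ (a + + t) ≡ true) → m ℕ.≤ ∣ D ∣
  interval-size D a m le h = subst₂ ℕ._≤_ (trans (cong length (cut-full D a m h)) (length-run a m))
    (trans (cong (λ t → length (cut D a t)) (ℕ.m+[n∸m]≡n le)) (length-cut-n D a)) (proj₁ (length-cut-mono D a m (n ℕ.∸ m)))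

  block-size : ∀ D {s x} a m → BlockStart D s x → D ∋ x ≡ true → s ≤ a → a + + m ≡ x + + 1 → m ℕ.≤ n → m ℕ.≤ ∣ D ∣
  block-size D {s} {x} a m bs e s≤a e′ le = interval-size D a m le λ t lt → at t lt (a + + t ≟ x)
    where
    at : ∀ t → t ℕ.< m → Dec (a + + t ≡ x) → D ∋ (a + + t) ≡ true
    at t lt (yes refl) = e
    at t lt (no ne)    = BlockStart.inside bs (a + + t) (lia 3 (λ s a t → s ≲ a ⇒ con (+ 0) ≲ t ⇒ ⊢ s ≲ a ⊕ t) s a (+ t) s≤a (+≤+ ℕ.z≤n))
      (ℤ.≤∧≢⇒< (lia 4 (λ a t m x → a ⊕ m ≈ x ⊕ one ⇒ one ⊕ t ≲ m ⇒ ⊢ a ⊕ t ≲ x) a (+ t) (+ m) x e′ (+≤+ lt)) ne)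

  in[_,_[ : ℕ → ℕ → G → Bool
  in[ i , j [ g = ⌊ i ℕ.≤? toℕ g ⌋ ∧ ⌊ toℕ g ℕ.<? j ⌋

  opaque
    interval : ℕ → ℕ → Subset n
    interval i j = tabulate in[ i , j [

    _∪[_,_[ _∖[_,_[ : Subset n → ℕ → ℕ → Subset n
    D ∪[ i , j [ = tabulate (λ g → lookup D g ∨ in[ i , j [ g)
    D ∖[ i , j [ = tabulate (λ g → lookup D g ∧ not (in[ i , j [ g))

    interval-∋ : ∀ i j x → interval i j ∋ x ≡ in[ i , j [ (ρ x)
    interval-∋ i j x = lookup∘tabulate in[ i , j [ (ρ x)

    ∪-∋ : ∀ D i j x → (D ∪[ i , j [) ∋ x ≡ D ∋ x ∨ in[ i , j [ (ρ x)
    ∪-∋ D i j x = lookup∘tabulate (λ g → lookup D g ∨ in[ i , j [ g) (ρ x)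

    ∖-∋ : ∀ D i j x → (D ∖[ i , j [) ∋ x ≡ D ∋ x ∧ not (in[ i , j [ (ρ x))
    ∖-∋ D i j x = lookup∘tabulate (λ g → lookup D g ∧ not (in[ i , j [ g)) (ρ x)

  toℕ-ρ-small : ∀ m → m ℕ.≤ k → toℕ (ρ (+ m)) ≡ m
  toℕ-ρ-small m le = trans (toℕ-ρ (+ m)) (ℕ.m<n⇒m%n≡m (ℕ.s≤s le))

  in-true : ∀ {i j m} → i ℕ.≤ m → m ℕ.< j → m ℕ.≤ k → in[ i , j [ (ρ (+ m)) ≡ true
  in-true {i} {j} {m} lo hi le rewrite toℕ-ρ-small m le = ∧-intro (⌊⌋-intro (i ℕ.≤? m) lo) (⌊⌋-intro (m ℕ.<? j) hi)

  in-false : ∀ {i j m} → m ℕ.< i ⊎ j ℕ.≤ m → m ℕ.≤ k → in[ i , j [ (ρ (+ m)) ≡ false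
  in-false {i} {j} {m} out le rewrite toℕ-ρ-small m le = in? (i ℕ.≤? m) (m ℕ.<? j) out
    where
    in? : (p : Dec (i ℕ.≤ m)) (q : Dec (m ℕ.< j)) → m ℕ.< i ⊎ j ℕ.≤ m → ⌊ p ⌋ ∧ ⌊ q ⌋ ≡ false
    in? (no _)  _        _         = refl
    in? (yes _) (no _)   _         = refl
    in? (yes p) (yes q)  (inj₁ lt) = ⊥-elim (ℕ.<⇒≱ lt p)
    in? (yes p) (yes q)  (inj₂ ge) = ⊥-elim (ℕ.<⇒≱ q ge)

  row : ℕ → W
  row j = run (+ 0) j

  k<N : + k < N
  k<N = lia 2 (λ k N → k ≈ N ⊝ one ⇒ ⊢ k ≺ N) (+ k) N k≡N-1

  ≤k⇒<N : ∀ {m} → m ℕ.≤ k → + m < N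
  ≤k⇒<N le = ℤ.≤-<-trans (+≤+ le) k<N

  row-state : ℕ → State
  row-state j = vac ∘ π (row j)

  row-quasi : ∀ j → Quasi (row-state j)
  row-quasi j = vacπ-quasi (row j)

  row-at : ∀ j → row-state j (+ j) ≡ - + 1
  row-at j = trans (cong vac (trans (cong (π (row j)) (sym (ℤ.+-identityˡ (+ j)))) (Run.run-end (+ 0) j)))
    (vac≡-1 (+ 0) (lia 1 (λ N → con (+ 0) ≺ N ⇒ ⊢ ⊖ N ≺ con (+ 0)) N 0<N) ℤ.≤-refl)

  row-zero : ∀ j x → j ℕ.≤ k → + 0 ≤ x → x < N → x ≢ + j → row-state j x ≡ + 0
  row-zero j x le lo hi ne = by-side (x <? + j)
    where
    by-side : Dec (x < + j) → row-state j x ≡ + 0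
    by-side (yes lt) = trans (cong vac (Run.run-mid (+ 0) j x (≤k⇒<N le) lo (subst (x <_) (sym (ℤ.+-identityˡ (+ j))) lt)))
      (vac≡0 (x + + 1) (lia 1 (λ x → con (+ 0) ≲ x ⇒ ⊢ con (+ 0) ≺ x ⊕ one) x lo) (lia 2 (λ x N → x ≺ N ⇒ ⊢ x ⊕ one ≲ N) x N hi))
    by-side (no ¬lt) = trans (cong vac (Run.run-out (+ 0) j x (subst (_< x) (sym (ℤ.+-identityˡ (+ j))) j<x) (subst (x <_) (sym (ℤ.+-identityˡ N)) hi)))
      (vac≡0 x (ℤ.≤-<-trans (+≤+ ℕ.z≤n) j<x) (ℤ.<⇒≤ hi))
      where
      j<x : + j < x
      j<x = ℤ.≤∧≢⇒< (ℤ.≮⇒≥ ¬lt) (≢-sym ne)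

  row-nonpos : ∀ j x → j ℕ.≤ k → + 0 ≤ x → x < N → row-state j x ≤ + 0
  row-nonpos j x le lo hi = by-place (x ≟ + j)
    where
    by-place : Dec (x ≡ + j) → row-state j x ≤ + 0
    by-place (yes e) = subst (_≤ + 0) (sym (trans (cong (row-state j) e) (row-at j))) Data.Integer.-≤+
    by-place (no ne) = ℤ.≤-reflexive (row-zero j x le lo hi ne)

  row-good : ∀ j → j ℕ.≤ k → Good (row j) vac
  row-good zero    le = tt
  row-good (suc j) le = row-good j le′ , asc-from (row-quasi j) (+ 0 + + j) refl
    (subst₂ _<_ (sym (trans (cong (row-state j) (ℤ.+-identityˡ (+ j))) (row-at j)))
      (sym (trans (cong (row-state j) (lia 1 (λ j → ⊢ con (+ 0) ⊕ j ⊕ one ≈ one ⊕ j) (+ j)))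
        (row-zero j (+ suc j) le′ (+≤+ ℕ.z≤n) (≤k⇒<N le) (λ e → ℕ.<-irrefl (sym (ℤ.+-injective e)) ℕ.≤-refl)))) Data.Integer.-<+)
    where le′ = ℕ.≤-trans (ℕ.n≤1+n j) le

  block-of : ∀ {D f} → ∣ D ∣ ℕ.≤ k → Quasi f → Good (u D) f → ∀ x → D ∋ x ≡ true → Σ ℤ λ s → BlockStart D s x × f s < f (x + + 1)
  block-of {D} {f} le qf gd x e =
    let c = u-cut D le ; s , bs = Cut.blockStart D (IsCut.at c) (IsCut.outside c) x in
    s , bs , Cut.good⇒below D (IsCut.at c) (IsCut.outside c) qf (subst (λ w → Good w f) (IsCut.word≡ c) gd) x s e bs

  not-true : ∀ {b : Bool} → ¬ (b ≡ true) → b ≡ false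
  not-true {true}  h = ⊥-elim (h refl)
  not-true {false} h = refl

  0+ : ∀ m → + 0 + + m ≡ + m
  0+ m = ℤ.+-identityˡ (+ m)

  interval-outside : ∀ j → j ℕ.≤ k → interval 0 j ∋ (+ 0 - + 1) ≡ false
  interval-outside j le = trans (interval-∋ 0 j (+ 0 - + 1)) (trans (cong in[ 0 , j [ wrap) (in-false {0} {j} {k} (inj₂ le) ℕ.≤-refl))
    where
    wrap : ρ (+ 0 - + 1) ≡ ρ (+ k)
    wrap = trans (sym (ρ+N (+ 0 - + 1))) (cong ρ (lia 2 (λ k N → k ≈ N ⊝ one ⇒ ⊢ con (+ 0) ⊝ one ⊕ N ≈ k) (+ k) N k≡N-1))

  interval-cut : ∀ j → j ℕ.≤ k → cut (interval 0 j) (+ 0) k ≡ row j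
  interval-cut j le = trans (cong (cut (interval 0 j) (+ 0)) (sym (ℕ.m+[n∸m]≡n le)))
    (trans (cut-stays (interval 0 j) (+ 0) j (k ℕ.∸ j) λ r lt → trans (cong (interval 0 j ∋_) (0+ (j ℕ.+ r)))
        (trans (interval-∋ 0 j (+ (j ℕ.+ r))) (in-false {0} {j} {j ℕ.+ r} (inj₂ (ℕ.m≤m+n j r)) (ℕ.≤-trans (ℕ.+-monoʳ-≤ j (ℕ.<⇒≤ lt)) (ℕ.≤-reflexive (ℕ.m+[n∸m]≡n le))))))
      (cut-full (interval 0 j) (+ 0) j λ t lt → trans (cong (interval 0 j ∋_) (0+ t))
        (trans (interval-∋ 0 j (+ t)) (in-true ℕ.z≤n lt (ℕ.≤-trans (ℕ.<⇒≤ lt) le)))))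

  interval-row : ∀ j → j ℕ.≤ k → u (interval 0 j) ∼ row j
  interval-row j le = subst (u (interval 0 j) ∼_) (interval-cut j le) (u-∼-cut (interval 0 j) (+ 0) (interval-outside j le))

  size-interval : ∀ j → j ℕ.≤ k → ∣ interval 0 j ∣ ≡ j
  size-interval j le = trans (sym (length-cut (interval 0 j) (+ 0) (interval-outside j le))) (trans (cong length (interval-cut j le)) (length-run (+ 0) j))

  -- On `vac` a block whose last member is some `g` in the window from 0 must start at or below 0.
  -- Hence `D` contains all of 0, ..., `g`, which forces `g` below its size `j`.
  reached-[] : ∀ j D → j ℕ.≤ k → ∣ D ∣ ≡ j → Good (u D) vac → D ≡ interval 0 j
  reached-[] j D le size gd = ⊑-equal D (interval 0 j) sub (trans size (sym (size-interval j le)))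
    where
    sub : D ⊑ interval 0 j
    sub g e = trans (cong (lookup (interval 0 j)) (sym (ρ-⌜⌝ g))) (trans (interval-∋ 0 j ⌜ g ⌝) (in-true ℕ.z≤n small-g (ℕ.s≤s⁻¹ (Fin.toℕ<n g))))
      where
      e′ : D ∋ ⌜ g ⌝ ≡ true
      e′ = trans (cong (lookup D) (ρ-⌜⌝ g)) e
      sb = block-of (ℕ.≤-trans (ℕ.≤-reflexive size) le) vac-quasi gd ⌜ g ⌝ e′
      s≤0 : proj₁ sb ≤ + 0
      s≤0 = ℤ.≮⇒≥ (λ lt → ℤ.<⇒≱ (subst (vac (proj₁ sb) <_) (vac≡0 (⌜ g ⌝ + + 1)
          (lia 1 (λ x → con (+ 0) ≲ x ⇒ ⊢ con (+ 0) ≺ x ⊕ one) ⌜ g ⌝ (0≤toℕ g)) (lia 2 (λ x N → x ≺ N ⇒ ⊢ x ⊕ one ≲ N) ⌜ g ⌝ N (toℕ<N g)))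
          (proj₂ (proj₂ sb))) (vac-nonneg (proj₁ sb) lt))
      small-g : toℕ g ℕ.< j
      small-g = subst (suc (toℕ g) ℕ.≤_) size (block-size D (+ 0) (suc (toℕ g)) (proj₁ (proj₂ sb)) e′ s≤0
        (lia 1 (λ g → ⊢ con (+ 0) ⊕ (one ⊕ g) ≈ g ⊕ one) ⌜ g ⌝) (Fin.toℕ<n g))

  -- Adding the interval [i, j) to D exchanges the roles of i and j.
  module Exchange {i j : ℕ} (1≤i : 1 ℕ.≤ i) (i<j : i ℕ.< j) (j≤k : j ℕ.≤ k) where

    m : ℕ
    m = j ℕ.∸ i

    i≤k : i ℕ.≤ k
    i≤k = ℕ.≤-trans (ℕ.<⇒≤ i<j) j≤k

    i+m : i ℕ.+ m ≡ j
    i+m = ℕ.m+[n∸m]≡n (ℕ.<⇒≤ i<j)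

    m≤k : m ℕ.≤ k
    m≤k = ℕ.≤-trans (ℕ.m∸n≤m j i) j≤k

    -- D′ = D ∪ [i, j), a disjoint union, and i − 1 ∉ D′.
    record Extends (D D′ : Subset n) : Set where
      field
        absent  : ∀ t → t ℕ.< m → D ∋ (+ i + + t) ≡ false
        present : ∀ t → t ℕ.< m → D′ ∋ (+ i + + t) ≡ true
        agree   : ∀ t → t ℕ.< k ℕ.∸ m → D′ ∋ (+ i + + (m ℕ.+ t)) ≡ D ∋ (+ i + + (m ℕ.+ t))
        outside : D ∋ (+ i - + 1) ≡ false
        outside′ : D′ ∋ (+ i - + 1) ≡ false

    module _ {D D′} (x : Extends D D′) where
      open Extends x

      cuts : cut D′ (+ i) k ≡ cut D (+ i) k ++ run (+ i) m
      cuts = subst (λ t → cut D′ (+ i) t ≡ cut D (+ i) t ++ run (+ i) m) (ℕ.m+[n∸m]≡n m≤k)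
        (cut-append D D′ (+ i) m (run (+ i) m) (trans (cut-full D′ (+ i) m present) (cong (_++ run (+ i) m) (sym (cut-empty D (+ i) m absent)))) (k ℕ.∸ m) agree)

      -- When the circle is cut just before `i`, the added interval contributes its letters at the
      -- very end of the word, and `run i m ++ row i` is `row j`.
      words : u D ++ row j ∼ u D′ ++ row i
      words = ∼-trans (∼-++ʳ (row j) (u-∼-cut D (+ i) outside))
        (∼-sym (∼-trans (∼-++ʳ (row i) (u-∼-cut D′ (+ i) outside′)) (subst (_∼ cut D (+ i) k ++ row j) (sym same-word) ∼-refl)))
        where
        same-word : cut D′ (+ i) k ++ row i ≡ cut D (+ i) k ++ row j
        same-word = trans (cong (_++ row i) cuts) (trans (++-assoc (cut D (+ i) k) (run (+ i) m) (row i))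
          (cong (cut D (+ i) k ++_) (trans (cong (λ a → run a m ++ row i) (sym (0+ i))) (trans (run-++ (+ 0) i m) (cong (run (+ 0)) i+m)))))

      sizes : ∣ D′ ∣ ≡ ∣ D ∣ ℕ.+ m
      sizes = trans (sym (length-cut D′ (+ i) outside′)) (trans (cong length cuts) (trans (length-++ (cut D (+ i) k))
        (cong₂ ℕ._+_ (length-cut D (+ i) outside) (length-run (+ i) m))))

    in-t : ∀ t → t ℕ.< m → in[ i , j [ (ρ (+ i + + t)) ≡ true
    in-t t lt = in-true (ℕ.m≤m+n i t) i+t<j (ℕ.≤-trans (ℕ.<⇒≤ i+t<j) j≤k)
      where
      i+t<j : i ℕ.+ t ℕ.< j
      i+t<j = subst (i ℕ.+ t ℕ.<_) i+m (ℕ.+-monoʳ-< i lt)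

    in-m+t : ∀ t → t ℕ.< k ℕ.∸ m → in[ i , j [ (ρ (+ i + + (m ℕ.+ t))) ≡ false
    in-m+t t lt = by-wrap (i ℕ.+ (m ℕ.+ t) ℕ.≤? k)
      where
      total = i ℕ.+ (m ℕ.+ t)
      m+t<k : m ℕ.+ t ℕ.< k
      m+t<k = subst (m ℕ.+ t ℕ.<_) (ℕ.m+[n∸m]≡n m≤k) (ℕ.+-monoʳ-< m lt)
      by-wrap : Dec (total ℕ.≤ k) → in[ i , j [ (ρ (+ i + + (m ℕ.+ t))) ≡ false
      by-wrap (yes le) = in-false (inj₂ (subst (ℕ._≤ total) i+m (ℕ.+-monoʳ-≤ i (ℕ.m≤m+n m t)))) le
      by-wrap (no ¬le) = trans (cong in[ i , j [ wrap) (in-false (inj₁ rest<i) (ℕ.≤-trans (ℕ.<⇒≤ rest<i) i≤k))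
        where
        r = total ℕ.∸ n
        total≡ : r ℕ.+ n ≡ total
        total≡ = ℕ.m∸n+n≡m (ℕ.≰⇒> ¬le)
        wrap : ρ (+ i + + (m ℕ.+ t)) ≡ ρ (+ r)
        wrap = trans (cong (λ t → ρ (+ t)) (sym total≡)) (trans (cong (λ M → ρ (+ r + M)) (sym N≡n)) (ρ+N (+ r)))
        rest<i : r ℕ.< i
        rest<i = ℕ.+-cancelʳ-< n r i (subst (ℕ._< i ℕ.+ n) (sym total≡) (ℕ.+-monoʳ-< i (ℕ.m≤n⇒m≤1+n m+t<k)))

    i-1 : ℕ
    i-1 = i ℕ.∸ 1

    i-1≡ : + i - + 1 ≡ + i-1
    i-1≡ = trans (ℤ.m-n≡m⊖n i 1) (ℤ.⊖-≥ 1≤i)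

    i-1<i : i-1 ℕ.< i
    i-1<i = ℕ.≤-reflexive (ℕ.m+[n∸m]≡n 1≤i)

    i-1≤k : i-1 ℕ.≤ k
    i-1≤k = ℕ.≤-trans (ℕ.<⇒≤ i-1<i) i≤k

    in-i-1 : in[ i , j [ (ρ (+ i - + 1)) ≡ false
    in-i-1 = trans (cong (in[ i , j [ ∘ ρ) i-1≡) (in-false (inj₁ i-1<i) i-1≤k)

    ∨-false : ∀ {b c : Bool} → c ≡ false → b ∨ c ≡ b
    ∨-false {true}  refl = refl
    ∨-false {false} refl = refl

    ∨-true : ∀ b {c : Bool} → c ≡ true → b ∨ c ≡ true
    ∨-true true  refl = refl
    ∨-true false refl = refl

    ∧-not-false : ∀ {b c : Bool} → c ≡ false → b ∧ not c ≡ b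
    ∧-not-false {true}  refl = refl
    ∧-not-false {false} refl = refl

    ∧-not-true : ∀ b {c : Bool} → c ≡ true → b ∧ not c ≡ false
    ∧-not-true true  refl = refl
    ∧-not-true false refl = refl

    -- `row-state j` vanishes on the places 0, ..., `j` - 1 and is - 1 at `j`. A member of `D`
    -- between `i` - 1 and `j` - 1 would need a block reaching down to - 1, which has more than `i`
    -- elements.
    add : ∀ {D} → ∣ D ∣ ≡ i → Good (u D) (row-state j) → Extends D (D ∪[ i , j [)
    add {D} size gd = record
      { absent = λ t lt → gap (i ℕ.+ t) (ℕ.≤-trans (ℕ.<⇒≤ i-1<i) (ℕ.m≤m+n i t)) (subst (i ℕ.+ t ℕ.<_) i+m (ℕ.+-monoʳ-< i lt))
      ; present = λ t lt → trans (∪-∋ D i j (+ i + + t)) (∨-true (D ∋ (+ i + + t)) (in-t t lt))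
      ; agree = λ t lt → trans (∪-∋ D i j (+ i + + (m ℕ.+ t))) (∨-false (in-m+t t lt))
      ; outside = out
      ; outside′ = trans (∪-∋ D i j (+ i - + 1)) (trans (∨-false in-i-1) out) }
      where
      gap : ∀ x → i-1 ℕ.≤ x → x ℕ.< j → D ∋ (+ x) ≡ false
      gap x lo hi = not-true absurd-inside
        where
        absurd-inside : ¬ (D ∋ (+ x) ≡ true)
        absurd-inside e = ℕ.<⇒≱ (ℕ.s≤s i≤x+1) (ℕ.≤-trans x+2≤ (ℕ.≤-reflexive size))
          where
          sb = block-of (ℕ.≤-trans (ℕ.≤-reflexive size) i≤k) (row-quasi j) gd (+ x) e
          s = proj₁ sb
          s≤x : s ≤ + x
          s≤x = BlockStart.s≤x (proj₁ (proj₂ sb))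
          s≤-1 : s ≤ - + 1
          s≤-1 = lia 1 (λ s → s ≺ con (+ 0) ⇒ ⊢ s ≲ con (- + 1)) s (ℤ.≰⇒> (λ 0≤s → ℤ.<⇒≱ (proj₂ (proj₂ sb))
            (subst (row-state j (+ x + + 1) ≤_) (sym (row-zero j s j≤k 0≤s (ℤ.≤-<-trans s≤x (≤k⇒<N (ℕ.≤-trans (ℕ.<⇒≤ hi) j≤k)))
                (λ e′ → ℤ.<-irrefl e′ (ℤ.≤-<-trans s≤x (+<+ hi)))))
              (row-nonpos j (+ x + + 1) j≤k (+≤+ ℕ.z≤n) (ℤ.≤-<-trans (+≤+ (subst (ℕ._≤ j) (ℕ.+-comm 1 x) hi)) (≤k⇒<N j≤k))))))
          i≤x+1 : i ℕ.≤ suc x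
          i≤x+1 = ℕ.≤-trans (ℕ.≤-reflexive (sym (ℕ.m+[n∸m]≡n 1≤i))) (ℕ.s≤s lo)
          x+2≤ : suc (suc x) ℕ.≤ ∣ D ∣
          x+2≤ = block-size D (- + 1) (suc (suc x)) (proj₁ (proj₂ sb)) e s≤-1
            (lia 1 (λ x → ⊢ con (- + 1) ⊕ (one ⊕ (one ⊕ x)) ≈ x ⊕ one) (+ x)) (ℕ.s≤s (ℕ.≤-trans hi j≤k))
      out : D ∋ (+ i - + 1) ≡ false
      out = trans (cong (D ∋_) i-1≡) (gap i-1 ℕ.≤-refl (ℕ.<-trans i-1<i i<j))

    -- Within the period starting at 0, `row-state i` vanishes except for - 1 at `i`. A block ending
    -- with `i` - 1 would have to start below the value - 1, that is at or below `i - N`, and would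
    -- contain all residues. So `i` - 1 is missing, and counting fills the interval.
    remove : ∀ {D} → ∣ D ∣ ≡ j → Good (u D) (row-state i) → Extends (D ∖[ i , j [) D
    remove {D} size gd = record
      { absent = λ t lt → trans (∖-∋ D i j (+ i + + t)) (∧-not-true (D ∋ (+ i + + t)) (in-t t lt))
      ; present = λ t lt → here-inside (i ℕ.+ t) (ℕ.m≤m+n i t) (subst (i ℕ.+ t ℕ.<_) i+m (ℕ.+-monoʳ-< i lt))
      ; agree = λ t lt → sym (trans (∖-∋ D i j (+ i + + (m ℕ.+ t))) (∧-not-false (in-m+t t lt)))
      ; outside = trans (∖-∋ D i j (+ i - + 1)) (trans (∧-not-false in-i-1) out)
      ; outside′ = out }
      where
      block-at : ∀ x → D ∋ x ≡ true → Σ ℤ λ s → BlockStart D s x × row-state i s < row-state i (x + + 1)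
      block-at = block-of {D} (ℕ.≤-trans (ℕ.≤-reflexive size) j≤k) (row-quasi i) gd
      out : D ∋ (+ i - + 1) ≡ false
      out = not-true inside
        where
        inside : ¬ (D ∋ (+ i - + 1) ≡ true)
        inside e = by-side (+ i - N <? s)
          where
          sb = block-at (+ i - + 1) e
          s = proj₁ sb
          bs : BlockStart D s (+ i - + 1)
          bs = proj₁ (proj₂ sb)
          s<-1 : row-state i s < - + 1
          s<-1 = subst (row-state i s <_) (trans (cong (row-state i) (x-1+1 (+ i))) (row-at i)) (proj₂ (proj₂ sb))
          by-sign : + i - N < s → Dec (+ 0 ≤ s) → ⊥
          by-sign lt (yes 0≤s) = ℤ.<-asym Data.Integer.-<+ (subst (_< - + 1) (row-zero i s i≤k 0≤s
            (lia 3 (λ s i N → s ≲ i ⊝ one ⇒ i ≺ N ⇒ ⊢ s ≺ N) s (+ i) N (BlockStart.s≤x bs) (≤k⇒<N i≤k))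
            (λ e′ → ℤ.<⇒≱ (lia 2 (λ s i → s ≲ i ⊝ one ⇒ ⊢ s ≺ i) s (+ i) (BlockStart.s≤x bs)) (ℤ.≤-reflexive (sym e′)))) s<-1)
          by-sign lt (no ¬0≤s) = ℤ.<-irrefl refl (subst (_< - + 1) (lia 2 (λ u v → v ≈ con (+ 0) ⇒ v ≈ u ⊕ one ⇒ ⊢ u ≈ con (- + 1)) (row-state i s) (row-state i (s + N))
            (row-zero i (s + N) i≤k (ℤ.<⇒≤ (lia 3 (λ s i N → i ⊝ N ≺ s ⇒ con (+ 0) ≲ i ⇒ ⊢ con (+ 0) ≺ s ⊕ N) s (+ i) N lt (+≤+ ℕ.z≤n)))
              (lia 2 (λ s N → s ≺ con (+ 0) ⇒ ⊢ s ⊕ N ≺ N) s N (ℤ.≰⇒> ¬0≤s))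
              (λ e′ → ℤ.<-irrefl (sym e′) (lia 3 (λ s i N → i ⊝ N ≺ s ⇒ ⊢ i ≺ s ⊕ N) s (+ i) N lt)))
            (stepN (row-quasi i) s)) s<-1)
          by-side : Dec (+ i - N < s) → ⊥
          by-side (yes lt) = by-sign lt (+ 0 ≤? s)
          by-side (no ¬lt) = ℕ.<-irrefl refl (ℕ.≤-trans (ℕ.≤-trans (block-size D (+ i - N) n bs e (ℤ.≮⇒≥ ¬lt)
            (trans (cong (λ M → + i - N + M) (sym N≡n)) (lia 2 (λ i N → ⊢ i ⊝ N ⊕ N ≈ i ⊝ one ⊕ one) (+ i) N)) ℕ.≤-refl) (ℕ.≤-reflexive size)) j≤k)
      -- A hole g in [i, j) would make D miss all of [g, k), leaving fewer than j elements.
      here-inside : ∀ g → i ℕ.≤ g → g ℕ.< j → D ∋ (+ g) ≡ true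
      here-inside g i≤g g<j = by-hole (D ∋ (+ g)) refl
        where
        g≤k : g ℕ.≤ k
        g≤k = ℕ.≤-trans (ℕ.<⇒≤ g<j) j≤k
        by-hole : ∀ c → D ∋ (+ g) ≡ c → D ∋ (+ g) ≡ true
        by-hole true  e = e
        by-hole false e = ⊥-elim (ℕ.<⇒≱ g<j (ℕ.≤-trans (ℕ.≤-reflexive (sym size)) few))
          where
          missing : ∀ x → g ℕ.≤ x → x ℕ.< k → D ∋ (+ x) ≡ false
          missing x g≤x x<k = not-true λ e′ →
            let s , bs , lt = block-at (+ x) e′
                s≤x = BlockStart.s≤x bs
                g<s = ℤ.≰⇒> (λ s≤g → true≢false (trans (sym (at-g s bs s≤g e′)) e))
            in ℤ.<-irrefl refl (subst₂ _<_
                 (row-zero i s i≤k (ℤ.≤-trans (+≤+ ℕ.z≤n) (ℤ.<⇒≤ g<s)) (ℤ.≤-<-trans s≤x (≤k⇒<N (ℕ.<⇒≤ x<k)))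
                   (λ e″ → ℤ.<⇒≱ g<s (subst (_≤ + g) (sym e″) (+≤+ i≤g))))
                 (row-zero i (+ x + + 1) i≤k (+≤+ ℕ.z≤n) (ℤ.≤-<-trans (+≤+ (subst (ℕ._≤ k) (ℕ.+-comm 1 x) x<k)) k<N)
                   (λ e″ → ℤ.<⇒≱ (ℤ.≤-<-trans (+≤+ (ℕ.≤-trans i≤g g≤x)) (x<x+1 (+ x))) (ℤ.≤-reflexive e″))) lt)
            where
            at-g : ∀ s → BlockStart D s (+ x) → s ≤ + g → D ∋ (+ x) ≡ true → D ∋ (+ g) ≡ true
            at-g s bs s≤g e′ with g ℕ.≟ x
            ... | yes refl = e′
            ... | no g≢x   = BlockStart.inside bs (+ g) s≤g (+<+ (ℕ.≤∧≢⇒< g≤x g≢x))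
          few : ∣ D ∣ ℕ.≤ g
          few = begin
            ∣ D ∣                                                  ≡⟨ sym (length-cut D (+ i) out) ⟩
            length (cut D (+ i) k)                                 ≡⟨ cong (λ t → length (cut D (+ i) t)) (sym k≡) ⟩
            length (cut D (+ i) ((g ℕ.∸ i) ℕ.+ (k ℕ.∸ g) ℕ.+ i))   ≤⟨ proj₂ (length-cut-mono D (+ i) ((g ℕ.∸ i) ℕ.+ (k ℕ.∸ g)) i) ⟩
            length (cut D (+ i) ((g ℕ.∸ i) ℕ.+ (k ℕ.∸ g))) ℕ.+ i   ≡⟨ cong (λ w → length w ℕ.+ i) (cut-stays D (+ i) (g ℕ.∸ i) (k ℕ.∸ g) holes) ⟩
            length (cut D (+ i) (g ℕ.∸ i)) ℕ.+ i                   ≤⟨ ℕ.+-monoˡ-≤ i (length-cut-≤ D (+ i) (g ℕ.∸ i)) ⟩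
            (g ℕ.∸ i) ℕ.+ i                                        ≡⟨ ℕ.m∸n+n≡m i≤g ⟩
            g                                                      ∎
            where
            open ℕ.≤-Reasoning
            k≡ : (g ℕ.∸ i) ℕ.+ (k ℕ.∸ g) ℕ.+ i ≡ k
            k≡ = trans (ℕ.+-comm ((g ℕ.∸ i) ℕ.+ (k ℕ.∸ g)) i) (trans (sym (ℕ.+-assoc i (g ℕ.∸ i) (k ℕ.∸ g)))
              (trans (cong (ℕ._+ (k ℕ.∸ g)) (ℕ.m+[n∸m]≡n i≤g)) (ℕ.m+[n∸m]≡n g≤k)))
            position-of : ∀ r → + i + + ((g ℕ.∸ i) ℕ.+ r) ≡ + (g ℕ.+ r)
            position-of r = cong +_ (trans (sym (ℕ.+-assoc i (g ℕ.∸ i) r)) (cong (ℕ._+ r) (ℕ.m+[n∸m]≡n i≤g)))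
            holes : ∀ r → r ℕ.< k ℕ.∸ g → D ∋ (+ i + + ((g ℕ.∸ i) ℕ.+ r)) ≡ false
            holes r lt = trans (cong (D ∋_) (position-of r)) (missing (g ℕ.+ r) (ℕ.m≤m+n g r) (subst (g ℕ.+ r ℕ.<_) (ℕ.m+[n∸m]≡n g≤k) (ℕ.+-monoʳ-< g lt)))

  module Commute {s : List ℕ → Comb k} (ks : IsKSchur k s) where
    open KSchur ks

    labels : ℕ → W → List (List ℕ)
    labels i a = map (λ D → label (u D ++ a)) (reached i a)

    labels-unique : ∀ {i a} → i ℕ.≤ k → Good a vac → Unique (labels i a)
    labels-unique {i} {a} i≤k ga = unique-map _ (Unique.filter⁺ (λ D → good? (u D) (vac ∘ π a)) (subsets-unique i)) λ {D} {E} p q e →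
      let sD , gD = ∈-reached⁻ {i} {a} {D} ga p ; sE , gE = ∈-reached⁻ {i} {a} {E} ga q in
      u-determined (ℕ.≤-trans (ℕ.≤-reflexive sD) i≤k) (ℕ.≤-trans (ℕ.≤-reflexive sE) i≤k) gD gE (label-injective {u D ++ a} {u E ++ a} gD gE e)

    pieri-labels : ∀ {i a} → 1 ℕ.≤ i → i ℕ.≤ k → Good a vac → ∀ {φ} → Ext φ → ∀ {f} → Quasi f →
      ⟦ s (label a) ⟧ (⟦ hA k i ⟧ φ) f ≡ ∑ (λ mu → ⟦ s mu ⟧ φ f) (labels i a)
    pieri-labels {i} {a} 1≤i i≤k ga {φ} ex {f} qf = trans (Pieri.pieri ks 1≤i i≤k ga ex qf)
      (sym (∑-map (λ mu → ⟦ s mu ⟧ φ f) (λ D → label (u D ++ a)) (reached i a)))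

    labels-[] : ∀ {j} → j ℕ.≤ k → labels j [] ↭ label (row j) ∷ []
    labels-[] {j} j≤k = unique-↭ (labels-unique {j} {[]} j≤k tt) ([] ∷ []) to from
      where
      row-label : label (u (interval 0 j) ++ []) ≡ label (row j)
      row-label = label-cong {u (interval 0 j) ++ []} {row j}
        (subst (λ w → Good w vac) (sym (++-identityʳ (u (interval 0 j)))) (proj₂ (∼-good vac-quasi (interval-row j j≤k)) (row-good j j≤k)))
        (row-good j j≤k) (λ x → cong vac (trans (cong (λ w → π w x) (++-identityʳ (u (interval 0 j)))) (∼-π (interval-row j j≤k) x)))
      to : ∀ {mu} → mu ∈ labels j [] → mu ∈ label (row j) ∷ []
      to m = let D , p , e = ∈-map⁻ (λ D → label (u D ++ [])) m
                 size , gD = ∈-reached⁻ {j} {[]} {D} tt p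
                 D≡ = reached-[] j D j≤k size (subst (λ w → Good w vac) (++-identityʳ (u D)) gD)
             in here (trans e (trans (cong (λ D → label (u D ++ [])) D≡) row-label))
      from : ∀ {mu} → mu ∈ label (row j) ∷ [] → mu ∈ labels j []
      from (here e) = subst (_∈ labels j []) (trans row-label (sym e)) (∈-map⁺ (λ D → label (u D ++ []))
        (∈-reached⁺ {j} {[]} {interval 0 j} (size-interval j j≤k)
          (subst (λ w → Good w vac) (sym (++-identityʳ (u (interval 0 j)))) (proj₂ (∼-good vac-quasi (interval-row j j≤k)) (row-good j j≤k)))))

    -- The Pieri rule at the empty partition has only one term, so each 𝐡_j is the k-Schur function
    -- of a row and can itself be fed to the Pieri rule.
    h-row : ∀ {j} → 1 ℕ.≤ j → j ℕ.≤ k → ∀ {φ} → Ext φ → ∀ {f} → Quasi f → ⟦ hA k j ⟧ φ f ≡ ⟦ s (label (row j)) ⟧ φ f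
    h-row {j} 1≤j j≤k {φ} ex {f} qf = begin
      ⟦ hA k j ⟧ φ f                        ≡⟨ sym (trans (ℤ.+-identityʳ _) (ℤ.*-identityˡ (⟦ hA k j ⟧ φ f))) ⟩
      ⟦ oneA k ⟧ (⟦ hA k j ⟧ φ) f           ≡⟨ sym (AEq⇒⟦⟧ (s []) (oneA k) (proj₁ ks) (⟦⟧-ext (hA k j) ex) qf) ⟩
      ⟦ s [] ⟧ (⟦ hA k j ⟧ φ) f             ≡⟨ pieri-labels {j} {[]} 1≤j j≤k tt ex qf ⟩
      ∑ (λ mu → ⟦ s mu ⟧ φ f) (labels j []) ≡⟨ ∑-↭ (λ mu → ⟦ s mu ⟧ φ f) (labels-[] j≤k) ⟩
      ⟦ s (label (row j)) ⟧ φ f + + 0       ≡⟨ ℤ.+-identityʳ _ ⟩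
      ⟦ s (label (row j)) ⟧ φ f             ∎
      where open ≡-Reasoning

    -- Adding and removing the interval from `i` to `j` are inverse correspondences between the two
    -- index sets, and `words` shows that they preserve the element reached, hence its label.
    labels-comm : ∀ {i j} → 1 ℕ.≤ i → i ℕ.< j → j ℕ.≤ k → labels i (row j) ↭ labels j (row i)
    labels-comm {i} {j} 1≤i i<j j≤k = unique-↭ (labels-unique {i} {row j} i≤k gj) (labels-unique {j} {row i} j≤k gi) to from
      where
      open Exchange 1≤i i<j j≤k
      gi = row-good i i≤k
      gj = row-good j j≤k
      to : ∀ {mu} → mu ∈ labels i (row j) → mu ∈ labels j (row i)
      to p = let D , q , e = ∈-map⁻ (λ D → label (u D ++ row j)) p
                 size , gD = ∈-reached⁻ {i} {row j} {D} gj q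
                 x = add {D} size (proj₁ (good-++ (u D) (row j) gD))
                 D′ = D ∪[ i , j [
                 gD′ = proj₁ (∼-good vac-quasi (words x)) gD
             in subst (_∈ labels j (row i)) (trans (label-cong {u D′ ++ row i} {u D ++ row j} gD′ gD (λ y → cong vac (sym (∼-π (words x) y)))) (sym e))
                  (∈-map⁺ (λ D → label (u D ++ row i)) (∈-reached⁺ {j} {row i} {D′} (trans (sizes x) (trans (cong (ℕ._+ m) size) i+m)) gD′))
      from : ∀ {mu} → mu ∈ labels j (row i) → mu ∈ labels i (row j)
      from p = let D′ , q , e = ∈-map⁻ (λ D → label (u D ++ row i)) p
                   size , gD′ = ∈-reached⁻ {j} {row i} {D′} gi q
                   x = remove {D′} size (proj₁ (good-++ (u D′) (row i) gD′))
                   D = D′ ∖[ i , j [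
                   gD = proj₂ (∼-good vac-quasi (words x)) gD′
               in subst (_∈ labels i (row j)) (trans (label-cong {u D ++ row j} {u D′ ++ row i} gD gD′ (λ y → cong vac (∼-π (words x) y))) (sym e))
                    (∈-map⁺ (λ D → label (u D ++ row j)) (∈-reached⁺ {i} {row j} {D}
                      (ℕ.+-cancelʳ-≡ m ∣ D ∣ i (trans (sym (sizes x)) (trans size (sym i+m)))) gD))

    h-h : ∀ {i j} → 1 ℕ.≤ i → i ℕ.≤ k → 1 ℕ.≤ j → j ℕ.≤ k → ∀ {φ} → Ext φ → ∀ {f} → Quasi f →
      ⟦ hA k j ⟧ (⟦ hA k i ⟧ φ) f ≡ ∑ (λ mu → ⟦ s mu ⟧ φ f) (labels i (row j))
    h-h {i} {j} 1≤i i≤k 1≤j j≤k ex qf = trans (h-row 1≤j j≤k (⟦⟧-ext (hA k i) ex) qf) (pieri-labels {i} {row j} 1≤i i≤k (row-good j j≤k) ex qf)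

    h-comm-< : ∀ {i j} → 1 ℕ.≤ i → i ℕ.< j → j ℕ.≤ k → ∀ {φ} → Ext φ → ∀ {f} → Quasi f →
      ⟦ hA k j ⟧ (⟦ hA k i ⟧ φ) f ≡ ⟦ hA k i ⟧ (⟦ hA k j ⟧ φ) f
    h-comm-< {i} {j} 1≤i i<j j≤k {φ} ex {f} qf = trans (h-h 1≤i i≤k 1≤j j≤k ex qf)
      (trans (∑-↭ (λ mu → ⟦ s mu ⟧ φ f) (labels-comm 1≤i i<j j≤k)) (sym (h-h 1≤j j≤k 1≤i i≤k ex qf)))
      where
      1≤j = ℕ.≤-trans 1≤i (ℕ.<⇒≤ i<j)
      i≤k = ℕ.≤-trans (ℕ.<⇒≤ i<j) j≤k

    h-comm : ∀ {i j} → 1 ℕ.≤ i → i ℕ.≤ k → 1 ℕ.≤ j → j ℕ.≤ k → ∀ {φ} → Ext φ → ∀ {f} → Quasi f →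
      ⟦ hA k j ⟧ (⟦ hA k i ⟧ φ) f ≡ ⟦ hA k i ⟧ (⟦ hA k j ⟧ φ) f
    h-comm {i} {j} 1≤i i≤k 1≤j j≤k ex qf with ℕ.<-cmp i j
    ... | tri< lt _ _   = h-comm-< 1≤i lt j≤k ex qf
    ... | tri≈ _ refl _ = refl
    ... | tri> _ _ lt   = sym (h-comm-< 1≤j lt i≤k ex qf)

module RectangularShape (k : ℕ) (1≤k : 1 ℕ.≤ k) (c r : ℕ) (1≤c : 1 ℕ.≤ c) (1≤r : 1 ℕ.≤ r) (c+r≡n : c ℕ.+ r ≡ suc k) where

  open LinearArithmetic
  open AffineSymmetricGroup k 1≤k
  open import Data.Integer using (ℤ; +_; -[1+_]; _+_; _*_; -_; _-_; _≤_; _<_; _%ℕ_; _/ℕ_; +≤+; +<+; _<?_; _≤?_; _≟_; nonNegative)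

  open Quasi

  -- Skew words

  N≡c+r : N ≡ + c + + r
  N≡c+r = trans N≡n (cong +_ (sym c+r≡n))

  0<c : + 0 < + c
  0<c = +<+ 1≤c

  0<r : + 0 < + r
  0<r = +<+ 1≤r

  record InBox (m l : ℕ) (ν : List ℕ) : Set where
    field
      decreasing : Decreasing ν
      positive   : All (1 ℕ.≤_) ν
      width      : part ν 0 ℕ.≤ m
      height     : length ν ℕ.≤ l

  open InBox

  part-++-left : ∀ l l′ i → i ℕ.< length l → part (l ++ l′) i ≡ part l i
  part-++-left (x ∷ l) l′ zero    _          = refl
  part-++-left (x ∷ l) l′ (suc i) (ℕ.s≤s lt) = part-++-left l l′ i lt

  part-++-right : ∀ l l′ i → part (l ++ l′) (length l ℕ.+ i) ≡ part l′ i
  part-++-right []      l′ i = refl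
  part-++-right (x ∷ l) l′ i = part-++-right l l′ i

  part-replicate : ∀ m x i → i ℕ.< m → part (replicate m x) i ≡ x
  part-replicate (suc m) x zero    _          = refl
  part-replicate (suc m) x (suc i) (ℕ.s≤s lt) = part-replicate m x i lt

  -- Each row of (R, ν)/ν contributes a run of consecutive generators.
  module Track (ν : List ℕ) (box : InBox c r ν) where

    lam : List ℕ
    lam = RNu c r ν

    lam-top : ∀ i → i ℕ.< r → part lam i ≡ c
    lam-top i lt = trans (part-++-left (replicate r c) ν i (subst (i ℕ.<_) (sym (length-replicate r)) lt)) (part-replicate r c i lt)

    lam-bottom : ∀ i → part lam (r ℕ.+ i) ≡ part ν i
    lam-bottom i = subst (λ l → part lam (l ℕ.+ i) ≡ part ν i) (length-replicate r) (part-++-right (replicate r c) ν i)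

    ν-beyond : ∀ i → r ℕ.≤ i → part ν i ≡ 0
    ν-beyond i le = part-beyond ν i (ℕ.≤-trans (height box) le)

    ν≤c : ∀ i → part ν i ℕ.≤ c
    ν≤c i = ℕ.≤-trans (decreasing-head ν (decreasing box) i) (width box)

    rowLetters : ℕ → W
    rowLetters i = map (λ t → content k i (part lam i ℕ.∸ suc t)) (upTo (part lam i ℕ.∸ part ν i))

    rows : ℕ → W
    rows m = concatMap rowLetters (downFrom m)

    rowLetters-run : ∀ i a m → + part ν i - + i ≡ a → part lam i ≡ part ν i ℕ.+ m → rowLetters i ≡ run a m
    rowLetters-run i _ m refl e = trans (map-upTo _ (part lam i ℕ.∸ part ν i))
      (trans (cong (applyUpTo (λ t → content k i (part lam i ℕ.∸ suc t))) (trans (cong (ℕ._∸ part ν i) e) (ℕ.m+n∸m≡n (part ν i) m)))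
        (letters m (λ t → content k i (part lam i ℕ.∸ suc t)) (λ t lt → trans (content-ρ i (part lam i ℕ.∸ suc t)) (cong ρ (position-of t lt)))))
      where
      letters : ∀ m h → (∀ t → t ℕ.< m → h t ≡ ρ (β ν i + + (m ℕ.∸ suc t))) → applyUpTo h m ≡ run (β ν i) m
      letters zero    h e = refl
      letters (suc m) h e = cong₂ _∷_ (e 0 (ℕ.s≤s ℕ.z≤n)) (letters m (h ∘ suc) (λ t lt → e (suc t) (ℕ.s≤s lt)))
      position-of : ∀ t → t ℕ.< m → + (part lam i ℕ.∸ suc t) - + i ≡ β ν i + + (m ℕ.∸ suc t)
      position-of t lt = trans (cong (λ p → + p - + i) (trans (cong (ℕ._∸ suc t) e) (ℕ.+-∸-assoc (part ν i) lt)))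
        (lia 3 (λ p q i → ⊢ p ⊕ q ⊝ i ≈ p ⊝ i ⊕ q) (+ part ν i) (+ (m ℕ.∸ suc t)) (+ i))

    rows-empty : ∀ i → length lam ℕ.≤ i → rowLetters i ≡ []
    rows-empty i le = cong (λ p → map (λ t → content k i (part lam i ℕ.∸ suc t)) (upTo p))
      (trans (cong (ℕ._∸ part ν i) (part-beyond lam i le)) (ℕ.0∸n≡0 (part ν i)))

    rows-stable : ∀ m → rows (length lam ℕ.+ m) ≡ rows (length lam)
    rows-stable zero    = cong rows (ℕ.+-identityʳ (length lam))
    rows-stable (suc m) = trans (cong rows (ℕ.+-suc (length lam) m))
      (trans (cong (_++ rows (length lam ℕ.+ m)) (rows-empty (length lam ℕ.+ m) (ℕ.m≤m+n (length lam) m))) (rows-stable m))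

    -- The word has one row for each part of (R, ν). Padding with empty rows makes their number
    -- `r + r` for every ν, so each upper row has a lower partner.
    Vword-rows : Vword k c r ν ≡ rows (r ℕ.+ r)
    Vword-rows = trans (cong (concatMap rowLetters) (reverse-upTo (length lam)))
      (trans (sym (rows-stable (r ℕ.∸ length ν))) (cong rows total))
      where
      total : length lam ℕ.+ (r ℕ.∸ length ν) ≡ r ℕ.+ r
      total = trans (cong (ℕ._+ (r ℕ.∸ length ν)) (trans (length-++ (replicate r c)) (cong (ℕ._+ length ν) (length-replicate r))))
        (trans (ℕ.+-assoc r (length ν) _) (cong (r ℕ.+_) (ℕ.m+[n∸m]≡n (height box))))

    rows-step : ∀ i p p′ → π (rowLetters i) p′ ≡ p → π (rows (suc i)) p′ ≡ π (rows i) p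
    rows-step i p p′ e = trans (π-++ (rowLetters i) (rows i) p′) (cong (π (rows i)) e)

    stay : ∀ d m p → (∀ i → i ℕ.< d → π (rowLetters (m ℕ.+ i)) p ≡ p) → π (rows (m ℕ.+ d)) p ≡ π (rows m) p
    stay zero    m p h = cong (λ t → π (rows t) p) (ℕ.+-identityʳ m)
    stay (suc d) m p h = trans (cong (λ t → π (rows t) p) (ℕ.+-suc m d))
      (trans (rows-step (m ℕ.+ d) p p (h d ℕ.≤-refl)) (stay d m p (λ i lt → h i (ℕ.m≤n⇒m≤1+n lt))))

    drift : ∀ d m p → (∀ i → i ℕ.< d → π (rowLetters (m ℕ.+ i)) (p - + suc i) ≡ p - + i) → π (rows (m ℕ.+ d)) (p - + d) ≡ π (rows m) p
    drift zero    m p h = cong₂ (λ t x → π (rows t) x) (ℕ.+-identityʳ m) (ℤ.+-identityʳ p)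
    drift (suc d) m p h = trans (cong (λ t → π (rows t) (p - + suc d)) (ℕ.+-suc m d))
      (trans (rows-step (m ℕ.+ d) (p - + d) (p - + suc d) (h d ℕ.≤-refl)) (drift d m p (λ i lt → h i (ℕ.m≤n⇒m≤1+n lt))))

    -- The run of row i < r carries β i to c − i, that of row r + i carries − r − i to β i − r.

    b : ℕ → ℤ
    b = β ν

    module Upper (i : ℕ) (i<r : i ℕ.< r) where

      m : ℕ
      m = c ℕ.∸ part ν i

      end : b i + + m ≡ + c - + i
      end = lia 4 (λ p m c i → p ⊕ m ≈ c ⇒ ⊢ p ⊝ i ⊕ m ≈ c ⊝ i) (+ part ν i) (+ m) (+ c) (+ i) (cong +_ (ℕ.m+[n∸m]≡n (ν≤c i)))

      is-run : rowLetters i ≡ run (b i) m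
      is-run = rowLetters-run i (b i) m refl (trans (lam-top i i<r) (sym (ℕ.m+[n∸m]≡n (ν≤c i))))

      m<N : + m < N
      m<N = subst (+ m <_) (sym N≡c+r) (lia 3 (λ m c r → m ≲ c ⇒ con (+ 0) ≺ r ⇒ ⊢ m ≺ c ⊕ r) (+ m) (+ c) (+ r) (+≤+ (ℕ.m∸n≤m c (part ν i))) 0<r)

      first : π (rowLetters i) (+ c - + i) ≡ b i
      first = trans (cong (λ w → π w (+ c - + i)) is-run) (trans (cong (π (run (b i) m)) (sym end)) (Run.run-end (b i) m))

      left : ∀ p → b i < p → p ≤ + c - + i → π (rowLetters i) (p - + 1) ≡ p
      left p lo hi = trans (cong (λ w → π w (p - + 1)) is-run) (trans (Run.run-mid (b i) m (p - + 1) m<N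
        (lia 2 (λ b p → b ≺ p ⇒ ⊢ b ≲ p ⊝ one) (b i) p lo) (subst (p - + 1 <_) (sym end) (lia 2 (λ p u → p ≲ u ⇒ ⊢ p ⊝ one ≺ u) p (+ c - + i) hi))) (x-1+1 p))

      above : ∀ p → + c - + i < p → p < b i + N → π (rowLetters i) p ≡ p
      above p lo hi = trans (cong (λ w → π w p) is-run) (Run.run-out (b i) m p (subst (_< p) (sym end) lo) hi)

      below : ∀ p → p < b i → - + r - + i < p → π (rowLetters i) p ≡ p
      below p hi lo = lia 3 (λ u p N → u ⊕ N ≈ p ⊕ N ⇒ ⊢ u ≈ p) (π (rowLetters i) p) p N (trans (sym (π-periodic (rowLetters i) p))
        (above (p + N) (lia 5 (λ p c r i N → ⊖ r ⊝ i ≺ p ⇒ N ≈ c ⊕ r ⇒ ⊢ c ⊝ i ≺ p ⊕ N) p (+ c) (+ r) (+ i) N lo N≡c+r) (ℤ.+-monoˡ-< N hi)))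

    module Lower (i : ℕ) where

      a : ℤ
      a = - + r - + i

      end : a + + part ν i ≡ b i - + r
      end = lia 3 (λ p r i → ⊢ ⊖ r ⊝ i ⊕ p ≈ p ⊝ i ⊝ r) (+ part ν i) (+ r) (+ i)

      is-run : rowLetters (r ℕ.+ i) ≡ run a (part ν i)
      is-run = rowLetters-run (r ℕ.+ i) a (part ν i)
        (trans (cong (λ p → + p - + (r ℕ.+ i)) (ν-beyond (r ℕ.+ i) (ℕ.m≤m+n r i))) (lia 2 (λ r i → ⊢ con (+ 0) ⊝ (r ⊕ i) ≈ ⊖ r ⊝ i) (+ r) (+ i)))
        (trans (lam-bottom i) (cong (ℕ._+ part ν i) (sym (ν-beyond (r ℕ.+ i) (ℕ.m≤m+n r i)))))

      p<N : + part ν i < N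
      p<N = subst (+ part ν i <_) (sym N≡c+r) (lia 3 (λ m c r → m ≲ c ⇒ con (+ 0) ≺ r ⇒ ⊢ m ≺ c ⊕ r) (+ part ν i) (+ c) (+ r) (+≤+ (ν≤c i)) 0<r)

      first : π (rowLetters (r ℕ.+ i)) (b i - + r) ≡ a
      first = trans (cong (λ w → π w (b i - + r)) is-run) (trans (cong (π (run a (part ν i))) (sym end)) (Run.run-end a (part ν i)))

      left : ∀ p → a < p → p ≤ b i - + r → π (rowLetters (r ℕ.+ i)) (p - + 1) ≡ p
      left p lo hi = trans (cong (λ w → π w (p - + 1)) is-run) (trans (Run.run-mid a (part ν i) (p - + 1) p<N
        (lia 2 (λ b p → b ≺ p ⇒ ⊢ b ≲ p ⊝ one) a p lo) (subst (p - + 1 <_) (sym end) (lia 2 (λ p u → p ≲ u ⇒ ⊢ p ⊝ one ≺ u) p (b i - + r) hi))) (x-1+1 p))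

      above : ∀ p → b i - + r < p → p < + c - + i → π (rowLetters (r ℕ.+ i)) p ≡ p
      above p lo hi = trans (cong (λ w → π w p) is-run) (Run.run-out a (part ν i) p (subst (_< p) (sym end) lo)
        (lia 5 (λ p c r i N → p ≺ c ⊝ i ⇒ N ≈ c ⊕ r ⇒ ⊢ p ≺ ⊖ r ⊝ i ⊕ N) p (+ c) (+ r) (+ i) N hi N≡c+r))

      below : ∀ p → p < a → b i - + r - N < p → π (rowLetters (r ℕ.+ i)) p ≡ p
      below p hi lo = lia 3 (λ u p N → u ⊕ N ≈ p ⊕ N ⇒ ⊢ u ≈ p) (π (rowLetters (r ℕ.+ i)) p) p N (trans (sym (π-periodic (rowLetters (r ℕ.+ i)) p))
        (above (p + N) (lia 3 (λ p u N → u ⊝ N ≺ p ⇒ ⊢ u ≺ p ⊕ N) p (b i - + r) N lo)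
          (lia 5 (λ p c r i N → p ≺ ⊖ r ⊝ i ⇒ N ≈ c ⊕ r ⇒ ⊢ p ⊕ N ≺ c ⊝ i) p (+ c) (+ r) (+ i) N hi N≡c+r)))

    V : W
    V = Vword k c r ν

    b-gap : ∀ {i j} → i ℕ.≤ j → b j + + j ≤ b i + + i
    b-gap {i} {j} le = lia 4 (λ p q i j → q ≲ p ⇒ ⊢ q ⊝ j ⊕ j ≲ p ⊝ i ⊕ i) (+ part ν i) (+ part ν j) (+ i) (+ j) (+≤+ (decreasing-≤ ν (decreasing box) le))

    b≤c : ∀ i → b i ≤ + c - + i
    b≤c i = lia 3 (λ p c i → p ≲ c ⇒ ⊢ p ⊝ i ≲ c ⊝ i) (+ part ν i) (+ c) (+ i) (+≤+ (ν≤c i))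

    b≥-i : ∀ i → - + i ≤ b i
    b≥-i i = lia 2 (λ p i → con (+ 0) ≲ p ⇒ ⊢ ⊖ i ≲ p ⊝ i) (+ part ν i) (+ i) (+≤+ ℕ.z≤n)

    split-rows : ∀ {i} → i ℕ.< r → i ℕ.+ suc (r ℕ.∸ suc i) ≡ r
    split-rows {i} lt = trans (ℕ.+-suc i (r ℕ.∸ suc i)) (ℕ.m+[n∸m]≡n lt)

    -- The preimage of `b i` is traced from row 0 on, against the order in which `π` applies the
    -- rows. Upper row `i` takes it to `c - i`, lower row `i` takes a translate of that to a
    -- translate of `b i + c`, and all other rows fix it.
    bead-forward : ∀ i → i ℕ.< r → π V (b i + + c) ≡ b i
    bead-forward i i<r = trans (cong (λ w → π w (b i + + c)) Vword-rows) final
      where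
      d = r ℕ.∸ suc i
      q = + c - + i
      phase₁ : π (rows i) (b i) ≡ b i
      phase₁ = stay i 0 (b i) (λ j j<i → Upper.below j (ℕ.<-trans j<i i<r) (b i) (β-< ν (decreasing box) j<i)
        (lia 4 (λ b i j r → ⊖ i ≲ b ⇒ i ≺ r ⇒ con (+ 0) ≲ j ⇒ ⊢ ⊖ r ⊝ j ≺ b) (b i) (+ i) (+ j) (+ r) (b≥-i i) (+<+ i<r) (+≤+ ℕ.z≤n)))
      phase₂ : π (rows (suc i)) q ≡ b i
      phase₂ = trans (rows-step i (b i) q (Upper.first i i<r)) phase₁
      phase₃ : π (rows r) q ≡ b i
      phase₃ = trans (cong (λ t → π (rows t) q) (sym (trans (sym (ℕ.+-suc i d)) (split-rows i<r))))
        (trans (stay d (suc i) q (λ j j<d → let l<r = subst (suc i ℕ.+ j ℕ.<_) (trans (sym (ℕ.+-suc i d)) (split-rows i<r)) (ℕ.+-monoʳ-< (suc i) j<d) in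
          Upper.above (suc i ℕ.+ j) l<r q
            (lia 3 (λ c i j → con (+ 0) ≲ j ⇒ ⊢ c ⊝ (one ⊕ i ⊕ j) ≺ c ⊝ i) (+ c) (+ i) (+ j) (+≤+ ℕ.z≤n))
            (lia 6 (λ c i l b r N → ⊖ l ≲ b ⇒ l ≺ r ⇒ N ≈ c ⊕ r ⇒ con (+ 0) ≲ i ⇒ ⊢ c ⊝ i ≺ b ⊕ N) (+ c) (+ i) (+ (suc i ℕ.+ j)) (b (suc i ℕ.+ j)) (+ r) N
              (b≥-i (suc i ℕ.+ j)) (+<+ l<r) N≡c+r (+≤+ ℕ.z≤n)))) phase₂)
      -- `c - i` lowered by `N`, which is the left end of lower row `i`: periodicity joins the two
      -- halves of the track.
      q′ = - + r - + i
      phase₃′ : π (rows r) q′ ≡ b i - N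
      phase₃′ = lia 3 (λ u v N → u ⊕ N ≈ v ⇒ ⊢ u ≈ v ⊝ N) (π (rows r) q′) (b i) N (trans (sym (π-periodic (rows r) q′))
        (trans (cong (π (rows r)) (lia 4 (λ c r i N → N ≈ c ⊕ r ⇒ ⊢ ⊖ r ⊝ i ⊕ N ≈ c ⊝ i) (+ c) (+ r) (+ i) N N≡c+r)) phase₃))
      phase₄ : π (rows (r ℕ.+ i)) q′ ≡ b i - N
      phase₄ = trans (stay i r q′ (λ j j<i → Lower.below j q′
        (lia 3 (λ r i j → j ≺ i ⇒ ⊢ ⊖ r ⊝ i ≺ ⊖ r ⊝ j) (+ r) (+ i) (+ j) (+<+ j<i))
        (lia 6 (λ b c r i j N → b ≲ c ⊝ j ⇒ i ≺ r ⇒ N ≈ c ⊕ r ⇒ con (+ 0) ≲ j ⇒ ⊢ b ⊝ r ⊝ N ≺ ⊖ r ⊝ i) (b j) (+ c) (+ r) (+ i) (+ j) N (b≤c j) (+<+ i<r) N≡c+r (+≤+ ℕ.z≤n)))) phase₃′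
      q″ = b i - + r
      phase₅ : π (rows (suc (r ℕ.+ i))) q″ ≡ b i - N
      phase₅ = trans (rows-step (r ℕ.+ i) q′ q″ (Lower.first i)) phase₄
      phase₆ : π (rows (r ℕ.+ r)) q″ ≡ b i - N
      phase₆ = trans (cong (λ t → π (rows (r ℕ.+ t)) q″) (sym (split-rows i<r))) (trans (cong (λ t → π (rows t) q″)
        (trans (sym (ℕ.+-assoc r i (suc d))) (trans (ℕ.+-suc (r ℕ.+ i) d) refl)))
        (trans (stay d (suc (r ℕ.+ i)) q″ (λ j j<d → let l = suc i ℕ.+ j ; l<r = subst (suc i ℕ.+ j ℕ.<_) (trans (sym (ℕ.+-suc i d)) (split-rows i<r)) (ℕ.+-monoʳ-< (suc i) j<d) in
          trans (cong (λ t → π (rowLetters t) q″) (trans (cong (λ t → suc t) (ℕ.+-assoc r i j)) (sym (ℕ.+-suc r (i ℕ.+ j)))))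
          (Lower.above l q″ (ℤ.+-monoˡ-< (- + r) (β-< ν (decreasing box) (ℕ.s≤s (ℕ.m≤m+n i j))))
            (lia 5 (λ b c r i l → b ≲ c ⊝ i ⇒ l ≺ r ⇒ con (+ 0) ≲ i ⇒ con (+ 0) ≲ i ⇒ ⊢ b ⊝ r ≺ c ⊝ l) (b i) (+ c) (+ r) (+ i) (+ l) (b≤c i) (+<+ l<r) (+≤+ ℕ.z≤n) (+≤+ ℕ.z≤n)))))
          phase₅))
      final : π (rows (r ℕ.+ r)) (b i + + c) ≡ b i
      final = trans (cong (π (rows (r ℕ.+ r))) (lia 4 (λ b c r N → N ≈ c ⊕ r ⇒ ⊢ b ⊕ c ≈ b ⊝ r ⊕ N) (b i) (+ c) (+ r) N N≡c+r))
        (trans (π-periodic (rows (r ℕ.+ r)) q″) (trans (cong (_+ N) phase₆) (lia 2 (λ b N → ⊢ b ⊝ N ⊕ N ≈ b) (b i) N)))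

    record Threshold (y : ℤ) (l : ℕ) : Set where
      field
        t     : ℕ
        t≤l   : t ℕ.≤ l
        above : ∀ i → i ℕ.< t → y < b i
        below : ∀ i → t ℕ.≤ i → i ℕ.< l → b i < y

    threshold : ∀ y l → (∀ i → i ℕ.< l → b i ≢ y) → Threshold y l
    threshold y zero    h = record { t = 0 ; t≤l = ℕ.z≤n ; above = λ _ () ; below = λ _ _ () }
    threshold y (suc l) h with ℤ.<-cmp (b l) y
    ... | tri≈ _ e _ = ⊥-elim (h l ℕ.≤-refl e)
    ... | tri> _ _ gt = record { t = suc l ; t≤l = ℕ.≤-refl
        ; above = λ i lt → ℤ.<-≤-trans gt (b-mono (ℕ.s≤s⁻¹ lt)) ; below = λ i ge lt → ⊥-elim (ℕ.<⇒≱ lt ge) }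
      where
      b-mono : ∀ {i} → i ℕ.≤ l → b l ≤ b i
      b-mono {i} le = lia 4 (λ p q i l → q ⊕ l ≲ p ⊕ i ⇒ i ≲ l ⇒ ⊢ q ≲ p) (b i) (b l) (+ i) (+ l) (b-gap le) (+≤+ le)
    ... | tri< lt _ _ = record { t = t ; t≤l = ℕ.m≤n⇒m≤1+n t≤l ; above = above ; below = below′ }
      where
      open Threshold (threshold y l (λ i i<l → h i (ℕ.m≤n⇒m≤1+n i<l)))
      below′ : ∀ i → t ℕ.≤ i → i ℕ.< suc l → b i < y
      below′ i ge i<sl with i ℕ.≟ l
      ... | yes refl = lt
      ... | no i≢l   = below i ge (ℕ.≤∧≢⇒< (ℕ.s≤s⁻¹ i<sl) i≢l)

    -- With `t` the number of beads above `y`, the preimage drops by one in each of the `r - t`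
    -- upper rows whose bead is below `y` and in each of the `t` lower rows whose bead is above it.
    -- The remaining rows fix it, so the total is `r`.
    gap-backward : ∀ y → - + r < y → y ≤ + c → (∀ i → i ℕ.< r → b i ≢ y) → π V (y - + r) ≡ y
    gap-backward y lo hi h = trans (cong (λ w → π w (y - + r)) Vword-rows) phase₄
      where
      open Threshold (threshold y r h)
      d = r ℕ.∸ t
      t+d : t ℕ.+ d ≡ r
      t+d = ℕ.m+[n∸m]≡n t≤l
      +d : + t + + d ≡ + r
      +d = cong +_ t+d
      y≤c-t : y ≤ + c - + t
      y≤c-t = by-t t refl
        where
        by-t : ∀ s → s ≡ t → y ≤ + c - + t
        by-t zero    e = lia 3 (λ y c t → y ≲ c ⇒ con (+ 0) ≈ t ⇒ ⊢ y ≲ c ⊝ t) y (+ c) (+ t) hi (cong +_ e)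
        by-t (suc s) e    = lia 5 (λ y b c s t → y ≺ b ⇒ b ≲ c ⊝ s ⇒ one ⊕ s ≈ t ⇒ ⊢ y ≲ c ⊝ t) y (b s) (+ c) (+ s) (+ t)
          (above s (subst (s ℕ.<_) e ℕ.≤-refl)) (b≤c s) (cong +_ e)
      0<y+t : + 0 < y + + t
      0<y+t = by-t (t ℕ.<? r)
        where
        by-t : Dec (t ℕ.< r) → + 0 < y + + t
        by-t (yes t<r) = lia 3 (λ b y t → b ≺ y ⇒ ⊖ t ≲ b ⇒ ⊢ con (+ 0) ≺ y ⊕ t) (b t) y (+ t) (below t ℕ.≤-refl t<r) (b≥-i t)
        by-t (no ¬t<r) = lia 3 (λ y t r → ⊖ r ≺ y ⇒ r ≲ t ⇒ ⊢ con (+ 0) ≺ y ⊕ t) y (+ t) (+ r) lo (+≤+ (ℕ.≮⇒≥ ¬t<r))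
      phase₁ : π (rows t) y ≡ y
      phase₁ = stay t 0 y (λ i i<t → Upper.below i (ℕ.≤-trans i<t t≤l) y (above i i<t)
        (lia 3 (λ y r i → ⊖ r ≺ y ⇒ con (+ 0) ≲ i ⇒ ⊢ ⊖ r ⊝ i ≺ y) y (+ r) (+ i) lo (+≤+ ℕ.z≤n)))
      phase₂ : π (rows r) (y - + d) ≡ y
      phase₂ = trans (cong (λ s → π (rows s) (y - + d)) (sym t+d)) (trans (drift d t y (λ i i<d →
          let l = t ℕ.+ i ; l<r = subst (l ℕ.<_) t+d (ℕ.+-monoʳ-< t i<d) in
          trans (cong (π (rowLetters l)) (lia 2 (λ y i → ⊢ y ⊝ (one ⊕ i) ≈ y ⊝ i ⊝ one) y (+ i)))
          (Upper.left l l<r (y - + i)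
            (lia 5 (λ y bl bt t i → bl ⊕ (t ⊕ i) ≲ bt ⊕ t ⇒ bt ≺ y ⇒ ⊢ bl ≺ y ⊝ i) y (b l) (b t) (+ t) (+ i) (b-gap (ℕ.m≤m+n t i)) (below t ℕ.≤-refl (ℕ.≤-<-trans (ℕ.m≤m+n t i) l<r)))
            (lia 4 (λ y c t i → y ≲ c ⊝ t ⇒ ⊢ y ⊝ i ≲ c ⊝ (t ⊕ i)) y (+ c) (+ t) (+ i) y≤c-t)))) phase₁)
      phase₃ : π (rows (r ℕ.+ t)) (y - + r) ≡ y
      phase₃ = trans (cong (π (rows (r ℕ.+ t))) (lia 4 (λ y r t d → t ⊕ d ≈ r ⇒ ⊢ y ⊝ r ≈ y ⊝ d ⊝ t) y (+ r) (+ t) (+ d) +d))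
        (trans (drift t r (y - + d) (λ i i<t →
          trans (cong (π (rowLetters (r ℕ.+ i))) (lia 3 (λ y d i → ⊢ y ⊝ d ⊝ (one ⊕ i) ≈ y ⊝ d ⊝ i ⊝ one) y (+ d) (+ i)))
          (Lower.left i (y - + d - + i)
            (lia 5 (λ y r t d i → t ⊕ d ≈ r ⇒ con (+ 0) ≺ y ⊕ t ⇒ ⊢ ⊖ r ⊝ i ≺ y ⊝ d ⊝ i) y (+ r) (+ t) (+ d) (+ i) +d 0<y+t)
            (rise i i<t))))
          phase₂)
        where
        rise : ∀ i → i ℕ.< t → y - + d - + i ≤ b i - + r
        rise i i<t = by-t t refl
          where
          by-t : ∀ s → s ≡ t → y - + d - + i ≤ b i - + r
          by-t zero    e = ⊥-elim (ℕ.n≮0 (subst (i ℕ.<_) (sym e) i<t))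
          by-t (suc s) e = lia 8 (λ y d i bi bs r s t → y ≺ bs ⇒ bs ⊕ s ≲ bi ⊕ i ⇒ one ⊕ s ≈ t ⇒ t ⊕ d ≈ r ⇒ ⊢ y ⊝ d ⊝ i ≲ bi ⊝ r)
            y (+ d) (+ i) (b i) (b s) (+ r) (+ s) (+ t) (above s (subst (s ℕ.<_) e ℕ.≤-refl)) (b-gap (ℕ.s≤s⁻¹ (subst (i ℕ.<_) (sym e) i<t))) (cong +_ e) +d
      phase₄ : π (rows (r ℕ.+ r)) (y - + r) ≡ y
      phase₄ = trans (cong (λ s → π (rows s) (y - + r)) (trans (cong (r ℕ.+_) (sym t+d)) (sym (ℕ.+-assoc r t d))))
        (trans (stay d (r ℕ.+ t) (y - + r) (λ i i<d → let l = t ℕ.+ i ; l<r = subst (l ℕ.<_) t+d (ℕ.+-monoʳ-< t i<d) in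
          trans (cong (λ s → π (rowLetters s) (y - + r)) (ℕ.+-assoc r t i))
          (Lower.above l (y - + r) (ℤ.+-monoˡ-< (- + r) (below l (ℕ.m≤m+n t i) l<r))
            (lia 4 (λ y c r l → y ≲ c ⇒ l ≺ r ⇒ ⊢ y ⊝ r ≺ c ⊝ l) y (+ c) (+ r) (+ l) hi (+<+ l<r)))))
        phase₃)

  -- Rectangles and subsets

  -- Partitions in a rectangle as subsets: reading the boundary path from the top right, the true
  -- entries are the vertical steps, and the length of a row is the number of later horizontal steps.

  horizontals : ∀ {m} → Subset m → ℕ
  horizontals []ᵥ          = 0
  horizontals (true  ∷ᵥ Q) = horizontals Q
  horizontals (false ∷ᵥ Q) = suc (horizontals Q)

  rowLengths : ∀ {m} → Subset m → List ℕ
  rowLengths []ᵥ          = []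
  rowLengths (true  ∷ᵥ Q) = horizontals Q ∷ rowLengths Q
  rowLengths (false ∷ᵥ Q) = rowLengths Q

  shape : ∀ {m} → Subset m → List ℕ
  shape Q = positives (rowLengths Q)

  size+horizontals : ∀ {m} (Q : Subset m) → ∣ Q ∣ ℕ.+ horizontals Q ≡ m
  size+horizontals []ᵥ          = refl
  size+horizontals (true  ∷ᵥ Q) = cong suc (size+horizontals Q)
  size+horizontals (false ∷ᵥ Q) = trans (ℕ.+-suc ∣ Q ∣ (horizontals Q)) (cong suc (size+horizontals Q))

  rowLengths≤ : ∀ {m} (Q : Subset m) i → part (rowLengths Q) i ℕ.≤ horizontals Q
  rowLengths≤ []ᵥ          i       = ℕ.z≤n
  rowLengths≤ (true  ∷ᵥ Q) zero    = ℕ.≤-refl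
  rowLengths≤ (true  ∷ᵥ Q) (suc i) = rowLengths≤ Q i
  rowLengths≤ (false ∷ᵥ Q) i       = ℕ.m≤n⇒m≤1+n (rowLengths≤ Q i)

  rowLengths-decreasing : ∀ {m} (Q : Subset m) → Decreasing (rowLengths Q)
  rowLengths-decreasing []ᵥ          i       = ℕ.z≤n
  rowLengths-decreasing (true  ∷ᵥ Q) zero    = rowLengths≤ Q 0
  rowLengths-decreasing (true  ∷ᵥ Q) (suc i) = rowLengths-decreasing Q i
  rowLengths-decreasing (false ∷ᵥ Q) i       = rowLengths-decreasing Q i

  length-rowLengths : ∀ {m} (Q : Subset m) → length (rowLengths Q) ≡ ∣ Q ∣
  length-rowLengths []ᵥ          = refl
  length-rowLengths (true  ∷ᵥ Q) = cong suc (length-rowLengths Q)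
  length-rowLengths (false ∷ᵥ Q) = length-rowLengths Q

  part-shape : ∀ {m} (Q : Subset m) i → part (shape Q) i ≡ part (rowLengths Q) i
  part-shape Q = part-positives (rowLengths Q) (rowLengths-decreasing Q)

  step⇒row : ∀ {m} (Q : Subset m) t → lookup Q t ≡ true → Σ ℕ λ i → i ℕ.< ∣ Q ∣ × part (rowLengths Q) i ℕ.+ toℕ t ≡ horizontals Q ℕ.+ i
  step⇒row (true  ∷ᵥ Q) Fin.zero    e = 0 , ℕ.s≤s ℕ.z≤n , refl
  step⇒row (true  ∷ᵥ Q) (Fin.suc t) e = let i , lt , eq = step⇒row Q t e in
    suc i , ℕ.s≤s lt , trans (ℕ.+-suc _ (toℕ t)) (trans (cong suc eq) (sym (ℕ.+-suc (horizontals Q) i)))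
  step⇒row (false ∷ᵥ Q) (Fin.suc t) e = let i , lt , eq = step⇒row Q t e in
    i , lt , trans (ℕ.+-suc _ (toℕ t)) (cong suc eq)

  row⇒step : ∀ {m} (Q : Subset m) i → i ℕ.< ∣ Q ∣ → Σ (Fin m) λ t → lookup Q t ≡ true × part (rowLengths Q) i ℕ.+ toℕ t ≡ horizontals Q ℕ.+ i
  row⇒step (true  ∷ᵥ Q) zero    lt         = Fin.zero , refl , refl
  row⇒step (true  ∷ᵥ Q) (suc i) (ℕ.s≤s lt) = let t , e , eq = row⇒step Q i lt in
    Fin.suc t , e , trans (ℕ.+-suc _ (toℕ t)) (trans (cong suc eq) (sym (ℕ.+-suc (horizontals Q) i)))
  row⇒step (false ∷ᵥ Q) i       lt         = let t , e , eq = row⇒step Q i lt in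
    Fin.suc t , e , trans (ℕ.+-suc _ (toℕ t)) (cong suc eq)

  pIn-step : ∀ l m → pIn (suc l) (suc m) ≡ pIn (suc l) m ++ map (suc m ∷_) (pIn l (suc m))
  pIn-step l m = cong ([] ∷_) (trans (cong (concatMap F ∘ map suc) (sym (upTo-∷ʳ m)))
    (trans (cong (concatMap F) (map-++ suc (upTo m) (m ∷ [])))
      (trans (concatMap-++ F (map suc (upTo m)) (suc m ∷ [])) (cong (concatMap F (map suc (upTo m)) ++_) (++-identityʳ (F (suc m)))))))
    where
    F : ℕ → List (List ℕ)
    F x = map (x ∷_) (pIn l x)

  guard : ∀ {P : Set} → Dec P → ℤ → ℤ
  guard (yes _) v = v
  guard (no _)  v = + 0

  guard-⇔ : ∀ {P P′ : Set} (d : Dec P) (d′ : Dec P′) {v v′} → P ⟺ P′ → (P → v ≡ v′) → guard d v ≡ guard d′ v′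
  guard-⇔ (yes p) (yes _)  _         e = e p
  guard-⇔ (no _)  (no _)   _         e = refl
  guard-⇔ (yes p) (no ¬p′) (to , _)  e = ⊥-elim (¬p′ (to p))
  guard-⇔ (no ¬p) (yes p′) (_ , from) e = ⊥-elim (¬p (from p′))

  guard-no : ∀ {P : Set} (d : Dec P) {v} → ¬ P → guard d v ≡ + 0
  guard-no (yes p) ¬p = ⊥-elim (¬p p)
  guard-no (no _)  ¬p = refl

  ∑-guard : ∀ {A : Set} {P : A → Set} (P? : ∀ x → Dec (P x)) h xs → ∑ (λ x → guard (P? x) (h x)) xs ≡ ∑ h (filter P? xs)
  ∑-guard P? h []       = refl
  ∑-guard P? h (x ∷ xs) with P? x
  ... | yes _ = cong (_+_ (h x)) (∑-guard P? h xs)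
  ... | no _  = trans (ℤ.+-identityˡ _) (∑-guard P? h xs)

  ∑-doubles : ∀ {m} (h : Subset (suc m) → ℤ) xs → ∑ h (doubles xs) ≡ ∑ (h ∘ (true ∷ᵥ_)) xs + ∑ (h ∘ (false ∷ᵥ_)) xs
  ∑-doubles h []       = refl
  ∑-doubles h (x ∷ xs) = trans (cong (λ t → h (true ∷ᵥ x) + (h (false ∷ᵥ x) + t)) (∑-doubles h xs)) (ring (h (true ∷ᵥ x)) (h (false ∷ᵥ x)) (∑ (h ∘ (true ∷ᵥ_)) xs) (∑ (h ∘ (false ∷ᵥ_)) xs))
    where
    ring : ∀ a b c d → a + (b + (c + d)) ≡ a + c + (b + d)
    ring = solve-∀

  sized : ∀ {m} → ℕ → (Subset m → ℤ) → Subset m → ℤ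
  sized l h Q = guard (∣ Q ∣ ℕ.≟ l) (h Q)

  size-≤ : ∀ {m} (Q : Subset m) → ∣ Q ∣ ℕ.≤ m
  size-≤ Q = subst (∣ Q ∣ ℕ.≤_) (size+horizontals Q) (ℕ.m≤m+n ∣ Q ∣ (horizontals Q))

  -- Both sides obey Pascal's recursion: the boundary path starts with a vertical step when the
  -- first row has full width, and with a horizontal one when the partition fits into a narrower
  -- box. Rows of length 0 occur in the path and are removed by `positives`.
  ∑-pIn : ∀ m l x → l ℕ.+ x ≡ m → ∀ h → ∑ h (pIn l x) ≡ ∑ (sized l (h ∘ shape)) (allSubsets m)
  ∑-pIn zero    zero    x       e h = refl
  ∑-pIn (suc m) zero    (suc x) e h = sym (trans (∑-doubles (sized 0 (h ∘ shape)) (allSubsets m))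
    (trans (cong₂ _+_ (∑-zero (sized 0 (h ∘ shape) ∘ (true ∷ᵥ_)) (allSubsets m) (λ {Q} _ → guard-no (suc ∣ Q ∣ ℕ.≟ 0) {h (shape (true ∷ᵥ Q))} λ ())) (sym (∑-pIn m zero x (ℕ.suc-injective e) h))) (ℤ.+-identityˡ _)))
  ∑-pIn (suc m) (suc l) zero    e h = sym (trans (∑-doubles (sized (suc l) (h ∘ shape)) (allSubsets m))
    (trans (cong₂ _+_ (trans (∑-cong (allSubsets m) (λ {Q} _ → guard-⇔ (suc ∣ Q ∣ ℕ.≟ suc l) (∣ Q ∣ ℕ.≟ l) (ℕ.suc-injective , cong suc) (λ p → cong h (first-empty Q (ℕ.suc-injective p)))))
                             (trans (sym (∑-pIn m l 0 (ℕ.suc-injective e) h)) (only-empty l)))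
                      (∑-zero _ (allSubsets m) (λ {Q} _ → guard-no (∣ Q ∣ ℕ.≟ suc l) (λ p → ℕ.<⇒≱ (ℕ.≤-reflexive (trans (cong suc m≡l) (sym p))) (size-≤ Q))))) (ℤ.+-identityʳ _)))
    where
    m≡l : m ≡ l
    m≡l = trans (sym (ℕ.suc-injective e)) (ℕ.+-identityʳ l)
    only-empty : ∀ l → ∑ h (pIn l 0) ≡ h [] + + 0
    only-empty zero    = refl
    only-empty (suc l) = refl
    first-empty : ∀ (Q : Subset m) → ∣ Q ∣ ≡ l → shape (true ∷ᵥ Q) ≡ shape Q
    first-empty Q p = cong (λ z → positives (z ∷ rowLengths Q)) (ℕ.+-cancelˡ-≡ l (horizontals Q) 0 (trans (cong (ℕ._+ horizontals Q) (sym p)) (trans (size+horizontals Q) (sym (ℕ.suc-injective e)))))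
  ∑-pIn (suc m) (suc l) (suc x) e h = begin
    ∑ h (pIn (suc l) (suc x))                                              ≡⟨ cong (∑ h) (pIn-step l x) ⟩
    ∑ h (pIn (suc l) x ++ map (suc x ∷_) (pIn l (suc x)))                  ≡⟨ ∑-++ h (pIn (suc l) x) _ ⟩
    ∑ h (pIn (suc l) x) + ∑ h (map (suc x ∷_) (pIn l (suc x)))             ≡⟨ cong₂ _+_ (∑-pIn m (suc l) x (trans (sym (ℕ.+-suc l x)) (ℕ.suc-injective e)) h)
                                                                                 (trans (∑-map h (suc x ∷_) (pIn l (suc x))) (∑-pIn m l (suc x) (ℕ.suc-injective e) (h ∘ (suc x ∷_)))) ⟩
    ∑ (sized (suc l) (h ∘ shape)) (allSubsets m) + ∑ (sized l (h ∘ (suc x ∷_) ∘ shape)) (allSubsets m)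
                                                                           ≡⟨ ℤ.+-comm (∑ (sized (suc l) (h ∘ shape)) (allSubsets m)) _ ⟩
    ∑ (sized l (h ∘ (suc x ∷_) ∘ shape)) (allSubsets m) + ∑ (sized (suc l) (h ∘ shape)) (allSubsets m)
                                                                           ≡⟨ cong (_+ ∑ (sized (suc l) (h ∘ shape)) (allSubsets m)) (∑-cong (allSubsets m) (λ {Q} _ →
                                                                                 guard-⇔ (∣ Q ∣ ℕ.≟ l) (suc ∣ Q ∣ ℕ.≟ suc l) (cong suc , ℕ.suc-injective) (λ p → cong h (sym (first-row Q p))))) ⟩
    ∑ (sized (suc l) (h ∘ shape) ∘ (true ∷ᵥ_)) (allSubsets m) + ∑ (sized (suc l) (h ∘ shape)) (allSubsets m)
                                                                           ≡⟨ sym (∑-doubles (sized (suc l) (h ∘ shape)) (allSubsets m)) ⟩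
    ∑ (sized (suc l) (h ∘ shape)) (allSubsets (suc m))                     ∎
    where
    open ≡-Reasoning
    first-row : ∀ (Q : Subset m) → ∣ Q ∣ ≡ l → shape (true ∷ᵥ Q) ≡ suc x ∷ shape Q
    first-row Q p = cong (λ z → positives (z ∷ rowLengths Q)) (ℕ.+-cancelˡ-≡ l (horizontals Q) (suc x) (trans (cong (ℕ._+ horizontals Q) (sym p)) (trans (size+horizontals Q) (sym (ℕ.suc-injective e)))))

  ∑-rectangle : ∀ h → ∑ h (pIn r c) ≡ ∑ (h ∘ shape) (subsets r)
  ∑-rectangle h = trans (∑-pIn n r c (trans (ℕ.+-comm r c) c+r≡n) h) (∑-guard (λ Q → ∣ Q ∣ ℕ.≟ r) (h ∘ shape) (allSubsets n))

  ρ-small : ∀ x → + 0 ≤ x → x < N → ⌜ ρ x ⌝ ≡ x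
  ρ-small x lo hi = ρ-injective-window
    (lia 3 (λ y r N → y ≺ N ⇒ con (+ 0) ≲ r ⇒ ⊢ y ⊝ N ≺ r) x ⌜ ρ x ⌝ N hi (0≤toℕ (ρ x)))
    (lia 3 (λ y r N → con (+ 0) ≲ y ⇒ r ≺ N ⇒ ⊢ r ≺ y ⊕ N) x ⌜ ρ x ⌝ N lo (toℕ<N (ρ x))) (sym (ρ-⌜⌝ (ρ x)))

  module Shape (Q : Subset n) (size : ∣ Q ∣ ≡ r) where

    ν : List ℕ
    ν = shape Q

    horizontals≡c : horizontals Q ≡ c
    horizontals≡c = ℕ.+-cancelˡ-≡ r (horizontals Q) c (trans (cong (ℕ._+ horizontals Q) (sym size)) (trans (size+horizontals Q) (trans (sym c+r≡n) (ℕ.+-comm c r))))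

    box : InBox c r ν
    box = record
      { decreasing = proj₁ (positives-partition (rowLengths Q) (rowLengths-decreasing Q))
      ; positive   = proj₂ (positives-partition (rowLengths Q) (rowLengths-decreasing Q))
      ; width      = subst₂ ℕ._≤_ (sym (part-shape Q 0)) horizontals≡c (rowLengths≤ Q 0)
      ; height     = ℕ.≤-trans (length-filter (1 ℕ.≤?_) (rowLengths Q)) (ℕ.≤-reflexive (trans (length-rowLengths Q) size)) }

    open Track ν box using (V; bead-forward; gap-backward)

    -- The vertical step at place `t` of the path is the bead `c - t`. This is the origin of the
    -- coordinate `c - y` in which subsets and positions are compared from here on.
    row-position : ∀ i t → part (rowLengths Q) i ℕ.+ t ≡ horizontals Q ℕ.+ i → β ν i ≡ + c - + t
    row-position i t e = lia 4 (λ p t c i → p ⊕ t ≈ c ⊕ i ⇒ ⊢ p ⊝ i ≈ c ⊝ t) (+ part ν i) (+ t) (+ c) (+ i)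
      (cong +_ (trans (cong (ℕ._+ t) (part-shape Q i)) (trans e (cong (ℕ._+ i) horizontals≡c))))

    Located : ℤ → Set
    Located y = Σ ℤ λ x → Σ ℤ λ m → - + r + + 1 ≤ x × x < - + r + + 1 + N × y ≡ x + m * N

    module At (x m : ℤ) (lo : - + r + + 1 ≤ x) (hi : x < - + r + + 1 + N) where

      x≤c : x ≤ + c
      x≤c = lia 4 (λ x r c N → x ≺ ⊖ r ⊕ one ⊕ N ⇒ N ≈ c ⊕ r ⇒ ⊢ x ≲ c) x (+ r) (+ c) N hi N≡c+r

      g : G
      g = ρ (+ c - x)

      ⌜g⌝ : ⌜ g ⌝ ≡ + c - x
      ⌜g⌝ = ρ-small (+ c - x) (lia 2 (λ x c → x ≲ c ⇒ ⊢ con (+ 0) ≲ c ⊝ x) x (+ c) x≤c)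
        (lia 4 (λ x r c N → ⊖ r ⊕ one ≲ x ⇒ N ≈ c ⊕ r ⇒ ⊢ c ⊝ x ≺ N) x (+ r) (+ c) N lo N≡c+r)

      membership : Q ∋ (+ c - (x + m * N)) ≡ lookup Q g
      membership = cong (lookup Q) (trans (cong ρ (ring (+ c) x m N)) (ρ-periodic (+ c - x) (- m)))
        where
        ring : ∀ c x m N → c - (x + m * N) ≡ c - x + (- m) * N
        ring = solve-∀

      at-g : + c - ⌜ g ⌝ ≡ x
      at-g = trans (cong (_-_ (+ c)) ⌜g⌝) (lia 2 (λ c x → ⊢ c ⊝ (c ⊝ x) ≈ x) (+ c) x)

      forward : lookup Q g ≡ true → π V (x + m * N + + c) ≡ x + m * N
      forward e = let i , i<r , eq = step⇒row Q g e
                      bx = trans (row-position i (toℕ g) eq) at-g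
                  in trans (cong (π V) (lia 3 (λ x u c → ⊢ x ⊕ u ⊕ c ≈ x ⊕ c ⊕ u) x (m * N) (+ c))) (trans (π-multiple V m (x + + c))
                    (cong (_+ m * N) (subst (λ y → π V (y + + c) ≡ y) bx (bead-forward i (subst (i ℕ.<_) size i<r)))))

      backward : lookup Q g ≡ false → π V (x + m * N - + r) ≡ x + m * N
      backward e = trans (cong (π V) (lia 3 (λ x u c → ⊢ x ⊕ u ⊝ c ≈ x ⊝ c ⊕ u) x (m * N) (+ r))) (trans (π-multiple V m (x - + r))
          (cong (_+ m * N) (gap-backward x (lia 2 (λ r x → ⊖ r ⊕ one ≲ x ⇒ ⊢ ⊖ r ≺ x) (+ r) x lo) x≤c not-bead′)))
        where
        not-bead′ : ∀ i → i ℕ.< r → β ν i ≢ x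
        not-bead′ i i<r bx = let t , e′ , eq = row⇒step Q i (subst (i ℕ.<_) (sym size) i<r)
                                 t≡g = Fin.toℕ-injective (ℤ.+-injective (lia 4 (λ c t g x → c ⊝ t ≈ x ⇒ c ⊝ g ≈ x ⇒ ⊢ t ≈ g) (+ c) (+ toℕ t) ⌜ g ⌝ x (trans (sym (row-position i (toℕ t) eq)) bx) at-g))
                             in true≢false (trans (sym e′) (trans (cong (lookup Q) t≡g) e))

    forward : ∀ y → Q ∋ (+ c - y) ≡ true → π V (y + + c) ≡ y
    forward y = by-window (window (- + r + + 1) y)
      where
      by-window : Located y → Q ∋ (+ c - y) ≡ true → π V (y + + c) ≡ y
      by-window (x , m , lo , hi , e) h = subst (λ y → π V (y + + c) ≡ y) (sym e)
        (At.forward x m lo hi (trans (sym (At.membership x m lo hi)) (subst (λ y → Q ∋ (+ c - y) ≡ true) e h)))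

    backward : ∀ y → Q ∋ (+ c - y) ≡ false → π V (y - + r) ≡ y
    backward y = by-window (window (- + r + + 1) y)
      where
      by-window : Located y → Q ∋ (+ c - y) ≡ false → π V (y - + r) ≡ y
      by-window (x , m , lo , hi , e) h = subst (λ y → π V (y - + r) ≡ y) (sym e)
        (At.backward x m lo hi (trans (sym (At.membership x m lo hi)) (subst (λ y → Q ∋ (+ c - y) ≡ false) e h)))

  id-not-flat : ∀ {t} → All (λ g → Flat g id) t → t ≡ []
  id-not-flat []             = refl
  id-not-flat {g ∷ _} (p ∷ _) = ⊥-elim (ℤ.<-irrefl p (x<x+1 ⌜ g ⌝))

  reduced-good : ∀ a → Reduced k a → Good a id
  reduced-good a red = by-strict strict
    where
    open Normal (normalise id-quasi id-sorted a)
    by-strict : Good a id ⊎ length word ℕ.< length a → Good a id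
    by-strict (inj₁ g)  = g
    by-strict (inj₂ lt) = ⊥-elim (ℕ.<⇒≱ lt (red word (subst (EqW k a) (trans (cong (word ++_) (id-not-flat stab)) (++-identityʳ word)) eqW)))

  opaque
    pull : (ℤ → ℤ) → Subset n → Subset n
    pull θ Q = tabulate (λ g → Q ∋ θ ⌜ g ⌝)

    pull-∋ : ∀ θ Q → (∀ x m → Q ∋ θ (x + m * N) ≡ Q ∋ θ x) → ∀ x → pull θ Q ∋ x ≡ Q ∋ θ x
    pull-∋ θ Q per x = trans (lookup∘tabulate (λ g → Q ∋ θ ⌜ g ⌝) (ρ x)) (let m , e = ρ-≡⇒multiple {⌜ ρ x ⌝} {x} (ρ-⌜⌝ (ρ x)) in
      sym (trans (cong (λ z → Q ∋ θ z) e) (per ⌜ ρ x ⌝ m)))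

  ∑-reindex : ∀ i (θ θ′ : Subset n → Subset n) → (∀ Q → ∣ θ Q ∣ ≡ ∣ Q ∣) → (∀ Q → ∣ θ′ Q ∣ ≡ ∣ Q ∣) →
    (∀ Q → θ′ (θ Q) ≡ Q) → (∀ Q → θ (θ′ Q) ≡ Q) → ∀ h → ∑ (h ∘ θ) (subsets i) ≡ ∑ h (subsets i)
  ∑-reindex i θ θ′ sθ sθ′ inv inv′ h = trans (sym (∑-map h θ (subsets i))) (∑-↭ h (unique-↭
    (unique-map θ (subsets-unique i) (λ {Q} {R} _ _ e → trans (sym (inv Q)) (trans (cong θ′ e) (inv R)))) (subsets-unique i)
    (λ m → let Q , q , e = ∈-map⁻ θ m in subst (_∈ subsets i) (sym e) (∈-subsets⁺ (trans (sθ Q) (∈-subsets⁻ q))))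
    (λ {R} m → subst (_∈ map θ (subsets i)) (inv′ R) (∈-map⁺ θ (∈-subsets⁺ (trans (sθ′ R) (∈-subsets⁻ m)))))))

  -- Rotation of generators by the rectangle

  ev-∑ : ∀ {A : Set} (F : A → Func) xs a f → ev (λ h → ∑ (λ x → F x h) xs) a f ≡ ∑ (λ x → ev (F x) a f) xs
  ev-∑ F xs a f with good? a f
  ... | yes _ = refl
  ... | no _  = sym (∑-zero _ xs (λ _ → refl))

  ⟦⟧-∑ : ∀ {A : Set} y (F : A → Func) xs f → ⟦ y ⟧ (λ h → ∑ (λ x → F x h) xs) f ≡ ∑ (λ x → ⟦ y ⟧ (F x) f) xs
  ⟦⟧-∑ []            F xs f = sym (∑-zero _ xs (λ _ → refl))
  ⟦⟧-∑ ((c , a) ∷ y) F xs f = trans (cong₂ (λ s t → c * s + t) (ev-∑ F xs a f) (⟦⟧-∑ y F xs f)) (distribute xs)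
    where
    ring : ∀ c p q s t → c * (p + s) + (q + t) ≡ c * p + q + (c * s + t)
    ring = solve-∀
    distribute : ∀ xs → c * ∑ (λ x → ev (F x) a f) xs + ∑ (λ x → ⟦ y ⟧ (F x) f) xs ≡ ∑ (λ x → ⟦ (c , a) ∷ y ⟧ (F x) f) xs
    distribute []       = trans (ℤ.+-identityʳ _) (ℤ.*-zeroʳ c)
    distribute (x ∷ xs) = trans (ring c (ev (F x) a f) (⟦ y ⟧ (F x) f) _ _) (cong (_+_ (⟦ (c , a) ∷ y ⟧ (F x) f)) (distribute xs))

  -- The index change of a generator that crosses the sum. The permutations undo shifts by `c` or
  -- `- r`, which are equal modulo `N`, so the same residue shift serves every term.
  hat : G → G
  hat g = ρ (⌜ g ⌝ - + r)

  hat-ρ : ∀ x → hat (ρ x) ≡ ρ (x - + r)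
  hat-ρ x = ρ-cong+ (- + r) (ρ-⌜⌝ (ρ x))

  ρ-hat : ∀ {g y} → ρ y ≡ g → ρ (y - + r) ≡ hat g
  ρ-hat {g} e = ρ-cong+ (- + r) (trans e (sym (ρ-⌜⌝ g)))

  hat-ρ⁻ : ∀ {g y} → ρ (y - + r) ≡ hat g → ρ y ≡ g
  hat-ρ⁻ {g} {y} e = trans (cong ρ (back y)) (trans (ρ-cong+ (+ r) e) (trans (cong ρ (sym (back ⌜ g ⌝))) (ρ-⌜⌝ g)))
    where
    back : ∀ y → y ≡ y - + r + + r
    back y = lia 2 (λ y r → ⊢ y ≈ y ⊝ r ⊕ r) y (+ r)

  σ-hat : ∀ g y → σ (hat g) (y - + r) ≡ σ g y - + r
  σ-hat g y with place g y
  ... | at-lo p         = trans (σ-lo (ρ-hat p)) (trans (lia 2 (λ y r → ⊢ y ⊝ r ⊕ one ≈ y ⊕ one ⊝ r) y (+ r)) (cong (_- + r) (sym (σ-lo p))))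
  ... | at-hi y′ refl p = trans (cong (σ (hat g)) (lia 2 (λ y r → ⊢ y ⊕ one ⊝ r ≈ y ⊝ r ⊕ one) y′ (+ r)))
                            (trans (σ-hi (ρ-hat p)) (cong (_- + r) (sym (σ-hi p))))
  ... | off p q         = trans (σ-fix (p ∘ hat-ρ⁻) (λ e → q (hat-ρ⁻ (trans (cong ρ (lia 2 (λ y r → ⊢ y ⊝ one ⊝ r ≈ y ⊝ r ⊝ one) y (+ r))) e))))
                            (cong (_- + r) (sym (σ-fix p q)))

  σ-multiple : ∀ g m x → σ g (x + m * N) ≡ σ g x + m * N
  σ-multiple g m x = quasi-multiple (quasi-σ g id-quasi) m x

  opaque
    rotate unrotate : Subset n → Subset n
    rotate   = pull (λ z → z + + r)
    unrotate = pull (λ z → z - + r)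

    rotate-∋ : ∀ D x → rotate D ∋ x ≡ D ∋ (x + + r)
    rotate-∋ D = pull-∋ (λ z → z + + r) D (λ x m → trans (cong (D ∋_) (lia 3 (λ x u r → ⊢ x ⊕ u ⊕ r ≈ x ⊕ r ⊕ u) x (m * N) (+ r))) (∋-+N D (x + + r) m))

    unrotate-∋ : ∀ D x → unrotate D ∋ x ≡ D ∋ (x - + r)
    unrotate-∋ D = pull-∋ (λ z → z - + r) D (λ x m → trans (cong (D ∋_) (lia 3 (λ x u r → ⊢ x ⊕ u ⊝ r ≈ x ⊝ r ⊕ u) x (m * N) (+ r))) (∋-+N D (x - + r) m))

  rotate-cut : ∀ D a t → map hat (cut D a t) ≡ cut (rotate D) (a - + r) t
  rotate-cut D a zero    = refl
  rotate-cut D a (suc t) = trans (map-letter (D ∋ (a + + t)))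
    (trans (cong (λ g → letter (D ∋ (a + + t)) g (map hat (cut D a t))) (trans (hat-ρ (a + + t)) (cong ρ move)))
      (cong₂ (λ c w → letter c (ρ (a - + r + + t)) w) member (rotate-cut D a t)))
    where
    map-letter : ∀ c {g w} → map hat (letter c g w) ≡ letter c (hat g) (map hat w)
    map-letter true  = refl
    map-letter false = refl
    move : a + + t - + r ≡ a - + r + + t
    move = lia 3 (λ a t r → ⊢ a ⊕ t ⊝ r ≈ a ⊝ r ⊕ t) a (+ t) (+ r)
    member : D ∋ (a + + t) ≡ rotate D ∋ (a - + r + + t)
    member = sym (trans (rotate-∋ D _) (cong (D ∋_) (lia 3 (λ a t r → ⊢ a ⊝ r ⊕ t ⊕ r ≈ a ⊕ t) a (+ t) (+ r))))

  rotate-unrotate : ∀ D → rotate (unrotate D) ≡ D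
  rotate-unrotate D = ∋-ext (λ x → trans (rotate-∋ (unrotate D) x) (trans (unrotate-∋ D (x + + r)) (cong (D ∋_) (lia 2 (λ x r → ⊢ x ⊕ r ⊝ r ≈ x) x (+ r)))))

  unrotate-rotate : ∀ D → unrotate (rotate D) ≡ D
  unrotate-rotate D = ∋-ext (λ x → trans (unrotate-∋ (rotate D) x) (trans (rotate-∋ D (x - + r)) (cong (D ∋_) (lia 2 (λ x r → ⊢ x ⊝ r ⊕ r ≈ x) x (+ r)))))

  rotate-size : ∀ D → ∣ rotate D ∣ ≡ ∣ D ∣
  rotate-size D = trans (sym (length-cut-n (rotate D) (+ 0 - + r))) (trans (cong length (sym (rotate-cut D (+ 0) n)))
    (trans (length-map hat (cut D (+ 0) n)) (length-cut-n D (+ 0))))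

  unrotate-size : ∀ D → ∣ unrotate D ∣ ≡ ∣ D ∣
  unrotate-size D = trans (sym (rotate-size (unrotate D))) (cong ∣_∣ (rotate-unrotate D))

  rotate-u : ∀ D → ∣ D ∣ ℕ.≤ k → map hat (u D) ∼ u (rotate D)
  rotate-u D le = subst (λ w → map hat w ∼ u (rotate D)) (sym (IsCut.word≡ isc)) (subst (_∼ u (rotate D)) (sym (rotate-cut D a k))
    (∼-sym (u-∼-cut (rotate D) (a - + r) (trans (rotate-∋ D _) (trans (cong (D ∋_) (lia 2 (λ a r → ⊢ a ⊝ r ⊝ one ⊕ r ≈ a ⊝ one) a (+ r))) (IsCut.outside isc))))))
    where
    isc = u-cut D le
    a = IsCut.at isc

  -- Q encodes the set of positions y with c − y ∈ Q; reflect g applies s_g to this set.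
  _moves_ : Subset n → ℤ → Bool
  Q moves y = Q ∋ (+ c - y)

  moves-ρ : ∀ Q {x y} → ρ x ≡ ρ y → Q moves x ≡ Q moves y
  moves-ρ Q {x} {y} e = let m , eq = ρ-≡⇒multiple {x} {y} e in
    sym (trans (cong (λ z → Q ∋ (+ c - z)) eq) (trans (cong (Q ∋_) (ring (+ c) x m N)) (∋-+N Q (+ c - x) (- m))))
    where
    ring : ∀ c x m N → c - (x + m * N) ≡ c - x + (- m) * N
    ring = solve-∀

  c-c- : ∀ y → + c - (+ c - y) ≡ y
  c-c- y = lia 2 (λ c y → ⊢ c ⊝ (c ⊝ y) ≈ y) (+ c) y

  opaque
    reflect : G → Subset n → Subset n
    reflect g = pull (λ z → + c - σ g (+ c - z))

    reflect-∋ : ∀ g Q z → reflect g Q ∋ z ≡ Q moves (σ g (+ c - z))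
    reflect-∋ g Q = pull-∋ (λ z → + c - σ g (+ c - z)) Q (λ x m →
      trans (cong (λ z → Q moves (σ g z)) (ring (+ c) x m N)) (trans (cong (Q moves_) (σ-multiple g (- m) (+ c - x)))
        (moves-ρ Q (ρ-periodic (σ g (+ c - x)) (- m)))))
      where
      ring : ∀ c x m N → c - (x + m * N) ≡ c - x + (- m) * N
      ring = solve-∀

  reflect-moves : ∀ g Q y → reflect g Q moves y ≡ Q moves (σ g y)
  reflect-moves g Q y = trans (reflect-∋ g Q (+ c - y)) (cong (λ z → Q moves (σ g z)) (c-c- y))

  reflect-involutive : ∀ g Q → reflect g (reflect g Q) ≡ Q
  reflect-involutive g Q = ∋-ext (λ x → trans (reflect-∋ g (reflect g Q) x) (trans (reflect-moves g Q (σ g (+ c - x)))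
    (trans (cong (Q moves_) (σ-involutive g (+ c - x))) (cong (Q ∋_) (c-c- x)))))

  length-cut-front : ∀ D a t → length (cut D a (suc t)) ≡ length (cut D (a + + 1) t) ℕ.+ bit (D ∋ a)
  length-cut-front D a t = trans (length-letter (D ∋ (a + + t)) _ _) (sym (length-cut-suc D a t))

  cut-cong : ∀ D E a t → (∀ i → i ℕ.< t → D ∋ (a + + i) ≡ E ∋ (a + + i)) → cut D a t ≡ cut E a t
  cut-cong D E a zero    h = refl
  cut-cong D E a (suc t) h = cong₂ (λ c w → letter c (ρ (a + + t)) w) (h t ℕ.≤-refl) (cut-cong D E a t (λ i lt → h i (ℕ.m≤n⇒m≤1+n lt)))

  reflect-size : ∀ g Q → ∣ reflect g Q ∣ ≡ ∣ Q ∣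
  reflect-size g Q = begin
    ∣ Q′ ∣                                                                              ≡⟨ front Q′ ⟩
    length (cut Q′ (a + + 1 + + 1) (k ℕ.∸ 1)) ℕ.+ bit (Q′ ∋ (a + + 1)) ℕ.+ bit (Q′ ∋ a) ≡⟨ cong₂ ℕ._+_ (cong₂ (λ w s → length w ℕ.+ bit s) others second) (cong bit first) ⟩
    length (cut Q (a + + 1 + + 1) (k ℕ.∸ 1)) ℕ.+ bit (Q ∋ a) ℕ.+ bit (Q ∋ (a + + 1))    ≡⟨ ring (length (cut Q (a + + 1 + + 1) (k ℕ.∸ 1))) (bit (Q ∋ a)) (bit (Q ∋ (a + + 1))) ⟩
    length (cut Q (a + + 1 + + 1) (k ℕ.∸ 1)) ℕ.+ bit (Q ∋ (a + + 1)) ℕ.+ bit (Q ∋ a)    ≡⟨ sym (front Q) ⟩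
    ∣ Q ∣                                                                               ∎
    where
    open ≡-Reasoning
    Q′ = reflect g Q
    -- In the coordinate `c - y` the places `g + 1` and `g` become `a` and `a + 1`. Starting the
    -- count at `a` puts the two exchanged memberships first and leaves the others untouched.
    a = + c - ⌜ g ⌝ - + 1
    ring : ∀ x y z → x ℕ.+ y ℕ.+ z ≡ x ℕ.+ z ℕ.+ y
    ring x y z = trans (ℕ.+-assoc x y z) (trans (cong (x ℕ.+_) (ℕ.+-comm y z)) (sym (ℕ.+-assoc x z y)))
    front : ∀ D → ∣ D ∣ ≡ length (cut D (a + + 1 + + 1) (k ℕ.∸ 1)) ℕ.+ bit (D ∋ (a + + 1)) ℕ.+ bit (D ∋ a)
    front D = trans (sym (length-cut-n D a)) (trans (length-cut-front D a k) (cong (ℕ._+ bit (D ∋ a))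
      (trans (cong (λ t → length (cut D (a + + 1) t)) (sym (ℕ.m+[n∸m]≡n 1≤k))) (length-cut-front D (a + + 1) (k ℕ.∸ 1)))))
    first : Q′ ∋ a ≡ Q ∋ (a + + 1)
    first = trans (reflect-∋ g Q a) (trans (cong (λ z → Q moves (σ g z)) (lia 2 (λ c g → ⊢ c ⊝ (c ⊝ g ⊝ one) ≈ g ⊕ one) (+ c) ⌜ g ⌝))
      (trans (cong (Q moves_) (σ-hi (ρ-⌜⌝ g))) (cong (Q ∋_) (lia 2 (λ c g → ⊢ c ⊝ g ≈ c ⊝ g ⊝ one ⊕ one) (+ c) ⌜ g ⌝))))
    second : Q′ ∋ (a + + 1) ≡ Q ∋ a
    second = trans (reflect-∋ g Q (a + + 1)) (trans (cong (λ z → Q moves (σ g z)) (lia 2 (λ c g → ⊢ c ⊝ (c ⊝ g ⊝ one ⊕ one) ≈ g) (+ c) ⌜ g ⌝))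
      (trans (cong (Q moves_) (σ-lo (ρ-⌜⌝ g))) (cong (Q ∋_) (lia 2 (λ c g → ⊢ c ⊝ (g ⊕ one) ≈ c ⊝ g ⊝ one) (+ c) ⌜ g ⌝))))
    others : cut Q′ (a + + 1 + + 1) (k ℕ.∸ 1) ≡ cut Q (a + + 1 + + 1) (k ℕ.∸ 1)
    others = cut-cong Q′ Q (a + + 1 + + 1) (k ℕ.∸ 1) λ i lt → let z = a + + 1 + + 1 + + i ; y = ⌜ g ⌝ - + 1 - + i in
      trans (reflect-∋ g Q z) (trans (cong (λ t → Q moves (σ g t)) (lia 3 (λ c g i → ⊢ c ⊝ (c ⊝ g ⊝ one ⊕ one ⊕ one ⊕ i) ≈ g ⊝ one ⊝ i) (+ c) ⌜ g ⌝ (+ i)))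
        (trans (cong (Q moves_) (σ-fix
          (λ e → ρ-≢ {y} {⌜ g ⌝} (lia 2 (λ g i → con (+ 0) ≲ i ⇒ ⊢ g ⊝ one ⊝ i ≺ g) ⌜ g ⌝ (+ i) (+≤+ ℕ.z≤n))
            (lia 4 (λ g i k N → i ≺ k ⇒ k ≈ N ⊝ con (+ 2) ⇒ ⊢ g ≺ g ⊝ one ⊝ i ⊕ N) ⌜ g ⌝ (+ i) (+ (k ℕ.∸ 1)) N (+<+ lt) +k≡) (trans e (sym (ρ-⌜⌝ g))))
          (λ e → ρ-≢ {y - + 1} {⌜ g ⌝} (lia 2 (λ g i → con (+ 0) ≲ i ⇒ ⊢ g ⊝ one ⊝ i ⊝ one ≺ g) ⌜ g ⌝ (+ i) (+≤+ ℕ.z≤n))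
            (lia 4 (λ g i k N → i ≺ k ⇒ k ≈ N ⊝ con (+ 2) ⇒ ⊢ g ≺ g ⊝ one ⊝ i ⊝ one ⊕ N) ⌜ g ⌝ (+ i) (+ (k ℕ.∸ 1)) N (+<+ lt) +k≡) (trans e (sym (ρ-⌜⌝ g))))))
        (cong (Q ∋_) (lia 3 (λ c g i → ⊢ c ⊝ (g ⊝ one ⊝ i) ≈ c ⊝ g ⊝ one ⊕ one ⊕ one ⊕ i) (+ c) ⌜ g ⌝ (+ i)))))

  []-in-box : ∀ {m l} → InBox m l []
  []-in-box = record { decreasing = λ _ → ℕ.z≤n ; positive = [] ; width = ℕ.z≤n ; height = ℕ.z≤n }

  wider-box : ∀ {m l ν} → InBox m l ν → InBox (suc m) l ν
  wider-box bx = record { decreasing = decreasing bx ; positive = positive bx ; width = ℕ.m≤n⇒m≤1+n (width bx) ; height = height bx }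

  ∷-in-box : ∀ {m l ν} → InBox (suc m) l ν → InBox (suc m) (suc l) (suc m ∷ ν)
  ∷-in-box bx = record
    { decreasing = λ { zero → width bx ; (suc i) → decreasing bx i } ; positive = ℕ.s≤s ℕ.z≤n ∷ positive bx
    ; width = ℕ.≤-refl ; height = ℕ.s≤s (height bx) }

  pIn-box : ∀ l m {ν} → ν ∈ pIn l m → InBox m l ν
  pIn-box zero    m       (here refl) = []-in-box
  pIn-box (suc l) zero    (here refl) = []-in-box
  pIn-box (suc l) (suc m) {ν} ν∈ with ∈-++⁻ (pIn (suc l) m) (subst (ν ∈_) (pIn-step l m) ν∈)
  ... | inj₁ p = wider-box (pIn-box (suc l) m p)
  ... | inj₂ p with ∈-map⁻ (suc m ∷_) p
  ...   | ν′ , q , refl = ∷-in-box (pIn-box l (suc m) q)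

  ∑-only-empty : ∀ l m (h : List ℕ → ℤ) → (∀ x ν → InBox m l (x ∷ ν) → h (x ∷ ν) ≡ + 0) → ∑ h (pIn l m) ≡ h []
  ∑-only-empty zero    m       h z = ℤ.+-identityʳ _
  ∑-only-empty (suc l) zero    h z = ℤ.+-identityʳ _
  ∑-only-empty (suc l) (suc m) h z = trans (cong (∑ h) (pIn-step l m)) (trans (∑-++ h (pIn (suc l) m) _)
    (trans (cong₂ _+_ (∑-only-empty (suc l) m h (λ x ν bx → z x ν (wider-box bx)))
                      (trans (∑-map h (suc m ∷_) (pIn l (suc m))) (∑-zero (h ∘ (suc m ∷_)) (pIn l (suc m))
                        (λ p → z (suc m) _ (∷-in-box (pIn-box l (suc m) p))))))
           (ℤ.+-identityʳ _)))

  -- The sum over the rectangle and its commutation with the 𝐡_i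

  module Rectangle (b : List ℕ → W) (reduced : ∀ ν → ReducedRep k (Vword k c r ν) (b ν)) where

    b-good : ∀ ν → Good (b ν) id
    b-good ν = reduced-good (b ν) (proj₁ (reduced ν))

    π-b : ∀ ν x → π (b ν) x ≡ π (Vword k c r ν) x
    π-b ν x = sym (EqW-π (proj₂ (reduced ν)) x)

    X : Comb k
    X = sumC k (map (λ ν → uA k (b ν)) (pIn r c))

    w : Subset n → W
    w Q = b (shape Q)

    ⟦X⟧-pIn : ∀ φ f → ⟦ X ⟧ φ f ≡ ∑ (λ ν → ev φ (b ν) f) (pIn r c)
    ⟦X⟧-pIn φ f = go (pIn r c)
      where
      go : ∀ νs → ⟦ sumC k (map (λ ν → uA k (b ν)) νs) ⟧ φ f ≡ ∑ (λ ν → ev φ (b ν) f) νs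
      go []       = refl
      go (ν ∷ νs) = cong₂ _+_ (ℤ.*-identityˡ (ev φ (b ν) f)) (go νs)

    ⟦X⟧-subsets : ∀ φ f → ⟦ X ⟧ φ f ≡ ∑ (λ Q → ev φ (w Q) f) (subsets r)
    ⟦X⟧-subsets φ f = trans (⟦X⟧-pIn φ f) (∑-rectangle (λ ν → ev φ (b ν) f))

    -- The inverse of the permutation of `w Q`, as `π-target` and `target-π` show. It depends on `Q`
    -- alone, so all further comparisons avoid the letters of the chosen words.
    target : Subset n → ℤ → ℤ
    target Q y = pick (Q moves y) (y + + c) (y - + r)

    module _ (Q : Subset n) (size : ∣ Q ∣ ≡ r) where

      π-target : ∀ y → π (w Q) (target Q y) ≡ y
      π-target y = by-case (Q moves y) refl
        where
        by-case : ∀ c′ → Q moves y ≡ c′ → π (w Q) (target Q y) ≡ y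
        by-case true  e = trans (cong (λ p → π (w Q) (pick p (y + + c) (y - + r))) e) (trans (π-b (shape Q) _) (Shape.forward Q size y e))
        by-case false e = trans (cong (λ p → π (w Q) (pick p (y + + c) (y - + r))) e) (trans (π-b (shape Q) _) (Shape.backward Q size y e))

      target-π : ∀ x → target Q (π (w Q) x) ≡ x
      target-π x = π-injective (w Q) (π-target (π (w Q) x))

      π-left : ∀ y → π (w Q) (y - + r) ≡ pick (Q moves y) (y - N) y
      π-left y = by-case (Q moves y) refl
        where
        by-case : ∀ c′ → Q moves y ≡ c′ → π (w Q) (y - + r) ≡ pick (Q moves y) (y - N) y
        by-case true  e = trans (lia 3 (λ p y N → p ⊕ N ≈ y ⇒ ⊢ p ≈ y ⊝ N) (π (w Q) (y - + r)) y N
            (trans (sym (π-periodic (w Q) (y - + r))) (trans (cong (π (w Q)) (lia 4 (λ y c r N → N ≈ c ⊕ r ⇒ ⊢ y ⊝ r ⊕ N ≈ y ⊕ c) y (+ c) (+ r) N N≡c+r))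
              (trans (cong (π (w Q)) (cong (λ p → pick p (y + + c) (y - + r)) (sym e))) (π-target y))))) (cong (λ p → pick p (y - N) y) (sym e))
        by-case false e = trans (trans (cong (π (w Q)) (cong (λ p → pick p (y + + c) (y - + r)) (sym e))) (π-target y)) (cong (λ p → pick p (y - N) y) (sym e))

    -- u_{v} u_g = u_{g − r} u_{v′} for the translations v, v′ attached to Q and to reflect g Q
    module Step (Q : Subset n) (size : ∣ Q ∣ ≡ r) (g : G) where

      Q′ : Subset n
      Q′ = reflect g Q

      size′ : ∣ Q′ ∣ ≡ r
      size′ = trans (reflect-size g Q) size

      x : ℤ
      x = ⌜ g ⌝

      moves′-x : Q′ moves x ≡ Q moves (x + + 1)
      moves′-x = trans (reflect-moves g Q x) (cong (Q moves_) (σ-lo (ρ-⌜⌝ g)))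

      moves′-x+1 : Q′ moves (x + + 1) ≡ Q moves x
      moves′-x+1 = trans (reflect-moves g Q (x + + 1)) (cong (Q moves_) (σ-hi (ρ-⌜⌝ g)))

      left-value : π (w Q′) (x - + r) ≡ pick (Q moves (x + + 1)) (x - N) x
      left-value = trans (π-left Q′ size′ x) (cong (λ p → pick p (x - N) x) moves′-x)

      right-value : π (w Q′) (x - + r + + 1) ≡ pick (Q moves x) (x + + 1 - N) (x + + 1)
      right-value = trans (cong (π (w Q′)) (lia 2 (λ x r → ⊢ x ⊝ r ⊕ one ≈ x ⊕ one ⊝ r) x (+ r)))
        (trans (π-left Q′ size′ (x + + 1)) (cong (λ p → pick p (x + + 1 - N) (x + + 1)) moves′-x+1))

      asc-hat : ∀ p q → Q moves x ≡ p → Q moves (x + + 1) ≡ q → pick q (x - N) x < pick p (x + + 1 - N) (x + + 1) → Asc (hat g) (π (w Q′))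
      asc-hat p q ep eq lt = asc-from (quasi-π (w Q′) id-quasi) (x - + r) refl
        (subst₂ _<_ (sym (trans left-value (cong (λ s → pick s (x - N) x) eq))) (sym (trans right-value (cong (λ s → pick s (x + + 1 - N) (x + + 1)) ep))) lt)

      -- On positions the identity holds without exception: reflecting the set along `σ g` preserves
      -- which way each value goes, and both possible shifts carry `σ g` to `σ (hat g)`. Only
      -- reducedness of the two words remains to be compared.
      same-π : ∀ z → π (w Q ++ [ g ]) z ≡ π (hat g ∷ w Q′) z
      same-π z = trans (π-++ (w Q) [ g ] z) (sym (trans (cong (π (w Q′)) moved) (π-target Q′ size′ (σ g y))))
        where
        y = π (w Q) z
        kept : Q′ moves (σ g y) ≡ Q moves y
        kept = trans (reflect-moves g Q (σ g y)) (cong (Q moves_) (σ-involutive g y))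
        by-pick : ∀ p → σ (hat g) (pick p (y + + c) (y - + r)) ≡ pick p (σ g y + + c) (σ g y - + r)
        by-pick false = σ-hat g y
        by-pick true  = trans (cong (σ (hat g)) (lia 4 (λ y c r N → N ≈ c ⊕ r ⇒ ⊢ y ⊕ c ≈ y ⊝ r ⊕ N) y (+ c) (+ r) N N≡c+r))
          (trans (σ-periodic (hat g) (y - + r)) (trans (cong (_+ N) (σ-hat g y)) (lia 4 (λ y c r N → N ≈ c ⊕ r ⇒ ⊢ y ⊝ r ⊕ N ≈ y ⊕ c) (σ g y) (+ c) (+ r) N N≡c+r)))
        moved : σ (hat g) z ≡ target Q′ (σ g y)
        moved = trans (cong (σ (hat g)) (sym (target-π Q size z))) (trans (by-pick (Q moves y)) (cong (λ p → pick p (σ g y + + c) (σ g y - + r)) (sym kept)))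

      -- The places sent to `x` and `x + 1` are already inverted by `π (w Q)`, so another `g` undoes
      -- an inversion and the left word is not reduced. On the other side `hat g` meets a descent.
      -- Both products vanish in 𝔸.
      module Blocked (e : Q moves x ≡ true) (e′ : Q moves (x + + 1) ≡ false) where

        left-bad : ¬ Good (w Q ++ [ g ]) id
        left-bad gd = ℤ.<-asym (x<x+1 x) (subst₂ _<_ (trans (cong (σ g) π-p′) (σ-lo (ρ-⌜⌝ g))) (trans (cong (σ g) π-p) (σ-hi (ρ-⌜⌝ g)))
            (good⇒inverts (quasi-σ g id-quasi) (w Q) (proj₁ (good-++ (w Q) [ g ] gd)) {p} {p′}
              (lia 4 (λ x c r N → N ≈ c ⊕ r ⇒ con (+ 2) ≲ N ⇒ ⊢ x ⊕ one ⊝ r ≺ x ⊕ c) x (+ c) (+ r) N N≡c+r 2≤N)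
              (subst₂ _<_ (sym π-p′) (sym π-p) (x<x+1 x))))
          where
          p = x + + 1 - + r
          p′ = x + + c
          π-p : π (w Q) p ≡ x + + 1
          π-p = trans (cong (λ s → π (w Q) (pick s (x + + 1 + + c) p)) (sym e′)) (π-target Q size (x + + 1))
          π-p′ : π (w Q) p′ ≡ x
          π-p′ = trans (cong (λ s → π (w Q) (pick s p′ (x - + r))) (sym e)) (π-target Q size x)

        right-bad : ¬ Good (hat g ∷ w Q′) id
        right-bad (_ , up) = ℤ.<-asym (asc-at (quasi-π (w Q′) id-quasi) (x - + r) refl up)
          (subst₂ _<_ (sym (trans right-value (cong (λ s → pick s (x + + 1 - N) (x + + 1)) e))) (sym (trans left-value (cong (λ s → pick s (x - N) x) e′)))
            (lia 2 (λ x N → con (+ 2) ≲ N ⇒ ⊢ x ⊕ one ⊝ N ≺ x) x N 2≤N))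

      -- Appending `g` could only spoil an inversion whose two values are the neighbours exchanged
      -- by `σ g`. By `target`, such an inversion exists only when the lower value moves by `c` and
      -- the upper one by `- r`, the excluded case.
      left-good : ¬ (Q moves x ≡ true × Q moves (x + + 1) ≡ false) → Good (w Q ++ [ g ]) id
      left-good free = good-++⁻ (w Q) [ g ] (inverts⇒good (quasi-σ g id-quasi) (w Q) (b-good (shape Q)) inv) (tt , x<x+1 x)
        where
        impossible : ∀ {p p′} → p < p′ → ∀ y → π (w Q) p′ ≡ y → π (w Q) p ≡ y + + 1 → ρ y ≡ g → ⊥
        impossible {p} {p′} lt y e′ e ρy = by-case (Q moves y) (Q moves (y + + 1)) refl refl
          where
          p≡ : p ≡ target Q (y + + 1)
          p≡ = trans (sym (target-π Q size p)) (cong (target Q) e)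
          p′≡ : p′ ≡ target Q y
          p′≡ = trans (sym (target-π Q size p′)) (cong (target Q) e′)
          order : ∀ s t → Q moves y ≡ s → Q moves (y + + 1) ≡ t → pick t (y + + 1 + + c) (y + + 1 - + r) < pick s (y + + c) (y - + r)
          order s t es et = subst₂ _<_ (trans p≡ (cong (λ q → pick q (y + + 1 + + c) (y + + 1 - + r)) et)) (trans p′≡ (cong (λ q → pick q (y + + c) (y - + r)) es)) lt
          by-case : ∀ s t → Q moves y ≡ s → Q moves (y + + 1) ≡ t → ⊥
          by-case true  false es et = free (trans (moves-ρ Q (trans (ρ-⌜⌝ g) (sym ρy))) es , trans (moves-ρ Q (ρ-cong+ (+ 1) (trans (ρ-⌜⌝ g) (sym ρy)))) et)
          by-case true  true  es et = ℤ.<-asym (order true true es et) (lia 2 (λ y c → ⊢ y ⊕ c ≺ y ⊕ one ⊕ c) y (+ c))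
          by-case false false es et = ℤ.<-asym (order false false es et) (lia 2 (λ y r → ⊢ y ⊝ r ≺ y ⊕ one ⊝ r) y (+ r))
          by-case false true  es et = ℤ.<-asym (order false true es et) (lia 4 (λ y c r N → N ≈ c ⊕ r ⇒ con (+ 2) ≲ N ⇒ ⊢ y ⊝ r ≺ y ⊕ one ⊕ c) y (+ c) (+ r) N N≡c+r 2≤N)
        inv : Inverts (w Q) (id ∘ σ g)
        inv {p} {p′} lt h = by-order (σ-order g h)
          where
          by-order : σ g (π (w Q) p′) < σ g (π (w Q) p) ⊎ (ρ (π (w Q) p′) ≡ g × π (w Q) p ≡ π (w Q) p′ + + 1) → σ g (π (w Q) p′) < σ g (π (w Q) p)
          by-order (inj₁ ok)       = ok
          by-order (inj₂ (e , eq)) = ⊥-elim (impossible lt (π (w Q) p′) refl eq e)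

      -- Of the four membership patterns at `x` and `x + 1`, one makes both words vanish. In the
      -- other three both are reduced with the same permutation, hence braid equivalent.
      exchange-word : ∀ {φ} → Ext φ → ∀ {f} → Quasi f → ev φ (w Q ++ [ g ]) f ≡ ev φ (hat g ∷ w Q′) f
      exchange-word {φ} ex {f} qf = by-case (Q moves x) (Q moves (x + + 1)) refl refl
        where
        equal : ∀ p q → Q moves x ≡ p → Q moves (x + + 1) ≡ q → ¬ (p ≡ true × q ≡ false) → pick q (x - N) x < pick p (x + + 1 - N) (x + + 1) →
          ev φ (w Q ++ [ g ]) f ≡ ev φ (hat g ∷ w Q′) f
        equal p q ep eq free lt = ev-∼ ex qf (matsumoto id-quasi id-sorted (w Q ++ [ g ]) (hat g ∷ w Q′)
          (left-good (λ (a , b) → free (trans (sym ep) a , trans (sym eq) b))) (b-good (shape Q′) , asc-hat p q ep eq lt) same-π)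
        by-case : ∀ p q → Q moves x ≡ p → Q moves (x + + 1) ≡ q → ev φ (w Q ++ [ g ]) f ≡ ev φ (hat g ∷ w Q′) f
        by-case true false ep eq = trans (ev-bad φ {w Q ++ [ g ]} (Blocked.left-bad ep eq ∘ good-id qf (w Q ++ [ g ])))
          (sym (ev-bad φ {hat g ∷ w Q′} (Blocked.right-bad ep eq ∘ good-id qf (hat g ∷ w Q′))))
        by-case true  true  ep eq = equal true true ep eq (λ ()) (lia 2 (λ x N → ⊢ x ⊝ N ≺ x ⊕ one ⊝ N) x N)
        by-case false false ep eq = equal false false ep eq (λ ()) (x<x+1 x)
        by-case false true  ep eq = equal false true ep eq (λ ()) (lia 2 (λ x N → con (+ 2) ≲ N ⇒ ⊢ x ⊝ N ≺ x ⊕ one) x N 2≤N)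

    X-letter : ∀ g {φ} → Ext φ → ∀ {f} → Quasi f → ev (⟦ X ⟧ φ) [ g ] f ≡ ⟦ X ⟧ (ev φ [ hat g ]) f
    X-letter g {φ} ex {f} qf = begin
      ev (⟦ X ⟧ φ) [ g ] f                                              ≡⟨ ev-≗ {⟦ X ⟧ φ} {λ h → ∑ (λ Q → ev φ (w Q) h) (subsets r)} [ g ] f (⟦X⟧-subsets φ (f ∘ π [ g ])) ⟩
      ev (λ h → ∑ (λ Q → ev φ (w Q) h) (subsets r)) [ g ] f             ≡⟨ ev-∑ (λ Q → ev φ (w Q)) (subsets r) [ g ] f ⟩
      ∑ (λ Q → ev (ev φ (w Q)) [ g ] f) (subsets r)                     ≡⟨ ∑-cong (subsets r) (λ {Q} _ → sym (ev-++ ex (w Q) [ g ] f)) ⟩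
      ∑ (λ Q → ev φ (w Q ++ [ g ]) f) (subsets r)                       ≡⟨ ∑-cong (subsets r) (λ {Q} m → Step.exchange-word Q (∈-subsets⁻ m) g ex qf) ⟩
      ∑ (λ Q → ev φ (hat g ∷ w (reflect g Q)) f) (subsets r)            ≡⟨ ∑-reindex r (reflect g) (reflect g) (reflect-size g) (reflect-size g) (reflect-involutive g) (reflect-involutive g) (λ Q → ev φ (hat g ∷ w Q) f) ⟩
      ∑ (λ Q → ev φ (hat g ∷ w Q) f) (subsets r)                        ≡⟨ ∑-cong (subsets r) (λ {Q} _ → ev-++ ex [ hat g ] (w Q) f) ⟩
      ∑ (λ Q → ev (ev φ [ hat g ]) (w Q) f) (subsets r)                 ≡⟨ sym (⟦X⟧-subsets (ev φ [ hat g ]) f) ⟩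
      ⟦ X ⟧ (ev φ [ hat g ]) f                                          ∎
      where open ≡-Reasoning

    X-word : ∀ a {φ} → Ext φ → ∀ {f} → Quasi f → ev (⟦ X ⟧ φ) a f ≡ ⟦ X ⟧ (ev φ (map hat a)) f
    X-word []      ex qf = refl
    X-word (g ∷ a) {φ} ex {f} qf = begin
      ev (⟦ X ⟧ φ) (g ∷ a) f                       ≡⟨ ev-++ (⟦⟧-ext X ex) [ g ] a f ⟩
      ev (ev (⟦ X ⟧ φ) [ g ]) a f                  ≡⟨ ev-≗ {ev (⟦ X ⟧ φ) [ g ]} {⟦ X ⟧ (ev φ [ hat g ])} a f (X-letter g ex (quasi-π a qf)) ⟩
      ev (⟦ X ⟧ (ev φ [ hat g ])) a f              ≡⟨ X-word a (ev-ext ex [ hat g ]) qf ⟩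
      ⟦ X ⟧ (ev (ev φ [ hat g ]) (map hat a)) f    ≡⟨ ⟦⟧-cong X {ev (ev φ [ hat g ]) (map hat a)} {ev φ (hat g ∷ map hat a)} qf (λ {h} _ → sym (ev-++ ex [ hat g ] (map hat a) h)) ⟩
      ⟦ X ⟧ (ev φ (hat g ∷ map hat a)) f           ∎
      where open ≡-Reasoning

    -- Each letter crosses with index changed by `hat`, which turns `u D` into `u (rotate D)`.
    -- Rotation permutes the sets of size `i`, so the sum is unchanged.
    X-h : ∀ {i} → i ℕ.≤ k → ∀ {φ} → Ext φ → ∀ {f} → Quasi f → ⟦ hA k i ⟧ (⟦ X ⟧ φ) f ≡ ⟦ X ⟧ (⟦ hA k i ⟧ φ) f
    X-h {i} i≤k {φ} ex {f} qf = begin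
      ⟦ hA k i ⟧ (⟦ X ⟧ φ) f                             ≡⟨ ⟦hA⟧ i (⟦ X ⟧ φ) f ⟩
      ∑ (λ D → ev (⟦ X ⟧ φ) (u D) f) (subsets i)         ≡⟨ ∑-cong (subsets i) (λ {D} _ → X-word (u D) ex qf) ⟩
      ∑ (λ D → ⟦ X ⟧ (ev φ (map hat (u D))) f) (subsets i) ≡⟨ ∑-cong (subsets i) (λ {D} m → ⟦⟧-cong X {ev φ (map hat (u D))} {ev φ (u (rotate D))} qf (λ qh → ev-∼ ex qh (rotate-u D (subst (ℕ._≤ k) (sym (∈-subsets⁻ m)) i≤k)))) ⟩
      ∑ (λ D → ⟦ X ⟧ (ev φ (u (rotate D))) f) (subsets i) ≡⟨ ∑-reindex i rotate unrotate rotate-size unrotate-size unrotate-rotate rotate-unrotate (λ D → ⟦ X ⟧ (ev φ (u D)) f) ⟩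
      ∑ (λ D → ⟦ X ⟧ (ev φ (u D)) f) (subsets i)         ≡⟨ sym (⟦⟧-∑ X (λ D → ev φ (u D)) (subsets i) f) ⟩
      ⟦ X ⟧ (λ h → ∑ (λ D → ev φ (u D) h) (subsets i)) f ≡⟨ ⟦⟧-cong X {λ h → ∑ (λ D → ev φ (u D) h) (subsets i)} {⟦ hA k i ⟧ φ} qf (λ {h} _ → sym (⟦hA⟧ i φ h)) ⟩
      ⟦ X ⟧ (⟦ hA k i ⟧ φ) f                             ∎
      where open ≡-Reasoning

    -- At vac only the term of the empty partition survives.

    -- The first bead `x` and a free place raised by `N` form an inversion whose two values lie
    -- between 1 and `N`. There `vac` is constantly 0 and cannot separate them.
    nonempty-bad : ∀ x ν → InBox c r (x ∷ ν) → ¬ Good (b (x ∷ ν)) vac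
    nonempty-bad x ν box gd = ℤ.<-irrefl refl (subst₂ _<_ (trans (cong vac π-p′) (vac≡0 (+ x) (+<+ 1≤x) (ℤ.≤-trans (+≤+ x≤c) (subst (+ c ≤_) (sym N≡c+r) (lia 2 (λ c r → con (+ 0) ≺ r ⇒ ⊢ c ≲ c ⊕ r) (+ c) (+ r) 0<r)))))
        (trans (cong vac π-p) (vac≡0 (y + N) (lia 2 (λ l N → l ≺ one ⊕ N ⇒ ⊢ con (+ 0) ≺ one ⊝ l ⊕ N) (+ l) N (ℤ.≤-<-trans (+≤+ l≤r) r<N+1)) (lia 2 (λ l N → one ≲ l ⇒ ⊢ one ⊝ l ⊕ N ≲ N) (+ l) N (+≤+ (ℕ.s≤s ℕ.z≤n)))))
        (good⇒inverts vac-quasi (b (x ∷ ν)) gd {p} {p′} (lia 3 (λ x l c → one ≲ x ⇒ one ≲ l ⇒ ⊢ one ⊝ l ⊕ c ≺ x ⊕ c) (+ x) (+ l) (+ c) (+≤+ 1≤x) (+≤+ (ℕ.s≤s ℕ.z≤n)))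
          (subst₂ _<_ (sym π-p′) (sym π-p) (lia 5 (λ x l c r N → x ≲ c ⇒ l ≲ r ⇒ N ≈ c ⊕ r ⇒ one ≲ l ⇒ ⊢ x ≺ one ⊝ l ⊕ N) (+ x) (+ l) (+ c) (+ r) N (+≤+ x≤c) (+≤+ l≤r) N≡c+r (+≤+ (ℕ.s≤s ℕ.z≤n))))))
      where
      open Track (x ∷ ν) box using (V; bead-forward; gap-backward)
      l = suc (length ν)
      -- The free place belonging to the first column.
      y = + 1 - + l
      p = y + + c
      p′ = + x + + c
      1≤x : 1 ℕ.≤ x
      1≤x = All.head (InBox.positive box)
      x≤c : x ℕ.≤ c
      x≤c = InBox.width box
      l≤r : l ℕ.≤ r
      l≤r = InBox.height box
      r<N+1 : + r < + 1 + N
      r<N+1 = lia 3 (λ c r N → N ≈ c ⊕ r ⇒ con (+ 0) ≺ c ⇒ ⊢ r ≺ one ⊕ N) (+ c) (+ r) N N≡c+r 0<c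
      π-p′ : π (b (x ∷ ν)) p′ ≡ + x
      π-p′ = trans (π-b (x ∷ ν) p′) (trans (cong (π V) (cong (_+ + c) (sym (ℤ.+-identityʳ (+ x))))) (trans (bead-forward 0 1≤r) (ℤ.+-identityʳ (+ x))))
      not-here : ∀ i → i ℕ.< r → β (x ∷ ν) i ≢ y
      not-here i i<r e = by-row (i ℕ.<? l)
        where
        by-row : Dec (i ℕ.< l) → ⊥
        by-row (yes i<l) = ℤ.<-irrefl refl (lia 4 (λ p i l y → p ⊝ i ≈ one ⊝ l ⇒ one ≲ p ⇒ i ≺ l ⇒ y ≈ y ⇒ ⊢ y ≺ y) (+ part (x ∷ ν) i) (+ i) (+ l) y e (+≤+ (row-positive i i<l (InBox.positive box))) (+<+ i<l) refl)
          where
          row-positive : ∀ {xs} i → i ℕ.< length xs → All (1 ℕ.≤_) xs → 1 ℕ.≤ part xs i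
          row-positive zero    _          (p ∷ _)  = p
          row-positive (suc i) (ℕ.s≤s lt) (_ ∷ ps) = row-positive i lt ps
        by-row (no ¬i<l) = ℤ.<-irrefl refl (lia 3 (λ i l y → con (+ 0) ⊝ i ≈ one ⊝ l ⇒ l ≲ i ⇒ ⊢ y ≺ y) (+ i) (+ l) y
          (trans (cong (λ p → + p - + i) (sym (part-beyond (x ∷ ν) i (ℕ.≮⇒≥ ¬i<l)))) e) (+≤+ (ℕ.≮⇒≥ ¬i<l)))
      π-p : π (b (x ∷ ν)) p ≡ y + N
      π-p = trans (π-b (x ∷ ν) p) (trans (cong (π V) (lia 4 (λ y c r N → N ≈ c ⊕ r ⇒ ⊢ y ⊕ c ≈ y ⊝ r ⊕ N) y (+ c) (+ r) N N≡c+r))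
        (trans (π-periodic V (y - + r)) (cong (_+ N) (gap-backward y (lia 2 (λ l r → l ≲ r ⇒ ⊢ ⊖ r ≺ one ⊝ l) (+ l) (+ r) (+≤+ l≤r))
          (lia 2 (λ l c → one ≲ l ⇒ con (+ 0) ≺ c ⇒ ⊢ one ⊝ l ≲ c) (+ l) (+ c) (+≤+ (ℕ.s≤s ℕ.z≤n)) 0<c) not-here))))

    b[] : W
    b[] = b []

    π-upper : ∀ y → + 0 < y → y ≤ + c → π b[] (y - + r) ≡ y
    π-upper y lo hi = trans (π-b [] _) (Track.gap-backward [] []-in-box y (lia 2 (λ r y → con (+ 0) ≺ r ⇒ con (+ 0) ≺ y ⇒ ⊢ ⊖ r ≺ y) (+ r) y 0<r lo) hi
      (λ i _ e → ℤ.<-irrefl refl (lia 2 (λ i y → con (+ 0) ⊝ i ≈ y ⇒ con (+ 0) ≺ y ⇒ con (+ 0) ≲ i ⇒ ⊢ y ≺ y) (+ i) y e lo (+≤+ ℕ.z≤n))))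

    π-lower : ∀ y → - + r < y → y ≤ + 0 → π b[] (y + + c) ≡ y
    π-lower y lo hi = trans (π-b [] _) (subst (λ y → π (Vword k c r []) (y + + c) ≡ y) β≡ (Track.bead-forward [] []-in-box i i<r))
      where
      i = Data.Integer.∣ y ∣
      -i : + i ≡ - y
      -i = abs y hi
        where
        abs : ∀ y → y ≤ + 0 → + Data.Integer.∣ y ∣ ≡ - y
        abs (+ zero)  _ = refl
        abs -[1+ m ]  _ = refl
        abs (+ suc m) (+≤+ ())
      β≡ : + 0 - + i ≡ y
      β≡ = lia 2 (λ i y → i ≈ ⊖ y ⇒ ⊢ con (+ 0) ⊝ i ≈ y) (+ i) y -i
      i<r : i ℕ.< r
      i<r = ℤ.drop‿+<+ (lia 3 (λ i y r → i ≈ ⊖ y ⇒ ⊖ r ≺ y ⇒ ⊢ i ≺ r) (+ i) y (+ r) -i lo)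

    -- The places `y - r` with 0 < `y` ≤ `c` and `y + c` with - `r` < `y` ≤ 0 together fill one
    -- window of length `N`, so up to translation every place has one of these forms.
    data Origin (p : ℤ) : Set where
      low  : ∀ y m → - + r < y → y ≤ + 0 → p ≡ y + + c + m * N → π b[] p ≡ y + m * N → Origin p
      high : ∀ y m → + 0 < y → y ≤ + c → p ≡ y - + r + m * N → π b[] p ≡ y + m * N → Origin p

    origin : ∀ p → Origin p
    origin p = by-window (window (- + r + + 1) p)
      where
      by-window : (Σ ℤ λ x → Σ ℤ λ m → - + r + + 1 ≤ x × x < - + r + + 1 + N × p ≡ x + m * N) → Origin p
      by-window (x , m , lo , hi , e) = by-side (x <? + c - + r + + 1)
        where
        by-side : Dec (x < + c - + r + + 1) → Origin p
        by-side (yes lt) = high y m 0<y y≤c (trans e (cong (_+ m * N) (lia 2 (λ x r → ⊢ x ≈ x ⊕ r ⊝ r) x (+ r))))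
            (trans (cong (π b[]) (trans e (cong (_+ m * N) (lia 2 (λ x r → ⊢ x ≈ x ⊕ r ⊝ r) x (+ r))))) (trans (π-multiple b[] m (y - + r)) (cong (_+ m * N) (π-upper y 0<y y≤c))))
          where
          y = x + + r
          0<y = lia 2 (λ x r → ⊖ r ⊕ one ≲ x ⇒ ⊢ con (+ 0) ≺ x ⊕ r) x (+ r) lo
          y≤c = lia 3 (λ x c r → x ≺ c ⊝ r ⊕ one ⇒ ⊢ x ⊕ r ≲ c) x (+ c) (+ r) lt
        by-side (no ¬lt) = low y m -r<y y≤0 (trans e (cong (_+ m * N) (lia 2 (λ x c → ⊢ x ≈ x ⊝ c ⊕ c) x (+ c))))
            (trans (cong (π b[]) (trans e (cong (_+ m * N) (lia 2 (λ x c → ⊢ x ≈ x ⊝ c ⊕ c) x (+ c))))) (trans (π-multiple b[] m (y + + c)) (cong (_+ m * N) (π-lower y -r<y y≤0))))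
          where
          y = x - + c
          -r<y = lia 3 (λ x c r → c ⊝ r ⊕ one ≲ x ⇒ ⊢ ⊖ r ≺ x ⊝ c) x (+ c) (+ r) (ℤ.≮⇒≥ ¬lt)
          y≤0 = lia 4 (λ x c r N → x ≺ ⊖ r ⊕ one ⊕ N ⇒ N ≈ c ⊕ r ⇒ ⊢ x ⊝ c ≲ con (+ 0)) x (+ c) (+ r) N hi N≡c+r

    vac-multiple : ∀ y m → vac (y + m * N) ≡ vac y + m
    vac-multiple y m = trans (quasi-multiple vac-quasi m y) (cong (_+_ (vac y)) (ℤ.*-identityʳ m))

    -- Only a high place followed by a low one can be inverted. Their representatives differ by less
    -- than `N`, so the low one has at most as many periods added; as `vac` is - 1 on low
    -- representatives and 0 on high ones, it separates them.
    b[]-good : Good b[] vac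
    b[]-good = inverts⇒good vac-quasi b[] (b-good []) (λ {p} {p′} lt h → inv lt h (origin p) (origin p′))
      where
      inv : ∀ {p p′} → p < p′ → π b[] p′ < π b[] p → Origin p → Origin p′ → vac (π b[] p′) < vac (π b[] p)
      inv {p} {p′} lt h (low y m _ _ e e′) (low y′ m′ _ _ f f′) = ⊥-elim (ℤ.<-irrefl refl (lia 8
        (λ p p′ q q′ y y′ u c → p ≺ p′ ⇒ q′ ≺ q ⇒ p ≈ y ⊕ c ⊕ u ⇒ q ≈ y ⊕ u ⇒ p′ ⊝ q′ ≈ c ⇒ ⊢ p ≺ p) p p′ (π b[] p) (π b[] p′) y y′ (m * N) (+ c) lt h e e′
          (lia 5 (λ p q y u c → p ≈ y ⊕ c ⊕ u ⇒ q ≈ y ⊕ u ⇒ ⊢ p ⊝ q ≈ c) p′ (π b[] p′) y′ (m′ * N) (+ c) f f′)))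
      inv {p} {p′} lt h (high y m _ _ e e′) (high y′ m′ _ _ f f′) = ⊥-elim (ℤ.<-irrefl refl (lia 7
        (λ p p′ q q′ y u r → p ≺ p′ ⇒ q′ ≺ q ⇒ p ≈ y ⊝ r ⊕ u ⇒ q ≈ y ⊕ u ⇒ q′ ⊝ p′ ≈ r ⇒ ⊢ p ≺ p) p p′ (π b[] p) (π b[] p′) y (m * N) (+ r) lt h e e′
          (lia 5 (λ p q y u r → p ≈ y ⊝ r ⊕ u ⇒ q ≈ y ⊕ u ⇒ ⊢ q ⊝ p ≈ r) p′ (π b[] p′) y′ (m′ * N) (+ r) f f′)))
      inv {p} {p′} lt h (low y m _ _ e e′) (high y′ m′ _ _ f f′) = ⊥-elim (ℤ.<-irrefl refl (lia 10
        (λ p p′ q q′ y y′ u u′ r c → p ≺ p′ ⇒ q′ ≺ q ⇒ p ≈ y ⊕ c ⊕ u ⇒ q ≈ y ⊕ u ⇒ p′ ≈ y′ ⊝ r ⊕ u′ ⇒ q′ ≈ y′ ⊕ u′ ⇒ con (+ 0) ≺ r ⇒ con (+ 0) ≺ c ⇒ ⊢ p ≺ p)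
          p p′ (π b[] p) (π b[] p′) y y′ (m * N) (m′ * N) (+ r) (+ c) lt h e e′ f f′ 0<r 0<c))
      inv {p} {p′} lt h (high y m y>0 y≤c e e′) (low y′ m′ y′>-r y′≤0 f f′) = subst₂ _<_
        (sym (trans (cong vac f′) (trans (vac-multiple y′ m′) (cong (_+ m′) (vac≡-1 y′ (ℤ.<-trans (lia 3 (λ c r N → N ≈ c ⊕ r ⇒ con (+ 0) ≺ c ⇒ ⊢ ⊖ N ≺ ⊖ r) (+ c) (+ r) N N≡c+r 0<c) y′>-r) y′≤0)))))
        (sym (trans (cong vac e′) (trans (vac-multiple y m) (cong (_+ m) (vac≡0 y y>0 (ℤ.≤-trans y≤c (lia 3 (λ c r N → N ≈ c ⊕ r ⇒ con (+ 0) ≺ r ⇒ ⊢ c ≲ N) (+ c) (+ r) N N≡c+r 0<r)))))))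
        (lia 2 (λ m m′ → con (- + 1) ≺ m ⊝ m′ ⇒ ⊢ con (- + 1) ⊕ m′ ≺ con (+ 0) ⊕ m) m m′ (ℤ.*-cancelʳ-<-nonNeg N {{Data.Integer.nonNegative (ℤ.<⇒≤ 0<N)}}
          (subst₂ _<_ (sym (ℤ.-1*i≡-i N)) (ring m m′ N) (lia 9 (λ q q′ y y′ u u′ c r N → q′ ≺ q ⇒ q ≈ y ⊕ u ⇒ q′ ≈ y′ ⊕ u′ ⇒ y ≲ c ⇒ ⊖ r ≺ y′ ⇒ N ≈ c ⊕ r ⇒ ⊢ ⊖ N ≺ u ⊝ u′)
            (π b[] p) (π b[] p′) y y′ (m * N) (m′ * N) (+ c) (+ r) N h e′ f′ y≤c y′>-r N≡c+r))))
        where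
        ring : ∀ m m′ N → m * N - m′ * N ≡ (m - m′) * N
        ring = solve-∀

    X-vac : ∀ φ → ⟦ X ⟧ φ vac ≡ φ (vac ∘ π b[])
    X-vac φ = trans (⟦X⟧-pIn φ vac) (trans (∑-only-empty r c (λ ν → ev φ (b ν) vac) (λ x ν box → ev-bad φ {b (x ∷ ν)} (nonempty-bad x ν box))) (ev-good φ {b[]} b[]-good))

  -- The k-Schur function of a rectangle

  rect : List ℕ
  rect = replicate r c

  part-rect-< : ∀ i → i ℕ.< r → part rect i ≡ c
  part-rect-< i lt = part-replicate r c i lt

  part-rect-≥ : ∀ i → r ℕ.≤ i → part rect i ≡ 0
  part-rect-≥ i le = part-beyond rect i (subst (ℕ._≤ i) (sym (length-replicate r)) le)

  rect-partition : IsPartition rect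
  rect-partition = rect-decreasing , replicate⁺ r 1≤c
    where
    rect-decreasing : Decreasing rect
    rect-decreasing i with suc i ℕ.<? r
    ... | yes lt = ℕ.≤-reflexive (trans (part-rect-< (suc i) lt) (sym (part-rect-< i (ℕ.<⇒≤ lt))))
    ... | no ¬lt = ℕ.≤-trans (ℕ.≤-reflexive (part-rect-≥ (suc i) (ℕ.≮⇒≥ ¬lt))) ℕ.z≤n

  β-rect-< : ∀ i → i ℕ.< r → β rect i ≡ + c - + i
  β-rect-< i lt = cong (λ p → + p - + i) (part-rect-< i lt)

  β-rect-≥ : ∀ i → r ℕ.≤ i → β rect i ≡ + 0 - + i
  β-rect-≥ i le = cong (λ p → + p - + i) (part-rect-≥ i le)

  -- Commuting with the subalgebra of the 𝐡_i

  Comm : Comb k → Comb k → Set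
  Comm y x = ∀ {φ} → Ext φ → ∀ {f} → Quasi f → ⟦ x ⟧ (⟦ y ⟧ φ) f ≡ ⟦ y ⟧ (⟦ x ⟧ φ) f

  module _ {y} (comm-h : ∀ {i} → 1 ℕ.≤ i → i ℕ.≤ k → Comm y (hA k i)) where

    comm-prodH : ∀ is → All (λ i → 1 ℕ.≤ i × i ℕ.≤ k) is → Comm y (prodH k is)
    comm-prodH [] [] {φ} ex {f} qf = trans (ring (⟦ y ⟧ φ f)) (⟦⟧-cong y {φ} {⟦ oneA k ⟧ φ} qf (λ {h} _ → sym (ring (φ h))))
      where
      ring : ∀ u → + 1 * u + + 0 ≡ u
      ring = solve-∀
    comm-prodH (i ∷ is) ((1≤i , i≤k) ∷ bs) {φ} ex {f} qf = begin
      ⟦ prodH k (i ∷ is) ⟧ (⟦ y ⟧ φ) f               ≡⟨ ⟦mulC⟧ (hA k i) (prodH k is) (⟦⟧-ext y ex) f ⟩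
      ⟦ prodH k is ⟧ (⟦ hA k i ⟧ (⟦ y ⟧ φ)) f        ≡⟨ ⟦⟧-cong (prodH k is) {⟦ hA k i ⟧ (⟦ y ⟧ φ)} {⟦ y ⟧ (⟦ hA k i ⟧ φ)} qf (comm-h 1≤i i≤k ex) ⟩
      ⟦ prodH k is ⟧ (⟦ y ⟧ (⟦ hA k i ⟧ φ)) f        ≡⟨ comm-prodH is bs (⟦⟧-ext (hA k i) ex) qf ⟩
      ⟦ y ⟧ (⟦ prodH k is ⟧ (⟦ hA k i ⟧ φ)) f        ≡⟨ ⟦⟧-cong y {⟦ prodH k is ⟧ (⟦ hA k i ⟧ φ)} {⟦ prodH k (i ∷ is) ⟧ φ} qf (λ {h} _ → sym (⟦mulC⟧ (hA k i) (prodH k is) ex h)) ⟩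
      ⟦ y ⟧ (⟦ prodH k (i ∷ is) ⟧ φ) f               ∎
      where open ≡-Reasoning

    comm-scaled : ∀ d x z → Comm y x → Comm y z → Comm y (scale k d x ++ z)
    comm-scaled d x z cx cz {φ} ex {f} qf = begin
      ⟦ scale k d x ++ z ⟧ (⟦ y ⟧ φ) f                    ≡⟨ expand-at (⟦ y ⟧ φ) f ⟩
      d * ⟦ x ⟧ (⟦ y ⟧ φ) f + ⟦ z ⟧ (⟦ y ⟧ φ) f           ≡⟨ cong₂ (λ p q → d * p + q) (cx ex qf) (cz ex qf) ⟩
      d * ⟦ y ⟧ (⟦ x ⟧ φ) f + ⟦ y ⟧ (⟦ z ⟧ φ) f           ≡⟨ sym (⟦⟧-linear y d (⟦ x ⟧ φ) (⟦ z ⟧ φ) f) ⟩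
      ⟦ y ⟧ (λ h → d * ⟦ x ⟧ φ h + ⟦ z ⟧ φ h) f           ≡⟨ ⟦⟧-cong y {λ h → d * ⟦ x ⟧ φ h + ⟦ z ⟧ φ h} {⟦ scale k d x ++ z ⟧ φ} qf (λ {h} _ → sym (expand-at φ h)) ⟩
      ⟦ y ⟧ (⟦ scale k d x ++ z ⟧ φ) f                    ∎
      where
      open ≡-Reasoning
      expand-at : ∀ ψ h → ⟦ scale k d x ++ z ⟧ ψ h ≡ d * ⟦ x ⟧ ψ h + ⟦ z ⟧ ψ h
      expand-at ψ h = trans (pair-++ (λ a → ev ψ a h) (scale k d x) z) (cong (_+ ⟦ z ⟧ ψ h) (pair-scale (λ a → ev ψ a h) d x))

    -- The summand is an abstract `h` with an equation because it must match the pattern lambda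
    -- inside `InSub`, which `comm-InSub` leaves to be inferred.
    comm-sum : (h : ℤ × List ℕ → Comb k) → (∀ d is → h (d , is) ≡ scale k d (prodH k is)) →
      ∀ ts → All (λ t → All (λ i → 1 ℕ.≤ i × i ℕ.≤ k) (proj₂ t)) ts → Comm y (sumC k (map h ts))
    comm-sum h e []             []       {φ} ex {f} qf = sym (⟦⟧-0 y f)
    comm-sum h e ((d , is) ∷ ts) (p ∷ ps) = subst (λ x → Comm y (x ++ sumC k (map h ts))) (sym (e d is))
      (comm-scaled d (prodH k is) (sumC k (map h ts)) (comm-prodH is p) (comm-sum h e ts ps))

    comm-AEq : ∀ x z → AEq k x z → Comm y z → Comm y x
    comm-AEq x z eq cz {φ} ex {f} qf = trans (AEq⇒⟦⟧ x z eq (⟦⟧-ext y ex) qf)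
      (trans (cz ex qf) (⟦⟧-cong y {⟦ z ⟧ φ} {⟦ x ⟧ φ} qf (λ qh → sym (AEq⇒⟦⟧ x z eq ex qh))))

    -- This is how membership in the subalgebra enters: an operator that commutes with every 𝐡_i
    -- commutes with each k-Schur function. It is applied to the 𝐡_i, to the k-Schur functions and
    -- to `X` in turn.
    comm-InSub : ∀ x → InSub k x → Comm y x
    comm-InSub x (terms , bounds , eq) = comm-AEq x (sumC k (map _ terms)) eq (comm-sum _ (λ _ _ → refl) terms bounds)

  module Final (b : List ℕ → W) (reduced : ∀ ν → ReducedRep k (Vword k c r ν) (b ν)) where
    open Rectangle b reduced

    rect-state : State
    rect-state = vac ∘ π b[]

    rect-beads : Beads rect-state rect
    rect-beads = record { partition = rect-partition ; bead = λ i → bead i (i ℕ.<? r) ; only = only }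
      where
      bead : ∀ i → Dec (i ℕ.< r) → rect-state (β rect i) < + 0
      bead i (yes lt) = subst (_< + 0) (cong vac (sym (trans (cong (π b[]) (trans (β-rect-< i lt) (lia 2 (λ c i → ⊢ c ⊝ i ≈ ⊖ i ⊕ c) (+ c) (+ i))))
          (π-lower (- + i) (lia 2 (λ i r → i ≺ r ⇒ ⊢ ⊖ r ≺ ⊖ i) (+ i) (+ r) (+<+ lt)) (lia 1 (λ i → con (+ 0) ≲ i ⇒ ⊢ ⊖ i ≲ con (+ 0)) (+ i) (+≤+ ℕ.z≤n))))))
        (vac-neg (- + i) (lia 1 (λ i → con (+ 0) ≲ i ⇒ ⊢ ⊖ i ≲ con (+ 0)) (+ i) (+≤+ ℕ.z≤n)))
      bead i (no ¬lt) = vac-neg _ (nonpos (origin (β rect i)))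
        where
        r≤i = ℕ.≮⇒≥ ¬lt
        p≤-r : β rect i ≤ - + r
        p≤-r = lia 3 (λ p i r → p ≈ con (+ 0) ⊝ i ⇒ r ≲ i ⇒ ⊢ p ≲ ⊖ r) (β rect i) (+ i) (+ r) (β-rect-≥ i r≤i) (+≤+ r≤i)
        nonpos : Origin (β rect i) → π b[] (β rect i) ≤ + 0
        nonpos (low y m _ _ e e′)  = lia 6 (λ p q y u c r → p ≈ y ⊕ c ⊕ u ⇒ q ≈ y ⊕ u ⇒ p ≲ ⊖ r ⇒ con (+ 0) ≺ r ⇒ con (+ 0) ≺ c ⇒ ⊢ q ≲ con (+ 0))
          (β rect i) (π b[] (β rect i)) y (m * N) (+ c) (+ r) e e′ p≤-r 0<r 0<c
        nonpos (high y m _ _ e e′) = lia 5 (λ p q y u r → p ≈ y ⊝ r ⊕ u ⇒ q ≈ y ⊕ u ⇒ p ≲ ⊖ r ⇒ ⊢ q ≲ con (+ 0))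
          (β rect i) (π b[] (β rect i)) y (m * N) (+ r) e e′ p≤-r
      deep-row : ∀ x → x ≤ - + r → Σ ℕ λ i → x ≡ β rect i
      deep-row x le = Data.Integer.∣ x ∣ , sym (trans (β-rect-≥ Data.Integer.∣ x ∣ (ℤ.drop‿+≤+ (subst (+ r ≤_) (sym -x) (lia 2 (λ x r → x ≲ ⊖ r ⇒ ⊢ r ≲ ⊖ x) x (+ r) le))))
          (lia 2 (λ i x → i ≈ ⊖ x ⇒ ⊢ con (+ 0) ⊝ i ≈ x) (+ Data.Integer.∣ x ∣) x -x))
        where
        abs : ∀ z → z ≤ + 0 → + Data.Integer.∣ z ∣ ≡ - z
        abs (+ zero)  _ = refl
        abs -[1+ m ]  _ = refl
        abs (+ suc m) (+≤+ ())
        -x : + Data.Integer.∣ x ∣ ≡ - x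
        -x = abs x (lia 2 (λ x r → x ≲ ⊖ r ⇒ con (+ 0) ≺ r ⇒ ⊢ x ≲ con (+ 0)) x (+ r) le 0<r)
      only : ∀ x → rect-state x < + 0 → Σ ℕ λ i → x ≡ β rect i
      only x neg = by-origin (origin x)
        where
        πx≤0 : π b[] x ≤ + 0
        πx≤0 = ℤ.≮⇒≥ (λ pos → ℤ.<⇒≱ neg (vac-nonneg (π b[] x) pos))
        by-origin : Origin x → Σ ℕ λ i → x ≡ β rect i
        by-origin (high y m _ _ e e′) = deep-row x (lia 5 (λ p q y u r → p ≈ y ⊝ r ⊕ u ⇒ q ≈ y ⊕ u ⇒ q ≲ con (+ 0) ⇒ ⊢ p ≲ ⊖ r) x (π b[] x) y (m * N) (+ r) e e′ πx≤0)
        by-origin (low y m lo hi e e′) = by-depth (x ≤? - + r)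
          where
          by-depth : Dec (x ≤ - + r) → Σ ℕ λ i → x ≡ β rect i
          by-depth (yes le) = deep-row x le
          by-depth (no ¬le) = i , trans x≡ (sym (β-rect-< i i<r))
            where
            m≡0 : m ≡ + 0
            m≡0 = N-multiple-small m
              (lia 6 (λ x y u c r N → ⊖ r ≺ x ⇒ x ≈ y ⊕ c ⊕ u ⇒ y ≲ con (+ 0) ⇒ N ≈ c ⊕ r ⇒ ⊢ ⊖ N ≺ u) x y (m * N) (+ c) (+ r) N (ℤ.≰⇒> ¬le) e hi N≡c+r)
              (lia 6 (λ q y u c r N → q ≲ con (+ 0) ⇒ q ≈ y ⊕ u ⇒ ⊖ r ≺ y ⇒ N ≈ c ⊕ r ⇒ con (+ 0) ≺ c ⇒ ⊢ u ≺ N) (π b[] x) y (m * N) (+ c) (+ r) N πx≤0 e′ lo N≡c+r 0<c)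
            i = Data.Integer.∣ - y ∣
            i≡ : + i ≡ - y
            i≡ = ℤ.0≤i⇒+∣i∣≡i (lia 1 (λ y → y ≲ con (+ 0) ⇒ ⊢ con (+ 0) ≲ ⊖ y) y hi)
            i<r : i ℕ.< r
            i<r = ℤ.drop‿+<+ (lia 3 (λ i y r → i ≈ ⊖ y ⇒ ⊖ r ≺ y ⇒ ⊢ i ≺ r) (+ i) y (+ r) i≡ lo)
            x≡ : x ≡ + c - + i
            x≡ = lia 5 (λ x y c u i → x ≈ y ⊕ c ⊕ u ⇒ u ≈ con (+ 0) ⇒ i ≈ ⊖ y ⇒ ⊢ x ≈ c ⊝ i) x y (+ c) (m * N) (+ i) e (trans (cong (_* N) m≡0) (ℤ.*-zeroˡ N)) i≡

    private
      module C = Core (vacπ-quasi b[]) refl rect-beads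

    -- By `small-jump` only the jump has to be found. For `i` below `r`, the bead `c - i` lowered by
    -- `N` is that of row `r + i`; below the rectangle the rows are empty and the jump is `n`.
    rect-small : ∀ i → Dec (i ℕ.< r) → small rect i ≡ part rect i
    rect-small i (yes lt) = trans (ℤ.+-injective (lia 6 (λ s j i r c N → s ⊕ j ≈ i ⊕ N ⇒ j ≈ r ⊕ i ⇒ N ≈ c ⊕ r ⇒ ⊢ s ≈ c)
        (+ small rect i) (+ C.jump i) (+ i) (+ r) (+ c) N (C.small-jump i) (cong +_ jump≡) N≡c+r)) (sym (part-rect-< i lt))
      where
      jump≡ : C.jump i ≡ r ℕ.+ i
      jump≡ = β-injective rect C.d (trans (C.β-jump i) (trans (cong (_- N) (β-rect-< i lt))
        (trans (lia 4 (λ c r i N → N ≈ c ⊕ r ⇒ ⊢ c ⊝ i ⊝ N ≈ con (+ 0) ⊝ (r ⊕ i)) (+ c) (+ r) (+ i) N N≡c+r) (sym (β-rect-≥ (r ℕ.+ i) (ℕ.m≤m+n r i))))))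
    rect-small i (no ¬lt) = trans (ℤ.+-injective (lia 4 (λ s j i N → s ⊕ j ≈ i ⊕ N ⇒ j ≈ i ⊕ N ⇒ ⊢ s ≈ con (+ 0))
        (+ small rect i) (+ C.jump i) (+ i) N (C.small-jump i) (trans (cong +_ jump≡) (cong (_+_ (+ i)) (sym N≡n))))) (sym (part-rect-≥ i r≤i))
      where
      r≤i = ℕ.≮⇒≥ ¬lt
      jump≡ : C.jump i ≡ i ℕ.+ n
      jump≡ = β-injective rect C.d (trans (C.β-jump i) (trans (cong (_- N) (β-rect-≥ i r≤i))
        (trans (lia 2 (λ i N → ⊢ con (+ 0) ⊝ i ⊝ N ≈ con (+ 0) ⊝ (i ⊕ N)) (+ i) N)
          (trans (cong (λ M → + 0 - (+ i + M)) N≡n) (sym (β-rect-≥ (i ℕ.+ n) (ℕ.≤-trans r≤i (ℕ.m≤m+n i n))))))))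

    label-rect : label b[] ≡ rect
    label-rect = trans (cong (boundedPart k) (beads-unique (λ _ → refl) (act-beads b[] b[]-good) rect-beads))
      (part-ext (proj₁ C.bounded-parts) rect-partition (λ i → trans (proj₂ C.bounded-parts i) (rect-small i (i ℕ.<? r))))

    module _ {s : List ℕ → Comb k} (ks : IsKSchur k s) where
      open KSchur ks using (claim)
      open Commute ks using (h-comm)

      in-sub : ∀ a → Good a vac → InSub k (s (label a))
      in-sub a ga = proj₁ (proj₂ ks) (label a) (label-bounded {a} ga)

      s-comm-h : ∀ a → Good a vac → ∀ {i} → 1 ℕ.≤ i → i ℕ.≤ k → Comm (s (label a)) (hA k i)
      s-comm-h a ga {i} 1≤i i≤k ex qf = sym (comm-InSub {hA k i} (λ 1≤j j≤k → h-comm 1≤i i≤k 1≤j j≤k) (s (label a)) (in-sub a ga) ex qf)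

      s-comm-s : ∀ a a′ → Good a vac → Good a′ vac → Comm (s (label a)) (s (label a′))
      s-comm-s a a′ ga ga′ = comm-InSub {s (label a)} (s-comm-h a ga) (s (label a′)) (in-sub a′ ga′)

      X-comm-s : ∀ a → Good a vac → Comm X (s (label a))
      X-comm-s a ga = comm-InSub {X} (λ _ i≤k → X-h i≤k) (s (label a)) (in-sub a ga)

      -- `claim` replaces an arbitrary point of the orbit by a k-Schur factor acting on `vac`. Once
      -- that factor has been commuted past, both operators are evaluated at `vac`, where each
      -- yields `rect-state`.
      same-action : ∀ {φ} → Ext φ → ∀ a → Good a vac → ⟦ s rect ⟧ φ (vac ∘ π a) ≡ ⟦ X ⟧ φ (vac ∘ π a)
      same-action {φ} ex a ga = begin
        ⟦ s rect ⟧ φ (vac ∘ π a)                       ≡⟨ cong (λ la → ⟦ s la ⟧ φ (vac ∘ π a)) (sym label-rect) ⟩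
        ⟦ s (label b[]) ⟧ φ (vac ∘ π a)                ≡⟨ sym (claim a ga (⟦⟧-ext (s (label b[])) ex)) ⟩
        ⟦ s (label a) ⟧ (⟦ s (label b[]) ⟧ φ) vac      ≡⟨ s-comm-s b[] a b[]-good ga ex vac-quasi ⟩
        ⟦ s (label b[]) ⟧ (⟦ s (label a) ⟧ φ) vac      ≡⟨ claim b[] b[]-good (⟦⟧-ext (s (label a)) ex) ⟩
        ⟦ s (label a) ⟧ φ rect-state                   ≡⟨ sym (X-vac (⟦ s (label a) ⟧ φ)) ⟩
        ⟦ X ⟧ (⟦ s (label a) ⟧ φ) vac                  ≡⟨ sym (X-comm-s a ga ex vac-quasi) ⟩
        ⟦ s (label a) ⟧ (⟦ X ⟧ φ) vac                  ≡⟨ claim a ga (⟦⟧-ext X ex) ⟩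
        ⟦ X ⟧ φ (vac ∘ π a)                            ∎
        where open ≡-Reasoning

      rectangle : AEq k (s rect) X
      rectangle = ≐-elim (faithful (s rect) X same-action)

open import Data.Nat using (_≤_; _+_)

theorem4p12 : (k c r : ℕ) → 1 ≤ k → 1 ≤ c → 1 ≤ r → c + r ≡ suc k →
    (s : List ℕ → Comb k) → IsKSchur k s →
    (b : List ℕ → Word k) → (∀ nu → ReducedRep k (Vword k c r nu) (b nu)) →
    AEq k (s (replicate r c)) (sumC k (map (λ nu → uA k (b nu)) (pIn r c)))
theorem4p12 k c r 1≤k 1≤c 1≤r c+r≡n s ks b reduced = Final.rectangle b reduced ks
  where open RectangularShape k 1≤k c r 1≤c 1≤r c+r≡n
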